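{- For every positive integer $n$, let $$P_n(q)=(1-q)(1-q^2)(1-q^4)(1-q^5)\cdots(1-q^{3n-2})(1-q^{3n-1})=\prod_{k=1}^{n}(1-q^{3k-2})(1-q^{3k-1}).$$ Then for every integer $m\ge 0$, the coefficient $[q^m]P_n(q)$ of $q^m$ in $P_n(q)$ satisfies $[q^m]P_n(q)\ge 0$ if $m\equiv 0\pmod 3$ and $[q^m]P_n(q)\le 0$ if $m\not\equiv 0\pmod 3$. (That is, the sign pattern of the coefficients is $+--+--+--\cdots$, a zero coefficient counting as both $+$ and $-$.)
   Context: This is the First Borwein Conjecture. $[q^m]F(q)$ denotes the coefficient of $q^m$ in the polynomial $F(q)$. -}

module Defs where

open import Data.Nat as ℕ using (ℕ; zero; suc)
open import Data.Integer as ℤ using (ℤ; +_; -_)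
open import Data.List using (List; []; _∷_; replicate; _++_)

-- Polynomials in q with integer coefficients, represented as coefficient
-- lists: the list  a₀ ∷ a₁ ∷ … ∷ aₖ ∷ []  is  a₀ + a₁ q + … + aₖ q^k.

Poly : Set
Poly = List ℤ

_⊕_ : Poly → Poly → Poly
[]       ⊕ g        = g
f        ⊕ []       = f
(a ∷ f)  ⊕ (b ∷ g)  = (a ℤ.+ b) ∷ (f ⊕ g)

scale : ℤ → Poly → Poly
scale c []      = []
scale c (a ∷ f) = (c ℤ.* a) ∷ scale c f

_⊗_ : Poly → Poly → Poly
[]      ⊗ g = []
(a ∷ f) ⊗ g = scale a g ⊕ (+ 0 ∷ (f ⊗ g))

one : Poly
one = + 1 ∷ []

1-q^ : ℕ → Poly
1-q^ j = (+ 1) ⊕ₛ (replicate j (+ 0) ++ (- (+ 1) ∷ []))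
  where
    _⊕ₛ_ : ℤ → Poly → Poly
    c ⊕ₛ f = (c ∷ []) ⊕ f

coeff : ℕ → Poly → ℤ
coeff m       []      = + 0
coeff zero    (a ∷ f) = a
coeff (suc m) (a ∷ f) = coeff m f

P : ℕ → Poly
P zero    = one
P (suc k) = P k ⊗ (1-q^ (3 ℕ.* suc k ℕ.∸ 2) ⊗ 1-q^ (3 ℕ.* suc k ℕ.∸ 1))

{-# OPTIONS --safe #-}
module Submission where

-- Write P_n(q) = A(q³) - q B(q³) - q² C(q³).  B is the reversal of C, and the recurrences in n express A
-- positively through A, B and C, so everything reduces to C ≥ 0.  The recurrences are solved by single sums
-- over j; for C the summand is, with n = 3j + ρ and Q = q³,
--   T_j = q^(3j²) (Q;Q)_(n-j-1) (q;q)_3j / ((q;q)_ρ (Q;Q)_(2j+1) (Q;Q)_j) · (z - u)(1 - qz + u(1 - q²z)),  z = q^3j, u = q^n.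
-- T_0 = (1 + q^n + q^(n+1)) ∏_{2 ≤ k < n} (1 + q^k + q^2k) is positive and dominates all the others coefficientwise:
--   5j(j+1) T_j ≥ -2 T_0 for 1 ≤ j ≤ 16   and   j(j+1) |T_j| ≤ 10 T_0 for j ≥ 17   (n ≥ 98),
-- and the sum of these bounds is less than T_0.  The first one is a finite check, because after cancelling the common
-- factor ∏_{3j+1 < k ≤ n-1-3j} (1 + q^k + q^2k) both sides are polynomials in q and v = q^(n-3j).  For the second one, a
-- few reserved factors of T_0 (2, 4, the powers of 3 and two large indices) have a product majorizing a window
-- q^2 + ... + q^(M+1), so that only sums of M consecutive coefficients need to be compared.  Such a window of a product
-- of trinomials carries a definite share of the smaller of the two tails at that place, and the tails are compared by
-- counting.  For n ≤ 97 the coefficients of C_n are read off from its value at a large power of 2.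

-- The weights 1/(j(j+1)) telescope: the two families of bounds add up to (2/5)(1 - 1/17) + 10/17 =
-- 82/85. The split at j = 16 and the threshold n = 98 = 6·16 + 2 belong together, because T_j and
-- T_0 have the common factor that makes the check finite only when n ≥ 6j + 2. The obstacle for
-- large j is that T_j contains factors 1 - Q^i, so its coefficients have no visible sign. All of
-- them are replaced by 1 + Q^i. This is affordable because T_j starts as late as q^(3j² + 3j),
-- where T_0 already offers many choices of exponents; by symmetry the same happens at the upper
-- end. But counting choices compares tails, whereas the goal concerns single coefficients. Instead
-- of proving that T_0 is unimodal, the smoothness is made by hand: a few factors of T_0 are set
-- aside to turn one coefficient into a sum over a long window, and window sums are controlled by
-- tails. For j ≤ 16 the signs are kept and the comparison is exact.

module PowerSeries where

  open import Algebra.Bundles using (CommutativeRing)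
  open import Data.Nat as ℕ using (ℕ; zero; suc)
  import Data.Nat.Properties as ℕ
  open import Data.Integer as ℤ using (ℤ; 0ℤ; 1ℤ)
  import Data.Integer.Properties as ℤ
  open import Data.Integer.Tactic.RingSolver using (solve-∀)
  open import Data.Maybe.Base using (Maybe; just; nothing)
  open import Data.Product using (_,_)
  open import Function using (_∘_)
  open import Relation.Binary.PropositionalEquality hiding (setoid)
  open import Relation.Nullary using (yes; no)
  import Algebra.Solver.Ring as RingSolver
  open import Algebra.Solver.Ring.AlmostCommutativeRing using (fromCommutativeRing; _-Raw-AlmostCommutative⟶_)

  -- Formal power series over the integers

  Ser : Set
  Ser = ℕ → ℤ

  infix 4 _≈_
  infixl 6 _⊞_
  infixl 7 _⊡_
  infix 8 ⊟_

  _≈_ : Ser → Ser → Set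
  f ≈ g = ∀ m → f m ≡ g m

  ⟨_⟩ : ℤ → Ser
  ⟨ c ⟩ zero = c
  ⟨ c ⟩ (suc _) = 0ℤ

  0s 1s : Ser
  0s _ = 0ℤ
  1s = ⟨ 1ℤ ⟩

  -- The product peels off the constant term of the left factor, f = f 0 + q (f ∘ suc), so it
  -- recurses on the degree alone and avoids finite sums.
  _⊞_ _⊡_ : Ser → Ser → Ser
  (f ⊞ g) m = f m ℤ.+ g m
  (f ⊡ g) zero = f 0 ℤ.* g 0
  (f ⊡ g) (suc m) = f 0 ℤ.* g (suc m) ℤ.+ ((f ∘ suc) ⊡ g) m

  ⊟_ : Ser → Ser
  (⊟ f) m = ℤ.- f m

  ⊡-cong : ∀ {f f′ g g′} → f ≈ f′ → g ≈ g′ → f ⊡ g ≈ f′ ⊡ g′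
  ⊡-cong p q zero = cong₂ ℤ._*_ (p 0) (q 0)
  ⊡-cong p q (suc m) = cong₂ ℤ._+_ (cong₂ ℤ._*_ (p 0) (q (suc m))) (⊡-cong (p ∘ suc) q m)

  ⊡-zeroˡ : ∀ f → 0s ⊡ f ≈ 0s
  ⊡-zeroˡ f zero = refl
  ⊡-zeroˡ f (suc m) = trans (ℤ.+-identityˡ _) (⊡-zeroˡ f m)

  ⊡-identityˡ : ∀ f → 1s ⊡ f ≈ f
  ⊡-identityˡ f zero = ℤ.*-identityˡ _
  ⊡-identityˡ f (suc m) = trans (cong₂ ℤ._+_ (ℤ.*-identityˡ (f (suc m))) (⊡-zeroˡ f m)) (ℤ.+-identityʳ _)

  ⊡-distribʳ : ∀ h f g → (f ⊞ g) ⊡ h ≈ (f ⊡ h) ⊞ (g ⊡ h)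
  ⊡-distribʳ h f g zero = ℤ.*-distribʳ-+ (h 0) (f 0) (g 0)
  ⊡-distribʳ h f g (suc m) = trans (cong (λ x → (f 0 ℤ.+ g 0) ℤ.* h (suc m) ℤ.+ x) (⊡-distribʳ h (f ∘ suc) (g ∘ suc) m))
    (lem (f 0) (g 0) (h (suc m)) _ _)
    where
    lem : ∀ a b c x y → (a ℤ.+ b) ℤ.* c ℤ.+ (x ℤ.+ y) ≡ (a ℤ.* c ℤ.+ x) ℤ.+ (b ℤ.* c ℤ.+ y)
    lem = solve-∀

  ⊡-scaleˡ : ∀ c f g m → ((λ k → c ℤ.* f k) ⊡ g) m ≡ c ℤ.* (f ⊡ g) m
  ⊡-scaleˡ c f g zero = ℤ.*-assoc c (f 0) (g 0)
  ⊡-scaleˡ c f g (suc m) = trans (cong (λ x → c ℤ.* f 0 ℤ.* g (suc m) ℤ.+ x) (⊡-scaleˡ c (f ∘ suc) g m)) (lem c (f 0) (g (suc m)) _)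
    where
    lem : ∀ c a b x → c ℤ.* a ℤ.* b ℤ.+ c ℤ.* x ≡ c ℤ.* (a ℤ.* b ℤ.+ x)
    lem = solve-∀

  ⊡-assoc : ∀ f g h → (f ⊡ g) ⊡ h ≈ f ⊡ (g ⊡ h)
  ⊡-assoc f g h zero = ℤ.*-assoc (f 0) (g 0) (h 0)
  ⊡-assoc f g h (suc m) = begin
    f 0 ℤ.* g 0 ℤ.* h (suc m) ℤ.+ (((λ k → f 0 ℤ.* g (suc k)) ⊞ ((f ∘ suc) ⊡ g)) ⊡ h) m
      ≡⟨ cong (λ x → f 0 ℤ.* g 0 ℤ.* h (suc m) ℤ.+ x) (⊡-distribʳ h (λ k → f 0 ℤ.* g (suc k)) ((f ∘ suc) ⊡ g) m) ⟩
    f 0 ℤ.* g 0 ℤ.* h (suc m) ℤ.+ (((λ k → f 0 ℤ.* g (suc k)) ⊡ h) m ℤ.+ (((f ∘ suc) ⊡ g) ⊡ h) m)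
      ≡⟨ cong₂ (λ x y → f 0 ℤ.* g 0 ℤ.* h (suc m) ℤ.+ (x ℤ.+ y)) (⊡-scaleˡ (f 0) (g ∘ suc) h m) (⊡-assoc (f ∘ suc) g h m) ⟩
    f 0 ℤ.* g 0 ℤ.* h (suc m) ℤ.+ (f 0 ℤ.* ((g ∘ suc) ⊡ h) m ℤ.+ ((f ∘ suc) ⊡ (g ⊡ h)) m)
      ≡⟨ lem (f 0) (g 0) (h (suc m)) _ _ ⟩
    f 0 ℤ.* (g 0 ℤ.* h (suc m) ℤ.+ ((g ∘ suc) ⊡ h) m) ℤ.+ ((f ∘ suc) ⊡ (g ⊡ h)) m ∎
    where
    open ≡-Reasoning
    lem : ∀ a b c x y → a ℤ.* b ℤ.* c ℤ.+ (a ℤ.* x ℤ.+ y) ≡ a ℤ.* (b ℤ.* c ℤ.+ x) ℤ.+ y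
    lem = solve-∀

  -- Peels off the constant term of the right factor. Set against the defining recursion, which
  -- works on the left, this gives commutativity.
  ⊡-sucʳ : ∀ f g m → (f ⊡ g) (suc m) ≡ (f ⊡ (g ∘ suc)) m ℤ.+ f (suc m) ℤ.* g 0
  ⊡-sucʳ f g zero = refl
  ⊡-sucʳ f g (suc m) = trans (cong (λ x → f 0 ℤ.* g (suc (suc m)) ℤ.+ x) (⊡-sucʳ (f ∘ suc) g m)) (sym (ℤ.+-assoc (f 0 ℤ.* g (suc (suc m))) _ _))

  ⊡-comm : ∀ f g → f ⊡ g ≈ g ⊡ f
  ⊡-comm f g zero = ℤ.*-comm (f 0) (g 0)
  ⊡-comm f g (suc m) = begin
    f 0 ℤ.* g (suc m) ℤ.+ ((f ∘ suc) ⊡ g) m ≡⟨ cong₂ ℤ._+_ (ℤ.*-comm (f 0) (g (suc m))) (⊡-comm (f ∘ suc) g m) ⟩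
    g (suc m) ℤ.* f 0 ℤ.+ (g ⊡ (f ∘ suc)) m ≡⟨ ℤ.+-comm (g (suc m) ℤ.* f 0) _ ⟩
    (g ⊡ (f ∘ suc)) m ℤ.+ g (suc m) ℤ.* f 0 ≡⟨ ⊡-sucʳ g f m ⟨
    (g ⊡ f) (suc m) ∎
    where open ≡-Reasoning

  serRing : CommutativeRing _ _
  serRing = record
    { Carrier = Ser ; _≈_ = _≈_ ; _+_ = _⊞_ ; _*_ = _⊡_ ; -_ = ⊟_ ; 0# = 0s ; 1# = 1s
    ; isCommutativeRing = record
      { isRing = record
        { +-isAbelianGroup = record
          { isGroup = record
            { isMonoid = record
              { isSemigroup = record
                { isMagma = record
                  { isEquivalence = record
                    { refl = λ _ → refl ; sym = λ p m → sym (p m) ; trans = λ p q m → trans (p m) (q m) }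
                  ; ∙-cong = λ p q m → cong₂ ℤ._+_ (p m) (q m) }
                ; assoc = λ f g h m → ℤ.+-assoc (f m) (g m) (h m) }
              ; identity = (λ f m → ℤ.+-identityˡ (f m)) , (λ f m → ℤ.+-identityʳ (f m)) }
            ; inverse = (λ f m → ℤ.+-inverseˡ (f m)) , (λ f m → ℤ.+-inverseʳ (f m))
            ; ⁻¹-cong = λ p m → cong ℤ.-_ (p m) }
          ; comm = λ f g m → ℤ.+-comm (f m) (g m) }
        ; *-cong = ⊡-cong
        ; *-assoc = ⊡-assoc
        ; *-identity = ⊡-identityˡ , (λ f m → trans (⊡-comm f 1s m) (⊡-identityˡ f m))
        ; distrib = (λ f g h m → trans (⊡-comm f (g ⊞ h) m) (trans (⊡-distribʳ f g h m) (cong₂ ℤ._+_ (⊡-comm g f m) (⊡-comm h f m))))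
                  , ⊡-distribʳ }
      ; *-comm = ⊡-comm } }

  open CommutativeRing serRing public using (setoid) renaming (refl to ≈-refl; sym to ≈-sym; trans to ≈-trans; +-cong to ⊞-cong; -‿cong to ⊟-cong)

  ⟨⟩-⊡ : ∀ a b → ⟨ a ℤ.* b ⟩ ≈ ⟨ a ⟩ ⊡ ⟨ b ⟩
  ⟨⟩-⊡ a b zero = refl
  ⟨⟩-⊡ a b (suc m) = sym (trans (cong₂ ℤ._+_ (ℤ.*-zeroʳ a) (⊡-zeroˡ ⟨ b ⟩ m)) refl)

  private
    -- Equality of series is undecidable, but the integers embed as constant series; with them as
    -- coefficients the solver can normalise identities between series.
    coeffMorphism : CommutativeRing.rawRing ℤ.+-*-commutativeRing -Raw-AlmostCommutative⟶ fromCommutativeRing serRing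
    coeffMorphism = record
      { ⟦_⟧ = ⟨_⟩
      ; +-homo = λ { a b zero → refl ; a b (suc m) → refl }
      ; *-homo = ⟨⟩-⊡
      ; -‿homo = λ { a zero → refl ; a (suc m) → refl }
      ; 0-homo = λ { zero → refl ; (suc m) → refl }
      ; 1-homo = λ _ → refl }

    coeff≟ : ∀ a b → Maybe (⟨ a ⟩ ≈ ⟨ b ⟩)
    coeff≟ a b with a ℤ.≟ b
    ... | yes refl = just (λ _ → refl)
    ... | no _ = nothing

  open RingSolver (CommutativeRing.rawRing ℤ.+-*-commutativeRing) (fromCommutativeRing serRing) coeffMorphism coeff≟ public
    using (solve; _:=_; _:+_; _:*_; :-_; _:-_; con; Polynomial)

  c1 : ∀ {n} → Polynomial n
  c1 = con 1ℤ

  infixl 6 _⊖_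
  _⊖_ : Ser → Ser → Ser
  f ⊖ g = f ⊞ ⊟ g

  sh : ℕ → Ser → Ser
  sh zero f m = f m
  sh (suc k) f zero = 0ℤ
  sh (suc k) f (suc m) = sh k f m

  q^ : ℕ → Ser
  q^ k = sh k 1s

  q^-⊡ : ∀ k f → q^ k ⊡ f ≈ sh k f
  q^-⊡ zero f m = ⊡-identityˡ f m
  q^-⊡ (suc k) f zero = refl
  q^-⊡ (suc k) f (suc m) = trans (ℤ.+-identityˡ _) (q^-⊡ k f m)

  sh-sh : ∀ k l f → sh k (sh l f) ≈ sh (k ℕ.+ l) f
  sh-sh zero l f m = refl
  sh-sh (suc k) l f zero = refl
  sh-sh (suc k) l f (suc m) = sh-sh k l f m

  sh-cong : ∀ k {f g} → f ≈ g → sh k f ≈ sh k g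
  sh-cong zero p m = p m
  sh-cong (suc k) p zero = refl
  sh-cong (suc k) p (suc m) = sh-cong k p m

  q^-+ : ∀ k l → q^ (k ℕ.+ l) ≈ q^ k ⊡ q^ l
  q^-+ k l m = sym (trans (q^-⊡ k (q^ l) m) (sh-sh k l 1s m))

  q^-cong : ∀ {k l} → k ≡ l → q^ k ≈ q^ l
  q^-cong refl _ = refl

-- The recurrences for A, B, C and their solution by single sums

module SingleSum where

  open PowerSeries
  open import Data.Nat as ℕ using (ℕ; zero; suc)
  import Data.Nat.Properties as ℕ
  import Data.Nat.Tactic.RingSolver as ℕ-Ring
  open import Data.Nat.DivMod using (_%_; m<n⇒m%n≡m; [m+n]%n≡m%n)
  open import Data.Integer as ℤ using (+_; 0ℤ; 1ℤ)
  import Data.Integer.Properties as ℤ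
  open import Data.Product using (_×_; _,_)
  open import Relation.Binary.PropositionalEquality hiding (setoid)
  open import Relation.Nullary using (yes; no)
  import Relation.Binary.Reasoning.Setoid as SetoidReasoning

  module ≈-Reasoning = SetoidReasoning setoid

  ⊡-congˡ : ∀ f {g h} → g ≈ h → f ⊡ g ≈ f ⊡ h
  ⊡-congˡ f p = ⊡-cong {f} {f} (λ _ → refl) p

  ⊡-congʳ : ∀ h {f g} → f ≈ g → f ⊡ h ≈ g ⊡ h
  ⊡-congʳ h p = ⊡-cong {g = h} {h} p (λ _ → refl)

  sh-≥ : ∀ l f i → sh l f (l ℕ.+ i) ≡ f i
  sh-≥ zero f i = refl
  sh-≥ (suc l) f i = sh-≥ l f i

  sh-< : ∀ l f i → i ℕ.< l → sh l f i ≡ 0ℤ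
  sh-< (suc l) f zero _ = refl
  sh-< (suc l) f (suc i) (ℕ.s≤s p) = sh-< l f i p

  -- The series 1/(1 - q^(k+1)): the remainder is tested for 0 by reading it as an index into the
  -- constant series 1. The offset in k keeps the divisor nonzero.
  geo : ℕ → Ser
  geo k m = 1s (m % suc k)

  geo-inverse : ∀ k → (1s ⊖ q^ (suc k)) ⊡ geo k ≈ 1s
  geo-inverse k m = trans (expand m) (body m)
    where
    expand : (1s ⊖ q^ (suc k)) ⊡ geo k ≈ geo k ⊖ sh (suc k) (geo k)
    expand = ≈-trans (solve 2 (λ x g → (con 1ℤ :- x) :* g := g :- x :* g) ≈-refl (q^ (suc k)) (geo k))
      (⊞-cong {geo k} (λ _ → refl) (⊟-cong (q^-⊡ (suc k) (geo k))))
    geo-+ : ∀ i → geo k (suc k ℕ.+ i) ≡ geo k i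
    geo-+ i = cong 1s (trans (cong (_% suc k) (ℕ.+-comm (suc k) i)) ([m+n]%n≡m%n i (suc k)))
    small : ∀ i → i ℕ.< suc k → geo k i ≡ 1s i
    small i p = cong 1s (m<n⇒m%n≡m p)
    body : geo k ⊖ sh (suc k) (geo k) ≈ 1s
    body m with m ℕ.<? suc k
    ... | yes p = trans (cong₂ (λ x y → x ℤ.+ ℤ.- y) (small m p) (sh-< (suc k) (geo k) m p)) (ℤ.+-identityʳ _)
    ... | no p = subst (λ m → (geo k ⊖ sh (suc k) (geo k)) m ≡ 1s m) (ℕ.m+[n∸m]≡n (ℕ.≮⇒≥ p))
        (trans (cong₂ (λ x y → x ℤ.+ ℤ.- y) (geo-+ (m ℕ.∸ suc k)) (sh-≥ (suc k) (geo k) (m ℕ.∸ suc k))) (ℤ.+-inverseʳ (geo k (m ℕ.∸ suc k))))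

  -- (q;q)_m and (Q;Q)_m with Q = q³, and their inverses as products of geometric series;
  -- `geo (2 + 3m)` is 1/(1 - q^(3(m+1))).
  poch ipoch pochQ ipochQ : ℕ → Ser
  poch zero = 1s
  poch (suc m) = poch m ⊡ (1s ⊖ q^ (suc m))
  ipoch zero = 1s
  ipoch (suc m) = ipoch m ⊡ geo m
  pochQ zero = 1s
  pochQ (suc m) = pochQ m ⊡ (1s ⊖ q^ (3 ℕ.* suc m))
  ipochQ zero = 1s
  ipochQ (suc m) = ipochQ m ⊡ geo (2 ℕ.+ 3 ℕ.* m)

  3*suc : ∀ m → 3 ℕ.* suc m ≡ suc (2 ℕ.+ 3 ℕ.* m)
  3*suc = ℕ-Ring.solve-∀

  ⊖-cong : ∀ {f g} → f ≈ g → 1s ⊖ f ≈ 1s ⊖ g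
  ⊖-cong p m = cong (λ x → 1s m ℤ.+ ℤ.- x) (p m)

  cancel-unit : ∀ a x y → x ⊡ y ≈ 1s → a ⊡ y ⊡ x ≈ a
  cancel-unit a x y p = ≈-trans (solve 3 (λ a x y → a :* y :* x := a :* (x :* y)) ≈-refl a x y)
    (≈-trans (⊡-congˡ a p) (≈-trans (⊡-comm a 1s) (⊡-identityˡ a)))

  ipoch-suc : ∀ m → ipoch (suc m) ⊡ (1s ⊖ q^ (suc m)) ≈ ipoch m
  ipoch-suc m = cancel-unit (ipoch m) _ (geo m) (geo-inverse m)

  geo-inverse₃ : ∀ m → (1s ⊖ q^ (3 ℕ.* suc m)) ⊡ geo (2 ℕ.+ 3 ℕ.* m) ≈ 1s
  geo-inverse₃ m = ≈-trans (⊡-congʳ (geo (2 ℕ.+ 3 ℕ.* m)) (⊖-cong (q^-cong (3*suc m)))) (geo-inverse (2 ℕ.+ 3 ℕ.* m))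

  ipochQ-suc : ∀ m → ipochQ (suc m) ⊡ (1s ⊖ q^ (3 ℕ.* suc m)) ≈ ipochQ m
  ipochQ-suc m = cancel-unit (ipochQ m) _ _ (geo-inverse₃ m)

  poch-ipoch : ∀ m → poch m ⊡ ipoch m ≈ 1s
  poch-ipoch zero = ⊡-identityˡ 1s
  poch-ipoch (suc m) = ≈-trans (solve 4 (λ a x b y → (a :* x) :* (b :* y) := (a :* b) :* (x :* y)) ≈-refl (poch m) (1s ⊖ q^ (suc m)) (ipoch m) (geo m))
    (≈-trans (⊡-cong (poch-ipoch m) (geo-inverse m)) (⊡-identityˡ 1s))

  pochQ-ipochQ : ∀ m → pochQ m ⊡ ipochQ m ≈ 1s
  pochQ-ipochQ zero = ⊡-identityˡ 1s
  pochQ-ipochQ (suc m) = ≈-trans (solve 4 (λ a x b y → (a :* x) :* (b :* y) := (a :* b) :* (x :* y)) ≈-refl (pochQ m) (1s ⊖ q^ (3 ℕ.* suc m)) (ipochQ m) (geo (2 ℕ.+ 3 ℕ.* m)))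
    (≈-trans (⊡-cong (pochQ-ipochQ m) (geo-inverse₃ m)) (⊡-identityˡ 1s))

  μ : ℕ → Ser
  μ n = 1s ⊞ q^ (suc (n ℕ.+ n))

  -- Multiply A(q³) - q B(q³) - q² C(q³) by 1 - q^(3n+1) - q^(3n+2) + q^(6n+3), sort the exponents
  -- modulo 3, and rename q³ as q.
  A B C : ℕ → Ser
  A zero = 1s
  A (suc n) = μ n ⊡ A n ⊞ q^ (suc n) ⊡ (B n ⊞ C n)
  B zero = 0s
  B (suc n) = μ n ⊡ B n ⊞ q^ n ⊡ (A n ⊖ q^ 1 ⊡ C n)
  C zero = 0s
  C (suc n) = μ n ⊡ C n ⊞ q^ n ⊡ (A n ⊖ B n)

  -- n = 3j + ρ throughout

  sT : ℕ → ℕ → Ser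
  sT j ρ = q^ (3 ℕ.* (j ℕ.* j)) ⊡ pochQ (ℕ.pred (2 ℕ.* j ℕ.+ ρ)) ⊡ poch (3 ℕ.* j) ⊡ ipoch ρ ⊡ ipochQ (suc (2 ℕ.* j)) ⊡ ipochQ j

  -- The factors that distinguish the three summands, taken at z = q^(3j) and u = q^n. With them the
  -- recurrences for B and C hold summand by summand, and the one for A holds up to a telescoping
  -- term.
  αP′ βP′ γP′ : Ser → Ser → Ser → Ser
  αP′ q z u = (1s ⊖ u ⊡ u) ⊡ (1s ⊖ q ⊡ q ⊡ q ⊡ z ⊡ z)
  βP′ q z u = (z ⊖ u) ⊡ (1s ⊖ q ⊡ q ⊡ z ⊞ u ⊡ q ⊡ (1s ⊖ q ⊡ z))
  γP′ q z u = (z ⊖ u) ⊡ (1s ⊖ q ⊡ z ⊞ u ⊡ (1s ⊖ q ⊡ q ⊡ z))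

  αP βP γP : Ser → Ser → Ser
  αP = αP′ (q^ 1)
  βP = βP′ (q^ 1)
  γP = γP′ (q^ 1)

  -- `gT` is the telescoping certificate. The recurrence for A fails on summand j by `gT j (ρ + 1)`
  -- minus the corresponding term of index j + 1 for the same value of n + 1; the boundary term
  -- `gT 0` vanishes because 1 - z² is 0 at z = 1.
  aT bT cT gT : ℕ → ℕ → Ser
  aT j ρ = sT j ρ ⊡ αP (q^ (3 ℕ.* j)) (q^ (3 ℕ.* j ℕ.+ ρ))
  bT j ρ = sT j ρ ⊡ βP (q^ (3 ℕ.* j)) (q^ (3 ℕ.* j ℕ.+ ρ))
  cT j ρ = sT j ρ ⊡ γP (q^ (3 ℕ.* j)) (q^ (3 ℕ.* j ℕ.+ ρ))
  gT j ρ = sT j ρ ⊡ (q^ ρ ⊡ ((1s ⊖ q^ (3 ℕ.* j) ⊡ q^ (3 ℕ.* j)) ⊡ (1s ⊖ q^ 1 ⊡ q^ 1 ⊡ q^ 1 ⊡ q^ (3 ℕ.* j) ⊡ q^ (3 ℕ.* j))))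

  -- The sum over all indices i ≥ j at a fixed n = 3j + ρ: raising i by one lowers ρ by three.
  Σ3 : (ℕ → ℕ → Ser) → ℕ → ℕ → Ser
  Σ3 f j zero = f j 0
  Σ3 f j (suc zero) = f j 1
  Σ3 f j (suc (suc zero)) = f j 2
  Σ3 f j (suc (suc (suc ρ))) = f j (3 ℕ.+ ρ) ⊞ Σ3 f (suc j) ρ

  q^-×2 : ∀ k → q^ (k ℕ.+ k) ≈ q^ k ⊡ q^ k
  q^-×2 k = q^-+ k k

  q^-×3 : ∀ k → q^ (3 ℕ.* k) ≈ q^ k ⊡ q^ k ⊡ q^ k
  q^-×3 k = ≈-trans (q^-cong {3 ℕ.* k} {k ℕ.+ k ℕ.+ k} (eq k))
     (≈-trans (q^-+ (k ℕ.+ k) k) (⊡-congʳ (q^ k) (q^-+ k k)))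
    where
    eq : ∀ k → 3 ℕ.* k ≡ k ℕ.+ k ℕ.+ k
    eq = ℕ-Ring.solve-∀

  pochQ-pred : ∀ m → 1 ℕ.≤ m → pochQ m ≈ pochQ (ℕ.pred m) ⊡ (1s ⊖ q^ (3 ℕ.* m))
  pochQ-pred (suc m) _ = ≈-refl

  private
    -- Dividing by (q;q)_(ρ+1) instead of (q;q)_ρ makes both `sT j ρ` and `sT j (ρ + 1)` polynomial
    -- multiples of one series, with factors 1 - q^(ρ+1) and 1 - Q^(2j+ρ). Each recurrence thereby
    -- becomes a polynomial identity in z = q^(3j), v = q^ρ and q.
    fbase : ℕ → ℕ → Ser
    fbase j ρ = q^ (3 ℕ.* (j ℕ.* j)) ⊡ pochQ (ℕ.pred (2 ℕ.* j ℕ.+ ρ)) ⊡ poch (3 ℕ.* j) ⊡ ipoch (suc ρ) ⊡ ipochQ (suc (2 ℕ.* j)) ⊡ ipochQ j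

    s-fbase : ∀ j ρ → sT j ρ ≈ fbase j ρ ⊡ (1s ⊖ q^ (suc ρ))
    s-fbase j ρ = ≈-sym (≈-trans (solve 7 (λ a b c d e f x → a :* b :* c :* d :* e :* f :* x := a :* b :* c :* (d :* x) :* e :* f) ≈-refl
        (q^ (3 ℕ.* (j ℕ.* j))) (pochQ (ℕ.pred (2 ℕ.* j ℕ.+ ρ))) (poch (3 ℕ.* j)) (ipoch (suc ρ)) (ipochQ (suc (2 ℕ.* j))) (ipochQ j) (1s ⊖ q^ (suc ρ)))
      (⊡-congʳ (ipochQ j) (⊡-congʳ (ipochQ (suc (2 ℕ.* j))) (⊡-congˡ (q^ (3 ℕ.* (j ℕ.* j)) ⊡ pochQ (ℕ.pred (2 ℕ.* j ℕ.+ ρ)) ⊡ poch (3 ℕ.* j)) (ipoch-suc ρ)))))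

    s-suc-fbase : ∀ j ρ → 1 ℕ.≤ 2 ℕ.* j ℕ.+ ρ → sT j (suc ρ) ≈ fbase j ρ ⊡ (1s ⊖ q^ (3 ℕ.* (2 ℕ.* j ℕ.+ ρ)))
    s-suc-fbase j ρ pos = ≈-trans
      (⊡-congʳ (ipochQ j) (⊡-congʳ (ipochQ (suc (2 ℕ.* j))) (⊡-congʳ (ipoch (suc ρ)) (⊡-congʳ (poch (3 ℕ.* j)) (⊡-congˡ (q^ (3 ℕ.* (j ℕ.* j)))
        (≈-trans (λ m → cong (λ k → pochQ (ℕ.pred k) m) (ℕ.+-suc (2 ℕ.* j) ρ)) (pochQ-pred (2 ℕ.* j ℕ.+ ρ) pos)))))))
      (solve 7 (λ a b c d e f x → a :* (b :* x) :* c :* d :* e :* f := a :* b :* c :* d :* e :* f :* x) ≈-refl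
        (q^ (3 ℕ.* (j ℕ.* j))) (pochQ (ℕ.pred (2 ℕ.* j ℕ.+ ρ))) (poch (3 ℕ.* j)) (ipoch (suc ρ)) (ipochQ (suc (2 ℕ.* j))) (ipochQ j) (1s ⊖ q^ (3 ℕ.* (2 ℕ.* j ℕ.+ ρ))))

    q^-suc : ∀ k → q^ (suc k) ≈ q^ 1 ⊡ q^ k
    q^-suc k = q^-+ 1 k

    uz : ∀ j ρ → q^ (3 ℕ.* j ℕ.+ ρ) ≈ q^ (3 ℕ.* j) ⊡ q^ ρ
    uz j ρ = q^-+ (3 ℕ.* j) ρ

    uz-suc : ∀ j ρ → q^ (3 ℕ.* j ℕ.+ suc ρ) ≈ q^ (3 ℕ.* j) ⊡ (q^ 1 ⊡ q^ ρ)
    uz-suc j ρ = ≈-trans (uz j (suc ρ)) (⊡-congˡ (q^ (3 ℕ.* j)) (q^-suc ρ))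

    Q2jρ : ∀ j ρ → q^ (3 ℕ.* (2 ℕ.* j ℕ.+ ρ)) ≈ (q^ (3 ℕ.* j) ⊡ q^ (3 ℕ.* j)) ⊡ (q^ ρ ⊡ q^ ρ ⊡ q^ ρ)
    Q2jρ j ρ = ≈-trans (q^-cong (eq j ρ)) (≈-trans (q^-+ (3 ℕ.* j ℕ.+ 3 ℕ.* j) (3 ℕ.* ρ)) (⊡-cong (q^-+ (3 ℕ.* j) (3 ℕ.* j)) (q^-×3 ρ)))
      where
      eq : ∀ j ρ → 3 ℕ.* (2 ℕ.* j ℕ.+ ρ) ≡ (3 ℕ.* j ℕ.+ 3 ℕ.* j) ℕ.+ 3 ℕ.* ρ
      eq = ℕ-Ring.solve-∀

    αP-cong : ∀ z {u u′} → u ≈ u′ → αP z u ≈ αP z u′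
    αP-cong z p = ⊡-congʳ _ (⊖-cong (⊡-cong p p))
    lemP : ∀ {x y} w → x ≈ y → w ⊖ x ≈ w ⊖ y
    lemP w p m = cong (λ x → w m ℤ.+ ℤ.- x) (p m)
    βP-cong : ∀ z {u u′} → u ≈ u′ → βP z u ≈ βP z u′
    βP-cong z p = ⊡-cong (lemP z p) (⊞-cong {1s ⊖ q^ 1 ⊡ q^ 1 ⊡ z} (λ _ → refl) (⊡-congʳ _ (⊡-congʳ (q^ 1) p)))
    γP-cong : ∀ z {u u′} → u ≈ u′ → γP z u ≈ γP z u′
    γP-cong z p = ⊡-cong (lemP z p) (⊞-cong {1s ⊖ q^ 1 ⊡ z} (λ _ → refl) (⊡-congʳ _ p))

    module _ (j ρ : ℕ) where
      z v q f : Ser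
      z = q^ (3 ℕ.* j)
      v = q^ ρ
      q = q^ 1
      f = fbase j ρ

      s≈ : sT j ρ ≈ f ⊡ (1s ⊖ q ⊡ v)
      s≈ = ≈-trans (s-fbase j ρ) (⊡-congˡ f (⊖-cong (q^-suc ρ)))

      s′≈ : 1 ℕ.≤ 2 ℕ.* j ℕ.+ ρ → sT j (suc ρ) ≈ f ⊡ (1s ⊖ (z ⊡ z) ⊡ (v ⊡ v ⊡ v))
      s′≈ pos = ≈-trans (s-suc-fbase j ρ pos) (⊡-congˡ f (⊖-cong (Q2jρ j ρ)))

      a≈ : aT j ρ ≈ f ⊡ (1s ⊖ q ⊡ v) ⊡ αP z (z ⊡ v)
      a≈ = ⊡-cong s≈ (αP-cong z (uz j ρ))
      b≈ : bT j ρ ≈ f ⊡ (1s ⊖ q ⊡ v) ⊡ βP z (z ⊡ v)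
      b≈ = ⊡-cong s≈ (βP-cong z (uz j ρ))
      c≈ : cT j ρ ≈ f ⊡ (1s ⊖ q ⊡ v) ⊡ γP z (z ⊡ v)
      c≈ = ⊡-cong s≈ (γP-cong z (uz j ρ))

      module _ (pos : 1 ℕ.≤ 2 ℕ.* j ℕ.+ ρ) where
        a′≈ : aT j (suc ρ) ≈ f ⊡ (1s ⊖ (z ⊡ z) ⊡ (v ⊡ v ⊡ v)) ⊡ αP z (z ⊡ (q ⊡ v))
        a′≈ = ⊡-cong (s′≈ pos) (αP-cong z (uz-suc j ρ))
        b′≈ : bT j (suc ρ) ≈ f ⊡ (1s ⊖ (z ⊡ z) ⊡ (v ⊡ v ⊡ v)) ⊡ βP z (z ⊡ (q ⊡ v))
        b′≈ = ⊡-cong (s′≈ pos) (βP-cong z (uz-suc j ρ))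
        c′≈ : cT j (suc ρ) ≈ f ⊡ (1s ⊖ (z ⊡ z) ⊡ (v ⊡ v ⊡ v)) ⊡ γP z (z ⊡ (q ⊡ v))
        c′≈ = ⊡-cong (s′≈ pos) (γP-cong z (uz-suc j ρ))

    :α :β :γ : ∀ {n} → Polynomial n → Polynomial n → Polynomial n → Polynomial n
    :α q z u = (c1 :- u :* u) :* (c1 :- q :* q :* q :* z :* z)
    :β q z u = (z :- u) :* (c1 :- q :* q :* z :+ u :* q :* (c1 :- q :* z))
    :γ q z u = (z :- u) :* (c1 :- q :* z :+ u :* (c1 :- q :* q :* z))

    γ-poly : ∀ f z v q → f ⊡ (1s ⊖ (z ⊡ z) ⊡ (v ⊡ v ⊡ v)) ⊡ γP′ q z (z ⊡ (q ⊡ v))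
       ≈ (1s ⊞ q ⊡ ((z ⊡ v) ⊡ (z ⊡ v))) ⊡ (f ⊡ (1s ⊖ q ⊡ v) ⊡ γP′ q z (z ⊡ v))
         ⊞ (z ⊡ v) ⊡ (f ⊡ (1s ⊖ q ⊡ v) ⊡ αP′ q z (z ⊡ v) ⊖ f ⊡ (1s ⊖ q ⊡ v) ⊡ βP′ q z (z ⊡ v))
    γ-poly = solve 4 (λ f z v q → f :* (c1 :- (z :* z) :* (v :* v :* v)) :* :γ q z (z :* (q :* v))
       := (c1 :+ q :* ((z :* v) :* (z :* v))) :* (f :* (c1 :- q :* v) :* :γ q z (z :* v))
         :+ (z :* v) :* (f :* (c1 :- q :* v) :* :α q z (z :* v) :- f :* (c1 :- q :* v) :* :β q z (z :* v))) ≈-refl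

    β-poly : ∀ f z v q → f ⊡ (1s ⊖ (z ⊡ z) ⊡ (v ⊡ v ⊡ v)) ⊡ βP′ q z (z ⊡ (q ⊡ v))
       ≈ (1s ⊞ q ⊡ ((z ⊡ v) ⊡ (z ⊡ v))) ⊡ (f ⊡ (1s ⊖ q ⊡ v) ⊡ βP′ q z (z ⊡ v))
         ⊞ (z ⊡ v) ⊡ (f ⊡ (1s ⊖ q ⊡ v) ⊡ αP′ q z (z ⊡ v) ⊖ q ⊡ (f ⊡ (1s ⊖ q ⊡ v) ⊡ γP′ q z (z ⊡ v)))
    β-poly = solve 4 (λ f z v q → f :* (c1 :- (z :* z) :* (v :* v :* v)) :* :β q z (z :* (q :* v))
       := (c1 :+ q :* ((z :* v) :* (z :* v))) :* (f :* (c1 :- q :* v) :* :β q z (z :* v))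
         :+ (z :* v) :* (f :* (c1 :- q :* v) :* :α q z (z :* v) :- q :* (f :* (c1 :- q :* v) :* :γ q z (z :* v)))) ≈-refl

    -- The last summand is the next telescoping term; v = q y.
    α-poly : ∀ f z y q → let v = q ⊡ y in f ⊡ (1s ⊖ (z ⊡ z) ⊡ (v ⊡ v ⊡ v)) ⊡ αP′ q z (z ⊡ (q ⊡ v))
       ≈ (1s ⊞ q ⊡ ((z ⊡ v) ⊡ (z ⊡ v))) ⊡ (f ⊡ (1s ⊖ q ⊡ v) ⊡ αP′ q z (z ⊡ v))
         ⊞ (q ⊡ (z ⊡ v)) ⊡ (f ⊡ (1s ⊖ q ⊡ v) ⊡ βP′ q z (z ⊡ v) ⊞ f ⊡ (1s ⊖ q ⊡ v) ⊡ γP′ q z (z ⊡ v))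
         ⊞ f ⊡ (1s ⊖ (z ⊡ z) ⊡ (v ⊡ v ⊡ v)) ⊡ ((q ⊡ v) ⊡ ((1s ⊖ z ⊡ z) ⊡ (1s ⊖ q ⊡ q ⊡ q ⊡ z ⊡ z)))
         ⊖ f ⊡ (q ⊡ q ⊡ y ⊡ z ⊡ z ⊡ (1s ⊖ q ⊡ z) ⊡ (1s ⊖ q ⊡ q ⊡ z) ⊡ (1s ⊖ y) ⊡ (1s ⊖ q ⊡ y) ⊡ (1s ⊖ q ⊡ q ⊡ y))
    α-poly = solve 4 (λ f z y q → let v = q :* y in f :* (c1 :- (z :* z) :* (v :* v :* v)) :* :α q z (z :* (q :* v))
       := (c1 :+ q :* ((z :* v) :* (z :* v))) :* (f :* (c1 :- q :* v) :* :α q z (z :* v))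
         :+ (q :* (z :* v)) :* (f :* (c1 :- q :* v) :* :β q z (z :* v) :+ f :* (c1 :- q :* v) :* :γ q z (z :* v))
         :+ f :* (c1 :- (z :* z) :* (v :* v :* v)) :* ((q :* v) :* ((c1 :- z :* z) :* (c1 :- q :* q :* q :* z :* z)))
         :- f :* (q :* q :* y :* z :* z :* (c1 :- q :* z) :* (c1 :- q :* q :* z) :* (c1 :- y) :* (c1 :- q :* y) :* (c1 :- q :* q :* y))) ≈-refl

    -- The case ρ = 0: here v = 1 is not of the form q y, and at n + 1 = 3j + 1 there is no summand
    -- j + 1 to telescope with.
    α-poly₀ : ∀ f z q → let v = 1s in f ⊡ (1s ⊖ (z ⊡ z) ⊡ (v ⊡ v ⊡ v)) ⊡ αP′ q z (z ⊡ (q ⊡ v))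
       ≈ (1s ⊞ q ⊡ ((z ⊡ v) ⊡ (z ⊡ v))) ⊡ (f ⊡ (1s ⊖ q ⊡ v) ⊡ αP′ q z (z ⊡ v))
         ⊞ (q ⊡ (z ⊡ v)) ⊡ (f ⊡ (1s ⊖ q ⊡ v) ⊡ βP′ q z (z ⊡ v) ⊞ f ⊡ (1s ⊖ q ⊡ v) ⊡ γP′ q z (z ⊡ v))
         ⊞ f ⊡ (1s ⊖ (z ⊡ z) ⊡ (v ⊡ v ⊡ v)) ⊡ ((q ⊡ v) ⊡ ((1s ⊖ z ⊡ z) ⊡ (1s ⊖ q ⊡ q ⊡ q ⊡ z ⊡ z)))
    α-poly₀ = solve 3 (λ f z q → let v = c1 in f :* (c1 :- (z :* z) :* (v :* v :* v)) :* :α q z (z :* (q :* v))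
       := (c1 :+ q :* ((z :* v) :* (z :* v))) :* (f :* (c1 :- q :* v) :* :α q z (z :* v))
         :+ (q :* (z :* v)) :* (f :* (c1 :- q :* v) :* :β q z (z :* v) :+ f :* (c1 :- q :* v) :* :γ q z (z :* v))
         :+ f :* (c1 :- (z :* z) :* (v :* v :* v)) :* ((q :* v) :* ((c1 :- z :* z) :* (c1 :- q :* q :* q :* z :* z)))) ≈-refl

    μ≈ : ∀ j ρ → μ (3 ℕ.* j ℕ.+ ρ) ≈ 1s ⊞ q^ 1 ⊡ ((q^ (3 ℕ.* j) ⊡ q^ ρ) ⊡ (q^ (3 ℕ.* j) ⊡ q^ ρ))
    μ≈ j ρ = ⊞-cong {1s} (λ _ → refl) (≈-trans (q^-suc _) (⊡-congˡ (q^ 1) (≈-trans (q^-+ (3 ℕ.* j ℕ.+ ρ) (3 ℕ.* j ℕ.+ ρ)) (⊡-cong (uz j ρ) (uz j ρ)))))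

    c-step : ∀ j ρ → 1 ℕ.≤ 2 ℕ.* j ℕ.+ ρ → let n = 3 ℕ.* j ℕ.+ ρ in
      cT j (suc ρ) ≈ μ n ⊡ cT j ρ ⊞ q^ n ⊡ (aT j ρ ⊖ bT j ρ)
    c-step j ρ pos = ≈-trans (c′≈ j ρ pos) (≈-trans (γ-poly (f j ρ) (z j ρ) (v j ρ) (q j ρ))
      (≈-sym (⊞-cong (⊡-cong (μ≈ j ρ) (c≈ j ρ)) (⊡-cong (uz j ρ) (⊞-cong (a≈ j ρ) (⊟-cong (b≈ j ρ)))))))

    b-step : ∀ j ρ → 1 ℕ.≤ 2 ℕ.* j ℕ.+ ρ → let n = 3 ℕ.* j ℕ.+ ρ in
      bT j (suc ρ) ≈ μ n ⊡ bT j ρ ⊞ q^ n ⊡ (aT j ρ ⊖ q^ 1 ⊡ cT j ρ)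
    b-step j ρ pos = ≈-trans (b′≈ j ρ pos) (≈-trans (β-poly (f j ρ) (z j ρ) (v j ρ) (q j ρ))
      (≈-sym (⊞-cong (⊡-cong (μ≈ j ρ) (b≈ j ρ)) (⊡-cong (uz j ρ) (⊞-cong (a≈ j ρ) (⊟-cong (⊡-congˡ (q^ 1) (c≈ j ρ))))))))

    g′≈ : ∀ j ρ → 1 ℕ.≤ 2 ℕ.* j ℕ.+ ρ → gT j (suc ρ) ≈
       f j ρ ⊡ (1s ⊖ (z j ρ ⊡ z j ρ) ⊡ (v j ρ ⊡ v j ρ ⊡ v j ρ)) ⊡ ((q j ρ ⊡ v j ρ) ⊡ ((1s ⊖ z j ρ ⊡ z j ρ) ⊡ (1s ⊖ q j ρ ⊡ q j ρ ⊡ q j ρ ⊡ z j ρ ⊡ z j ρ)))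
    g′≈ j ρ pos = ⊡-cong (s′≈ j ρ pos) (⊡-congʳ _ (q^-suc ρ))

    -- The factors 1 - Q^(2j+2) and 1 - Q^(2j+3) of `gT (j + 1)` cancel the two new factors of
    -- (Q;Q)_(2j+3), and the factor 1 - q^(3j+3) that is new in (q;q)_(3j+3) cancels the new one in
    -- (Q;Q)_(j+1). So both ends of the telescoping step are multiples of the same `fbase`.
    g-next : ∀ j κ → gT (suc j) κ ≈ fbase j (2 ℕ.+ κ) ⊡ (q^ 1 ⊡ q^ 1 ⊡ q^ (suc κ) ⊡ q^ (3 ℕ.* j) ⊡ q^ (3 ℕ.* j) ⊡ (1s ⊖ q^ 1 ⊡ q^ (3 ℕ.* j)) ⊡ (1s ⊖ q^ 1 ⊡ q^ 1 ⊡ q^ (3 ℕ.* j))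
         ⊡ (1s ⊖ q^ (suc κ)) ⊡ (1s ⊖ q^ 1 ⊡ q^ (suc κ)) ⊡ (1s ⊖ q^ 1 ⊡ q^ 1 ⊡ q^ (suc κ)))
    g-next j κ = begin
        q^ (3 ℕ.* (suc j ℕ.* suc j)) ⊡ pochQ (ℕ.pred (2 ℕ.* suc j ℕ.+ κ)) ⊡ poch (3 ℕ.* suc j) ⊡ ipoch κ ⊡ ipochQ (suc (2 ℕ.* suc j)) ⊡ ipochQ (suc j)
          ⊡ (q^ κ ⊡ ((1s ⊖ q^ (3 ℕ.* suc j) ⊡ q^ (3 ℕ.* suc j)) ⊡ (1s ⊖ q^ 1 ⊡ q^ 1 ⊡ q^ 1 ⊡ q^ (3 ℕ.* suc j) ⊡ q^ (3 ℕ.* suc j))))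
      ≈⟨ ⊡-cong (⊡-congʳ (ipochQ (suc j)) (⊡-cong (⊡-cong (⊡-cong (⊡-cong e1 e2) e3) e4) e5))
           (⊡-congˡ (q^ κ) (⊡-cong e6 e7)) ⟩
        (q₁ ⊡ q₁ ⊡ q₁ ⊡ z₁ ⊡ z₁ ⊡ N) ⊡ PQ ⊡ (PZ ⊡ (1s ⊖ q₁ ⊡ z₁) ⊡ (1s ⊖ q₁ ⊡ q₁ ⊡ z₁) ⊡ (1s ⊖ q^ (3 ℕ.* suc j)))
          ⊡ (IP ⊡ (1s ⊖ q₁ ⊡ q₁ ⊡ y) ⊡ (1s ⊖ q₁ ⊡ y) ⊡ (1s ⊖ y)) ⊡ ipochQ (3 ℕ.+ 2 ℕ.* j) ⊡ ipochQ (suc j)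
          ⊡ (q^ κ ⊡ ((1s ⊖ q^ (3 ℕ.* (2 ℕ.+ 2 ℕ.* j))) ⊡ (1s ⊖ q^ (3 ℕ.* (3 ℕ.+ 2 ℕ.* j)))))
      ≈⟨ step ⟩
        N ⊡ PQ ⊡ PZ ⊡ IP ⊡ ((ipochQ (3 ℕ.+ 2 ℕ.* j) ⊡ (1s ⊖ q^ (3 ℕ.* (3 ℕ.+ 2 ℕ.* j)))) ⊡ (1s ⊖ q^ (3 ℕ.* (2 ℕ.+ 2 ℕ.* j))))
          ⊡ (ipochQ (suc j) ⊡ (1s ⊖ q^ (3 ℕ.* suc j)))
          ⊡ (q₁ ⊡ q₁ ⊡ (q₁ ⊡ q^ κ) ⊡ z₁ ⊡ z₁ ⊡ (1s ⊖ q₁ ⊡ z₁) ⊡ (1s ⊖ q₁ ⊡ q₁ ⊡ z₁) ⊡ (1s ⊖ y) ⊡ (1s ⊖ q₁ ⊡ y) ⊡ (1s ⊖ q₁ ⊡ q₁ ⊡ y))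
      ≈⟨ ⊡-cong (⊡-cong (⊡-congˡ (N ⊡ PQ ⊡ PZ ⊡ IP) (≈-trans (⊡-congʳ _ (ipochQ-suc (2 ℕ.+ 2 ℕ.* j))) (ipochQ-suc (1 ℕ.+ 2 ℕ.* j)))) (ipochQ-suc j))
           (⊡-congʳ (1s ⊖ q₁ ⊡ q₁ ⊡ y) (⊡-congʳ (1s ⊖ q₁ ⊡ y) (⊡-congʳ (1s ⊖ y) (⊡-congʳ _ (⊡-congʳ _ (⊡-congʳ z₁ (⊡-congʳ z₁ (⊡-congˡ (q₁ ⊡ q₁) (≈-sym (q^-suc κ)))))))))) ⟩
        N ⊡ PQ ⊡ PZ ⊡ IP ⊡ ipochQ (suc (2 ℕ.* j)) ⊡ ipochQ j
          ⊡ (q₁ ⊡ q₁ ⊡ y ⊡ z₁ ⊡ z₁ ⊡ (1s ⊖ q₁ ⊡ z₁) ⊡ (1s ⊖ q₁ ⊡ q₁ ⊡ z₁) ⊡ (1s ⊖ y) ⊡ (1s ⊖ q₁ ⊡ y) ⊡ (1s ⊖ q₁ ⊡ q₁ ⊡ y)) ∎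
      where
      open ≈-Reasoning
      q₁ = q^ 1
      z₁ = q^ (3 ℕ.* j)
      y = q^ (suc κ)
      N = q^ (3 ℕ.* (j ℕ.* j))
      PQ = pochQ (ℕ.pred (2 ℕ.* j ℕ.+ (2 ℕ.+ κ)))
      PZ = poch (3 ℕ.* j)
      IP = ipoch (3 ℕ.+ κ)
      n1 : ∀ j → 3 ℕ.* (suc j ℕ.* suc j) ≡ 1 ℕ.+ 1 ℕ.+ 1 ℕ.+ 3 ℕ.* j ℕ.+ 3 ℕ.* j ℕ.+ 3 ℕ.* (j ℕ.* j)
      n1 = ℕ-Ring.solve-∀
      n2 : ∀ j κ → 2 ℕ.* suc j ℕ.+ κ ≡ 2 ℕ.* j ℕ.+ (2 ℕ.+ κ)
      n2 = ℕ-Ring.solve-∀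
      n3 : ∀ j → 3 ℕ.* suc j ≡ 3 ℕ.+ 3 ℕ.* j
      n3 = ℕ-Ring.solve-∀
      n5 : ∀ j → suc (2 ℕ.* suc j) ≡ 3 ℕ.+ 2 ℕ.* j
      n5 = ℕ-Ring.solve-∀
      n6 : ∀ j → 3 ℕ.* (2 ℕ.+ 2 ℕ.* j) ≡ 3 ℕ.* suc j ℕ.+ 3 ℕ.* suc j
      n6 = ℕ-Ring.solve-∀
      n7 : ∀ j → 3 ℕ.* (3 ℕ.+ 2 ℕ.* j) ≡ 1 ℕ.+ 1 ℕ.+ 1 ℕ.+ 3 ℕ.* suc j ℕ.+ 3 ℕ.* suc j
      n7 = ℕ-Ring.solve-∀
      q³ : ∀ a b → q^ (1 ℕ.+ 1 ℕ.+ 1 ℕ.+ a ℕ.+ b) ≈ q₁ ⊡ q₁ ⊡ q₁ ⊡ q^ a ⊡ q^ b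
      q³ a b = ≈-trans (q^-+ (3 ℕ.+ a) b) (⊡-congʳ (q^ b) (≈-trans (q^-+ 3 a) (⊡-congʳ (q^ a) (≈-trans (q^-+ 2 1) (⊡-congʳ q₁ (q^-+ 1 1))))))
      e1 : q^ (3 ℕ.* (suc j ℕ.* suc j)) ≈ q₁ ⊡ q₁ ⊡ q₁ ⊡ z₁ ⊡ z₁ ⊡ N
      e1 = ≈-trans (q^-cong (n1 j)) (≈-trans (q^-+ (3 ℕ.+ 3 ℕ.* j ℕ.+ 3 ℕ.* j) (3 ℕ.* (j ℕ.* j))) (⊡-congʳ N (q³ (3 ℕ.* j) (3 ℕ.* j))))
      e2 : pochQ (ℕ.pred (2 ℕ.* suc j ℕ.+ κ)) ≈ PQ
      e2 m = cong (λ k → pochQ (ℕ.pred k) m) (n2 j κ)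
      e3 : poch (3 ℕ.* suc j) ≈ PZ ⊡ (1s ⊖ q₁ ⊡ z₁) ⊡ (1s ⊖ q₁ ⊡ q₁ ⊡ z₁) ⊡ (1s ⊖ q^ (3 ℕ.* suc j))
      e3 = ≈-trans (λ m → cong (λ k → poch k m) (n3 j))
        (⊡-cong (⊡-cong (⊡-congˡ PZ (⊖-cong (q^-suc _))) (⊖-cong (≈-trans (q^-+ 2 _) (⊡-congʳ z₁ (q^-+ 1 1))))) (⊖-cong (q^-cong (sym (n3 j)))))
      e4 : ipoch κ ≈ IP ⊡ (1s ⊖ q₁ ⊡ q₁ ⊡ y) ⊡ (1s ⊖ q₁ ⊡ y) ⊡ (1s ⊖ y)
      e4 = ≈-sym (≈-trans (⊡-congʳ (1s ⊖ y) (≈-trans (⊡-congʳ (1s ⊖ q₁ ⊡ y)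
               (≈-trans (⊡-congˡ IP (⊖-cong (≈-sym (≈-trans (q^-+ 2 (suc κ)) (⊡-congʳ y (q^-+ 1 1)))))) (ipoch-suc (2 ℕ.+ κ))))
               (≈-trans (⊡-congˡ (ipoch (2 ℕ.+ κ)) (⊖-cong (≈-sym (q^-suc (suc κ))))) (ipoch-suc (suc κ))))) (ipoch-suc κ))
      e5 : ipochQ (suc (2 ℕ.* suc j)) ≈ ipochQ (3 ℕ.+ 2 ℕ.* j)
      e5 m = cong (λ k → ipochQ k m) (n5 j)
      e6 : 1s ⊖ q^ (3 ℕ.* suc j) ⊡ q^ (3 ℕ.* suc j) ≈ 1s ⊖ q^ (3 ℕ.* (2 ℕ.+ 2 ℕ.* j))
      e6 = ⊖-cong (≈-sym (≈-trans (q^-cong (n6 j)) (q^-+ (3 ℕ.* suc j) (3 ℕ.* suc j))))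
      e7 : 1s ⊖ q₁ ⊡ q₁ ⊡ q₁ ⊡ q^ (3 ℕ.* suc j) ⊡ q^ (3 ℕ.* suc j) ≈ 1s ⊖ q^ (3 ℕ.* (3 ℕ.+ 2 ℕ.* j))
      e7 = ⊖-cong (≈-sym (≈-trans (q^-cong (n7 j)) (q³ (3 ℕ.* suc j) (3 ℕ.* suc j))))
      step = solve 17 (λ q z N PQ PZ c d e IP p t w i₃ i₁ x m₂ m₃ → 
              (q :* q :* q :* z :* z :* N) :* PQ :* (PZ :* c :* d :* e) :* (IP :* p :* t :* w) :* i₃ :* i₁ :* (x :* (m₂ :* m₃))
              := N :* PQ :* PZ :* IP :* ((i₃ :* m₃) :* m₂) :* (i₁ :* e) :* (q :* q :* (q :* x) :* z :* z :* c :* d :* w :* t :* p)) ≈-refl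
           q₁ z₁ N PQ PZ (1s ⊖ q₁ ⊡ z₁) (1s ⊖ q₁ ⊡ q₁ ⊡ z₁) (1s ⊖ q^ (3 ℕ.* suc j)) IP (1s ⊖ q₁ ⊡ q₁ ⊡ y) (1s ⊖ q₁ ⊡ y) (1s ⊖ y)
           (ipochQ (3 ℕ.+ 2 ℕ.* j)) (ipochQ (suc j)) (q^ κ) (1s ⊖ q^ (3 ℕ.* (2 ℕ.+ 2 ℕ.* j))) (1s ⊖ q^ (3 ℕ.* (3 ℕ.+ 2 ℕ.* j)))

    qu≈ : ∀ j ρ → q^ (suc (3 ℕ.* j ℕ.+ ρ)) ≈ q^ 1 ⊡ (q^ (3 ℕ.* j) ⊡ q^ ρ)
    qu≈ j ρ = ≈-trans (q^-suc _) (⊡-congˡ (q^ 1) (uz j ρ))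

    a-rhs : ℕ → ℕ → Ser
    a-rhs j ρ = μ n ⊡ aT j ρ ⊞ q^ (suc n) ⊡ (bT j ρ ⊞ cT j ρ) ⊞ gT j (suc ρ)
      where n = 3 ℕ.* j ℕ.+ ρ

    a-rhs≈ : ∀ j ρ → 1 ℕ.≤ 2 ℕ.* j ℕ.+ ρ → a-rhs j ρ ≈
       (1s ⊞ q^ 1 ⊡ ((q^ (3 ℕ.* j) ⊡ q^ ρ) ⊡ (q^ (3 ℕ.* j) ⊡ q^ ρ))) ⊡ (f j ρ ⊡ (1s ⊖ q^ 1 ⊡ q^ ρ) ⊡ αP (q^ (3 ℕ.* j)) (q^ (3 ℕ.* j) ⊡ q^ ρ))
         ⊞ (q^ 1 ⊡ (q^ (3 ℕ.* j) ⊡ q^ ρ)) ⊡ (f j ρ ⊡ (1s ⊖ q^ 1 ⊡ q^ ρ) ⊡ βP (q^ (3 ℕ.* j)) (q^ (3 ℕ.* j) ⊡ q^ ρ) ⊞ f j ρ ⊡ (1s ⊖ q^ 1 ⊡ q^ ρ) ⊡ γP (q^ (3 ℕ.* j)) (q^ (3 ℕ.* j) ⊡ q^ ρ))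
         ⊞ f j ρ ⊡ (1s ⊖ (z j ρ ⊡ z j ρ) ⊡ (v j ρ ⊡ v j ρ ⊡ v j ρ)) ⊡ ((q j ρ ⊡ v j ρ) ⊡ ((1s ⊖ z j ρ ⊡ z j ρ) ⊡ (1s ⊖ q j ρ ⊡ q j ρ ⊡ q j ρ ⊡ z j ρ ⊡ z j ρ)))
    a-rhs≈ j ρ pos = ⊞-cong (⊞-cong (⊡-cong (μ≈ j ρ) (a≈ j ρ)) (⊡-cong (qu≈ j ρ) (⊞-cong (b≈ j ρ) (c≈ j ρ)))) (g′≈ j ρ pos)

    α-poly′ : ∀ f z y q v → v ≈ q ⊡ y → f ⊡ (1s ⊖ (z ⊡ z) ⊡ (v ⊡ v ⊡ v)) ⊡ αP′ q z (z ⊡ (q ⊡ v))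
       ≈ (1s ⊞ q ⊡ ((z ⊡ v) ⊡ (z ⊡ v))) ⊡ (f ⊡ (1s ⊖ q ⊡ v) ⊡ αP′ q z (z ⊡ v))
         ⊞ (q ⊡ (z ⊡ v)) ⊡ (f ⊡ (1s ⊖ q ⊡ v) ⊡ βP′ q z (z ⊡ v) ⊞ f ⊡ (1s ⊖ q ⊡ v) ⊡ γP′ q z (z ⊡ v))
         ⊞ f ⊡ (1s ⊖ (z ⊡ z) ⊡ (v ⊡ v ⊡ v)) ⊡ ((q ⊡ v) ⊡ ((1s ⊖ z ⊡ z) ⊡ (1s ⊖ q ⊡ q ⊡ q ⊡ z ⊡ z)))
         ⊖ f ⊡ (q ⊡ q ⊡ y ⊡ z ⊡ z ⊡ (1s ⊖ q ⊡ z) ⊡ (1s ⊖ q ⊡ q ⊡ z) ⊡ (1s ⊖ y) ⊡ (1s ⊖ q ⊡ y) ⊡ (1s ⊖ q ⊡ q ⊡ y))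
    α-poly′ f z y q v p = ≈-trans (lhs p) (≈-trans (α-poly f z y q)
        (⊞-cong (≈-sym (⊞-cong (⊞-cong (⊡-cong (⊞-cong {1s} (λ _ → refl) (⊡-congˡ q (⊡-cong (⊡-congˡ z p) (⊡-congˡ z p)))) (⊡-cong fv (αc (⊡-congˡ z p))))
          (⊡-cong (⊡-congˡ q (⊡-congˡ z p)) (⊞-cong (⊡-cong fv (βc (⊡-congˡ z p))) (⊡-cong fv (γc (⊡-congˡ z p))))))
          (⊡-cong (⊡-congˡ f (⊖-cong (⊡-congˡ (z ⊡ z) (⊡-cong (⊡-cong p p) p)))) (⊡-congʳ _ (⊡-congˡ q p))))) (λ _ → refl)))
      where
      fv : f ⊡ (1s ⊖ q ⊡ v) ≈ f ⊡ (1s ⊖ q ⊡ (q ⊡ y))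
      fv = ⊡-congˡ f (⊖-cong (⊡-congˡ q p))
      αc : ∀ {u u′} → u ≈ u′ → αP′ q z u ≈ αP′ q z u′
      αc p = ⊡-congʳ _ (⊖-cong (⊡-cong p p))
      βc : ∀ {u u′} → u ≈ u′ → βP′ q z u ≈ βP′ q z u′
      βc p = ⊡-cong (lemP z p) (⊞-cong {1s ⊖ q ⊡ q ⊡ z} (λ _ → refl) (⊡-congʳ _ (⊡-congʳ q p)))
      γc : ∀ {u u′} → u ≈ u′ → γP′ q z u ≈ γP′ q z u′
      γc p = ⊡-cong (lemP z p) (⊞-cong {1s ⊖ q ⊡ z} (λ _ → refl) (⊡-congʳ _ p))
      lhs : v ≈ q ⊡ y → f ⊡ (1s ⊖ (z ⊡ z) ⊡ (v ⊡ v ⊡ v)) ⊡ αP′ q z (z ⊡ (q ⊡ v)) ≈ f ⊡ (1s ⊖ (z ⊡ z) ⊡ ((q ⊡ y) ⊡ (q ⊡ y) ⊡ (q ⊡ y))) ⊡ αP′ q z (z ⊡ (q ⊡ (q ⊡ y)))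
      lhs p = ⊡-cong (⊡-congˡ f (⊖-cong (⊡-congˡ (z ⊡ z) (⊡-cong (⊡-cong p p) p)))) (αc (⊡-congˡ z (⊡-congˡ q p)))

    a-step : ∀ j κ → aT j (3 ℕ.+ κ) ≈ a-rhs j (2 ℕ.+ κ) ⊖ gT (suc j) κ
    a-step j κ = ≈-trans (a′≈ j (2 ℕ.+ κ) pos) (≈-trans (α-poly′ (f j (2 ℕ.+ κ)) (q^ (3 ℕ.* j)) (q^ (suc κ)) (q^ 1) (q^ (2 ℕ.+ κ)) (q^-suc (suc κ)))
        (≈-sym (⊞-cong (a-rhs≈ j (2 ℕ.+ κ) pos) (⊟-cong (g-next j κ)))))
      where
      pos : 1 ℕ.≤ 2 ℕ.* j ℕ.+ (2 ℕ.+ κ)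
      pos = ℕ.≤-trans (ℕ.s≤s ℕ.z≤n) (ℕ.m≤n+m (2 ℕ.+ κ) (2 ℕ.* j))

    a-step₀ : ∀ j → 1 ℕ.≤ 2 ℕ.* j ℕ.+ 0 → aT j 1 ≈ a-rhs j 0
    a-step₀ j pos = ≈-trans (a′≈ j 0 pos) (≈-trans (α-poly₀ (f j 0) (q^ (3 ℕ.* j)) (q^ 1)) (≈-sym (a-rhs≈ j 0 pos)))

    -- For ρ = 1 the next telescoping term is absent as well: in the polynomial identity it carries
    -- the factor 1 - y, and y = 1.
    a-step₁ : ∀ j → aT j 2 ≈ a-rhs j 1
    a-step₁ j = ≈-trans (a′≈ j 1 pos) (≈-trans (α-poly′ (f j 1) (q^ (3 ℕ.* j)) 1s (q^ 1) (q^ 1) (≈-sym (≈-trans (⊡-comm (q^ 1) 1s) (⊡-identityˡ (q^ 1)))))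
        (≈-trans (solve 5 (λ a b c d e → a :- b :* (c :* (c1 :- c1) :* d :* e) := a) ≈-refl _ (f j 1) _ _ _) (≈-sym (a-rhs≈ j 1 pos))))
      where
      pos : 1 ℕ.≤ 2 ℕ.* j ℕ.+ 1
      pos = ℕ.m≤n+m 1 (2 ℕ.* j)

    -- The factor z - u vanishes, so the summand that enters the sum when n becomes a multiple of 3
    -- can be added for free.
    γ₀ : ∀ j → cT j 0 ≈ 0s
    γ₀ j = ≈-trans (⊡-congˡ (sT j 0) (γP-cong _ (q^-cong (ℕ.+-identityʳ (3 ℕ.* j)))))
      (≈-trans (solve 3 (λ s z x → s :* ((z :- z) :* x) := con 0ℤ) ≈-refl (sT j 0) (q^ (3 ℕ.* j)) _) (λ { zero → refl ; (suc _) → refl }))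

    β₀ : ∀ j → bT j 0 ≈ 0s
    β₀ j = ≈-trans (⊡-congˡ (sT j 0) (βP-cong _ (q^-cong (ℕ.+-identityʳ (3 ℕ.* j)))))
      (≈-trans (solve 3 (λ s z x → s :* ((z :- z) :* x) := con 0ℤ) ≈-refl (sT j 0) (q^ (3 ℕ.* j)) _) (λ { zero → refl ; (suc _) → refl }))

    ⊞-zeroʳ : ∀ {f g} → g ≈ 0s → f ⊞ g ≈ f
    ⊞-zeroʳ {f} p m = trans (cong (λ x → f m ℤ.+ x) (p m)) (ℤ.+-identityʳ (f m))

    n-next : ∀ j ρ → 3 ℕ.* j ℕ.+ (3 ℕ.+ ρ) ≡ 3 ℕ.* suc j ℕ.+ ρ
    n-next = ℕ-Ring.solve-∀

    pos-next : ∀ j ρ → 1 ℕ.≤ 2 ℕ.* suc j ℕ.+ ρ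
    pos-next j ρ = ℕ.s≤s ℕ.z≤n

    Σc-step : ∀ n j ρ → n ≡ 3 ℕ.* j ℕ.+ ρ → 1 ℕ.≤ 2 ℕ.* j ℕ.+ ρ →
      Σ3 cT j (suc ρ) ≈ μ n ⊡ Σ3 cT j ρ ⊞ q^ n ⊡ (Σ3 aT j ρ ⊖ Σ3 bT j ρ)
    Σc-step _ j 0 refl pos = c-step j 0 pos
    Σc-step _ j 1 refl pos = c-step j 1 pos
    Σc-step _ j 2 refl pos = ≈-trans (⊞-zeroʳ (γ₀ (suc j))) (c-step j 2 pos)
    Σc-step _ j (suc (suc (suc ρ))) refl pos = ≈-trans
      (⊞-cong (c-step j (3 ℕ.+ ρ) pos) (Σc-step _ (suc j) ρ (n-next j ρ) (pos-next j ρ)))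
      (solve 8 (λ m c u a b c′ a′ b′ → (m :* c :+ u :* (a :- b)) :+ (m :* c′ :+ u :* (a′ :- b′)) := m :* (c :+ c′) :+ u :* ((a :+ a′) :- (b :+ b′))) ≈-refl
        (μ (3 ℕ.* j ℕ.+ (3 ℕ.+ ρ))) _ (q^ (3 ℕ.* j ℕ.+ (3 ℕ.+ ρ))) (aT j (3 ℕ.+ ρ)) (bT j (3 ℕ.+ ρ)) (Σ3 cT (suc j) ρ) (Σ3 aT (suc j) ρ) (Σ3 bT (suc j) ρ))

    Σb-step : ∀ n j ρ → n ≡ 3 ℕ.* j ℕ.+ ρ → 1 ℕ.≤ 2 ℕ.* j ℕ.+ ρ →
      Σ3 bT j (suc ρ) ≈ μ n ⊡ Σ3 bT j ρ ⊞ q^ n ⊡ (Σ3 aT j ρ ⊖ q^ 1 ⊡ Σ3 cT j ρ)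
    Σb-step _ j 0 refl pos = b-step j 0 pos
    Σb-step _ j 1 refl pos = b-step j 1 pos
    Σb-step _ j 2 refl pos = ≈-trans (⊞-zeroʳ (β₀ (suc j))) (b-step j 2 pos)
    Σb-step _ j (suc (suc (suc ρ))) refl pos = ≈-trans
      (⊞-cong (b-step j (3 ℕ.+ ρ) pos) (Σb-step _ (suc j) ρ (n-next j ρ) (pos-next j ρ)))
      (solve 9 (λ m c u a q b c′ a′ b′ → (m :* c :+ u :* (a :- q :* b)) :+ (m :* c′ :+ u :* (a′ :- q :* b′)) := m :* (c :+ c′) :+ u :* ((a :+ a′) :- q :* (b :+ b′))) ≈-refl
        (μ (3 ℕ.* j ℕ.+ (3 ℕ.+ ρ))) _ (q^ (3 ℕ.* j ℕ.+ (3 ℕ.+ ρ))) (aT j (3 ℕ.+ ρ)) (q^ 1) (cT j (3 ℕ.+ ρ)) (Σ3 bT (suc j) ρ) (Σ3 aT (suc j) ρ) (Σ3 cT (suc j) ρ))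

    -- When n + 1 = 3(j + 1), the summand that newly enters A equals the telescoping term left over
    -- at the end of the sum, and cancels it.
    aT₀ : ∀ j → aT j 0 ≈ gT j 0
    aT₀ j = ≈-trans (⊡-congˡ (sT j 0) (αP-cong _ (q^-cong (ℕ.+-identityʳ (3 ℕ.* j)))))
       (⊡-congˡ (sT j 0) (≈-sym (⊡-identityˡ _)))

    Σa-step : ∀ n j ρ → n ≡ 3 ℕ.* j ℕ.+ ρ → 1 ℕ.≤ 2 ℕ.* j ℕ.+ ρ →
      Σ3 aT j (suc ρ) ≈ μ n ⊡ Σ3 aT j ρ ⊞ q^ (suc n) ⊡ (Σ3 bT j ρ ⊞ Σ3 cT j ρ) ⊞ gT j (suc ρ)
    Σa-step _ j 0 refl pos = a-step₀ j pos
    Σa-step _ j 1 refl pos = a-step₁ j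
    Σa-step _ j 2 refl pos = ≈-trans (⊞-cong (a-step j 0) (aT₀ (suc j)))
      (solve 2 (λ x g → x :- g :+ g := x) ≈-refl (a-rhs j 2) (gT (suc j) 0))
    Σa-step _ j (suc (suc (suc ρ))) refl pos = ≈-trans
      (⊞-cong (a-step j (suc ρ)) (Σa-step _ (suc j) ρ (n-next j ρ) (pos-next j ρ)))
      (solve 10 (λ m a u b c g g′ a′ b′ c′ → (m :* a :+ u :* (b :+ c) :+ g) :- g′ :+ (m :* a′ :+ u :* (b′ :+ c′) :+ g′) := m :* (a :+ a′) :+ u :* ((b :+ b′) :+ (c :+ c′)) :+ g) ≈-refl
        (μ (3 ℕ.* j ℕ.+ (3 ℕ.+ ρ))) _ (q^ (suc (3 ℕ.* j ℕ.+ (3 ℕ.+ ρ)))) (bT j (3 ℕ.+ ρ)) (cT j (3 ℕ.+ ρ)) (gT j (4 ℕ.+ ρ)) (gT (suc j) (suc ρ)) (Σ3 aT (suc j) ρ) (Σ3 bT (suc j) ρ) (Σ3 cT (suc j) ρ))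

    g₀ : ∀ ρ → gT 0 ρ ≈ 0s
    g₀ ρ = ≈-trans (solve 3 (λ s u x → s :* (u :* ((c1 :- c1 :* c1) :* x)) := con 0ℤ) ≈-refl (sT 0 ρ) (q^ ρ) _) (λ { zero → refl ; (suc _) → refl })

    s₁ : sT 0 1 ≈ geo 0 ⊡ geo 2
    s₁ = solve 2 (λ x y → c1 :* c1 :* c1 :* (c1 :* x) :* (c1 :* y) :* c1 := x :* y) ≈-refl (geo 0) (geo 2)

    q³≈ : q^ 3 ≈ q^ 1 ⊡ q^ 1 ⊡ q^ 1
    q³≈ = ≈-trans (q^-+ 2 1) (⊡-congʳ (q^ 1) (q^-+ 1 1))

    units : (geo 0 ⊡ geo 2) ⊡ ((1s ⊖ q^ 1) ⊡ (1s ⊖ q^ 1 ⊡ q^ 1 ⊡ q^ 1)) ≈ 1s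
    units = ≈-trans (⊡-congˡ (geo 0 ⊡ geo 2) (⊡-congˡ (1s ⊖ q^ 1) (⊖-cong (≈-sym q³≈))))
      (≈-trans (solve 4 (λ a b c d → (a :* b) :* (c :* d) := (c :* a) :* (d :* b)) ≈-refl (geo 0) (geo 2) (1s ⊖ q^ 1) (1s ⊖ q^ 3))
      (≈-trans (⊡-cong (geo-inverse 0) (geo-inverse 2)) (⊡-identityˡ 1s)))

    0≈ : ∀ x → x ⊡ (0s ⊞ 0s) ≈ 0s
    0≈ x = ≈-trans (⊡-comm x (0s ⊞ 0s)) (⊡-zeroˡ x)

    A₁ : A 1 ≈ Σ3 aT 0 1
    A₁ = ≈-trans (⊞-cong {μ 0 ⊡ 1s} (λ _ → refl) (0≈ (q^ 1))) (≈-trans (⊞-zeroʳ (λ _ → refl)) (≈-sym (≈-trans (⊡-congʳ (αP 1s (q^ 1)) s₁)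
      (≈-trans (solve 2 (λ q s → s :* :α q c1 q := (s :* ((c1 :- q) :* (c1 :- q :* q :* q))) :* (c1 :+ q)) ≈-refl (q^ 1) (geo 0 ⊡ geo 2))
      (≈-trans (⊡-congʳ (1s ⊞ q^ 1) units) (⊡-comm 1s (1s ⊞ q^ 1)))))))

    B₁ : B 1 ≈ Σ3 bT 0 1
    B₁ = ≈-trans (⊞-cong {u = q^ 0 ⊡ (1s ⊖ q^ 1 ⊡ 0s)} (≈-trans (⊡-comm (μ 0) 0s) (⊡-zeroˡ (μ 0))) (⊡-congˡ 1s (⊖-cong (≈-trans (⊡-comm (q^ 1) 0s) (⊡-zeroˡ (q^ 1))))))
      (≈-trans (λ { zero → refl ; (suc m) → trans (ℤ.+-identityˡ _) (⊡-identityˡ (1s ⊖ 0s) (suc m)) })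
      (≈-sym (≈-trans (⊡-congʳ (βP 1s (q^ 1)) s₁)
      (≈-trans (solve 2 (λ q s → s :* :β q c1 q := (s :* ((c1 :- q) :* (c1 :- q :* q :* q)))) ≈-refl (q^ 1) (geo 0 ⊡ geo 2))
       units))))

    C₁ : C 1 ≈ Σ3 cT 0 1
    C₁ = ≈-trans (⊞-cong {u = q^ 0 ⊡ (1s ⊖ 0s)} (≈-trans (⊡-comm (μ 0) 0s) (⊡-zeroˡ (μ 0))) (λ _ → refl))
      (≈-trans (λ { zero → refl ; (suc m) → trans (ℤ.+-identityˡ _) (⊡-identityˡ (1s ⊖ 0s) (suc m)) })
      (≈-sym (≈-trans (⊡-congʳ (γP 1s (q^ 1)) s₁)
      (≈-trans (solve 2 (λ q s → s :* :γ q c1 q := (s :* ((c1 :- q) :* (c1 :- q :* q :* q)))) ≈-refl (q^ 1) (geo 0 ⊡ geo 2))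
       units))))

  -- The induction starts at n = 1: for n = j = 0 the index n - j - 1 of (Q;Q) is negative, and with
  -- the truncated index the summand is 0 while `A 0` is 1.
  ABC-formula : ∀ n → A (suc n) ≈ Σ3 aT 0 (suc n) × B (suc n) ≈ Σ3 bT 0 (suc n) × C (suc n) ≈ Σ3 cT 0 (suc n)
  ABC-formula zero = A₁ , B₁ , C₁
  ABC-formula (suc n) with ABC-formula n
  ... | a , b , c =
      ≈-trans (⊞-cong (⊡-congˡ (μ (suc n)) a) (⊡-congˡ (q^ (2 ℕ.+ n)) (⊞-cong b c)))
        (≈-sym (≈-trans (Σa-step (suc n) 0 (suc n) refl (ℕ.s≤s ℕ.z≤n)) (⊞-zeroʳ (g₀ (2 ℕ.+ n)))))
    , ≈-trans (⊞-cong (⊡-congˡ (μ (suc n)) b) (⊡-congˡ (q^ (1 ℕ.+ n)) (⊞-cong a (⊟-cong (⊡-congˡ (q^ 1) c)))))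
        (≈-sym (Σb-step (suc n) 0 (suc n) refl (ℕ.s≤s ℕ.z≤n)))
    , ≈-trans (⊞-cong (⊡-congˡ (μ (suc n)) c) (⊡-congˡ (q^ (1 ℕ.+ n)) (⊞-cong a (⊟-cong b))))
        (≈-sym (Σc-step (suc n) 0 (suc n) refl (ℕ.s≤s ℕ.z≤n)))

  cT-zero : ∀ j → cT j 0 ≈ 0s
  cT-zero = γ₀

-- Trisection of the product, reciprocity, and the reduction to C ≥ 0

module Trisection where

  open PowerSeries
  open SingleSum
  open import Defs
  open import Data.Nat as ℕ using (ℕ; zero; suc)
  import Data.Nat.Properties as ℕ
  import Data.Nat.Tactic.RingSolver as ℕ-Ring
  open import Data.Nat.DivMod using (_%_; _/_; m≡m%n+[m/n]*n; m%n<n)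
  open import Data.Integer as ℤ using (ℤ; +_; 0ℤ; 1ℤ)
  import Data.Integer.Properties as ℤ
  open import Data.Integer.Tactic.RingSolver using (solve-∀)
  open import Data.List using ([]; _∷_; replicate; _++_)
  open import Data.Product using (_×_; _,_; proj₁; proj₂)
  open import Data.Empty using (⊥-elim)
  open import Relation.Binary.PropositionalEquality hiding (setoid)
  open import Relation.Nullary using (yes; no)

  ser : Poly → Ser
  ser f m = coeff m f

  ser-⊕ : ∀ f g → ser (f ⊕ g) ≈ ser f ⊞ ser g
  ser-⊕ [] g m = sym (ℤ.+-identityˡ _)
  ser-⊕ (a ∷ f) [] m = sym (ℤ.+-identityʳ (coeff m (a ∷ f)))
  ser-⊕ (a ∷ f) (b ∷ g) zero = refl
  ser-⊕ (a ∷ f) (b ∷ g) (suc m) = ser-⊕ f g m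

  ser-scale : ∀ c f m → ser (scale c f) m ≡ c ℤ.* ser f m
  ser-scale c [] m = sym (ℤ.*-zeroʳ c)
  ser-scale c (a ∷ f) zero = refl
  ser-scale c (a ∷ f) (suc m) = ser-scale c f m

  ser-⊗ : ∀ f g → ser (f ⊗ g) ≈ ser f ⊡ ser g
  ser-⊗ [] g m = sym (trans (⊡-cong {ser []} {0s} {ser g} (λ _ → refl) (λ _ → refl) m) (⊡-zeroˡ (ser g) m))
  ser-⊗ (a ∷ f) g zero = trans (ser-⊕ (scale a g) (+ 0 ∷ (f ⊗ g)) 0) (trans (ℤ.+-identityʳ _) (ser-scale a g 0))
  ser-⊗ (a ∷ f) g (suc m) = trans (ser-⊕ (scale a g) (+ 0 ∷ (f ⊗ g)) (suc m)) (cong₂ ℤ._+_ (ser-scale a g (suc m)) (ser-⊗ f g m))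

  ser-1-q^ : ∀ k → ser (1-q^ (suc k)) ≈ 1s ⊖ q^ (suc k)
  ser-1-q^ k zero = refl
  ser-1-q^ k (suc m) = trans (tail k m) (sym (ℤ.+-identityˡ _))
    where
    tail : ∀ k m → coeff m (replicate k (+ 0) ++ (ℤ.- (+ 1) ∷ [])) ≡ ℤ.- q^ k m
    tail zero zero = refl
    tail zero (suc m) = refl
    tail (suc k) zero = refl
    tail (suc k) (suc m) = tail k m

  p : ℕ → Ser
  p n = ser (P n)

  p-suc : ∀ n → p (suc n) ≈ p n ⊡ ((1s ⊖ q^ (suc (3 ℕ.* n))) ⊡ (1s ⊖ q^ (suc (suc (3 ℕ.* n)))))
  p-suc n = ≈-trans (ser-⊗ (P n) _) (⊡-congˡ (p n) (≈-trans (ser-⊗ (1-q^ (3 ℕ.* suc n ℕ.∸ 2)) (1-q^ (3 ℕ.* suc n ℕ.∸ 1)))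
    (⊡-cong (λ m → trans (cong (λ k → ser (1-q^ k) m) (e₁ n)) (ser-1-q^ (3 ℕ.* n) m))
            (λ m → trans (cong (λ k → ser (1-q^ k) m) (e₂ n)) (ser-1-q^ (suc (3 ℕ.* n)) m)))))
    where
    eq : ∀ n → 3 ℕ.* suc n ≡ 3 ℕ.+ 3 ℕ.* n
    eq = ℕ-Ring.solve-∀
    e₁ : ∀ n → 3 ℕ.* suc n ℕ.∸ 2 ≡ suc (3 ℕ.* n)
    e₁ n = cong (ℕ._∸ 2) (eq n)
    e₂ : ∀ n → 3 ℕ.* suc n ℕ.∸ 1 ≡ suc (suc (3 ℕ.* n))
    e₂ n = cong (ℕ._∸ 1) (eq n)

  res : ℕ → Ser → Ser
  res d f i = f (d ℕ.+ 3 ℕ.* i)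

  private
    3suc : ∀ d i → d ℕ.+ 3 ℕ.* suc i ≡ 3 ℕ.+ (d ℕ.+ 3 ℕ.* i)
    3suc = ℕ-Ring.solve-∀

    res-sh3 : ∀ d f → d ℕ.< 3 → res d (sh 3 f) ≈ sh 1 (res d f)
    res-sh3 0 f _ zero = refl
    res-sh3 1 f _ zero = refl
    res-sh3 2 f _ zero = refl
    res-sh3 (suc (suc (suc _))) f (ℕ.s≤s (ℕ.s≤s (ℕ.s≤s ()))) zero
    res-sh3 d f _ (suc i) = cong (sh 3 f) (3suc d i)

    res-sh : ∀ d a f → d ℕ.< 3 → res d (sh (3 ℕ.* a) f) ≈ sh a (res d f)
    res-sh d zero f _ i = refl
    res-sh d (suc a) f l i = trans (cong (λ k → sh k f (d ℕ.+ 3 ℕ.* i)) (eq a)) (trans (sym (sh-sh 3 (3 ℕ.* a) f (d ℕ.+ 3 ℕ.* i)))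
        (trans (res-sh3 d (sh (3 ℕ.* a) f) l i) (trans (sh-cong 1 (res-sh d a f l) i) (sh-sh 1 a (res d f) i))))
      where
      eq : ∀ a → 3 ℕ.* suc a ≡ 3 ℕ.+ 3 ℕ.* a
      eq = ℕ-Ring.solve-∀

    res0-sh1 : ∀ f → res 0 (sh 1 f) ≈ sh 1 (res 2 f)
    res0-sh1 f zero = refl
    res0-sh1 f (suc i) = cong (sh 1 f) (3suc 0 i)

    res0-sh2 : ∀ f → res 0 (sh 2 f) ≈ sh 1 (res 1 f)
    res0-sh2 f zero = refl
    res0-sh2 f (suc i) = cong (sh 2 f) (3suc 0 i)

    res1-sh2 : ∀ f → res 1 (sh 2 f) ≈ sh 1 (res 2 f)
    res1-sh2 f zero = refl
    res1-sh2 f (suc i) = cong (sh 2 f) (3suc 1 i)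

    l₀ : 0 ℕ.< 3
    l₀ = ℕ.s≤s ℕ.z≤n
    l₁ : 1 ℕ.< 3
    l₁ = ℕ.s≤s (ℕ.s≤s ℕ.z≤n)
    l₂ : 2 ℕ.< 3
    l₂ = ℕ.s≤s (ℕ.s≤s (ℕ.s≤s ℕ.z≤n))

    -- Each shift is split into a multiple of 3 and a remainder 1 or 2: within a residue class the
    -- former is an honest shift by a third of its size, and the latter changes the class.
    p-suc-sh : ∀ n m → p (suc n) m ≡ p n m ℤ.- sh (3 ℕ.* n) (sh 1 (p n)) m ℤ.- sh (3 ℕ.* n) (sh 2 (p n)) m ℤ.+ sh (3 ℕ.* suc (n ℕ.+ n)) (p n) m
    p-suc-sh n m = trans (p-suc n m) (trans (solve 3 (λ f x y → f :* ((con 1ℤ :- x) :* (con 1ℤ :- y)) := f :- x :* f :- y :* f :+ (x :* y) :* f) ≈-refl (p n) X Y m)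
      (cong₂ ℤ._+_ (cong₂ (λ a b → p n m ℤ.- a ℤ.- b) (trans (q^-⊡ (suc (3 ℕ.* n)) (p n) m) (e 1 m)) (trans (q^-⊡ (suc (suc (3 ℕ.* n))) (p n) m) (e 2 m)))
        (trans (⊡-congʳ (p n) (≈-sym (q^-+ (suc (3 ℕ.* n)) (suc (suc (3 ℕ.* n))))) m)
          (trans (q^-⊡ (suc (3 ℕ.* n) ℕ.+ suc (suc (3 ℕ.* n))) (p n) m) (cong (λ k → sh k (p n) m) (eq n))))))
      where
      X = q^ (suc (3 ℕ.* n))
      Y = q^ (suc (suc (3 ℕ.* n)))
      e : ∀ d m → sh (d ℕ.+ 3 ℕ.* n) (p n) m ≡ sh (3 ℕ.* n) (sh d (p n)) m
      e d m = trans (cong (λ k → sh k (p n) m) (ℕ.+-comm d (3 ℕ.* n))) (sym (sh-sh (3 ℕ.* n) d (p n) m))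
      eq : ∀ n → suc (3 ℕ.* n) ℕ.+ suc (suc (3 ℕ.* n)) ≡ 3 ℕ.* suc (n ℕ.+ n)
      eq = ℕ-Ring.solve-∀

    sh-⊟ : ∀ k f m → sh k (⊟ f) m ≡ ℤ.- sh k f m
    sh-⊟ zero f m = refl
    sh-⊟ (suc k) f zero = refl
    sh-⊟ (suc k) f (suc m) = sh-⊟ k f m

  sh-⊞ : ∀ k f g → sh k (f ⊞ g) ≈ sh k f ⊞ sh k g
  sh-⊞ zero f g m = refl
  sh-⊞ (suc k) f g zero = refl
  sh-⊞ (suc k) f g (suc m) = sh-⊞ k f g m

  A-suc : ∀ n m → A (suc n) m ≡ A n m ℤ.+ sh (suc (n ℕ.+ n)) (A n) m ℤ.+ sh (suc n) (B n ⊞ C n) m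
  A-suc n m = cong₂ ℤ._+_ (trans (⊡-distribʳ (A n) 1s (q^ (suc (n ℕ.+ n))) m) (cong₂ ℤ._+_ (⊡-identityˡ (A n) m) (q^-⊡ (suc (n ℕ.+ n)) (A n) m))) (q^-⊡ (suc n) (B n ⊞ C n) m)

  B-suc : ∀ n m → B (suc n) m ≡ B n m ℤ.+ sh (suc (n ℕ.+ n)) (B n) m ℤ.+ (sh n (A n) m ℤ.- sh (suc n) (C n) m)
  B-suc n m = cong₂ ℤ._+_ (trans (⊡-distribʳ (B n) 1s (q^ (suc (n ℕ.+ n))) m) (cong₂ ℤ._+_ (⊡-identityˡ (B n) m) (q^-⊡ (suc (n ℕ.+ n)) (B n) m)))
    (trans (q^-⊡ n (A n ⊖ q^ 1 ⊡ C n) m) (trans (sh-⊞ n (A n) _ m) (cong (λ x → sh n (A n) m ℤ.+ x)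
      (trans (sh-⊟ n (q^ 1 ⊡ C n) m) (cong ℤ.-_ (trans (sh-cong n (q^-⊡ 1 (C n)) m) (trans (sh-sh n 1 (C n) m) (cong (λ k → sh k (C n) m) (ℕ.+-comm n 1)))))))))

  C-suc : ∀ n m → C (suc n) m ≡ C n m ℤ.+ sh (suc (n ℕ.+ n)) (C n) m ℤ.+ (sh n (A n) m ℤ.- sh n (B n) m)
  C-suc n m = cong₂ ℤ._+_ (trans (⊡-distribʳ (C n) 1s (q^ (suc (n ℕ.+ n))) m) (cong₂ ℤ._+_ (⊡-identityˡ (C n) m) (q^-⊡ (suc (n ℕ.+ n)) (C n) m)))
    (trans (q^-⊡ n (A n ⊖ B n) m) (trans (sh-⊞ n (A n) _ m) (cong (λ x → sh n (A n) m ℤ.+ x) (sh-⊟ n (B n) m))))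

  trisection : ∀ n → res 0 (p n) ≈ A n × res 1 (p n) ≈ ⊟ B n × res 2 (p n) ≈ ⊟ C n
  trisection zero = (λ { zero → refl ; (suc i) → refl }) , (λ i → refl) , (λ i → refl)
  trisection (suc n) with trisection n
  ... | a , b , c =
      (λ i → trans (p-suc-sh n (3 ℕ.* i)) (trans (cong₂ ℤ._+_ (cong₂ ℤ._-_ (cong₂ ℤ._-_ (a i)
         (trans (res-sh 0 n (sh 1 (p n)) l₀ i) (trans (sh-cong n (res0-sh1 (p n)) i) (trans (sh-cong n (sh-cong 1 c) i) (trans (sh-sh n 1 (⊟ C n) i) (trans (sh-⊟ (n ℕ.+ 1) (C n) i) (cong (λ k → ℤ.- sh k (C n) i) (ℕ.+-comm n 1))))))))
         (trans (res-sh 0 n (sh 2 (p n)) l₀ i) (trans (sh-cong n (res0-sh2 (p n)) i) (trans (sh-cong n (sh-cong 1 b) i) (trans (sh-sh n 1 (⊟ B n) i) (trans (sh-⊟ (n ℕ.+ 1) (B n) i) (cong (λ k → ℤ.- sh k (B n) i) (ℕ.+-comm n 1))))))))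
         (trans (res-sh 0 (suc (n ℕ.+ n)) (p n) l₀ i) (sh-cong (suc (n ℕ.+ n)) a i)))
         (trans (alg₀ (A n i) (sh (suc n) (C n) i) (sh (suc n) (B n) i) (sh (suc (n ℕ.+ n)) (A n) i))
         (trans (cong (λ x → A n i ℤ.+ sh (suc (n ℕ.+ n)) (A n) i ℤ.+ x) (sym (sh-⊞ (suc n) (B n) (C n) i))) (sym (A-suc n i))))))
    , (λ i → trans (p-suc-sh n (1 ℕ.+ 3 ℕ.* i)) (trans (cong₂ ℤ._+_ (cong₂ ℤ._-_ (cong₂ ℤ._-_ (b i)
         (trans (res-sh 1 n (sh 1 (p n)) l₁ i) (sh-cong n a i)))
         (trans (res-sh 1 n (sh 2 (p n)) l₁ i) (trans (sh-cong n (res1-sh2 (p n)) i) (trans (sh-cong n (sh-cong 1 c) i) (trans (sh-sh n 1 (⊟ C n) i) (trans (sh-⊟ (n ℕ.+ 1) (C n) i) (cong (λ k → ℤ.- sh k (C n) i) (ℕ.+-comm n 1))))))))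
         (trans (res-sh 1 (suc (n ℕ.+ n)) (p n) l₁ i) (trans (sh-cong (suc (n ℕ.+ n)) b i) (sh-⊟ (suc (n ℕ.+ n)) (B n) i))))
         (trans (alg₁ (B n i) (sh n (A n) i) (sh (suc n) (C n) i) (sh (suc (n ℕ.+ n)) (B n) i)) (cong ℤ.-_ (sym (B-suc n i))))))
    , (λ i → trans (p-suc-sh n (2 ℕ.+ 3 ℕ.* i)) (trans (cong₂ ℤ._+_ (cong₂ ℤ._-_ (cong₂ ℤ._-_ (c i)
         (trans (res-sh 2 n (sh 1 (p n)) l₂ i) (trans (sh-cong n b i) (sh-⊟ n (B n) i))))
         (trans (res-sh 2 n (sh 2 (p n)) l₂ i) (sh-cong n a i)))
         (trans (res-sh 2 (suc (n ℕ.+ n)) (p n) l₂ i) (trans (sh-cong (suc (n ℕ.+ n)) c i) (sh-⊟ (suc (n ℕ.+ n)) (C n) i))))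
         (trans (alg₂ (C n i) (sh n (B n) i) (sh n (A n) i) (sh (suc (n ℕ.+ n)) (C n) i)) (cong ℤ.-_ (sym (C-suc n i))))))
    where
    alg₀ : ∀ a c b x → a ℤ.- ℤ.- c ℤ.- ℤ.- b ℤ.+ x ≡ a ℤ.+ x ℤ.+ (b ℤ.+ c)
    alg₀ = solve-∀
    alg₁ : ∀ b a c x → ℤ.- b ℤ.- a ℤ.- ℤ.- c ℤ.+ ℤ.- x ≡ ℤ.- (b ℤ.+ x ℤ.+ (a ℤ.- c))
    alg₁ = solve-∀
    alg₂ : ∀ c b a x → ℤ.- c ℤ.- ℤ.- b ℤ.- a ℤ.+ ℤ.- x ≡ ℤ.- (c ℤ.+ x ℤ.+ (a ℤ.- b))
    alg₂ = solve-∀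

  -- The relation q^D f(1/q) = ε f(q) for a polynomial of degree at most D.
  Reciprocal : ℤ → ℕ → Ser → Set
  Reciprocal ε D f = (∀ a b → a ℕ.+ b ≡ D → f a ≡ ε ℤ.* f b) × (∀ m → D ℕ.< m → f m ≡ 0ℤ)

  -- Each factor 1 - q^k is antisymmetric, hence the change of sign; the factors of P_n come in
  -- pairs, which restores it.
  reciprocal-step : ∀ {ε D f} k → ε ℤ.* ε ≡ 1ℤ → Reciprocal ε D f → Reciprocal (ℤ.- ε) (D ℕ.+ k) (f ⊖ sh k f)
  reciprocal-step {ε} {D} {f} k εε (sym-f , zero-f) = (λ a b e → trans (cong₂ (λ x y → x ℤ.- y) (ε-flip (sh k f b) (f a) (sh-f b a (trans (ℕ.+-comm b a) e))) (sh-f a b e))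
        (alg ε (sh k f b) (f b))) , zero-g
    where
    ε-flip : ∀ x y → x ≡ ε ℤ.* y → y ≡ ε ℤ.* x
    ε-flip x y refl = sym (trans (sym (ℤ.*-assoc ε ε y)) (trans (cong (ℤ._* y) εε) (ℤ.*-identityˡ y)))
    sh-f : ∀ a b → a ℕ.+ b ≡ D ℕ.+ k → sh k f a ≡ ε ℤ.* f b
    sh-f a b e with a ℕ.<? k
    ... | yes l = trans (sh-< k f a l) (sym (trans (cong (ε ℤ.*_) (zero-f b (ℕ.+-cancelˡ-< a D b (ℕ.<-≤-trans (ℕ.+-monoˡ-< D l) (ℕ.≤-reflexive (trans (ℕ.+-comm k D) (sym e))))))) (ℤ.*-zeroʳ ε)))
    ... | no l = trans (trans (cong (sh k f) (sym (ℕ.m+[n∸m]≡n (ℕ.≮⇒≥ l)))) (sh-≥ k f (a ℕ.∸ k)))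
         (sym-f (a ℕ.∸ k) b (ℕ.+-cancelˡ-≡ k _ _ (trans (sym (ℕ.+-assoc k _ b)) (trans (cong (ℕ._+ b) (ℕ.m+[n∸m]≡n (ℕ.≮⇒≥ l))) (trans e (ℕ.+-comm D k))))))
    alg : ∀ ε x y → ε ℤ.* x ℤ.- ε ℤ.* y ≡ ℤ.- ε ℤ.* (y ℤ.- x)
    alg = solve-∀
    zero-g : ∀ m → D ℕ.+ k ℕ.< m → f m ℤ.- sh k f m ≡ 0ℤ
    zero-g m l = cong₂ ℤ._-_ (zero-f m (ℕ.≤-<-trans (ℕ.m≤m+n D k) l)) (trans (trans (cong (sh k f) (sym e)) (sh-≥ k f (m ℕ.∸ k))) (zero-f (m ℕ.∸ k) l′))
      where
      e : k ℕ.+ (m ℕ.∸ k) ≡ m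
      e = ℕ.m+[n∸m]≡n (ℕ.≤-trans (ℕ.m≤n+m k D) (ℕ.<⇒≤ l))
      l′ : D ℕ.< m ℕ.∸ k
      l′ = ℕ.+-cancelˡ-< k D (m ℕ.∸ k) (ℕ.<-≤-trans (subst (ℕ._< m) (ℕ.+-comm D k) l) (ℕ.≤-reflexive (sym e)))

  reciprocal-cong : ∀ {ε D f g} → f ≈ g → Reciprocal ε D f → Reciprocal ε D g
  reciprocal-cong {ε} e (s , z) = (λ a b p → trans (sym (e a)) (trans (s a b p) (cong (ε ℤ.*_) (e b)))) , (λ m l → trans (sym (e m)) (z m l))

  p-reciprocal : ∀ n → Reciprocal 1ℤ (3 ℕ.* (n ℕ.* n)) (p n)
  p-reciprocal zero = (λ { zero zero refl → refl }) , (λ { (suc m) _ → refl })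
  p-reciprocal (suc n) = subst (λ D → Reciprocal 1ℤ D (p (suc n))) (eq n)
    (reciprocal-cong {1ℤ} step (reciprocal-step {ℤ.- 1ℤ} (suc (suc (3 ℕ.* n))) refl (reciprocal-step {1ℤ} (suc (3 ℕ.* n)) refl (p-reciprocal n))))
    where
    eq : ∀ n → 3 ℕ.* (n ℕ.* n) ℕ.+ suc (3 ℕ.* n) ℕ.+ suc (suc (3 ℕ.* n)) ≡ 3 ℕ.* (suc n ℕ.* suc n)
    eq = ℕ-Ring.solve-∀
    one-minus : ∀ k f → f ⊖ sh k f ≈ f ⊡ (1s ⊖ q^ k)
    one-minus k f = ≈-trans (⊞-cong {f} (λ _ → refl) (⊟-cong (≈-sym (q^-⊡ k f)))) (solve 2 (λ f x → f :- x :* f := f :* (con 1ℤ :- x)) ≈-refl f (q^ k))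
    step : (p n ⊖ sh (suc (3 ℕ.* n)) (p n)) ⊖ sh (suc (suc (3 ℕ.* n))) (p n ⊖ sh (suc (3 ℕ.* n)) (p n)) ≈ p (suc n)
    step = ≈-trans (one-minus (suc (suc (3 ℕ.* n))) _) (≈-trans (⊡-congʳ _ (one-minus (suc (3 ℕ.* n)) (p n)))
      (≈-trans (⊡-assoc (p n) (1s ⊖ q^ (suc (3 ℕ.* n))) (1s ⊖ q^ (suc (suc (3 ℕ.* n))))) (≈-sym (p-suc n))))

  module FromC (C≥0 : ∀ n i → 0ℤ ℤ.≤ C n i) where

    p-res2 : ∀ n i → p n (2 ℕ.+ 3 ℕ.* i) ℤ.≤ 0ℤ
    p-res2 n i = subst (ℤ._≤ 0ℤ) (sym (proj₂ (proj₂ (trisection n)) i)) (ℤ.neg-mono-≤ (C≥0 n i))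

    -- The degree 3n² of P_n is divisible by 3, so reflecting the exponents exchanges the residue
    -- classes 1 and 2.
    p-res1 : ∀ n i → p n (1 ℕ.+ 3 ℕ.* i) ℤ.≤ 0ℤ
    p-res1 n i with 3 ℕ.* (n ℕ.* n) ℕ.<? 1 ℕ.+ 3 ℕ.* i
    ... | yes l = ℤ.≤-reflexive (proj₂ (p-reciprocal n) _ l)
    ... | no l = subst (ℤ._≤ 0ℤ) (sym (trans (proj₁ (p-reciprocal n) (1 ℕ.+ 3 ℕ.* i) (2 ℕ.+ 3 ℕ.* k) eq) (ℤ.*-identityˡ _))) (p-res2 n k)
      where
      i<n² : i ℕ.< n ℕ.* n
      i<n² = ℕ.*-cancelˡ-< 3 i (n ℕ.* n) (ℕ.≮⇒≥ l)
      k = n ℕ.* n ℕ.∸ suc i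
      lem : ∀ i k → 1 ℕ.+ 3 ℕ.* i ℕ.+ (2 ℕ.+ 3 ℕ.* k) ≡ 3 ℕ.* (suc i ℕ.+ k)
      lem = ℕ-Ring.solve-∀
      eq : 1 ℕ.+ 3 ℕ.* i ℕ.+ (2 ℕ.+ 3 ℕ.* k) ≡ 3 ℕ.* (n ℕ.* n)
      eq = trans (lem i k) (cong (3 ℕ.*_) (ℕ.m+[n∸m]≡n i<n²))

    sh-≥0 : ∀ k f → (∀ m → 0ℤ ℤ.≤ f m) → ∀ m → 0ℤ ℤ.≤ sh k f m
    sh-≥0 zero f p m = p m
    sh-≥0 (suc k) f p zero = ℤ.≤-refl
    sh-≥0 (suc k) f p (suc m) = sh-≥0 k f p m

    B≥0 : ∀ n i → 0ℤ ℤ.≤ B n i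
    B≥0 n i = ℤ.neg-cancel-≤ (subst (ℤ._≤ 0ℤ) (proj₁ (proj₂ (trisection n)) i) (p-res1 n i))

    A≥0 : ∀ n i → 0ℤ ℤ.≤ A n i
    A≥0 zero zero = ℤ.+≤+ ℕ.z≤n
    A≥0 zero (suc i) = ℤ.≤-refl
    A≥0 (suc n) i = subst (0ℤ ℤ.≤_) (sym (A-suc n i)) (ℤ.+-mono-≤ (ℤ.+-mono-≤ (A≥0 n i) (sh-≥0 (suc (n ℕ.+ n)) (A n) (A≥0 n) i))
      (sh-≥0 (suc n) (B n ⊞ C n) (λ m → ℤ.+-mono-≤ (B≥0 n m) (C≥0 n m)) i))

    p-res0 : ∀ n i → 0ℤ ℤ.≤ p n (3 ℕ.* i)
    p-res0 n i = subst (0ℤ ℤ.≤_) (sym (proj₁ (trisection n) i)) (A≥0 n i)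

    sign-pattern : ∀ n m → (m % 3 ≡ 0 → 0ℤ ℤ.≤ p n m) × (m % 3 ≢ 0 → p n m ℤ.≤ 0ℤ)
    sign-pattern n m with m % 3 | m / 3 | m≡m%n+[m/n]*n m 3 | m%n<n m 3
    ... | 0 | i | refl | _ = (λ _ → subst (λ k → 0ℤ ℤ.≤ p n k) (ℕ.*-comm 3 i) (p-res0 n i)) , (λ ne → ⊥-elim (ne refl))
    ... | 1 | i | refl | _ = (λ ()) , (λ _ → subst (λ k → p n (suc k) ℤ.≤ 0ℤ) (ℕ.*-comm 3 i) (p-res1 n i))
    ... | 2 | i | refl | _ = (λ ()) , (λ _ → subst (λ k → p n (suc (suc k)) ℤ.≤ 0ℤ) (ℕ.*-comm 3 i) (p-res2 n i))
    ... | suc (suc (suc _)) | i | _ | ℕ.s≤s (ℕ.s≤s (ℕ.s≤s ()))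

-- Reading off nonnegative coefficients from a single value

module Kronecker where

  open PowerSeries
  open SingleSum
  open Trisection
  open import Data.Bool using (Bool; true; false; _∧_; T; if_then_else_)
  open import Data.Nat as ℕ using (ℕ; zero; suc; NonZero)
  import Data.Nat.Properties as ℕ
  import Data.Nat.Tactic.RingSolver as ℕ-Ring
  open import Data.Nat.DivMod using (_%_; _/_; m≡m%n+[m/n]*n; m<n⇒m%n≡m; m<n⇒m/n≡0)
  open import Data.Integer as ℤ using (ℤ; +_; 0ℤ; ∣_∣)
  import Data.Integer.Properties as ℤ
  open import Data.Integer.Tactic.RingSolver using (solve-∀)
  open import Data.List using (List; []; _∷_)
  open import Data.Product using (_×_; _,_; proj₁; proj₂)
  open import Data.Unit using (tt)
  open import Function using (_∘_)
  open import Relation.Binary.PropositionalEquality hiding (setoid)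
  open import Relation.Nullary using (yes; no)

  eval : ℤ → Ser → ℕ → ℤ
  eval X f zero = 0ℤ
  eval X f (suc l) = f 0 ℤ.+ X ℤ.* eval X (f ∘ suc) l

  eval-cong : ∀ X {f g} l → f ≈ g → eval X f l ≡ eval X g l
  eval-cong X zero e = refl
  eval-cong X (suc l) e = cong₂ (λ a b → a ℤ.+ X ℤ.* b) (e 0) (eval-cong X l (e ∘ suc))

  eval-⊞ : ∀ X f g l → eval X (f ⊞ g) l ≡ eval X f l ℤ.+ eval X g l
  eval-⊞ X f g zero = refl
  eval-⊞ X f g (suc l) = trans (cong (λ x → f 0 ℤ.+ g 0 ℤ.+ X ℤ.* x) (eval-⊞ X (f ∘ suc) (g ∘ suc) l)) (lem (f 0) (g 0) X _ _)
    where
    lem : ∀ a b X x y → a ℤ.+ b ℤ.+ X ℤ.* (x ℤ.+ y) ≡ (a ℤ.+ X ℤ.* x) ℤ.+ (b ℤ.+ X ℤ.* y)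
    lem = solve-∀

  eval-scale : ∀ X c f l → eval X (λ m → c ℤ.* f m) l ≡ c ℤ.* eval X f l
  eval-scale X c f zero = sym (ℤ.*-zeroʳ c)
  eval-scale X c f (suc l) = trans (cong (λ x → c ℤ.* f 0 ℤ.+ X ℤ.* x) (eval-scale X c (f ∘ suc) l)) (lem c (f 0) X _)
    where
    lem : ∀ c a X x → c ℤ.* a ℤ.+ X ℤ.* (c ℤ.* x) ≡ c ℤ.* (a ℤ.+ X ℤ.* x)
    lem = solve-∀

  eval-⊟ : ∀ X f l → eval X (⊟ f) l ≡ ℤ.- eval X f l
  eval-⊟ X f zero = refl
  eval-⊟ X f (suc l) = trans (cong (λ x → ℤ.- f 0 ℤ.+ X ℤ.* x) (eval-⊟ X (f ∘ suc) l)) (lem (f 0) X _)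
    where
    lem : ∀ a X x → ℤ.- a ℤ.+ X ℤ.* (ℤ.- x) ≡ ℤ.- (a ℤ.+ X ℤ.* x)
    lem = solve-∀

  eval-sh : ∀ X k f l → eval X (sh k f) (k ℕ.+ l) ≡ X ℤ.^ k ℤ.* eval X f l
  eval-sh X zero f l = sym (ℤ.*-identityˡ _)
  eval-sh X (suc k) f l = trans (ℤ.+-identityˡ _) (trans (cong (X ℤ.*_) (eval-sh X k f l)) (sym (ℤ.*-assoc X (X ℤ.^ k) (eval X f l))))

  eval-split : ∀ X f k l → eval X f (k ℕ.+ l) ≡ eval X f k ℤ.+ X ℤ.^ k ℤ.* eval X (λ m → f (k ℕ.+ m)) l
  eval-split X f zero l = sym (trans (ℤ.+-identityˡ _) (ℤ.*-identityˡ _))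
  eval-split X f (suc k) l = trans (cong (λ x → f 0 ℤ.+ X ℤ.* x) (eval-split X (f ∘ suc) k l)) (lem (f 0) X _ _ _)
    where
    lem : ∀ a X x p y → a ℤ.+ X ℤ.* (x ℤ.+ p ℤ.* y) ≡ a ℤ.+ X ℤ.* x ℤ.+ X ℤ.* p ℤ.* y
    lem = solve-∀

  Vanish : ℕ → Ser → Set
  Vanish l f = ∀ m → l ℕ.≤ m → f m ≡ 0ℤ

  eval-vanish : ∀ X f l → Vanish 0 f → eval X f l ≡ 0ℤ
  eval-vanish X f zero v = refl
  eval-vanish X f (suc l) v = trans (cong₂ (λ a b → a ℤ.+ X ℤ.* b) (v 0 ℕ.z≤n) (eval-vanish X (f ∘ suc) l (λ m _ → v (suc m) ℕ.z≤n))) (trans (ℤ.+-identityˡ _) (ℤ.*-zeroʳ X))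

  -- Kronecker substitution: a polynomial with at most l coefficients is represented by the one
  -- integer f(X), on which ring operations are fast.
  record Enc (X : ℤ) (f : Ser) (l : ℕ) (v : ℤ) : Set where
    constructor enc
    field
      vanish : Vanish l f
      value : eval X f l ≡ v
  open Enc

  Enc-mono : ∀ {X f l v} k → l ℕ.≤ k → Enc X f l v → Enc X f k v
  Enc-mono {X} {f} {l} {v} k l≤k (enc z e) = enc (λ m k≤m → z m (ℕ.≤-trans l≤k k≤m))
    (trans (cong (eval X f) (sym (ℕ.m+[n∸m]≡n l≤k))) (trans (eval-split X f l (k ℕ.∸ l))
      (trans (cong₂ (λ a b → a ℤ.+ X ℤ.^ l ℤ.* b) e (eval-vanish X _ (k ℕ.∸ l) (λ m _ → z (l ℕ.+ m) (ℕ.m≤m+n l m)))) (trans (cong (λ □ → v ℤ.+ □) (ℤ.*-zeroʳ (X ℤ.^ l))) (ℤ.+-identityʳ v)))))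

  Enc-⊞ : ∀ {X f g l v w} → Enc X f l v → Enc X g l w → Enc X (f ⊞ g) l (v ℤ.+ w)
  Enc-⊞ {X} {f} {g} {l} (enc z e) (enc z′ e′) = enc (λ m p → cong₂ ℤ._+_ (z m p) (z′ m p)) (trans (eval-⊞ X f g l) (cong₂ ℤ._+_ e e′))

  Enc-⊟ : ∀ {X f l v} → Enc X f l v → Enc X (⊟ f) l (ℤ.- v)
  Enc-⊟ {X} {f} {l} (enc z e) = enc (λ m p → cong ℤ.-_ (z m p)) (trans (eval-⊟ X f l) (cong ℤ.-_ e))

  Enc-scale : ∀ {X f l v} c → Enc X f l v → Enc X (λ m → c ℤ.* f m) l (c ℤ.* v)
  Enc-scale {X} {f} {l} c (enc z e) = enc (λ m p → trans (cong (c ℤ.*_) (z m p)) (ℤ.*-zeroʳ c)) (trans (eval-scale X c f l) (cong (c ℤ.*_) e))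

  Enc-sh : ∀ {X f l v} k → Enc X f l v → Enc X (sh k f) (k ℕ.+ l) (X ℤ.^ k ℤ.* v)
  Enc-sh {X} {f} {l} k (enc z e) = enc zz (trans (eval-sh X k f l) (cong (X ℤ.^ k ℤ.*_) e))
    where
    zz : Vanish (k ℕ.+ l) (sh k f)
    zz m p = trans (cong (sh k f) (sym e′)) (trans (sh-≥ k f (m ℕ.∸ k)) (z _ (ℕ.+-cancelˡ-≤ k l _ (ℕ.≤-trans p (ℕ.≤-reflexive (sym e′))))))
      where e′ = ℕ.m+[n∸m]≡n (ℕ.≤-trans (ℕ.m≤m+n k l) p)

  Enc-cong : ∀ {X f g l v w} → f ≈ g → v ≡ w → Enc X f l v → Enc X g l w
  Enc-cong {X} {l = l} e v≡w (enc z ev) = enc (λ m p → trans (sym (e m)) (z m p)) (trans (sym (eval-cong X l e)) (trans ev v≡w))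

  record Bounded (b : ℕ) (f : Ser) : Set where
    constructor bounded
    field bound : ∀ m → ∣ f m ∣ ℕ.≤ b
  open Bounded

  Bounded-⊞ : ∀ {a b f g} → Bounded a f → Bounded b g → Bounded (a ℕ.+ b) (f ⊞ g)
  Bounded-⊞ {f = f} {g} p q = bounded λ m → ℕ.≤-trans (ℤ.∣i+j∣≤∣i∣+∣j∣ (f m) (g m)) (ℕ.+-mono-≤ (bound p m) (bound q m))

  Bounded-⊟ : ∀ {a f} → Bounded a f → Bounded a (⊟ f)
  Bounded-⊟ {f = f} p = bounded λ m → ℕ.≤-trans (ℕ.≤-reflexive (ℤ.∣-i∣≡∣i∣ (f m))) (bound p m)

  Bounded-sh : ∀ {a f} k → Bounded a f → Bounded a (sh k f)
  Bounded-sh {a} {f} k p = bounded (go k)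
    where
    go : ∀ k m → ∣ sh k f m ∣ ℕ.≤ a
    go zero m = bound p m
    go (suc k) zero = ℕ.z≤n
    go (suc k) (suc m) = go k m

  Bounded-cong : ∀ {a f g} → f ≈ g → Bounded a f → Bounded a g
  Bounded-cong {a} e p = bounded λ m → subst (λ x → ∣ x ∣ ℕ.≤ a) (e m) (bound p m)

  -- The list holds X^(2^i) - 1 in decreasing order.

  digits : List ℕ → ℕ → ℕ → Bool
  digits [] h v = v ℕ.<ᵇ h
  digits (p ∷ ps) h v = digits ps h (v % suc p) ∧ digits ps h (v / suc p)

  squares : ℕ → ℕ → List ℕ → List ℕ
  squares zero x acc = acc
  squares (suc d) x acc = squares d (x ℕ.* x) (x ℕ.∸ 1 ∷ acc)

  -- Storing X^L - 1 makes the divisor `suc p` nonzero by its form. The last index counts the base-X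
  -- digits that the whole list can separate; each entry cuts that number in half.
  data Squares (X : ℕ) : List ℕ → ℕ → Set where
    [] : Squares X [] 1
    cons : ∀ {p ps L} → suc p ≡ X ℕ.^ L → Squares X ps L → Squares X (p ∷ ps) (L ℕ.+ L)

  squares-sound : ∀ X d {x acc L} → 1 ℕ.≤ X → x ≡ X ℕ.^ L → Squares X acc L → Squares X (squares d x acc) (2 ℕ.^ d ℕ.* L)
  squares-sound X zero {L = L} 1≤X e s = subst (Squares X _) (sym (ℕ.+-identityʳ L)) s
  squares-sound X (suc d) {x} {L = L} 1≤X e s = subst (Squares X _) (eq (2 ℕ.^ d) L)
    (squares-sound X d 1≤X (trans (cong₂ ℕ._*_ e e) (sym (ℕ.^-distribˡ-+-* X L L))) (cons (trans (ℕ.m+[n∸m]≡n {1} {x} pos) e) s))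
    where
    pos : 1 ℕ.≤ x
    pos = subst (1 ℕ.≤_) (sym e) (ℕ.m^n>0 X {{ℕ.>-nonZero 1≤X}} L)
    eq : ∀ a L → a ℕ.* (L ℕ.+ L) ≡ (a ℕ.+ (a ℕ.+ 0)) ℕ.* L
    eq = ℕ-Ring.solve-∀

  ∧-true : ∀ {a b} → a ∧ b ≡ true → a ≡ true × b ≡ true
  ∧-true {true} {true} _ = refl , refl

  <ᵇ-sound : ∀ m n → (m ℕ.<ᵇ n) ≡ true → m ℕ.< n
  <ᵇ-sound m n e = ℕ.<ᵇ⇒< m n (subst T (sym e) tt)

  -- The version that is actually run: if the upper half is zero, a comparison replaces a division
  -- and a recursive call. Zero digits always pass, so nothing is lost.
  digits′ : List ℕ → ℕ → ℕ → Bool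
  digits′ [] h v = v ℕ.<ᵇ h
  digits′ (p ∷ ps) h v = if v ℕ.<ᵇ suc p then digits′ ps h v else digits′ ps h (v % suc p) ∧ digits′ ps h (v / suc p)

  digits-zero : ∀ ps h → 0 ℕ.< h → digits ps h 0 ≡ true
  digits-zero [] (suc h) _ = refl
  digits-zero (p ∷ ps) h l = cong₂ _∧_ (trans (cong (digits ps h) (m<n⇒m%n≡m {suc p} {0} (ℕ.s≤s ℕ.z≤n))) (digits-zero ps h l)) (trans (cong (digits ps h) (m<n⇒m/n≡0 {0} {suc p} (ℕ.s≤s ℕ.z≤n))) (digits-zero ps h l))

  digits′-sound : ∀ ps h v → 0 ℕ.< h → digits′ ps h v ≡ true → digits ps h v ≡ true
  digits′-sound [] h v l e = e
  digits′-sound (p ∷ ps) h v l e with v ℕ.<ᵇ suc p in eq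
  ... | true = cong₂ _∧_ (trans (cong (digits ps h) (m<n⇒m%n≡m v<)) (digits′-sound ps h v l e)) (trans (cong (digits ps h) (m<n⇒m/n≡0 v<)) (digits-zero ps h l))
    where v< = <ᵇ-sound v (suc p) eq
  ... | false = cong₂ _∧_ (digits′-sound ps h (v % suc p) l (proj₁ (∧-true e))) (digits′-sound ps h (v / suc p) l (proj₂ (∧-true {digits′ ps h (v % suc p)} e)))

  private
    pos-^ : ∀ X L → (+ X) ℤ.^ L ≡ + (X ℕ.^ L)
    pos-^ X zero = refl
    pos-^ X (suc L) = trans (cong (+ X ℤ.*_) (pos-^ X L)) (sym (ℤ.pos-* X (X ℕ.^ L)))

    -- Two integers of absolute value below h differ by less than 2h ≤ X, so a difference divisible
    -- by X is 0.
    small-congruent : ∀ X h (f v : ℤ) k → h ℕ.+ h ℕ.≤ X → ∣ f ∣ ℕ.< h → ∣ v ∣ ℕ.< h → f ≡ v ℤ.+ k ℤ.* + X → f ≡ v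
    small-congruent X h f v k hX bf bv e = trans e (trans (cong (λ k → v ℤ.+ k ℤ.* + X) k≡0) (ℤ.+-identityʳ v))
      where
      diff : f ℤ.- v ≡ k ℤ.* + X
      diff = trans (cong (ℤ._- v) e) (lem v (k ℤ.* + X))
        where
        lem : ∀ v x → v ℤ.+ x ℤ.- v ≡ x
        lem = solve-∀
      kX<X : ∣ k ∣ ℕ.* X ℕ.< X
      kX<X = ℕ.<-≤-trans (ℕ.≤-<-trans (ℕ.≤-reflexive (trans (sym (ℤ.abs-* k (+ X))) (cong ∣_∣ (sym diff))))
        (ℕ.≤-<-trans (ℤ.∣i-j∣≤∣i∣+∣j∣ f v) (ℕ.+-mono-< bf bv))) hX
      k≡0 : k ≡ 0ℤ
      k≡0 = ℤ.∣i∣≡0⇒i≡0 (ℕ.n<1⇒n≡0 (ℕ.*-cancelʳ-< X ∣ k ∣ 1 (subst (∣ k ∣ ℕ.* X ℕ.<_) (sym (ℕ.+-identityʳ X)) kX<X)))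

  -- A priori the coefficients may be negative, but they and the digits are smaller than X/2, so
  -- both are determined modulo X. The lower half of the sum is at first known only modulo X^L, and
  -- the multiple k in the hypothesis makes room for this. The exact value in the conclusion is then
  -- subtracted and X^L cancelled, which leaves the upper half.
  digits-sound : ∀ {X h ps L} (f : Ser) v (k : ℤ) → h ℕ.+ h ℕ.≤ X → Squares X ps L → (∀ m → ∣ f m ∣ ℕ.< h) →
    eval (+ X) f L ≡ + v ℤ.+ k ℤ.* + (X ℕ.^ L) → digits ps h v ≡ true → (∀ m → m ℕ.< L → 0ℤ ℤ.≤ f m) × eval (+ X) f L ≡ + v
  digits-sound {X} {h} f v k hX [] bf e d = (λ { zero _ → subst (0ℤ ℤ.≤_) (sym f0) (ℤ.+≤+ ℕ.z≤n) ; (suc _) (ℕ.s≤s ()) }) , trans ev f0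
    where
    ev : eval (+ X) f 1 ≡ f 0
    ev = trans (cong (λ □ → f 0 ℤ.+ □) (ℤ.*-zeroʳ (+ X))) (ℤ.+-identityʳ (f 0))
    f0 : f 0 ≡ + v
    f0 = small-congruent X h (f 0) (+ v) k hX (bf 0) (<ᵇ-sound v h d) (trans (sym ev) (trans e (cong (λ x → + v ℤ.+ k ℤ.* + x) (ℕ.*-identityʳ X))))
  digits-sound {X} {h} f v k hX (cons {p} {ps} {L} pe s) bf e d = all , ev
    where
    d₁ = proj₁ (∧-true d)
    d₂ = proj₂ (∧-true {digits ps h (v % suc p)} d)
    g : Ser
    g m = f (L ℕ.+ m)
    lo = v % suc p
    hi = v / suc p
    XL = + (X ℕ.^ L)
    v≡ : + v ≡ + lo ℤ.+ + hi ℤ.* XL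
    v≡ = trans (cong +_ (m≡m%n+[m/n]*n v (suc p))) (trans (ℤ.pos-+ lo (hi ℕ.* suc p)) (cong (λ □ → + lo ℤ.+ □) (trans (ℤ.pos-* hi (suc p)) (cong (λ x → + hi ℤ.* + x) pe))))
    XX : + (X ℕ.^ (L ℕ.+ L)) ≡ XL ℤ.* XL
    XX = trans (cong +_ (ℕ.^-distribˡ-+-* X L L)) (ℤ.pos-* (X ℕ.^ L) (X ℕ.^ L))
    sp : eval (+ X) f L ℤ.+ XL ℤ.* eval (+ X) g L ≡ (+ lo ℤ.+ + hi ℤ.* XL) ℤ.+ k ℤ.* (XL ℤ.* XL)
    sp = trans (cong (λ x → eval (+ X) f L ℤ.+ x ℤ.* eval (+ X) g L) (sym (pos-^ X L))) (trans (sym (eval-split (+ X) f L L)) (trans e (cong₂ (λ a b → a ℤ.+ k ℤ.* b) v≡ XX)))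
    e₁ : eval (+ X) f L ≡ + lo ℤ.+ (+ hi ℤ.+ k ℤ.* XL ℤ.- eval (+ X) g L) ℤ.* XL
    e₁ = trans (lem (eval (+ X) f L) XL (eval (+ X) g L)) (trans (cong (ℤ._- XL ℤ.* eval (+ X) g L) sp) (lem′ (+ lo) (+ hi) XL k (eval (+ X) g L)))
      where
      lem : ∀ a x b → a ≡ a ℤ.+ x ℤ.* b ℤ.- x ℤ.* b
      lem = solve-∀
      lem′ : ∀ l h x k b → l ℤ.+ h ℤ.* x ℤ.+ k ℤ.* (x ℤ.* x) ℤ.- x ℤ.* b ≡ l ℤ.+ (h ℤ.+ k ℤ.* x ℤ.- b) ℤ.* x
      lem′ = solve-∀
    IH₁ = digits-sound f lo (+ hi ℤ.+ k ℤ.* XL ℤ.- eval (+ X) g L) hX s bf e₁ d₁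
    instance
      XL≢0 : NonZero (X ℕ.^ L)
      XL≢0 = subst NonZero pe _
    e₂ : eval (+ X) g L ≡ + hi ℤ.+ k ℤ.* XL
    e₂ = ℤ.*-cancelˡ-≡ XL _ _ {{ℤ.≢-nonZero λ eq → ℕ.≢-nonZero⁻¹ (X ℕ.^ L) (ℤ.+-injective eq)}}
      (trans (lem (+ lo) (XL ℤ.* eval (+ X) g L)) (trans (cong (λ x → x ℤ.+ XL ℤ.* eval (+ X) g L ℤ.- + lo) (sym (proj₂ IH₁))) (trans (cong (ℤ._- + lo) sp) (lem′ (+ lo) (+ hi) XL k))))
      where
      lem : ∀ l x → x ≡ l ℤ.+ x ℤ.- l
      lem = solve-∀
      lem′ : ∀ l h x k → l ℤ.+ h ℤ.* x ℤ.+ k ℤ.* (x ℤ.* x) ℤ.- l ≡ x ℤ.* (h ℤ.+ k ℤ.* x)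
      lem′ = solve-∀
    IH₂ = digits-sound g hi k hX s (λ m → bf _) e₂ d₂
    all : ∀ m → m ℕ.< L ℕ.+ L → 0ℤ ℤ.≤ f m
    all m m<2L with m ℕ.<? L
    ... | yes l = proj₁ IH₁ m l
    ... | no l = subst (λ i → 0ℤ ℤ.≤ f i) eq (proj₁ IH₂ (m ℕ.∸ L) (ℕ.+-cancelˡ-< L _ _ (subst (ℕ._< L ℕ.+ L) (sym eq) m<2L)))
      where eq = ℕ.m+[n∸m]≡n (ℕ.≮⇒≥ l)
    ev : eval (+ X) f (L ℕ.+ L) ≡ + v
    ev = trans (eval-split (+ X) f L L) (trans (cong₂ (λ a b → a ℤ.+ b ℤ.* eval (+ X) g L) (proj₂ IH₁) (pos-^ X L)) (trans (cong (λ x → + lo ℤ.+ XL ℤ.* x) (proj₂ IH₂)) (trans (cong (λ □ → + lo ℤ.+ □) (ℤ.*-comm XL (+ hi))) (sym v≡))))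

  nonneg-by-digits : ∀ {X h l L ps v b} (f : Ser) → h ℕ.+ h ℕ.≤ X → Squares X ps L → Enc (+ X) f l (+ v) → l ℕ.≤ L → Bounded b f → b ℕ.< h →
    digits ps h v ≡ true → ∀ m → 0ℤ ℤ.≤ f m
  nonneg-by-digits {X} {L = L} {v = v} f hX s ef l≤L bf b<h d m with m ℕ.<? L
  ... | yes p = proj₁ (digits-sound f v 0ℤ hX s (λ m → ℕ.≤-<-trans (bound bf m) b<h) (trans (value (Enc-mono L l≤L ef)) (sym (ℤ.+-identityʳ (+ v)))) d) m p
  ... | no p = ℤ.≤-reflexive (sym (vanish ef m (ℕ.≤-trans l≤L (ℕ.≮⇒≥ p))))

-- The finite range n ≤ 97

module SmallN where

  open PowerSeries
  open SingleSum
  open Trisection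
  open Kronecker
  open import Data.Bool using (Bool; true; _∧_)
  open import Data.Nat as ℕ using (ℕ; zero; suc)
  import Data.Nat.Properties as ℕ
  import Data.Nat.Tactic.RingSolver as ℕ-Ring
  open import Data.Integer as ℤ using (+_; 0ℤ; 1ℤ)
  import Data.Integer.Properties as ℤ
  open import Data.List using (List; [])
  open import Data.Product using (_×_; _,_; proj₁; proj₂)
  open import Relation.Binary.PropositionalEquality hiding (setoid)

  -- a, b, c and x are the values at X of A n, B n, C n and q^n.

  checkC : ℕ → List ℕ → ℕ → ℕ → ℕ → ℕ → ℕ → ℕ → Bool
  checkC zero ps h X a b c x = true
  checkC (suc k) ps h X a b c x =
    let x₁ = X ℕ.* x
        x₂ = x ℕ.* x₁
        ta = x ℕ.* a
        tb = b ℕ.+ x₂ ℕ.* b ℕ.+ ta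
        tc = c ℕ.+ x₂ ℕ.* c ℕ.+ ta
        c′ = tc ℕ.∸ x ℕ.* b
    in (x₁ ℕ.* c ℕ.<ᵇ suc tb) ∧ (x ℕ.* b ℕ.<ᵇ suc tc) ∧ digits′ ps h c′ ∧
       checkC k ps h X (a ℕ.+ x₂ ℕ.* a ℕ.+ x₁ ℕ.* (b ℕ.+ c)) (tb ℕ.∸ x₁ ℕ.* c) c′ x₁

  private
    pos-∸ : ∀ m n → n ℕ.≤ m → + (m ℕ.∸ n) ≡ + m ℤ.- + n
    pos-∸ m n p = trans (sym (ℤ.⊖-≥ p)) (sym (ℤ.m-n≡m⊖n m n))

    pos-^ : ∀ X L → (+ X) ℤ.^ L ≡ + (X ℕ.^ L)
    pos-^ X zero = refl
    pos-^ X (suc L) = trans (cong (+ X ℤ.*_) (pos-^ X L)) (sym (ℤ.pos-* X (X ℕ.^ L)))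

    -- P_n has degree 3n², so A, B and C have degree at most n² in the variable that was q³.
    len : ℕ → ℕ
    len n = suc (n ℕ.* n)

    len-suc : ∀ n → len (suc n) ≡ suc (n ℕ.+ n) ℕ.+ len n
    len-suc = lem
      where
      lem : ∀ n → suc (suc n ℕ.* suc n) ≡ suc (n ℕ.+ n) ℕ.+ suc (n ℕ.* n)
      lem = ℕ-Ring.solve-∀

    module Step (X n a b c : ℕ) (eA : Enc (+ X) (A n) (len n) (+ a)) (eB : Enc (+ X) (B n) (len n) (+ b)) (eC : Enc (+ X) (C n) (len n) (+ c)) where
      l′ : ℕ
      l′ = suc (n ℕ.+ n) ℕ.+ len n
      x = X ℕ.^ n
      x₁ = X ℕ.* x
      x₂ = x ℕ.* x₁

      up : ∀ {f v} → Enc (+ X) f (len n) v → Enc (+ X) f l′ v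
      up = Enc-mono l′ (ℕ.m≤n+m (len n) (suc (n ℕ.+ n)))

      at : ∀ {f v} k y → k ℕ.≤ suc (n ℕ.+ n) → X ℕ.^ k ≡ y → Enc (+ X) f (len n) (+ v) → Enc (+ X) (sh k f) l′ (+ (y ℕ.* v))
      at {v = v} k y p e ef = Enc-cong (λ _ → refl) (trans (cong (ℤ._* + v) (trans (pos-^ X k) (cong +_ e))) (sym (ℤ.pos-* y v)))
        (Enc-mono l′ (ℕ.+-monoˡ-≤ (len n) p) (Enc-sh k ef))

      n≤ : n ℕ.≤ suc (n ℕ.+ n)
      n≤ = ℕ.≤-trans (ℕ.m≤m+n n n) (ℕ.n≤1+n _)
      sn≤ : suc n ℕ.≤ suc (n ℕ.+ n)
      sn≤ = ℕ.s≤s (ℕ.m≤m+n n n)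
      e₂ : X ℕ.^ suc (n ℕ.+ n) ≡ x₂
      e₂ = trans (cong (X ℕ.*_) (ℕ.^-distribˡ-+-* X n n)) (lem X x)
        where
        lem : ∀ X x → X ℕ.* (x ℕ.* x) ≡ x ℕ.* (X ℕ.* x)
        lem = ℕ-Ring.solve-∀

      Enc-⊞′ : ∀ {f g v w} → Enc (+ X) f l′ (+ v) → Enc (+ X) g l′ (+ w) → Enc (+ X) (f ⊞ g) l′ (+ (v ℕ.+ w))
      Enc-⊞′ {v = v} {w} p q = Enc-cong (λ _ → refl) (sym (ℤ.pos-+ v w)) (Enc-⊞ p q)

      Enc-⊖′ : ∀ {f g v w} → w ℕ.≤ v → Enc (+ X) f l′ (+ v) → Enc (+ X) g l′ (+ w) → Enc (+ X) (f ⊖ g) l′ (+ (v ℕ.∸ w))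
      Enc-⊖′ {v = v} {w} l p q = Enc-cong (λ _ → refl) (sym (pos-∸ v w l)) (Enc-⊞ p (Enc-⊟ q))

      re : ∀ {f v} → Enc (+ X) f l′ v → Enc (+ X) f (len (suc n)) v
      re {f} {v} = subst (λ l → Enc (+ X) f l v) (sym (len-suc n))

      A′ : Enc (+ X) (A (suc n)) (len (suc n)) (+ (a ℕ.+ x₂ ℕ.* a ℕ.+ x₁ ℕ.* (b ℕ.+ c)))
      A′ = re (Enc-cong (λ m → sym (A-suc n m)) refl (Enc-⊞′ (Enc-⊞′ (up eA) (at (suc (n ℕ.+ n)) x₂ ℕ.≤-refl e₂ eA))
         (at (suc n) x₁ sn≤ refl (Enc-cong {l = len n} (λ _ → refl) (sym (ℤ.pos-+ b c)) (Enc-⊞ {l = len n} eB eC)))))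

      B′ : x₁ ℕ.* c ℕ.≤ b ℕ.+ x₂ ℕ.* b ℕ.+ x ℕ.* a → Enc (+ X) (B (suc n)) (len (suc n)) (+ (b ℕ.+ x₂ ℕ.* b ℕ.+ x ℕ.* a ℕ.∸ x₁ ℕ.* c))
      B′ l = re (Enc-cong (λ m → trans (ℤ.+-assoc (B n m ℤ.+ sh (suc (n ℕ.+ n)) (B n) m) (sh n (A n) m) (ℤ.- sh (suc n) (C n) m)) (sym (B-suc n m))) refl
         (Enc-⊖′ l (Enc-⊞′ (Enc-⊞′ (up eB) (at (suc (n ℕ.+ n)) x₂ ℕ.≤-refl e₂ eB)) (at n x n≤ refl eA)) (at (suc n) x₁ sn≤ refl eC)))

      C′ : x ℕ.* b ℕ.≤ c ℕ.+ x₂ ℕ.* c ℕ.+ x ℕ.* a → Enc (+ X) (C (suc n)) (len (suc n)) (+ (c ℕ.+ x₂ ℕ.* c ℕ.+ x ℕ.* a ℕ.∸ x ℕ.* b))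
      C′ l = re (Enc-cong (λ m → trans (ℤ.+-assoc (C n m ℤ.+ sh (suc (n ℕ.+ n)) (C n) m) (sh n (A n) m) (ℤ.- sh n (B n) m)) (sym (C-suc n m))) refl
         (Enc-⊖′ l (Enc-⊞′ (Enc-⊞′ (up eC) (at (suc (n ℕ.+ n)) x₂ ℕ.≤-refl e₂ eC)) (at n x n≤ refl eA)) (at n x n≤ refl eB)))

    4β : ∀ β → β ℕ.+ β ℕ.+ (β ℕ.+ β) ≡ 4 ℕ.* β
    4β = ℕ-Ring.solve-∀

  -- Each recurrence adds or subtracts exactly four shifted series of the preceding stage.
  ABC-bounded : ∀ n → Bounded (4 ℕ.^ n) (A n) × Bounded (4 ℕ.^ n) (B n) × Bounded (4 ℕ.^ n) (C n)
  ABC-bounded zero = bounded (λ { zero → ℕ.≤-refl ; (suc _) → ℕ.z≤n }) , bounded (λ _ → ℕ.z≤n) , bounded (λ _ → ℕ.z≤n)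
  ABC-bounded (suc n) with ABC-bounded n
  ... | a , b , c =
      subst (λ k → Bounded k (A (suc n))) (4β (4 ℕ.^ n)) (Bounded-cong (λ m → sym (A-suc n m)) (Bounded-⊞ (Bounded-⊞ a (Bounded-sh (suc (n ℕ.+ n)) a)) (Bounded-sh (suc n) (Bounded-⊞ b c))))
    , subst (λ k → Bounded k (B (suc n))) (4β (4 ℕ.^ n)) (Bounded-cong (λ m → sym (B-suc n m)) (Bounded-⊞ (Bounded-⊞ b (Bounded-sh (suc (n ℕ.+ n)) b)) (Bounded-⊞ (Bounded-sh n a) (Bounded-⊟ (Bounded-sh (suc n) c)))))
    , subst (λ k → Bounded k (C (suc n))) (4β (4 ℕ.^ n)) (Bounded-cong (λ m → sym (C-suc n m)) (Bounded-⊞ (Bounded-⊞ c (Bounded-sh (suc (n ℕ.+ n)) c)) (Bounded-⊞ (Bounded-sh n a) (Bounded-⊟ (Bounded-sh n b)))))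

  -- The comparison that `checkC` makes for each subtraction ensures that the truncated difference
  -- is the true one, so the natural numbers it carries along stay the values of A, B and C at X.
  checkC-sound : ∀ k {ps h X L} n a b c → h ℕ.+ h ℕ.≤ X → Squares X ps L → 4 ℕ.^ (k ℕ.+ n) ℕ.< h → len (k ℕ.+ n) ℕ.≤ L →
    Enc (+ X) (A n) (len n) (+ a) → Enc (+ X) (B n) (len n) (+ b) → Enc (+ X) (C n) (len n) (+ c) →
    checkC k ps h X a b c (X ℕ.^ n) ≡ true → ∀ i → i ℕ.< k → ∀ m → 0ℤ ℤ.≤ C (suc (i ℕ.+ n)) m
  checkC-sound (suc k) {ps} {h} {X} {L} n a b c hX sq bh lL eA eB eC chk i i<k = go i i<k
    where
    open Step X n a b c eA eB eC
    tb = b ℕ.+ x₂ ℕ.* b ℕ.+ x ℕ.* a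
    tc = c ℕ.+ x₂ ℕ.* c ℕ.+ x ℕ.* a
    k₁ = ∧-true chk
    lb : x₁ ℕ.* c ℕ.≤ tb
    lb = ℕ.≤-pred (<ᵇ-sound (x₁ ℕ.* c) (suc tb) (proj₁ k₁))
    k₂ = ∧-true {x ℕ.* b ℕ.<ᵇ suc tc} (proj₂ k₁)
    lc : x ℕ.* b ℕ.≤ tc
    lc = ℕ.≤-pred (<ᵇ-sound (x ℕ.* b) (suc tc) (proj₁ k₂))
    k₃ = ∧-true {digits′ ps h (tc ℕ.∸ x ℕ.* b)} (proj₂ k₂)
    mono-len : len (suc n) ℕ.≤ len (suc (k ℕ.+ n))
    mono-len = ℕ.s≤s (ℕ.*-mono-≤ {suc n} {suc (k ℕ.+ n)} (ℕ.s≤s (ℕ.m≤n+m n k)) (ℕ.s≤s (ℕ.m≤n+m n k)))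
    go : ∀ i → i ℕ.< suc k → ∀ m → 0ℤ ℤ.≤ C (suc (i ℕ.+ n)) m
    go zero _ = nonneg-by-digits (C (suc n)) hX sq (C′ lc) (ℕ.≤-trans mono-len lL) (proj₂ (proj₂ (ABC-bounded (suc n))))
      (ℕ.≤-<-trans (ℕ.^-monoʳ-≤ 4 (ℕ.s≤s (ℕ.m≤n+m n k))) bh) (digits′-sound ps h _ (ℕ.≤-<-trans ℕ.z≤n bh) (proj₁ k₃))
    go (suc i) (ℕ.s≤s p) = subst (λ j → ∀ m → 0ℤ ℤ.≤ C (suc j) m) (ℕ.+-suc i n)
      (checkC-sound k (suc n) _ _ _ hX sq (subst (λ j → 4 ℕ.^ j ℕ.< h) (sym (ℕ.+-suc k n)) bh) (subst (λ j → len j ℕ.≤ L) (sym (ℕ.+-suc k n)) lL)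
         A′ (B′ lb) (C′ lc) (proj₂ k₃) i p)

  -- The general argument uses n ≥ 6j + 2 for every j ≤ 16, which means n ≥ 98.
  n₀ : ℕ
  n₀ = 97

  private
    -- The coefficients are at most 4^97 = 2^194 < 2^199, and there are at most 97² + 1 of them,
    -- which fit into 2^14 digits.
    X₀ h₀ : ℕ
    X₀ = 2 ℕ.^ 200
    h₀ = 2 ℕ.^ 199

    checked : checkC n₀ (squares 14 X₀ []) h₀ X₀ 1 0 0 (X₀ ℕ.^ 0) ≡ true
    checked = refl

  C≥0-small : ∀ n → n ℕ.≤ n₀ → ∀ m → 0ℤ ℤ.≤ C n m
  C≥0-small zero _ m = ℤ.≤-refl
  C≥0-small (suc n) p = subst (λ j → ∀ m → 0ℤ ℤ.≤ C (suc j) m) (ℕ.+-identityʳ n)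
    (checkC-sound n₀ 0 1 0 0 (ℕ.≤ᵇ⇒≤ (h₀ ℕ.+ h₀) X₀ _) (squares-sound X₀ 14 (ℕ.≤ᵇ⇒≤ 1 X₀ _) (sym (ℕ.*-identityʳ X₀)) [])
      (ℕ.<ᵇ⇒< (4 ℕ.^ n₀) h₀ _) (ℕ.≤ᵇ⇒≤ (len n₀) (2 ℕ.^ 14 ℕ.* 1) _)
      (enc (λ { (suc m) _ → refl }) (trans (cong (λ □ → 1ℤ ℤ.+ □) (ℤ.*-zeroʳ (+ X₀))) refl)) (enc (λ _ _ → refl) (trans (ℤ.+-identityˡ _) (ℤ.*-zeroʳ (+ X₀)))) (enc (λ _ _ → refl) (trans (ℤ.+-identityˡ _) (ℤ.*-zeroʳ (+ X₀))))
      checked n p)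

-- Partial sums, window sums and the comparison of tails

module Windows where

  open import Data.Nat as ℕ using (ℕ; zero; suc; _+_; _*_; _≤_; _<_; z≤n; s≤s)
  open import Data.Nat.Properties as ℕ
  open import Data.Nat.Tactic.RingSolver using (solve-∀)
  open import Data.Product using (Σ; _×_; _,_)
  open import Data.Sum using (_⊎_; inj₁; inj₂)
  open import Relation.Binary.PropositionalEquality hiding (setoid)

  NSer : Set
  NSer = ℕ → ℕ

  infix 4 _≼_
  _≼_ : NSer → NSer → Set
  f ≼ g = ∀ m → f m ≤ g m

  shN : ℕ → NSer → NSer
  shN zero f m = f m
  shN (suc k) f zero = 0
  shN (suc k) f (suc m) = shN k f m

  bit tri : ℕ → NSer → NSer
  bit k f m = f m + shN k f m
  tri k f m = f m + shN k f m + shN (k + k) f m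

  cum : NSer → NSer
  cum f zero = f 0
  cum f (suc m) = cum f m + f (suc m)

  shN-cong : ∀ k {f g} → f ≗ g → shN k f ≗ shN k g
  shN-cong zero e m = e m
  shN-cong (suc k) e zero = refl
  shN-cong (suc k) e (suc m) = shN-cong k e m

  shN-mono : ∀ k {f g} → f ≼ g → shN k f ≼ shN k g
  shN-mono zero e m = e m
  shN-mono (suc k) e zero = z≤n
  shN-mono (suc k) e (suc m) = shN-mono k e m

  shN-shN : ∀ k l f → shN k (shN l f) ≗ shN (k + l) f
  shN-shN zero l f m = refl
  shN-shN (suc k) l f zero = refl
  shN-shN (suc k) l f (suc m) = shN-shN k l f m

  shN-+ : ∀ k f g m → shN k (λ i → f i + g i) m ≡ shN k f m + shN k g m
  shN-+ zero f g m = refl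
  shN-+ (suc k) f g zero = refl
  shN-+ (suc k) f g (suc m) = shN-+ k f g m

  shN-≥ : ∀ k f i → shN k f (k + i) ≡ f i
  shN-≥ zero f i = refl
  shN-≥ (suc k) f i = shN-≥ k f i

  shN-< : ∀ k f i → i < k → shN k f i ≡ 0
  shN-< (suc k) f zero _ = refl
  shN-< (suc k) f (suc i) (s≤s p) = shN-< k f i p

  shN-case : ∀ k f m → (m < k × shN k f m ≡ 0) ⊎ (Σ ℕ λ i → m ≡ k + i × shN k f m ≡ f i)
  shN-case zero f m = inj₂ (m , refl , refl)
  shN-case (suc k) f zero = inj₁ (s≤s z≤n , refl)
  shN-case (suc k) f (suc m) with shN-case k f m
  ... | inj₁ (p , e) = inj₁ (s≤s p , e)
  ... | inj₂ (i , p , e) = inj₂ (i , cong suc p , e)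

  shN-tri : ∀ j k f m → shN j (tri k f) m ≡ shN j f m + shN (j + k) f m + shN (j + (k + k)) f m
  shN-tri j k f m = trans (shN-+ j (λ i → f i + shN k f i) (shN (k + k) f) m)
    (cong₂ _+_ (trans (shN-+ j f (shN k f) m) (cong (shN j f m +_) (shN-shN j k f m))) (shN-shN j (k + k) f m))

  shN-bit : ∀ j k f m → shN j (bit k f) m ≡ shN j f m + shN (j + k) f m
  shN-bit j k f m = trans (shN-+ j f (shN k f) m) (cong (shN j f m +_) (shN-shN j k f m))

  tri-cong : ∀ k {f g} → f ≗ g → tri k f ≗ tri k g
  tri-cong k e m = cong₂ _+_ (cong₂ _+_ (e m) (shN-cong k e m)) (shN-cong (k + k) e m)

  bit-cong : ∀ k {f g} → f ≗ g → bit k f ≗ bit k g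
  bit-cong k e m = cong₂ _+_ (e m) (shN-cong k e m)

  tri-mono : ∀ k {f g} → f ≼ g → tri k f ≼ tri k g
  tri-mono k e m = +-mono-≤ (+-mono-≤ (e m) (shN-mono k e m)) (shN-mono (k + k) e m)

  cum-suc : ∀ k f m → cum (shN (suc k) f) (suc m) ≡ cum (shN k f) m
  cum-suc k f zero = refl
  cum-suc k f (suc m) = cong (_+ shN k f (suc m)) (cum-suc k f m)

  cum-shN : ∀ k f → cum (shN k f) ≗ shN k (cum f)
  cum-shN zero f m = refl
  cum-shN (suc k) f zero = refl
  cum-shN (suc k) f (suc m) = trans (cum-suc k f m) (cum-shN k f m)

  cum-+ : ∀ f g m → cum (λ i → f i + g i) m ≡ cum f m + cum g m
  cum-+ f g zero = refl
  cum-+ f g (suc m) = trans (cong (_+ (f (suc m) + g (suc m))) (cum-+ f g m)) (lem (cum f m) (cum g m) (f (suc m)) (g (suc m)))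
    where
    lem : ∀ a b c d → a + b + (c + d) ≡ a + c + (b + d)
    lem = solve-∀

  cum-bit : ∀ k f → cum (bit k f) ≗ bit k (cum f)
  cum-bit k f m = trans (cum-+ f (shN k f) m) (cong (cum f m +_) (cum-shN k f m))

  cum-tri : ∀ k f → cum (tri k f) ≗ tri k (cum f)
  cum-tri k f m = trans (cum-+ (bit k f) (shN (k + k) f) m) (cong₂ _+_ (cum-bit k f m) (cum-shN (k + k) f m))

  cum-cong : ∀ {f g} → f ≗ g → cum f ≗ cum g
  cum-cong e zero = e 0
  cum-cong e (suc m) = cong₂ _+_ (cum-cong e m) (e (suc m))

  Mono : NSer → Set
  Mono c = ∀ {m n} → m ≤ n → c m ≤ c n

  cum-Mono : ∀ f → Mono (cum f)
  cum-Mono f {m} m≤n = subst (λ n → cum f m ≤ cum f n) (m+[n∸m]≡n m≤n) (go _)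
    where
    go : ∀ k → cum f m ≤ cum f (m + k)
    go zero = ≤-reflexive (cong (cum f) (sym (+-identityʳ m)))
    go (suc k) = subst (λ i → cum f m ≤ cum f i) (sym (+-suc m k)) (≤-trans (go k) (m≤m+n _ _))

  -- Terms of negative argument count as 0, so monotonicity survives shifting: all that matters is u
  -- - x ≤ v - y, written without subtraction.
  sh-≤ : ∀ {c} → Mono c → ∀ x y u v → u + y ≤ v + x → shN x c u ≤ shN y c v
  sh-≤ {c} mono x y u v l with shN-case x c u
  ... | inj₁ (_ , e) = subst (_≤ shN y c v) (sym e) z≤n
  ... | inj₂ (i , refl , e) = subst₂ _≤_ (sym e) (trans (sym (shN-≥ y c (v ℕ.∸ y))) (cong (shN y c) v≡)) (mono i≤)
    where
    y+i≤v : y + i ≤ v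
    y+i≤v = +-cancelˡ-≤ x (y + i) v (subst₂ _≤_ (lem x i y) (+-comm v x) l)
      where
      lem : ∀ x i y → x + i + y ≡ x + (y + i)
      lem = solve-∀
    v≡ : y + (v ℕ.∸ y) ≡ v
    v≡ = m+[n∸m]≡n (≤-trans (m≤m+n y i) y+i≤v)
    i≤ : i ≤ v ℕ.∸ y
    i≤ = +-cancelˡ-≤ y i _ (subst (y + i ≤_) (sym v≡) y+i≤v)

  tri-Mono : ∀ {c} k → Mono c → Mono (tri k c)
  tri-Mono {c} k mono {m} {n} p = +-mono-≤ (+-mono-≤ (mono p) (sh-≤ mono k k m n (+-monoˡ-≤ k p))) (sh-≤ mono (k + k) (k + k) m n (+-monoˡ-≤ (k + k) p))

  bit-Mono : ∀ {c} k → Mono c → Mono (bit k c)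
  bit-Mono {c} k mono {m} {n} p = +-mono-≤ (mono p) (sh-≤ mono k k m n (+-monoˡ-≤ k p))

  -- Partial sums c of a finitely supported sequence of total τ.  The inequality says
  -- 3 c(p) (τ - c(p-M)) ≤ S τ (c(p) - c(p-M)): a window of length M carries a definite share of the
  -- smaller of the two tails.  It is inherited by products because replacing one factor at a time turns
  -- a choice of total weight ≤ p into one of total weight > p - M without jumping over the window.

  record Spread (M S τ : ℕ) (c : NSer) : Set where
    field
      mono : Mono c
      ≤τ : ∀ m → c m ≤ τ
      window : ∀ p → 3 * (c p * τ) + S * (τ * shN M c p) ≤ S * (τ * c p) + 3 * (c p * shN M c p)

  private
    shN-≤τ : ∀ {c τ} k → (∀ m → c m ≤ τ) → ∀ m → shN k c m ≤ τ
    shN-≤τ {c} k b m with shN-case k c m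
    ... | inj₁ (_ , e) = subst (_≤ _) (sym e) z≤n
    ... | inj₂ (i , _ , e) = subst (_≤ _) (sym e) (b i)

    module _ {M S τ c} (sp : Spread M S τ c) where
      open Spread sp
      window-sh : ∀ k p → 3 * (shN k c p * τ) + S * (τ * shN k (shN M c) p) ≤ S * (τ * shN k c p) + 3 * (shN k c p * shN k (shN M c) p)
      window-sh k p with shN-case k c p
      ... | inj₁ (l , e) rewrite e | shN-< k (shN M c) p l = ≤-reflexive (lem S τ)
        where
        lem : ∀ S τ → 3 * (0 * τ) + S * (τ * 0) ≡ S * (τ * 0) + 3 * (0 * 0)
        lem = solve-∀
      ... | inj₂ (i , refl , e) rewrite e | shN-≥ k (shN M c) i = window i

    cancel : ∀ {a b A B D} → a ≤ b → B + a ≡ A + b + D → A ≤ B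
    cancel {a} {b} {A} {B} {D} a≤b e = +-cancelʳ-≤ a A B (≤-trans (+-monoʳ-≤ A a≤b) (≤-trans (m≤m+n (A + b) D) (≤-reflexive (sym e))))

    diff : ∀ {m n} → m ≤ n → Σ ℕ λ d → n ≡ m + d
    diff {m} {n} p = n ℕ.∸ m , sym (m+[n∸m]≡n p)

    -- After e the variables are the gaps in the chain c(p-M-2k) ≤ c(p-M-k) ≤ c(p-M) ≤ c(p-2k) ≤
    -- c(p-k) ≤ c(p) ≤ τ. In these variables the new window inequality exceeds three times the sum
    -- of the three old ones by a polynomial with nonnegative coefficients.
    tri-arith : ∀ S e d₁ d₀ g f₁ f₀ t →
      let l₂′ = e ; l₁′ = e + d₁ ; l₀′ = e + d₁ + d₀ ; l₂ = l₀′ + g ; l₁ = l₂ + f₁ ; l₀ = l₁ + f₀ ; τ = l₀ + t in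
      (2 + S) * (3 * τ * (l₀ + l₁ + l₂)) + 3 * ((l₀ + l₁ + l₂) * (l₀′ + l₁′ + l₂′))
        + 3 * ((3 * (l₀ * τ) + S * (τ * l₀′)) + (3 * (l₁ * τ) + S * (τ * l₁′)) + (3 * (l₂ * τ) + S * (τ * l₂′)))
      ≡ (3 * ((l₀ + l₁ + l₂) * (3 * τ)) + (2 + S) * (3 * τ * (l₀′ + l₁′ + l₂′)))
        + 3 * ((S * (τ * l₀) + 3 * (l₀ * l₀′)) + (S * (τ * l₁) + 3 * (l₁ * l₁′)) + (S * (τ * l₂) + 3 * (l₂ * l₂′)))
        + (6 * ((t + e + g + f₁ + f₀) * (3 * g + 2 * f₁ + f₀ + 2 * d₀ + d₁)) + 6 * ((d₁ + d₀) * (3 * g + 2 * d₀ + d₁)) + (6 * (d₁ * f₁) + 3 * (d₁ * f₀) + 9 * (d₀ * f₁)))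
    tri-arith = solve-∀

    bit-arith : ∀ S e d₀ g f₀ t →
      let l₁′ = e ; l₀′ = e + d₀ ; l₁ = l₀′ + g ; l₀ = l₁ + f₀ ; τ = l₀ + t in
      (2 + S) * (2 * τ * (l₀ + l₁)) + 3 * ((l₀ + l₁) * (l₀′ + l₁′))
        + 2 * ((3 * (l₀ * τ) + S * (τ * l₀′)) + (3 * (l₁ * τ) + S * (τ * l₁′)))
      ≡ (3 * ((l₀ + l₁) * (2 * τ)) + (2 + S) * (2 * τ * (l₀′ + l₁′)))
        + 2 * ((S * (τ * l₀) + 3 * (l₀ * l₀′)) + (S * (τ * l₁) + 3 * (l₁ * l₁′)))
        + (4 * ((t + e + g + f₀) * (2 * g + f₀ + d₀)) + 4 * (d₀ * (2 * g + d₀)) + d₀ * f₀)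
    bit-arith = solve-∀

    tri-window : ∀ S {e₂ e₁ e₀ l₂ l₁ l₀ τ} → e₂ ≤ e₁ → e₁ ≤ e₀ → e₀ ≤ l₂ → l₂ ≤ l₁ → l₁ ≤ l₀ → l₀ ≤ τ →
      3 * (l₀ * τ) + S * (τ * e₀) ≤ S * (τ * l₀) + 3 * (l₀ * e₀) →
      3 * (l₁ * τ) + S * (τ * e₁) ≤ S * (τ * l₁) + 3 * (l₁ * e₁) →
      3 * (l₂ * τ) + S * (τ * e₂) ≤ S * (τ * l₂) + 3 * (l₂ * e₂) →
      3 * ((l₀ + l₁ + l₂) * (3 * τ)) + (2 + S) * (3 * τ * (e₀ + e₁ + e₂)) ≤ (2 + S) * (3 * τ * (l₀ + l₁ + l₂)) + 3 * ((l₀ + l₁ + l₂) * (e₀ + e₁ + e₂))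
    tri-window S {e₂} p₁ p₂ p₃ p₄ p₅ p₆ h₀ h₁ h₂ with diff p₁
    ... | d₁ , refl with diff p₂
    ... | d₀ , refl with diff p₃
    ... | g , refl with diff p₄
    ... | f₁ , refl with diff p₅
    ... | f₀ , refl with diff p₆
    ... | t , refl = cancel (*-monoʳ-≤ 3 (+-mono-≤ (+-mono-≤ h₀ h₁) h₂)) (tri-arith S e₂ d₁ d₀ g f₁ f₀ t)

    bit-window : ∀ S {e₁ e₀ l₁ l₀ τ} → e₁ ≤ e₀ → e₀ ≤ l₁ → l₁ ≤ l₀ → l₀ ≤ τ →
      3 * (l₀ * τ) + S * (τ * e₀) ≤ S * (τ * l₀) + 3 * (l₀ * e₀) →
      3 * (l₁ * τ) + S * (τ * e₁) ≤ S * (τ * l₁) + 3 * (l₁ * e₁) →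
      3 * ((l₀ + l₁) * (2 * τ)) + (2 + S) * (2 * τ * (e₀ + e₁)) ≤ (2 + S) * (2 * τ * (l₀ + l₁)) + 3 * ((l₀ + l₁) * (e₀ + e₁))
    bit-window S {e₁} p₂ p₃ p₅ p₆ h₀ h₁ with diff p₂
    ... | d₀ , refl with diff p₃
    ... | g , refl with diff p₅
    ... | f₀ , refl with diff p₆
    ... | t , refl = cancel (*-monoʳ-≤ 2 (+-mono-≤ h₀ h₁)) (bit-arith S e₁ d₀ g f₀ t)

    shN-comm : ∀ k M c p → shN (M + k) c p ≡ shN k (shN M c) p
    shN-comm k M c p = trans (cong (λ i → shN i c p) (+-comm M k)) (sym (shN-shN k M c p))

  -- The condition 2k ≤ M, under which a change of one factor cannot jump over the window, supplies
  -- the middle link c(p-M) ≤ c(p-2k) of the chain. A factor costs 2 in the constant S.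
  spread-tri : ∀ {M S τ c} k → k + k ≤ M → Spread M S τ c → Spread M (2 + S) (3 * τ) (tri k c)
  spread-tri {M} {S} {τ} {c} k 2k≤M sp = record
    { mono = tri-Mono k mono
    ; ≤τ = λ m → ≤-trans (+-mono-≤ (+-mono-≤ (≤τ m) (shN-≤τ k ≤τ m)) (shN-≤τ (k + k) ≤τ m)) (≤-reflexive (lem τ))
    ; window = λ p → subst (λ w → 3 * (tri k c p * (3 * τ)) + (2 + S) * (3 * τ * w) ≤ (2 + S) * (3 * τ * tri k c p) + 3 * (tri k c p * w)) (sym (shM p))
        (tri-window S
          (subst₂ _≤_ (shN-comm (k + k) M c p) (shN-comm k M c p) (sh-≤ mono (M + (k + k)) (M + k) p p (+-monoʳ-≤ p (+-monoʳ-≤ M (m≤m+n k k)))))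
          (subst (_≤ shN M c p) (shN-comm k M c p) (sh-≤ mono (M + k) M p p (+-monoʳ-≤ p (m≤m+n M k))))
          (sh-≤ mono M (k + k) p p (+-monoʳ-≤ p 2k≤M))
          (sh-≤ mono (k + k) k p p (+-monoʳ-≤ p (m≤m+n k k)))
          (sh-≤ mono k 0 p p (+-monoʳ-≤ p z≤n))
          (≤τ p) (window p) (window-sh sp k p) (window-sh sp (k + k) p)) }
    where
    open Spread sp
    lem : ∀ τ → τ + τ + τ ≡ 3 * τ
    lem = solve-∀
    shM : ∀ p → shN M (tri k c) p ≡ shN M c p + shN k (shN M c) p + shN (k + k) (shN M c) p
    shM p = trans (shN-tri M k c p) (cong₂ (λ a b → shN M c p + a + b) (shN-comm k M c p) (shN-comm (k + k) M c p))

  spread-bit : ∀ {M S τ c} k → k ≤ M → Spread M S τ c → Spread M (2 + S) (2 * τ) (bit k c)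
  spread-bit {M} {S} {τ} {c} k k≤M sp = record
    { mono = bit-Mono k mono
    ; ≤τ = λ m → ≤-trans (+-mono-≤ (≤τ m) (shN-≤τ k ≤τ m)) (≤-reflexive (lem τ))
    ; window = λ p → subst (λ w → 3 * (bit k c p * (2 * τ)) + (2 + S) * (2 * τ * w) ≤ (2 + S) * (2 * τ * bit k c p) + 3 * (bit k c p * w)) (sym (shM p))
        (bit-window S
          (subst (_≤ shN M c p) (shN-comm k M c p) (sh-≤ mono (M + k) M p p (+-monoʳ-≤ p (m≤m+n M k))))
          (sh-≤ mono M k p p (+-monoʳ-≤ p k≤M))
          (sh-≤ mono k 0 p p (+-monoʳ-≤ p z≤n))
          (≤τ p) (window p) (window-sh sp k p)) }
    where
    open Spread sp
    lem : ∀ τ → τ + τ ≡ 2 * τ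
    lem = solve-∀
    shM : ∀ p → shN M (bit k c) p ≡ shN M c p + shN k (shN M c) p
    shM p = trans (shN-bit M k c p) (cong (λ a → shN M c p + a) (shN-comm k M c p))

  -- N copies of a distribution X fit under Y at both ends: N · X(≤ u) ≤ Y(≤ u) and N · X(> u - b) ≤
  -- Y(> u - a). When a and b are read as the top degrees of X and Y, the second condition compares
  -- weights counted downwards from the top.
  record Below (N a b τX τY : ℕ) (cX cY : NSer) : Set where
    field
      total : N * τX ≤ τY
      lower : ∀ u → N * cX u ≤ cY u
      upper : ∀ u → N * τX + shN a cY u ≤ τY + N * shN b cX u

  private
    module _ {N a b τX τY cX cY} (bl : Below N a b τX τY cX cY) where
      open Below bl
      upper-sh : ∀ j u → N * τX + shN (j + a) cY u ≤ τY + N * shN (j + b) cX u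
      upper-sh j u = subst₂ (λ x y → N * τX + x ≤ τY + N * y) (shN-shN j a cY u) (shN-shN j b cX u) (go j u)
        where
        go : ∀ j u → N * τX + shN j (shN a cY) u ≤ τY + N * shN j (shN b cX) u
        go zero u = upper u
        go (suc j) zero = +-mono-≤ total z≤n
        go (suc j) (suc u) = go j u

      lower-sh : ∀ j u → N * shN j cX u ≤ shN j cY u
      lower-sh zero u = lower u
      lower-sh (suc j) zero = ≤-reflexive (*-zeroʳ N)
      lower-sh (suc j) (suc u) = lower-sh j u

  -- A factor that only Y has: the choice 1 serves the lower tail and the choice q^2k the upper one.
  below-tri : ∀ {N a b τX τY cX cY} k → (∀ m → cY m ≤ τY) → Below N a b τX τY cX cY → Below N a (b + (k + k)) τX (3 * τY) cX (tri k cY)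
  below-tri {N} {a} {b} {τX} {τY} {cX} {cY} k ≤τ bl = record
    { total = ≤-trans total (m≤m+n τY _)
    ; lower = λ u → ≤-trans (lower u) (≤-trans (m≤m+n (cY u) (shN k cY u)) (m≤m+n _ _))
    ; upper = λ u → begin
        N * τX + shN a (tri k cY) u ≡⟨ cong (N * τX +_) (shN-tri a k cY u) ⟩
        N * τX + (shN a cY u + shN (a + k) cY u + shN (a + (k + k)) cY u) ≡⟨ lem₁ (N * τX) (shN a cY u) (shN (a + k) cY u) (shN (a + (k + k)) cY u) ⟩
        shN a cY u + shN (a + k) cY u + (N * τX + shN (a + (k + k)) cY u)
          ≤⟨ +-mono-≤ (+-mono-≤ (shN-≤τ a ≤τ u) (shN-≤τ (a + k) ≤τ u)) (subst₂ (λ i j → N * τX + shN i cY u ≤ τY + N * shN j cX u) (+-comm (k + k) a) (+-comm (k + k) b) (upper-sh bl (k + k) u)) ⟩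
        τY + τY + (τY + N * shN (b + (k + k)) cX u) ≡⟨ lem₂ τY (N * shN (b + (k + k)) cX u) ⟩
        3 * τY + N * shN (b + (k + k)) cX u ∎ }
    where
    open Below bl
    open ≤-Reasoning
    lem₁ : ∀ n x y z → n + (x + y + z) ≡ x + y + (n + z)
    lem₁ = solve-∀
    lem₂ : ∀ t n → t + t + (t + n) ≡ 3 * t + n
    lem₂ = solve-∀

  below-bit : ∀ {N a b τX τY cX cY} k → (∀ m → cY m ≤ τY) → Below N a b τX τY cX cY → Below N a (b + k) τX (2 * τY) cX (bit k cY)
  below-bit {N} {a} {b} {τX} {τY} {cX} {cY} k ≤τ bl = record
    { total = ≤-trans total (m≤m+n τY _)
    ; lower = λ u → ≤-trans (lower u) (m≤m+n (cY u) (shN k cY u))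
    ; upper = λ u → begin
        N * τX + shN a (bit k cY) u ≡⟨ cong (N * τX +_) (shN-bit a k cY u) ⟩
        N * τX + (shN a cY u + shN (a + k) cY u) ≡⟨ lem₁ (N * τX) (shN a cY u) (shN (a + k) cY u) ⟩
        shN a cY u + (N * τX + shN (a + k) cY u)
          ≤⟨ +-mono-≤ (shN-≤τ a ≤τ u) (subst₂ (λ i j → N * τX + shN i cY u ≤ τY + N * shN j cX u) (+-comm k a) (+-comm k b) (upper-sh bl k u)) ⟩
        τY + (τY + N * shN (b + k) cX u) ≡⟨ lem₂ τY (N * shN (b + k) cX u) ⟩
        2 * τY + N * shN (b + k) cX u ∎ }
    where
    open Below bl
    open ≤-Reasoning
    lem₁ : ∀ n x y → n + (x + y) ≡ x + (n + y)
    lem₁ = solve-∀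
    lem₂ : ∀ t n → t + (t + n) ≡ 2 * t + n
    lem₂ = solve-∀

  -- In the lower tail 1 and q^s are matched with 1 and q^k, in the upper tail with q^k and q^2k.
  -- Because k ≤ s, neither matching moves a weight away from its end.
  below-pair : ∀ {N a b τX τY cX cY} s k → k ≤ s → Mono cY → (∀ m → cY m ≤ τY) → Below N a b τX τY cX cY →
    Below N (a + s) (b + (k + k)) (2 * τX) (3 * τY) (bit s cX) (tri k cY)
  below-pair {N} {a} {b} {τX} {τY} {cX} {cY} s k k≤s mono ≤τ bl = record
    { total = ≤-trans (≤-reflexive (lem₀ N τX)) (*-mono-≤ {2} {3} (s≤s (s≤s z≤n)) total)
    ; lower = λ u → ≤-trans (≤-reflexive (*-distribˡ-+ N (cX u) (shN s cX u)))
        (≤-trans (+-mono-≤ (lower u) (≤-trans (lower-sh bl s u) (sh-≤ mono s k u u (+-monoʳ-≤ u k≤s)))) (m≤m+n _ _))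
    ; upper = λ u → begin
        N * (2 * τX) + shN (a + s) (tri k cY) u ≡⟨ cong (N * (2 * τX) +_) (shN-tri (a + s) k cY u) ⟩
        N * (2 * τX) + (shN (a + s) cY u + shN (a + s + k) cY u + shN (a + s + (k + k)) cY u) ≡⟨ lem₁ N τX (shN (a + s) cY u) (shN (a + s + k) cY u) (shN (a + s + (k + k)) cY u) ⟩
        shN (a + s) cY u + (N * τX + shN (a + s + k) cY u) + (N * τX + shN (a + s + (k + k)) cY u)
          ≤⟨ +-mono-≤ (+-mono-≤ (shN-≤τ (a + s) ≤τ u) (≤-trans (+-monoʳ-≤ (N * τX) (sh-≤ mono (a + s + k) (k + k + a) u u (+-monoʳ-≤ u (≤-trans (≤-reflexive (lem₂ a k)) (+-monoˡ-≤ k (+-monoʳ-≤ a k≤s)))))) (upper-sh bl (k + k) u)))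
               (subst₂ (λ i j → N * τX + shN i cY u ≤ τY + N * shN j cX u) (lem₃ s k a) (lem₄ s k b) (upper-sh bl (s + (k + k)) u)) ⟩
        τY + (τY + N * shN (k + k + b) cX u) + (τY + N * shN (b + (k + k) + s) cX u) ≡⟨ cong (λ i → τY + (τY + N * shN i cX u) + (τY + N * shN (b + (k + k) + s) cX u)) (+-comm (k + k) b) ⟩
        τY + (τY + N * shN (b + (k + k)) cX u) + (τY + N * shN (b + (k + k) + s) cX u) ≡⟨ lem₅ τY N (shN (b + (k + k)) cX u) (shN (b + (k + k) + s) cX u) ⟩
        3 * τY + N * (shN (b + (k + k)) cX u + shN (b + (k + k) + s) cX u) ≡⟨ cong (λ i → 3 * τY + N * i) (shN-bit (b + (k + k)) s cX u) ⟨
        3 * τY + N * shN (b + (k + k)) (bit s cX) u ∎ }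
    where
    open Below bl
    open ≤-Reasoning
    lem₀ : ∀ N t → N * (2 * t) ≡ 2 * (N * t)
    lem₀ = solve-∀
    lem₁ : ∀ N t x y z → N * (2 * t) + (x + y + z) ≡ x + (N * t + y) + (N * t + z)
    lem₁ = solve-∀
    lem₂ : ∀ a k → k + k + a ≡ a + k + k
    lem₂ = solve-∀
    lem₃ : ∀ s k a → s + (k + k) + a ≡ a + s + (k + k)
    lem₃ = solve-∀
    lem₄ : ∀ s k b → s + (k + k) + b ≡ b + (k + k) + s
    lem₄ = solve-∀
    lem₅ : ∀ t N x y → t + (t + N * x) + (t + N * y) ≡ 3 * t + N * (x + y)
    lem₅ = solve-∀

  -- x and w are the masses of windows of lengths M₀ and M ending at p.

  window-dom : ∀ {N a b τX τY cX cY M M₀ S} p {x w} → Spread M S τY cY → Below N a b τX τY cX cY → Mono cX → (∀ m → cX m ≤ τX) → 1 ≤ τY →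
    M₀ + a ≤ b + M → x + shN M₀ cX p ≡ cX p → w + shN M cY p ≡ cY p → 3 * (N * x) ≤ 2 * (S * w)
  window-dom {N} {a} {b} {τX} {τY} {cX} {cY} {M} {M₀} {S} p {x} {w} sp bl monoX ≤τX 1≤τ len ex ew = *-cancelʳ-≤ _ _ τY {{ℕ.>-nonZero 1≤τ}} (begin
      3 * (N * x) * τY ≤⟨ *-monoʳ-≤ (3 * (N * x)) τ≤ ⟩
      3 * (N * x) * (ℓ + υ) ≡⟨ lem₁ (N * x) ℓ υ ⟩
      3 * (N * x * ℓ + N * x * υ) ≤⟨ *-monoʳ-≤ 3 (+-mono-≤ (*-monoˡ-≤ ℓ Nx≤υ) (*-monoˡ-≤ υ Nx≤ℓ)) ⟩
      3 * (υ * ℓ + ℓ * υ) ≡⟨ lem₂ υ ℓ ⟩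
      2 * (3 * (ℓ * υ)) ≤⟨ *-monoʳ-≤ 2 win ⟩
      2 * (S * (τY * w)) ≡⟨ lem₃ S τY w ⟩
      2 * (S * w) * τY ∎)
    where
    open Below bl
    open Spread sp
    open ≤-Reasoning
    -- `ℓ` is the mass of Y up to p and `υ` its mass beyond p - M. The two tails overlap in the
    -- window, so τY ≤ ℓ + υ; N x is at most each of them; and the window inequality bounds 3 ℓ υ by
    -- S τY w.
    ℓ = cY p
    ℓ′ = shN M cY p
    υ = τY ℕ.∸ ℓ′
    ℓ′≤τ : ℓ′ ≤ τY
    ℓ′≤τ = shN-≤τ M ≤τ p
    τ≡ : ℓ′ + υ ≡ τY
    τ≡ = m+[n∸m]≡n ℓ′≤τ
    ℓ′≤ℓ : ℓ′ ≤ ℓ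
    ℓ′≤ℓ = sh-≤ mono M 0 p p (+-monoʳ-≤ p z≤n)
    τ≤ : τY ≤ ℓ + υ
    τ≤ = ≤-trans (≤-reflexive (sym τ≡)) (+-monoˡ-≤ υ ℓ′≤ℓ)
    Nx≤ℓ : N * x ≤ ℓ
    Nx≤ℓ = ≤-trans (*-monoʳ-≤ N (≤-trans (m≤m+n x _) (≤-reflexive ex))) (lower p)
    z = shN M₀ cX p
    up : N * τX + ℓ′ ≤ τY + N * z
    up = ≤-trans (≤-reflexive (cong (N * τX +_) e₁)) (≤-trans (upper-sh bl M (p + a)) (+-monoʳ-≤ τY (*-monoʳ-≤ N (sh-≤ monoX (M + b) M₀ (p + a) p
        (≤-trans (≤-reflexive (lem₄ p a M₀)) (+-monoʳ-≤ p (≤-trans len (≤-reflexive (+-comm b M)))))))))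
      where
      e₁ : ℓ′ ≡ shN (M + a) cY (p + a)
      e₁ = sym (trans (cong₂ (λ i j → shN i cY j) (+-comm M a) (+-comm p a)) (trans (sym (shN-shN a M cY (a + p))) (shN-≥ a (shN M cY) p)))
      lem₄ : ∀ p a m → p + a + m ≡ p + (m + a)
      lem₄ = solve-∀
    Nx≤υ : N * x ≤ υ
    Nx≤υ = +-cancelˡ-≤ (ℓ′ + N * z) (N * x) υ (begin
      ℓ′ + N * z + N * x ≡⟨ lem₅ ℓ′ N z x ⟩
      N * (x + z) + ℓ′ ≡⟨ cong (λ i → N * i + ℓ′) ex ⟩
      N * cX p + ℓ′ ≤⟨ +-monoˡ-≤ ℓ′ (*-monoʳ-≤ N (≤τX p)) ⟩
      N * τX + ℓ′ ≤⟨ up ⟩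
      τY + N * z ≡⟨ cong (_+ N * z) τ≡ ⟨
      ℓ′ + υ + N * z ≡⟨ lem₆ ℓ′ υ (N * z) ⟩
      ℓ′ + N * z + υ ∎)
      where
      lem₅ : ∀ l N z x → l + N * z + N * x ≡ N * (x + z) + l
      lem₅ = solve-∀
      lem₆ : ∀ l u z → l + u + z ≡ l + z + u
      lem₆ = solve-∀
    win : 3 * (ℓ * υ) ≤ S * (τY * w)
    win = +-cancelʳ-≤ (3 * (ℓ * ℓ′) + S * (τY * ℓ′)) _ _ (begin
      3 * (ℓ * υ) + (3 * (ℓ * ℓ′) + S * (τY * ℓ′)) ≡⟨ lem₇ ℓ υ ℓ′ (S * (τY * ℓ′)) ⟩
      3 * (ℓ * (ℓ′ + υ)) + S * (τY * ℓ′) ≡⟨ cong (λ i → 3 * (ℓ * i) + S * (τY * ℓ′)) τ≡ ⟩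
      3 * (ℓ * τY) + S * (τY * ℓ′) ≤⟨ window p ⟩
      S * (τY * ℓ) + 3 * (ℓ * ℓ′) ≡⟨ cong (λ i → S * (τY * i) + 3 * (ℓ * ℓ′)) ew ⟨
      S * (τY * (w + ℓ′)) + 3 * (ℓ * ℓ′) ≡⟨ lem₈ S τY w ℓ′ (3 * (ℓ * ℓ′)) ⟩
      S * (τY * w) + (3 * (ℓ * ℓ′) + S * (τY * ℓ′)) ∎)
      where
      lem₇ : ∀ l u m x → 3 * (l * u) + (3 * (l * m) + x) ≡ 3 * (l * (m + u)) + x
      lem₇ = solve-∀
      lem₈ : ∀ S t w l x → S * (t * (w + l)) + x ≡ S * (t * w) + (x + S * (t * l))
      lem₈ = solve-∀
    lem₁ : ∀ n l u → 3 * n * (l + u) ≡ 3 * (n * l + n * u)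
    lem₁ = solve-∀
    lem₂ : ∀ u l → 3 * (u * l + l * u) ≡ 2 * (3 * (l * u))
    lem₂ = solve-∀
    lem₃ : ∀ S t w → 2 * (S * (t * w)) ≡ 2 * (S * w) * t
    lem₃ = solve-∀

-- Products of trinomials over intervals, and symmetric weights

module IntervalProducts where

  open Windows
  open import Data.Bool using (Bool; true; false; _∧_; not; if_then_else_)
  open import Data.Nat as ℕ using (ℕ; zero; suc; _+_; _*_; _≤_; _<_; z≤n; s≤s)
  open import Data.Nat.Properties as ℕ
  open import Data.Nat.Tactic.RingSolver using (solve-∀)
  open import Data.Product using (_,_)
  open import Data.Sum using (inj₁; inj₂)
  open import Data.Empty using (⊥-elim)
  open import Relation.Binary.PropositionalEquality hiding (setoid)
  open import Relation.Nullary using (yes; no)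

  -- Products of (1 + q^k + q^2k) over the k in (a , a + l] with χ k

  triIf : Bool → ℕ → NSer → NSer
  triIf b k f = if b then tri k f else f

  TriP : (ℕ → Bool) → ℕ → ℕ → NSer → NSer
  TriP χ a zero f = f
  TriP χ a (suc l) f = triIf (χ (suc (a + l))) (suc (a + l)) (TriP χ a l f)

  sumP cntP : (ℕ → Bool) → ℕ → ℕ → ℕ
  sumP χ a zero = 0
  sumP χ a (suc l) = sumP χ a l + (if χ (suc (a + l)) then suc (a + l) else 0)
  cntP χ a zero = 0
  cntP χ a (suc l) = cntP χ a l + (if χ (suc (a + l)) then 1 else 0)

  tauP : ℕ → (ℕ → Bool) → ℕ → ℕ → ℕ → ℕ
  tauP d χ a zero τ = τ
  tauP d χ a (suc l) τ = if χ (suc (a + l)) then d * tauP d χ a l τ else tauP d χ a l τ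

  all : ℕ → Bool
  all _ = true

  tauP-≥1 : ∀ d χ a l {τ} → 1 ≤ d → 1 ≤ τ → 1 ≤ tauP d χ a l τ
  tauP-≥1 d χ a zero p q = q
  tauP-≥1 d χ a (suc l) p q with χ (suc (a + l))
  ... | true = *-mono-≤ p (tauP-≥1 d χ a l p q)
  ... | false = tauP-≥1 d χ a l p q

  tauP-^ : ∀ d χ a l τ → tauP d χ a l τ ≡ d ℕ.^ cntP χ a l * τ
  tauP-^ d χ a zero τ = sym (+-identityʳ τ)
  tauP-^ d χ a (suc l) τ with χ (suc (a + l))
  ... | true = trans (cong (d *_) (tauP-^ d χ a l τ)) (trans (sym (*-assoc d _ τ)) (cong (λ c → d ℕ.^ c * τ) (+-comm 1 (cntP χ a l))))
  ... | false = trans (tauP-^ d χ a l τ) (cong (λ c → d ℕ.^ c * τ) (sym (+-identityʳ (cntP χ a l))))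

  triIf-cong : ∀ b k {f g} → f ≗ g → triIf b k f ≗ triIf b k g
  triIf-cong true k e = tri-cong k e
  triIf-cong false k e = e

  triIf-mono : ∀ b k {f g} → f ≼ g → triIf b k f ≼ triIf b k g
  triIf-mono true k e = tri-mono k e
  triIf-mono false k e = e

  TriP-cong : ∀ χ a l {f g} → f ≗ g → TriP χ a l f ≗ TriP χ a l g
  TriP-cong χ a zero e = e
  TriP-cong χ a (suc l) e = triIf-cong (χ (suc (a + l))) (suc (a + l)) (TriP-cong χ a l e)

  TriP-mono : ∀ χ a l {f g} → f ≼ g → TriP χ a l f ≼ TriP χ a l g
  TriP-mono χ a zero e = e
  TriP-mono χ a (suc l) e = triIf-mono (χ (suc (a + l))) (suc (a + l)) (TriP-mono χ a l e)

  tri-comm : ∀ k l f → tri k (tri l f) ≗ tri l (tri k f)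
  tri-comm k l f m = trans (cong₂ (λ x y → tri l f m + x + y) (shN-tri k l f m) (shN-tri (k + k) l f m))
    (trans (lem (f m) (shN l f m) (shN (l + l) f m) (shN k f m) (shN (k + l) f m) (shN (k + (l + l)) f m) (shN (k + k) f m) (shN (k + k + l) f m) (shN (k + k + (l + l)) f m))
    (trans (cong₂ (λ x y → tri k f m + x + y) (cong₂ (λ i j → shN l f m + shN i f m + shN j f m) (+-comm k l) (+-comm (k + k) l))
              (cong₂ (λ i j → shN (l + l) f m + shN i f m + shN j f m) (+-comm k (l + l)) (+-comm (k + k) (l + l))))
    (sym (cong₂ (λ x y → tri k f m + x + y) (shN-tri l k f m) (shN-tri (l + l) k f m)))))
    where
    lem : ∀ a b c d e g h i j → a + b + c + (d + e + g) + (h + i + j) ≡ a + d + h + (b + e + i) + (c + g + j)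
    lem = solve-∀

  triIf-comm : ∀ b k b′ l f → triIf b k (triIf b′ l f) ≗ triIf b′ l (triIf b k f)
  triIf-comm true k true l f = tri-comm k l f
  triIf-comm true k false l f m = refl
  triIf-comm false k true l f m = refl
  triIf-comm false k false l f m = refl

  TriP-triIf : ∀ b k χ a l f → triIf b k (TriP χ a l f) ≗ TriP χ a l (triIf b k f)
  TriP-triIf b k χ a zero f m = refl
  TriP-triIf b k χ a (suc l) f m = trans (triIf-comm b k (χ (suc (a + l))) (suc (a + l)) (TriP χ a l f) m)
    (triIf-cong (χ (suc (a + l))) (suc (a + l)) (TriP-triIf b k χ a l f) m)

  TriP-TriP : ∀ χ a l ψ b k f → TriP χ a l (TriP ψ b k f) ≗ TriP ψ b k (TriP χ a l f)
  TriP-TriP χ a zero ψ b k f m = refl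
  TriP-TriP χ a (suc l) ψ b k f m = trans (triIf-cong (χ (suc (a + l))) (suc (a + l)) (TriP-TriP χ a l ψ b k f) m)
    (TriP-triIf (χ (suc (a + l))) (suc (a + l)) ψ b k (TriP χ a l f) m)

  _∩_ : (ℕ → Bool) → (ℕ → Bool) → ℕ → Bool
  (χ ∩ ψ) k = χ k ∧ ψ k

  ∁ : (ℕ → Bool) → ℕ → Bool
  ∁ χ k = not (χ k)

  TriP-split : ∀ χ ψ a l f → TriP χ a l f ≗ TriP (χ ∩ ψ) a l (TriP (χ ∩ ∁ ψ) a l f)
  TriP-split χ ψ a zero f m = refl
  TriP-split χ ψ a (suc l) f m with χ (suc (a + l)) | ψ (suc (a + l))
  ... | true | true = tri-cong (suc (a + l)) (TriP-split χ ψ a l f) m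
  ... | true | false = trans (tri-cong (suc (a + l)) (TriP-split χ ψ a l f) m) (TriP-triIf true (suc (a + l)) (χ ∩ ψ) a l (TriP (χ ∩ ∁ ψ) a l f) m)
  ... | false | _ = TriP-split χ ψ a l f m

  TriP-++ : ∀ χ a l k f → TriP χ a (l + k) f ≗ TriP χ (a + l) k (TriP χ a l f)
  TriP-++ χ a l zero f m = cong (λ i → TriP χ a i f m) (+-identityʳ l)
  TriP-++ χ a l (suc k) f m = trans (cong (λ i → TriP χ a i f m) (+-suc l k))
    (trans (cong (λ i → triIf (χ (suc i)) (suc i) (TriP χ a (l + k) f) m) (sym (+-assoc a l k)))
      (triIf-cong (χ (suc (a + l + k))) (suc (a + l + k)) (TriP-++ χ a l k f) m))

  TriP-ext : ∀ {χ ψ} a l f → (∀ k → a < k → k ≤ a + l → χ k ≡ ψ k) → TriP χ a l f ≗ TriP ψ a l f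
  TriP-ext a zero f e m = refl
  TriP-ext {χ} {ψ} a (suc l) f e m = trans (cong (λ b → triIf b (suc (a + l)) (TriP χ a l f) m) (e (suc (a + l)) (s≤s (m≤m+n a l)) (≤-reflexive (sym (+-suc a l)))))
    (triIf-cong (ψ (suc (a + l))) (suc (a + l)) (TriP-ext a l f (λ k p q → e k p (≤-trans q (+-monoʳ-≤ a (n≤1+n l))))) m)

  cum-TriP : ∀ χ a l f → cum (TriP χ a l f) ≗ TriP χ a l (cum f)
  cum-TriP χ a zero f m = refl
  cum-TriP χ a (suc l) f m with χ (suc (a + l))
  ... | true = trans (cum-tri (suc (a + l)) (TriP χ a l f) m) (tri-cong (suc (a + l)) (cum-TriP χ a l f) m)
  ... | false = cum-TriP χ a l f m

  TriP-≼ : ∀ χ a l f → f ≼ TriP χ a l f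
  TriP-≼ χ a zero f m = ≤-refl
  TriP-≼ χ a (suc l) f m with χ (suc (a + l))
  ... | true = ≤-trans (TriP-≼ χ a l f m) (≤-trans (m≤m+n _ _) (m≤m+n _ _))
  ... | false = TriP-≼ χ a l f m

  shN-TriP : ∀ j χ a l f → shN j (TriP χ a l f) ≗ TriP χ a l (shN j f)
  shN-TriP j χ a zero f m = refl
  shN-TriP j χ a (suc l) f m with χ (suc (a + l))
  ... | true = trans (sh-tri j (suc (a + l)) (TriP χ a l f) m) (tri-cong (suc (a + l)) (shN-TriP j χ a l f) m)
    where
    sh-tri : ∀ j k f m → shN j (tri k f) m ≡ tri k (shN j f) m
    sh-tri j k f m = trans (shN-tri j k f m) (cong₂ (λ x y → shN j f m + x + y)
      (trans (cong (λ i → shN i f m) (+-comm j k)) (sym (shN-shN k j f m))) (trans (cong (λ i → shN i f m) (+-comm j (k + k))) (sym (shN-shN (k + k) j f m))))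
  ... | false = shN-TriP j χ a l f m

  sumP-++ : ∀ χ a l k → sumP χ a (l + k) ≡ sumP χ a l + sumP χ (a + l) k
  sumP-++ χ a l zero = trans (cong (sumP χ a) (+-identityʳ l)) (sym (+-identityʳ _))
  sumP-++ χ a l (suc k) = trans (cong (sumP χ a) (+-suc l k)) (trans (cong₂ _+_ (sumP-++ χ a l k) (cong (λ i → if χ (suc i) then suc i else 0) (sym (+-assoc a l k)))) (+-assoc (sumP χ a l) _ _))

  sumP-split : ∀ χ ψ a l → sumP χ a l ≡ sumP (χ ∩ ψ) a l + sumP (χ ∩ ∁ ψ) a l
  sumP-split χ ψ a zero = refl
  sumP-split χ ψ a (suc l) with χ (suc (a + l)) | ψ (suc (a + l))
  ... | true | true = trans (cong (_+ suc (a + l)) (sumP-split χ ψ a l)) (lem (sumP (χ ∩ ψ) a l) (sumP (χ ∩ ∁ ψ) a l) (suc (a + l)))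
    where
    lem : ∀ x y z → x + y + z ≡ x + z + (y + 0)
    lem = solve-∀
  ... | true | false = trans (cong (_+ suc (a + l)) (sumP-split χ ψ a l)) (lem (sumP (χ ∩ ψ) a l) (sumP (χ ∩ ∁ ψ) a l) (suc (a + l)))
    where
    lem : ∀ x y z → x + y + z ≡ x + 0 + (y + z)
    lem = solve-∀
  ... | false | _ = trans (+-identityʳ _) (trans (sumP-split χ ψ a l) (cong₂ _+_ (sym (+-identityʳ (sumP (χ ∩ ψ) a l))) (sym (+-identityʳ (sumP (χ ∩ ∁ ψ) a l)))))

  sumP-ext : ∀ {χ ψ} a l → (∀ k → a < k → k ≤ a + l → χ k ≡ ψ k) → sumP χ a l ≡ sumP ψ a l
  sumP-ext a zero e = refl
  sumP-ext a (suc l) e = cong₂ _+_ (sumP-ext a l (λ k p q → e k p (≤-trans q (+-monoʳ-≤ a (n≤1+n l)))))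
    (cong (λ b → if b then suc (a + l) else 0) (e (suc (a + l)) (s≤s (m≤m+n a l)) (≤-reflexive (sym (+-suc a l)))))

  castSpread : ∀ {M S S′ τ c} → S ≡ S′ → Spread M S τ c → Spread M S′ τ c
  castSpread refl x = x

  castBelow : ∀ {N a a′ b b′ τX τY cX cY} → a ≡ a′ → b ≡ b′ → Below N a b τX τY cX cY → Below N a′ b′ τX τY cX cY
  castBelow refl refl x = x

  spread-TriP : ∀ {M S τ c} χ a l → (∀ k → a < k → k ≤ a + l → χ k ≡ true → k + k ≤ M) → Spread M S τ c →
    Spread M (cntP χ a l + cntP χ a l + S) (tauP 3 χ a l τ) (TriP χ a l c)
  spread-TriP χ a zero p sp = sp
  spread-TriP {M} {S} {τ} {c} χ a (suc l) p sp with χ (suc (a + l)) in eq | spread-TriP χ a l (λ k x y → p k x (≤-trans y (+-monoʳ-≤ a (n≤1+n l)))) sp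
  ... | true | sp′ = castSpread (lem (cntP χ a l) S) (spread-tri (suc (a + l)) (p (suc (a + l)) (s≤s (m≤m+n a l)) (≤-reflexive (sym (+-suc a l))) eq) sp′)
    where
    lem : ∀ c S → 2 + (c + c + S) ≡ c + 1 + (c + 1) + S
    lem = solve-∀
  ... | false | sp′ = castSpread (lem (cntP χ a l) S) sp′
    where
    lem : ∀ c S → c + c + S ≡ c + 0 + (c + 0) + S
    lem = solve-∀

  ≤τ-TriP : ∀ χ a l {c τ} → (∀ m → c m ≤ τ) → ∀ m → TriP χ a l c m ≤ tauP 3 χ a l τ
  ≤τ-TriP χ a zero p = p
  ≤τ-TriP χ a (suc l) {c} {τ} p m with χ (suc (a + l))
  ... | false = ≤τ-TriP χ a l p m
  ... | true = ≤-trans (+-mono-≤ (+-mono-≤ (ih m) (sh (suc (a + l)) m)) (sh (suc (a + l) + suc (a + l)) m)) (≤-reflexive (lem (tauP 3 χ a l τ)))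
    where
    ih = ≤τ-TriP χ a l p
    sh : ∀ k m → shN k (TriP χ a l c) m ≤ tauP 3 χ a l τ
    sh zero m = ih m
    sh (suc k) zero = z≤n
    sh (suc k) (suc m) = sh k m
    lem : ∀ τ → τ + τ + τ ≡ 3 * τ
    lem = solve-∀

  Mono-TriP : ∀ χ a l {c} → Mono c → Mono (TriP χ a l c)
  Mono-TriP χ a zero p = p
  Mono-TriP χ a (suc l) p with χ (suc (a + l))
  ... | true = tri-Mono (suc (a + l)) (Mono-TriP χ a l p)
  ... | false = Mono-TriP χ a l p

  below-TriP : ∀ {N a b τX τY cX cY} χ o l → (∀ m → cY m ≤ τY) → Below N a b τX τY cX cY →
    Below N a (b + (sumP χ o l + sumP χ o l)) τX (tauP 3 χ o l τY) cX (TriP χ o l cY)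
  below-TriP {b = b} χ o zero ≤τ bl = castBelow refl (sym (+-identityʳ b)) bl
  below-TriP {b = b} χ o (suc l) ≤τ bl with χ (suc (o + l)) | below-TriP χ o l ≤τ bl
  ... | true | bl′ = castBelow refl (lem b (sumP χ o l) (suc (o + l))) (below-tri (suc (o + l)) (≤τ-TriP χ o l ≤τ) bl′)
    where
    lem : ∀ b s k → b + (s + s) + (k + k) ≡ b + (s + k + (s + k))
    lem = solve-∀
  ... | false | bl′ = castBelow refl (lem b (sumP χ o l)) bl′
    where
    lem : ∀ b s → b + (s + s) ≡ b + (s + 0 + (s + 0))
    lem = solve-∀

  -- The product of 1 + Q^i over o < i ≤ o + l: the factors 1 - Q^i of a summand after their signs
  -- are dropped.
  Bit3 : ℕ → ℕ → NSer → NSer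
  Bit3 o zero f = f
  Bit3 o (suc l) f = bit (3 * suc (o + l)) (Bit3 o l f)

  sum3 : ℕ → ℕ → ℕ
  sum3 o zero = 0
  sum3 o (suc l) = sum3 o l + 3 * suc (o + l)

  cum-Bit3 : ∀ o l f → cum (Bit3 o l f) ≗ Bit3 o l (cum f)
  cum-Bit3 o zero f m = refl
  cum-Bit3 o (suc l) f m = trans (cum-bit (3 * suc (o + l)) (Bit3 o l f) m) (bit-cong (3 * suc (o + l)) (cum-Bit3 o l f) m)

  -- The largest index k + l of a trinomial is at most the smallest exponent 3(o + 1), so the l
  -- factors on either side can be paired in order.
  below-pair3 : ∀ {N a b τX τY cX cY} o k l → k + l ≤ 3 * suc o → Mono cY → (∀ m → cY m ≤ τY) → Below N a b τX τY cX cY →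
    Below N (a + sum3 o l) (b + (sumP all k l + sumP all k l)) (tauP 2 all k l τX) (tauP 3 all k l τY) (Bit3 o l cX) (TriP all k l cY)
  below-pair3 {a = a} {b} o k zero p mono ≤τ bl = castBelow (sym (+-identityʳ a)) (sym (+-identityʳ b)) bl
  below-pair3 {a = a} {b} o k (suc l) p mono ≤τ bl = castBelow (+-assoc a (sum3 o l) (3 * suc (o + l))) (lem b (sumP all k l) (suc (k + l)))
        (below-pair (3 * suc (o + l)) (suc (k + l)) (≤-trans (≤-trans (≤-reflexive (sym (+-suc k l))) p) (*-monoʳ-≤ 3 (s≤s (m≤m+n o l)))) (Mono-TriP all k l mono) (≤τ-TriP all k l ≤τ)
          (below-pair3 o k l (≤-trans (+-monoʳ-≤ k (n≤1+n l)) p) mono ≤τ bl))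
    where
    lem : ∀ b s k → b + (s + s) + (k + k) ≡ b + (s + k + (s + k))
    lem = solve-∀

  -- Partial sums of weights that are symmetric under x ↦ D - x: the weights up to x mirror those
  -- from D - x = y + 1 on. D is the least plus the greatest weight.
  record Palin (D τ : ℕ) (c : NSer) : Set where
    field
      sym-sum : ∀ x y → x + y + 1 ≡ D → c x + c y ≡ τ
      full : ∀ x → D ≤ x → c x ≡ τ

  castPalin : ∀ {D D′ τ c} → D ≡ D′ → Palin D τ c → Palin D′ τ c
  castPalin refl x = x

  private
    palin-sh : ∀ {D τ c} → Palin D τ c → ∀ i j x y → x + y + 1 ≡ D + (i + j) → shN i c x + shN j c y ≡ τ
    palin-sh {D} {τ} {c} pl i j x y e with shN-case i c x | shN-case j c y
    ... | inj₁ (x<i , ex) | inj₁ (y<j , ey) = contra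
      where
      contra = ⊥-elim (<-irrefl e (≤-<-trans (≤-reflexive (lem x y)) (<-≤-trans (+-mono-<-≤ x<i y<j) (m≤n+m (i + j) D))))
        where
        lem : ∀ x y → x + y + 1 ≡ x + suc y
        lem = solve-∀
    ... | inj₁ (x<i , ex) | inj₂ (y′ , refl , ey) = trans (cong₂ _+_ ex ey) (Palin.full pl y′ (+-cancelˡ-≤ (i + j) D y′ (≤-trans (≤-reflexive (trans (+-comm (i + j) D) (sym e))) (≤-trans (≤-reflexive (lem x j y′)) (+-monoˡ-≤ y′ (+-monoˡ-≤ j x<i))))))
      where
      lem : ∀ x j y → x + (j + y) + 1 ≡ suc x + j + y
      lem = solve-∀
    ... | inj₂ (x′ , refl , ex) | inj₁ (y<j , ey) = trans (cong₂ _+_ ex ey) (trans (+-identityʳ _) (Palin.full pl x′ (+-cancelˡ-≤ (i + j) D x′ (≤-trans (≤-reflexive (trans (+-comm (i + j) D) (sym e))) (≤-trans (≤-reflexive (lem i x′ y)) (+-monoˡ-≤ x′ (+-monoʳ-≤ i y<j)))))))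
      where
      lem : ∀ i x y → i + x + y + 1 ≡ i + suc y + x
      lem = solve-∀
    ... | inj₂ (x′ , refl , ex) | inj₂ (y′ , refl , ey) = trans (cong₂ _+_ ex ey) (Palin.sym-sum pl x′ y′ (+-cancelʳ-≡ (i + j) _ _ (trans (lem i x′ j y′) e)))
      where
      lem : ∀ i x j y → x + y + 1 + (i + j) ≡ i + x + (j + y) + 1
      lem = solve-∀

  palin-tri : ∀ {D τ c} k → Palin D τ c → Palin (D + (k + k)) (3 * τ) (tri k c)
  palin-tri {D} {τ} {c} k pl = record
    { sym-sum = λ x y e → trans (lem (c x) (shN k c x) (shN (k + k) c x) (c y) (shN k c y) (shN (k + k) c y))
        (trans (cong₂ _+_ (cong₂ _+_ (palin-sh pl 0 (k + k) x y e) (palin-sh pl k k x y e)) (palin-sh pl (k + k) 0 x y (trans e (cong (D +_) (sym (+-identityʳ (k + k))))))) (lem₂ τ))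
    ; full = λ x p → trans (cong₂ _+_ (cong₂ _+_ (Palin.full pl x (≤-trans (m≤m+n D (k + k)) p)) (f k x (≤-trans (+-monoʳ-≤ D (m≤m+n k k)) p))) (f (k + k) x p)) (lem₂ τ) }
    where
    lem : ∀ a b c d e f → a + b + c + (d + e + f) ≡ (a + f) + (b + e) + (c + d)
    lem = solve-∀
    lem₂ : ∀ τ → τ + τ + τ ≡ 3 * τ
    lem₂ = solve-∀
    f : ∀ j x → D + j ≤ x → shN j c x ≡ τ
    f j x p with shN-case j c x
    ... | inj₂ (i , refl , e) = trans e (Palin.full pl i (+-cancelˡ-≤ j D i (≤-trans (≤-reflexive (+-comm j D)) p)))
    ... | inj₁ (x<j , _) = ⊥-elim (<-irrefl refl (<-≤-trans x<j (≤-trans (m≤n+m j D) p)))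

  palin-TriP : ∀ {D τ c} χ a l → Palin D τ c → Palin (D + (sumP χ a l + sumP χ a l)) (tauP 3 χ a l τ) (TriP χ a l c)
  palin-TriP {D} χ a zero pl = castPalin (sym (+-identityʳ D)) pl
  palin-TriP {D} χ a (suc l) pl with χ (suc (a + l)) | palin-TriP χ a l pl
  ... | true | pl′ = castPalin (lem D (sumP χ a l) (suc (a + l))) (palin-tri (suc (a + l)) pl′)
    where
    lem : ∀ b s k → b + (s + s) + (k + k) ≡ b + (s + k + (s + k))
    lem = solve-∀
  ... | false | pl′ = castPalin (lem D (sumP χ a l)) pl′
    where
    lem : ∀ b s → b + (s + s) ≡ b + (s + 0 + (s + 0))
    lem = solve-∀

  -- X has no mass before lo, and there Y already offers N τX choices. At the upper end the symmetry
  -- of Y provides equally many choices of weight at least D - lo.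
  below-base : ∀ {N D τX τY cX cY lo hi} → Mono cY → (∀ m → cY m ≤ τY) → Palin D τY cY →
    (∀ m → m < lo → cX m ≡ 0) → (∀ m → cX m ≤ τX) → (∀ m → hi ≤ m → cX m ≡ τX) → N * τX ≤ cY lo →
    Below N hi (D ℕ.∸ lo) τX τY cX cY
  below-base {N} {D} {τX} {τY} {cX} {cY} {lo} {hi} mono ≤τ pl z ≤τX f Nτ = record
    { total = ≤-trans Nτ (≤τ lo) ; lower = low ; upper = up }
    where
    low : ∀ u → N * cX u ≤ cY u
    low u with u ℕ.<? lo
    ... | yes p = ≤-trans (≤-reflexive (trans (cong (N *_) (z u p)) (*-zeroʳ N))) z≤n
    ... | no p = ≤-trans (*-monoʳ-≤ N (≤τX u)) (≤-trans Nτ (mono (≮⇒≥ p)))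
    up : ∀ u → N * τX + shN hi cY u ≤ τY + N * shN (D ℕ.∸ lo) cX u
    up u with shN-case hi cY u
    ... | inj₁ (_ , e) = ≤-trans (≤-reflexive (trans (cong (N * τX +_) e) (+-identityʳ _))) (≤-trans (≤-trans Nτ (≤τ lo)) (m≤m+n τY _))
    ... | inj₂ (x , refl , e) with x ℕ.<? D ℕ.∸ lo
    ...   | yes p = ≤-trans (≤-reflexive (cong (N * τX +_) e)) (≤-trans (+-monoˡ-≤ (cY x) (≤-trans Nτ (mono lo≤y)))
              (≤-trans (≤-reflexive (trans (+-comm (cY y) (cY x)) (Palin.sym-sum pl x y xy))) (m≤m+n τY _)))
      where
      lo≤D : lo ≤ D
      lo≤D with ≤-total lo D
      ... | inj₁ q = q
      ... | inj₂ q = ⊥-elim (n≮0 (subst (x <_) (m≤n⇒m∸n≡0 q) p))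
      y = D ℕ.∸ lo ℕ.∸ suc x + lo
      xy : x + y + 1 ≡ D
      xy = trans (lem x (D ℕ.∸ lo ℕ.∸ suc x) lo) (trans (cong (_+ lo) (m+[n∸m]≡n p)) (m∸n+n≡m lo≤D))
        where
        lem : ∀ x w l → x + (w + l) + 1 ≡ suc x + w + l
        lem = solve-∀
      lo≤y : lo ≤ y
      lo≤y = m≤n+m lo _
    ...   | no p = ≤-trans (≤-reflexive (cong (N * τX +_) e)) (≤-trans (≤-reflexive (+-comm (N * τX) (cY x))) (+-mono-≤ (≤τ x) (≤-reflexive (cong (N *_) (sym fullX)))))
      where
      fullX : shN (D ℕ.∸ lo) cX (hi + x) ≡ τX
      fullX = trans (cong (shN (D ℕ.∸ lo) cX) eq) (trans (shN-≥ (D ℕ.∸ lo) cX _) (f _ (m≤m+n hi _)))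
        where
        eq : hi + x ≡ D ℕ.∸ lo + (hi + (x ℕ.∸ (D ℕ.∸ lo)))
        eq = trans (cong (hi +_) (sym (m+[n∸m]≡n (≮⇒≥ p)))) (lem hi (D ℕ.∸ lo) _)
          where
          lem : ∀ a b c → a + (b + c) ≡ b + (a + c)
          lem = solve-∀

-- Boxes and the window covered by the reserved indices

module Boxes where

  open Windows
  open IntervalProducts
  open import Data.Bool using (Bool; true; false; _∨_; if_then_else_; T)
  open import Data.Nat as ℕ using (ℕ; zero; suc; _+_; _*_; _≤_; _<_; z≤n; s≤s; _≡ᵇ_)
  open import Data.Nat.Properties as ℕ
  open import Data.Nat.Tactic.RingSolver using (solve-∀)
  open import Data.Product using (_,_)
  open import Data.Unit using (tt)
  open import Relation.Binary.PropositionalEquality hiding (setoid)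

  -- Multiplication by 1 + q + ... + q^(M-1); its coefficients are sums over windows of length M.
  box : ℕ → NSer → NSer
  box zero f m = 0
  box (suc M) f m = box M f m + shN M f m

  cum-step : ∀ f m → f m + shN 1 (cum f) m ≡ cum f m
  cum-step f zero = +-identityʳ (f 0)
  cum-step f (suc m) = +-comm (f (suc m)) (cum f m)

  box-cum : ∀ M f p → box M f p + shN M (cum f) p ≡ cum f p
  box-cum zero f p = refl
  box-cum (suc M) f p = begin
    box M f p + shN M f p + shN (suc M) (cum f) p ≡⟨ +-assoc (box M f p) _ _ ⟩
    box M f p + (shN M f p + shN (suc M) (cum f) p) ≡⟨ cong (box M f p +_) e ⟩
    box M f p + shN M (cum f) p ≡⟨ box-cum M f p ⟩
    cum f p ∎
    where
    open ≡-Reasoning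
    e : shN M f p + shN (suc M) (cum f) p ≡ shN M (cum f) p
    e = trans (cong (shN M f p +_) (trans (cong (λ i → shN i (cum f) p) (+-comm 1 M)) (sym (shN-shN M 1 (cum f) p))))
      (trans (sym (shN-+ M f (shN 1 (cum f)) p)) (shN-cong M (cum-step f) p))

  shN-zero : ∀ k m → shN k (λ _ → 0) m ≡ 0
  shN-zero zero m = refl
  shN-zero (suc k) zero = refl
  shN-zero (suc k) (suc m) = shN-zero k m

  box-+ : ∀ M N f m → box (M + N) f m ≡ box M f m + shN M (box N f) m
  box-+ M zero f m = trans (cong (λ i → box i f m) (+-identityʳ M)) (sym (trans (cong (box M f m +_) (shN-zero M m)) (+-identityʳ _)))
  box-+ M (suc N) f m = trans (cong (λ i → box i f m) (+-suc M N)) (trans (cong₂ _+_ (box-+ M N f m) (sym (shN-shN M N f m)))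
    (trans (+-assoc (box M f m) _ _) (cong (box M f m +_) (sym (shN-+ M (box N f) (shN N f) m)))))

  box-mono : ∀ {M N} f → M ≤ N → box M f ≼ box N f
  box-mono {M} {N} f p m = subst (λ i → box M f m ≤ box i f m) (m+[n∸m]≡n p) (≤-trans (m≤m+n _ _) (≤-reflexive (sym (box-+ M (N ℕ.∸ M) f m))))

  box-2k : ∀ B k f m → box (B + (k + k)) f m ≡ box k f m + shN k (box k f) m + shN (k + k) (box B f) m
  box-2k B k f m = trans (cong (λ i → box i f m) (+-comm B (k + k))) (trans (box-+ (k + k) B f m) (cong (_+ shN (k + k) (box B f) m) (box-+ k k f m)))

  -- For B ≤ k the three translates of the box do not overlap.
  box-tri-≤ : ∀ {B k} f → B ≤ k → tri k (box B f) ≼ box (B + (k + k)) f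
  box-tri-≤ {B} {k} f p m = ≤-trans (+-monoˡ-≤ _ (+-mono-≤ (box-mono f p m) (shN-mono k (box-mono f p) m))) (≤-reflexive (sym (box-2k B k f m)))

  -- For k ≤ L the three translates leave no gap.
  box-tri-≥ : ∀ {L k} f → k ≤ L → box (L + (k + k)) f ≼ tri k (box L f)
  box-tri-≥ {L} {k} f p m = ≤-trans (≤-reflexive (box-2k L k f m)) (+-monoˡ-≤ _ (+-mono-≤ (box-mono f p m) (shN-mono k (box-mono f p) m)))

  -- np m is the least power of 3 that exceeds m and is at least 3.

  np-next : ℕ → ℕ → ℕ
  np-next k x = if k ≡ᵇ x then 3 * x else x

  np : ℕ → ℕ
  np zero = 3
  np (suc m) = np-next (suc m) (np m)

  p3 : ℕ → Bool
  p3 zero = false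
  p3 (suc m) = suc m ≡ᵇ np m

  ≡ᵇ-sound : ∀ m n → (m ≡ᵇ n) ≡ true → m ≡ n
  ≡ᵇ-sound m n e = ≡ᵇ⇒≡ m n (subst T (sym e) tt)

  ≡ᵇ-false : ∀ m n → (m ≡ᵇ n) ≡ false → m ≢ n
  ≡ᵇ-false m n e p = subst T e (≡⇒≡ᵇ m n p)

  <np : ∀ m → m < np m
  <np zero = s≤s z≤n
  <np (suc m) with suc m ≡ᵇ np m in e
  ... | true = subst (λ i → suc m < 3 * i) (≡ᵇ-sound (suc m) (np m) e) (m<m+n (suc m) {suc m + (suc m + 0)} (s≤s z≤n))
  ... | false = ≤∧≢⇒< (<np m) (≡ᵇ-false (suc m) (np m) e)

  -- The geometric sum 2(3 + 9 + ... + 3^i) + 3 = 3^(i+1), which explains the lower limit 3 of `np`.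
  np-sum : ∀ m → sumP p3 0 m + sumP p3 0 m + 3 ≡ np m
  np-sum zero = refl
  np-sum (suc m) with suc m ≡ᵇ np m in e
  ... | true = trans (lem (sumP p3 0 m) (suc m)) (trans (cong₂ (λ a b → a + (b + b)) (np-sum m) (≡ᵇ-sound (suc m) (np m) e)) (lem₂ (np m)))
    where
    lem : ∀ s k → s + k + (s + k) + 3 ≡ s + s + 3 + (k + k)
    lem = solve-∀
    lem₂ : ∀ n → n + (n + n) ≡ 3 * n
    lem₂ = solve-∀
  ... | false = trans (lem (sumP p3 0 m)) (np-sum m)
    where
    lem : ∀ s → s + 0 + (s + 0) + 3 ≡ s + s + 3
    lem = solve-∀

  -- Base-3 expansions are unique, so the product has coefficients 0 and 1.
  pow3-box : ∀ a l f → TriP p3 a l f ≼ box (suc (sumP p3 a l + sumP p3 a l)) f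
  pow3-box a zero f m = ≤-refl
  pow3-box a (suc l) f m with p3 (suc (a + l)) in e
  ... | true = ≤-trans (tri-mono (suc (a + l)) (pow3-box a l f) m) (≤-trans (box-tri-≤ f B≤ m) (≤-reflexive (cong (λ i → box i f m) (lem (sumP p3 a l) (suc (a + l))))))
    where
    lem : ∀ s k → suc (s + s) + (k + k) ≡ suc (s + k + (s + k))
    lem = solve-∀
    s≤ : sumP p3 a l ≤ sumP p3 0 (a + l)
    s≤ = ≤-trans (m≤n+m _ (sumP p3 0 a)) (≤-reflexive (sym (sumP-++ p3 0 a l)))
    B≤ : suc (sumP p3 a l + sumP p3 a l) ≤ suc (a + l)
    B≤ = ≤-trans (s≤s (+-mono-≤ s≤ s≤)) (≤-trans (≤-trans (≤-trans (≤-reflexive (+-comm 1 _)) (+-monoʳ-≤ _ (s≤s z≤n))) (≤-reflexive (np-sum (a + l)))) (≤-reflexive (sym (≡ᵇ-sound (suc (a + l)) (np (a + l)) e))))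
  ... | false = ≤-trans (pow3-box a l f m) (≤-reflexive (cong (λ i → box i f m) (lem (sumP p3 a l))))
    where
    lem : ∀ s → suc (s + s) ≡ suc (s + 0 + (s + 0))
    lem = solve-∀

  -- The reserved indices: their product reaches every exponent from 2 on.
  rsv : ℕ → Bool
  rsv k = (k ≡ᵇ 2) ∨ (k ≡ᵇ 4) ∨ p3 k

  private
    -- The trinomials of index 2, 3, 4 reach every exponent from 2 to 16 but miss 1 and 17. This is
    -- the origin of the shift by 2 and of the length 15 = `np 4` + 6.
    base : ∀ f m → shN 2 (box 15 f) m ≤ tri 4 (tri 3 (tri 2 f)) m
    base f m = ≤-trans (≤-reflexive lhs) (≤-trans (≤-trans (m≤m+n _ _) (≤-reflexive (key (x 0) (x 2) (x 3) (x 4) (x 5) (x 6) (x 7) (x 8) (x 9) (x 10) (x 11) (x 12) (x 13) (x 14) (x 15) (x 16) (x 18)))) (≤-reflexive (sym rhs)))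
      where
      x : ℕ → ℕ
      x k = shN k f m
      s = shN-shN 2
      lhs : shN 2 (box 15 f) m ≡ 0 + x 2 + x 3 + x 4 + x 5 + x 6 + x 7 + x 8 + x 9 + x 10 + x 11 + x 12 + x 13 + x 14 + x 15 + x 16
      lhs = go 15
        where
        sumx : ℕ → ℕ
        sumx zero = 0
        sumx (suc k) = sumx k + x (2 + k)
        go : ∀ k → shN 2 (box k f) m ≡ sumx k
        go zero = shN-zero 2 m
        go (suc k) = trans (shN-+ 2 (box k f) (shN k f) m) (cong₂ _+_ (go k) (shN-shN 2 k f m))
      t2 : ∀ j → shN j (tri 2 f) m ≡ x j + x (j + 2) + x (j + 4)
      t2 j = shN-tri j 2 f m
      t3 : ∀ j → shN j (tri 3 (tri 2 f)) m ≡ (x j + x (j + 2) + x (j + 4)) + (x (j + 3) + x (j + 3 + 2) + x (j + 3 + 4)) + (x (j + 6) + x (j + 6 + 2) + x (j + 6 + 4))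
      t3 j = trans (shN-tri j 3 (tri 2 f) m) (cong₂ _+_ (cong₂ _+_ (t2 j) (t2 (j + 3))) (t2 (j + 6)))
      rhs : tri 4 (tri 3 (tri 2 f)) m ≡ ((x 0 + x 2 + x 4) + (x 3 + x 5 + x 7) + (x 6 + x 8 + x 10)) + ((x 4 + x 6 + x 8) + (x 7 + x 9 + x 11) + (x 10 + x 12 + x 14)) + ((x 8 + x 10 + x 12) + (x 11 + x 13 + x 15) + (x 14 + x 16 + x 18))
      rhs = cong₂ _+_ (cong₂ _+_ (t3 0) (t3 4)) (t3 8)
      key : ∀ a0 a2 a3 a4 a5 a6 a7 a8 a9 a10 a11 a12 a13 a14 a15 a16 a18 →
        0 + a2 + a3 + a4 + a5 + a6 + a7 + a8 + a9 + a10 + a11 + a12 + a13 + a14 + a15 + a16 + (a0 + a4 + a6 + a7 + a8 + a8 + a10 + a10 + a11 + a12 + a14 + a18)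
        ≡ ((a0 + a2 + a4) + (a3 + a5 + a7) + (a6 + a8 + a10)) + ((a4 + a6 + a8) + (a7 + a9 + a11) + (a10 + a12 + a14)) + ((a8 + a10 + a12) + (a11 + a13 + a15) + (a14 + a16 + a18))
      key = solve-∀

  shN-tri′ : ∀ j k f m → shN j (tri k f) m ≡ tri k (shN j f) m
  shN-tri′ j k f m = trans (shN-tri j k f m) (cong₂ (λ x y → shN j f m + x + y)
    (trans (cong (λ i → shN i f m) (+-comm j k)) (sym (shN-shN k j f m))) (trans (cong (λ i → shN i f m) (+-comm j (k + k))) (sym (shN-shN (k + k) j f m))))

  cover-tri : ∀ {L k f g} → k ≤ L → shN 2 (box L f) ≼ g → shN 2 (box (L + (k + k)) f) ≼ tri k g
  cover-tri {L} {k} {f} p h m = ≤-trans (shN-mono 2 (box-tri-≥ f p) m) (≤-trans (≤-reflexive (shN-tri′ 2 k (box L f) m)) (tri-mono k h m))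

  -- A new power of 3 is equal to the current `np`, hence within the window length reached so far,
  -- and no gap can arise.
  rsv-cover : ∀ f l → shN 2 (box (np (4 + l) + 6) f) ≼ TriP rsv 0 (4 + l) f
  rsv-cover f zero m = base f m
  rsv-cover f (suc l) m with 5 + l ≡ᵇ np (4 + l) in e
  ... | true = ≤-trans (≤-reflexive (cong (λ i → shN 2 (box i f) m) (trans (lem (np (4 + l))) (cong (λ k → np (4 + l) + 6 + (k + k)) (sym (≡ᵇ-sound (5 + l) (np (4 + l)) e))))))
      (cover-tri (≤-trans (≤-reflexive (≡ᵇ-sound (5 + l) (np (4 + l)) e)) (m≤m+n _ 6)) (rsv-cover f l) m)
    where
    lem : ∀ n → 3 * n + 6 ≡ n + 6 + (n + n)
    lem = solve-∀
  ... | false = rsv-cover f l m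

  rsv-sum : ∀ l → sumP rsv 0 (4 + l) ≡ 6 + sumP p3 0 (4 + l)
  rsv-sum zero = refl
  rsv-sum (suc l) = cong (_+ (if p3 (5 + l) then 5 + l else 0)) (rsv-sum l)

-- Comparison with the dominant summand when 6j + 2 ≤ n

module FarSummands where

  open Windows
  open IntervalProducts
  open Boxes
  open import Data.Bool using (Bool; true; false)
  open import Data.Empty using (⊥-elim)
  open import Data.Nat as ℕ using (ℕ; zero; suc; _+_; _*_; _≤_; _<_; z≤n; s≤s)
  open import Data.Nat.Properties as ℕ
  open import Data.Nat.Tactic.RingSolver using (solve-∀)
  open import Data.Product using (Σ; _×_; _,_; proj₁; proj₂)
  open import Data.Sum using (_⊎_; inj₁; inj₂)
  open import Relation.Binary.PropositionalEquality hiding (setoid)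

  δ : NSer
  δ zero = 1
  δ (suc _) = 0

  -- The dominant summand (1 + q^n + q^(n+1)) ∏_{2 ≤ k < n} (1 + q^k + q^2k)

  lead : ℕ → NSer
  lead n m = δ m + shN n δ m + shN (suc n) δ m

  T₀ : ℕ → NSer
  T₀ n = TriP all 1 (n ℕ.∸ 2) (lead n)

  sumP-all : ∀ a l → sumP all a l + sumP all a l ≡ l * (a + a + l + 1)
  sumP-all a zero = refl
  sumP-all a (suc l) = trans (lem (sumP all a l) a l) (trans (cong (_+ (suc (a + l) + suc (a + l))) (sumP-all a l)) (lem₂ a l))
    where
    lem : ∀ s a l → s + suc (a + l) + (s + suc (a + l)) ≡ s + s + (suc (a + l) + suc (a + l))
    lem = solve-∀
    lem₂ : ∀ a l → l * (a + a + l + 1) + (suc (a + l) + suc (a + l)) ≡ suc l * (a + a + suc l + 1)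
    lem₂ = solve-∀

  sum3-closed : ∀ o l → 2 * sum3 o l ≡ 3 * (l * (o + o + l + 1))
  sum3-closed o zero = refl
  sum3-closed o (suc l) = trans (*-distribˡ-+ 2 (sum3 o l) (3 * suc (o + l))) (trans (cong (_+ 2 * (3 * suc (o + l))) (sum3-closed o l)) (lem o l))
    where
    lem : ∀ o l → 3 * (l * (o + o + l + 1)) + 2 * (3 * suc (o + l)) ≡ 3 * (suc l * (o + o + suc l + 1))
    lem = solve-∀

  cntP-≤ : ∀ χ a l → cntP χ a l ≤ l
  cntP-≤ χ a zero = z≤n
  cntP-≤ χ a (suc l) with χ (suc (a + l))
  ... | true = ≤-trans (+-monoˡ-≤ 1 (cntP-≤ χ a l)) (≤-reflexive (+-comm l 1))
  ... | false = ≤-trans (≤-reflexive (+-identityʳ _)) (≤-trans (cntP-≤ χ a l) (n≤1+n l))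

  TriP-scale : ∀ χ a l d f m → TriP χ a l (λ i → d * f i) m ≡ d * TriP χ a l f m
  TriP-scale χ a zero d f m = refl
  TriP-scale χ a (suc l) d f m with χ (suc (a + l))
  ... | false = TriP-scale χ a l d f m
  ... | true = trans (cong₂ _+_ (cong₂ _+_ (TriP-scale χ a l d f m) (sh (suc (a + l)) m)) (sh (suc (a + l) + suc (a + l)) m))
      (lem d (TriP χ a l f m) (shN (suc (a + l)) (TriP χ a l f) m) (shN (suc (a + l) + suc (a + l)) (TriP χ a l f) m))
    where
    sh : ∀ k m → shN k (TriP χ a l (λ i → d * f i)) m ≡ d * shN k (TriP χ a l f) m
    sh zero m = TriP-scale χ a l d f m
    sh (suc k) zero = sym (*-zeroʳ d)
    sh (suc k) (suc m) = sh k m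
    lem : ∀ d x y z → d * x + d * y + d * z ≡ d * (x + y + z)
    lem = solve-∀

  TriP-ratio : ∀ χ a l c d {f g} → (∀ m → c * f m ≤ d * g m) → ∀ m → c * TriP χ a l f m ≤ d * TriP χ a l g m
  TriP-ratio χ a l c d {f} {g} p m = subst₂ _≤_ (TriP-scale χ a l c f m) (TriP-scale χ a l d g m) (TriP-mono χ a l p m)

  box-sh : ∀ M j f m → box M (shN j f) m ≡ shN j (box M f) m
  box-sh zero j f m = sym (shN-zero j m)
  box-sh (suc M) j f m = trans (cong₂ _+_ (box-sh M j f m) (trans (shN-shN M j f m) (trans (cong (λ i → shN i f m) (+-comm M j)) (sym (shN-shN j M f m))))) (sym (shN-+ j (box M f) (shN M f) m))

  -- Weights between lo and hi of total τ, phrased through partial sums because the tail comparison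
  -- sees nothing else.
  record Supp (f : NSer) (lo hi τ : ℕ) : Set where
    field
      zero-below : ∀ m → m < lo → cum f m ≡ 0
      ≤total : ∀ m → cum f m ≤ τ
      full-above : ∀ m → hi ≤ m → cum f m ≡ τ

  -- The shift by 2 is that of the window covered by the reserved indices.
  c₂ : NSer
  c₂ = cum (shN 2 δ)

  private
    c₂-cases : ∀ m → (m < 2 × c₂ m ≡ 0) ⊎ (2 ≤ m × c₂ m ≡ 1)
    c₂-cases 0 = inj₁ (s≤s z≤n , refl)
    c₂-cases 1 = inj₁ (s≤s (s≤s z≤n) , refl)
    c₂-cases 2 = inj₂ (s≤s (s≤s z≤n) , refl)
    c₂-cases (suc (suc (suc m))) = inj₂ (s≤s (s≤s z≤n) , trans (cong (_+ 0) (go m)) refl)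
      where
      go : ∀ m → c₂ (2 + m) ≡ 1
      go zero = refl
      go (suc m) = trans (+-identityʳ _) (go m)

  c₂-≤ : ∀ m → c₂ m ≤ 1
  c₂-≤ m with c₂-cases m
  ... | inj₁ (_ , e) = subst (_≤ 1) (sym e) z≤n
  ... | inj₂ (_ , e) = ≤-reflexive e

  -- A single point mass satisfies the window inequality with S = 3, whatever the length; every
  -- further factor adds 2.
  c₂-spread : ∀ M → Spread M 3 1 c₂
  c₂-spread M = record { mono = cum-Mono (shN 2 δ) ; ≤τ = c₂-≤ ; window = λ p → win (c₂ p) (shN M c₂ p) (c₂-≤ p) (sh-≤ (cum-Mono (shN 2 δ)) M 0 p p (+-monoʳ-≤ p z≤n)) }
    where
    win : ∀ x y → x ≤ 1 → y ≤ x → 3 * (x * 1) + 3 * (1 * y) ≤ 3 * (1 * x) + 3 * (x * y)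
    win zero zero _ _ = z≤n
    win (suc zero) y _ _ = ≤-refl
    win (suc (suc _)) _ (s≤s ()) _

  c₂-palin : Palin 4 1 c₂
  c₂-palin = record { sym-sum = sy ; full = fu }
    where
    sy : ∀ x y → x + y + 1 ≡ 4 → c₂ x + c₂ y ≡ 1
    sy 0 3 refl = refl
    sy 1 2 refl = refl
    sy 2 1 refl = refl
    sy 3 0 refl = refl
    sy 0 0 ()
    sy 0 1 ()
    sy 0 2 ()
    sy 0 (suc (suc (suc (suc y)))) e = ⊥-elim (1+n≢0 (suc-injective (suc-injective (suc-injective (suc-injective (trans (cong suc (sym (+-suc (3 + y) 0)) ) (trans (lem y) e)))))))
      where
      lem : ∀ y → suc (3 + y + 1) ≡ 0 + suc (suc (suc (suc y))) + 1
      lem y = refl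
    sy 1 0 ()
    sy 1 1 ()
    sy 1 (suc (suc (suc y))) e = ⊥-elim (1+n≢0 (suc-injective (suc-injective (suc-injective (suc-injective (trans (cong (λ i → suc (3 + i)) (+-comm 1 y)) e))))))
    sy 2 0 ()
    sy 2 (suc (suc y)) e = ⊥-elim (1+n≢0 (suc-injective (suc-injective (suc-injective (suc-injective (trans (cong (λ i → suc (3 + i)) (+-comm 1 y)) e))))))
    sy 3 (suc y) e = ⊥-elim (1+n≢0 (suc-injective (suc-injective (suc-injective (suc-injective (trans (cong (λ i → suc (3 + i)) (+-comm 1 y)) e))))))
    sy (suc (suc (suc (suc x)))) y e = ⊥-elim (1+n≢0 (suc-injective (suc-injective (suc-injective (suc-injective (trans (cong (λ i → suc (3 + i)) (+-comm 1 (x + y))) e))))))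
    fu : ∀ x → 4 ≤ x → c₂ x ≡ 1
    fu x p with c₂-cases x
    ... | inj₂ (_ , e) = e
    ... | inj₁ (q , _) = ⊥-elim (<-irrefl refl (<-≤-trans q (≤-trans (s≤s (s≤s z≤n)) p)))

  rsv-mid : ∀ k → 4 < k → rsv k ≡ p3 k
  rsv-mid k p = subst (λ i → rsv i ≡ p3 i) (m+[n∸m]≡n p) refl

  bit-tri : ∀ k l f → bit k (tri l f) ≗ tri l (bit k f)
  bit-tri k l f m = trans (cong (tri l f m +_) (shN-tri k l f m))
    (trans (lem (f m) (shN l f m) (shN (l + l) f m) (shN k f m) (shN (k + l) f m) (shN (k + (l + l)) f m))
    (trans (cong₂ (λ i j → f m + shN k f m + (shN l f m + shN i f m) + (shN (l + l) f m + shN j f m)) (+-comm k l) (+-comm k (l + l)))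
    (sym (cong₂ (λ x y → bit k f m + x + y) (shN-bit l k f m) (shN-bit (l + l) k f m)))))
    where
    lem : ∀ a b c d e g → a + b + c + (d + e + g) ≡ a + d + (b + e) + (c + g)
    lem = solve-∀

  TriP-bit : ∀ k χ a l f → bit k (TriP χ a l f) ≗ TriP χ a l (bit k f)
  TriP-bit k χ a zero f m = refl
  TriP-bit k χ a (suc l) f m with χ (suc (a + l))
  ... | true = trans (bit-tri k (suc (a + l)) (TriP χ a l f) m) (tri-cong (suc (a + l)) (TriP-bit k χ a l f) m)
  ... | false = TriP-bit k χ a l f m

  cntP-all : ∀ a l → cntP all a l ≡ l
  cntP-all a zero = refl
  cntP-all a (suc l) = trans (cong (_+ 1) (cntP-all a l)) (+-comm l 1)

  -- Dropping the middle term q^n leaves the two-term factor 1 + q^(n+1), for which `Spread` and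
  -- `Below` have product rules; its top degree is still n + 1.
  lead-≽ : ∀ n → bit (suc n) δ ≼ lead n
  lead-≽ n m = +-monoˡ-≤ (shN (suc n) δ m) (m≤m+n (δ m) _)

  Bit3-Mono : ∀ o l {c} → Mono c → Mono (Bit3 o l c)
  Bit3-Mono o zero p = p
  Bit3-Mono o (suc l) p = bit-Mono (3 * suc (o + l)) (Bit3-Mono o l p)

  shN-bound : ∀ k {f τ} → (∀ m → f m ≤ τ) → ∀ m → shN k f m ≤ τ
  shN-bound zero p m = p m
  shN-bound (suc k) p zero = z≤n
  shN-bound (suc k) p (suc m) = shN-bound k p m

  bit-bound : ∀ k {f τ} → (∀ m → f m ≤ τ) → ∀ m → bit k f m ≤ 2 * τ
  bit-bound k {f} {τ} p m = ≤-trans (+-mono-≤ (p m) (shN-bound k p m)) (≤-reflexive (cong (τ +_) (sym (+-identityʳ τ))))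

  Bit3-bound : ∀ o k l {f τ} → (∀ m → f m ≤ τ) → ∀ m → Bit3 o l f m ≤ tauP 2 all k l τ
  Bit3-bound o k zero p = p
  Bit3-bound o k (suc l) p = bit-bound (3 * suc (o + l)) (Bit3-bound o k l p)

  nrs : ℕ → Bool
  nrs = all ∩ ∁ rsv

  ∸-shift : ∀ x l D y → x + l ≤ D + y → x ≤ D ℕ.∸ l + y
  ∸-shift x l D y p = +-cancelʳ-≤ l x _ (≤-trans p (≤-trans (+-monoˡ-≤ y (≤-trans (m≤n+m∸n D l) (≤-reflexive (+-comm l _)))) (≤-reflexive (lem (D ℕ.∸ l) l y))))
    where
    lem : ∀ d l y → d + l + y ≡ d + y + l
    lem = solve-∀

  -- Summands with 6j + 2 ≤ n: comparison of
  --   ∏_{3j+1 < k ≤ r} (1 + q^k + q^2k) ∏_{r < i ≤ r+2j} (1 + Q^i) K   with T₀ n,   r = 3j + 1 + e, n = r + 3j + 1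

  module FarIndex (j₀ e : ℕ) where
    j r n : ℕ
    j = 2 + j₀
    r = 1 + (3 * j + e)
    n = 2 + (3 * j + e + 3 * j)

    private
      -- `M` is the length of the window produced by the reserved indices 2, 4, the powers of 3 up
      -- to r, and the two large indices r + 1 and r + 3j. Powers of 3 in (3j + 1, r] also occur in
      -- T_j; there they amount to at most a box of length `M₀`.
      s₀ s₁ s₂ M M₀ : ℕ
      s₀ = sumP p3 0 (1 + 3 * j)
      s₁ = sumP p3 (1 + 3 * j) e
      s₂ = sumP nrs 1 (3 * j)
      M₀ = suc (s₁ + s₁)
      M = np r + 6 + (suc r + suc r) + ((r + 3 * j) + (r + 3 * j))

      -- Multiplication by what is left of T₀ without the reserved indices and without the interval
      -- (3j + 1, r], which it shares with T_j.
      Yf : NSer → NSer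
      Yf f = TriP all (r + 1) (2 * j + j₀) (TriP nrs 1 (3 * j) (bit (suc n) f))

      3j≡ : ∀ j₀ → 3 * (2 + j₀) ≡ suc (1 + (2 * (2 + j₀) + j₀))
      3j≡ = solve-∀

      4+ : Σ ℕ λ l → r ≡ 4 + l
      4+ = _ , lem j₀ e
        where
        lem : ∀ j₀ e → 1 + (3 * (2 + j₀) + e) ≡ 4 + (3 + 3 * j₀ + e)
        lem = solve-∀

      high : ∀ f → TriP all r (3 * j) f ≗ tri (r + 3 * j) (TriP all (r + 1) (2 * j + j₀) (tri (suc r) f))
      high f m = trans (cong (λ l → TriP all r l f m) (3j≡ j₀))
        (trans (cong (λ k → tri k (TriP all r (1 + (2 * j + j₀)) f) m) (trans (sym (+-suc r _)) (cong (r +_) (sym (3j≡ j₀)))))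
        (tri-cong (r + 3 * j) (λ i → trans (TriP-++ all r 1 (2 * j + j₀) f i) (TriP-cong all (r + 1) (2 * j + j₀) (λ i → cong (λ k → tri (suc k) f i) (+-identityʳ r)) i)) m))

      small-mid : ∀ f → TriP p3 (1 + 3 * j) e (TriP rsv 1 (3 * j) f) ≗ TriP rsv 0 r f
      small-mid f m = sym (trans (TriP-++ rsv 0 1 (3 * j + e) f m) (trans (TriP-++ rsv 1 (3 * j) e f m)
        (TriP-ext (1 + 3 * j) e (TriP rsv 1 (3 * j) f) (λ k p _ → rsv-mid k (≤-trans (s≤s 4≤) p)) m)))
        where
        4≤ : 4 ≤ 1 + 3 * j
        4≤ = ≤-trans (m≤m+n 4 (3 + 3 * j₀)) (≤-reflexive (lem j₀))
          where
          lem : ∀ j₀ → 4 + (3 + 3 * j₀) ≡ 1 + 3 * (2 + j₀)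
          lem = solve-∀

      cover : ∀ f → shN 2 (box M f) ≼ tri (r + 3 * j) (tri (suc r) (TriP rsv 0 r f))
      cover f = cover-tri (≤-trans (+-mono-≤ (n≤1+n r) (≤-trans (m≤m+n (3 * j) e) (≤-trans (n≤1+n _) (n≤1+n r)))) (m≤n+m (suc r + suc r) (np r + 6)))
        (cover-tri (≤-trans (<np r) (m≤m+n (np r) 6)) (λ m → subst (λ r → shN 2 (box (np r + 6) f) m ≤ TriP rsv 0 r f m) (sym (proj₂ 4+)) (rsv-cover f (proj₁ 4+) m)))

      mid : NSer → NSer
      mid = TriP p3 (1 + 3 * j) e

      G : NSer
      G = TriP all r (3 * j) (TriP all 1 (3 * j) (lead n))

      -- Putting the reserved factors back turns window sums of the remaining product into lower
      -- bounds for single coefficients. On the right stands T₀ without the common trinomials whose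
      -- index is not a power of 3.
      G-≽ : shN 2 (box M (Yf δ)) ≼ mid G
      G-≽ m = ≤-trans (cover (Yf δ) m) (≤-trans (≤-reflexive (sym e₁)) (TriP-mono p3 (1 + 3 * j) e g m))
        where
        F = TriP rsv 1 (3 * j) (Yf δ)
        g : tri (r + 3 * j) (tri (suc r) F) ≼ G
        g m = ≤-trans (≤-reflexive e₂) (≤-trans (tri-mono (r + 3 * j) (TriP-mono all (r + 1) (2 * j + j₀) (tri-mono (suc r) (TriP-mono all 1 (3 * j) (lead-≽ n)))) m) (≤-reflexive (sym (high (TriP all 1 (3 * j) (lead n)) m))))
          where
          e₂ : tri (r + 3 * j) (tri (suc r) F) m ≡ tri (r + 3 * j) (TriP all (r + 1) (2 * j + j₀) (tri (suc r) (TriP all 1 (3 * j) (bit (suc n) δ)))) m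
          e₂ = tri-cong (r + 3 * j) (λ i → trans (tri-cong (suc r) (λ i → trans (TriP-TriP rsv 1 (3 * j) all (r + 1) (2 * j + j₀) (TriP nrs 1 (3 * j) (bit (suc n) δ)) i)
                (TriP-cong all (r + 1) (2 * j + j₀) (λ i → sym (TriP-split all rsv 1 (3 * j) (bit (suc n) δ) i)) i)) i)
                (TriP-triIf true (suc r) all (r + 1) (2 * j + j₀) (TriP all 1 (3 * j) (bit (suc n) δ)) i)) m
        e₁ : mid (tri (r + 3 * j) (tri (suc r) F)) m ≡ tri (r + 3 * j) (tri (suc r) (TriP rsv 0 r (Yf δ))) m
        e₁ = trans (sym (TriP-triIf true (r + 3 * j) p3 (1 + 3 * j) e (tri (suc r) F) m))
          (tri-cong (r + 3 * j) (λ i → trans (sym (TriP-triIf true (suc r) p3 (1 + 3 * j) e F i)) (tri-cong (suc r) (small-mid (Yf δ)) i)) m)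

      T₀≗ : ∀ m → T₀ n m ≡ TriP all (1 + 3 * j) e G m
      T₀≗ m = trans (TriP-++ all 1 (3 * j + e) (3 * j) (lead n) m) (trans (TriP-cong all r (3 * j) (TriP-++ all 1 (3 * j) e (lead n)) m) (TriP-TriP all r (3 * j) all (1 + 3 * j) e (TriP all 1 (3 * j) (lead n)) m))

      -- The 3j - 2 large indices are divided into 2j and j₀: the first 2j are going to be paired
      -- with the 2j factors 1 + Q^i of T_j.
      cY : NSer
      cY = bit (suc n) (TriP all (suc r + 2 * j) j₀ (TriP all (suc r) (2 * j) (TriP nrs 1 (3 * j) c₂)))

      cY≗ : cum (shN 2 (Yf δ)) ≗ cY
      cY≗ m = trans (cum-cong (λ i → trans (shN-TriP 2 all (r + 1) (2 * j + j₀) _ i) (TriP-cong all (r + 1) (2 * j + j₀) (λ i → trans (shN-TriP 2 nrs 1 (3 * j) (bit (suc n) δ) i) (TriP-cong nrs 1 (3 * j) sh-bit i)) i)) m)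
        (trans (cum-TriP all (r + 1) (2 * j + j₀) _ m) (trans (TriP-cong all (r + 1) (2 * j + j₀) (λ i → trans (cum-TriP nrs 1 (3 * j) _ i) (TriP-cong nrs 1 (3 * j) (cum-bit (suc n) (shN 2 δ)) i)) m)
        (trans (TriP-cong all (r + 1) (2 * j + j₀) (λ i → sym (TriP-bit (suc n) nrs 1 (3 * j) c₂ i)) m)
        (trans (sym (TriP-bit (suc n) all (r + 1) (2 * j + j₀) _ m)) (bit-cong (suc n) (λ i → trans (cong (λ k → TriP all k (2 * j + j₀) (TriP nrs 1 (3 * j) c₂) i) (+-comm r 1)) (TriP-++ all (suc r) (2 * j) j₀ _ i)) m)))))
        where
        sh-bit : shN 2 (bit (suc n) δ) ≗ bit (suc n) (shN 2 δ)
        sh-bit i = trans (shN-bit 2 (suc n) δ i) (cong (shN 2 δ i +_) (trans (cong (λ k → shN k δ i) (+-comm 2 (suc n))) (sym (shN-shN (suc n) 2 δ i))))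

      S : ℕ
      S = 2 + (cntP all (suc r + 2 * j) j₀ + cntP all (suc r + 2 * j) j₀ + (cntP all (suc r) (2 * j) + cntP all (suc r) (2 * j) + (cntP nrs 1 (3 * j) + cntP nrs 1 (3 * j) + 3)))

      S≤ : S ≤ 12 * j + 1
      S≤ = ≤-trans (+-monoʳ-≤ 2 (+-mono-≤ (≤-reflexive (cong₂ _+_ (cntP-all _ j₀) (cntP-all _ j₀))) (+-mono-≤ (≤-reflexive (cong₂ _+_ (cntP-all _ (2 * j)) (cntP-all _ (2 * j)))) (+-monoˡ-≤ 3 (+-mono-≤ (cntP-≤ nrs 1 (3 * j)) (cntP-≤ nrs 1 (3 * j)))))))
        (≤-reflexive (lem j₀))
        where
        lem : ∀ j₀ → 2 + (j₀ + j₀ + (2 * (2 + j₀) + 2 * (2 + j₀) + (3 * (2 + j₀) + 3 * (2 + j₀) + 3))) ≡ 12 * (2 + j₀) + 1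
        lem = solve-∀

      2top≤M : (r + 3 * j) + (r + 3 * j) ≤ M
      2top≤M = m≤n+m _ (np r + 6 + (suc r + suc r))

      2k≤M : ∀ {k} → k ≤ r + 3 * j → k + k ≤ M
      2k≤M p = ≤-trans (+-mono-≤ p p) 2top≤M

      spread : Spread M S (2 * tauP 3 all (suc r + 2 * j) j₀ (tauP 3 all (suc r) (2 * j) (tauP 3 nrs 1 (3 * j) 1))) cY
      spread = spread-bit (suc n) n≤ (spread-TriP all (suc r + 2 * j) j₀ (λ k _ p _ → 2k≤M (≤-trans p top)) (spread-TriP all (suc r) (2 * j) (λ k _ p _ → 2k≤M (≤-trans p (≤-trans (m≤m+n _ j₀) top)))
          (spread-TriP nrs 1 (3 * j) (λ k _ p _ → 2k≤M (≤-trans p (+-monoˡ-≤ (3 * j) (s≤s (z≤n {3 * j + e}))))) (c₂-spread M))))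
        where
        top : suc r + 2 * j + j₀ ≤ r + 3 * j
        top = ≤-trans (n≤1+n _) (≤-reflexive (lem r j₀))
          where
          lem : ∀ r j₀ → suc (suc r + 2 * (2 + j₀) + j₀) ≡ r + 3 * (2 + j₀)
          lem = solve-∀
        n≤ : suc n ≤ M
        n≤ = +-mono-≤ {suc (suc r)} {np r + 6 + (suc r + suc r)} (≤-trans (s≤s (m≤n+m (suc r) r)) (m≤n+m (suc r + suc r) (np r + 6))) (≤-trans (m≤n+m (3 * j) r) (m≤m+n _ (r + 3 * j)))

    lo hi : ℕ
    lo = 3 * (j * j) + 3 * j
    hi = lo + (6 * (j * j) + 3 * j + 1 + n)

    private
      A₁ A₂ : ℕ
      A₁ = sumP all (suc r) (2 * j)
      A₂ = sumP all (suc r + 2 * j) j₀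

      sum-nrs : s₂ + s₂ + (6 + s₀ + (6 + s₀)) ≡ 3 * j * (1 + 1 + 3 * j + 1)
      sum-nrs = trans (cong (λ x → s₂ + s₂ + (x + x)) (sym e₁)) (trans (lem s₂ (sumP rsv 1 (3 * j))) (trans (cong (λ x → x + x) (sym (sumP-split all rsv 1 (3 * j)))) (sumP-all 1 (3 * j))))
        where
        lem : ∀ a b → a + a + (b + b) ≡ b + a + (b + a)
        lem = solve-∀
        e₀ : 1 + 3 * j ≡ 4 + (3 + 3 * j₀)
        e₀ = lem′ j₀
          where
          lem′ : ∀ j₀ → 1 + 3 * (2 + j₀) ≡ 4 + (3 + 3 * j₀)
          lem′ = solve-∀
        e₁ : sumP rsv 1 (3 * j) ≡ 6 + s₀
        e₁ = trans (sym (sumP-++ rsv 0 1 (3 * j))) (subst (λ l → sumP rsv 0 l ≡ 6 + sumP p3 0 l) (sym e₀) (rsv-sum (3 + 3 * j₀)))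

      np-r : s₀ + s₁ + (s₀ + s₁) + 3 ≡ np r
      np-r = trans (cong (λ x → x + x + 3) (sym (sumP-++ p3 0 (1 + 3 * j) e))) (np-sum r)

      sum3≡ : sum3 r (2 * j) ≡ 3 * (j * (r + r + 2 * j + 1))
      sum3≡ = *-cancelˡ-≡ _ _ 2 (trans (sum3-closed r (2 * j)) (lem r j))
        where
        lem : ∀ r j → 3 * (2 * j * (r + r + 2 * j + 1)) ≡ 2 * (3 * (j * (r + r + 2 * j + 1)))
        lem = solve-∀

      -- The exponents of the majorant of T_j run from lo to n² - 1 - lo and those of T₀ from 0 to
      -- n² - 1, so the top degrees match exactly; the equation expresses this after the common
      -- factors are removed.
      degrees : M₀ + (hi + sum3 r (2 * j)) + lo ≡ 4 + (s₂ + s₂) + (A₁ + A₁ + (A₂ + A₂) + suc n + M)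
      degrees = +-cancelʳ-≡ (6 + s₀ + (6 + s₀)) _ _ (trans (cong (λ x → M₀ + (hi + x) + lo + (6 + s₀ + (6 + s₀))) sum3≡) (trans (lem j₀ r s₀ s₁)
        (sym (trans (shuffle (s₂ + s₂) (6 + s₀ + (6 + s₀)) (A₁ + A₁) (A₂ + A₂) n (np r) (suc r + suc r) (r + 3 * j + (r + 3 * j)))
          (cong₂ (λ x y → 4 + x + y) sum-nrs (cong₂ (λ x y → x + suc n + y) (cong₂ _+_ (sumP-all (suc r) (2 * j)) (sumP-all (suc r + 2 * j) j₀)) (cong (_+ (6 + (suc r + suc r) + (r + 3 * j + (r + 3 * j)))) (sym np-r))))))))
        where
        shuffle : ∀ s z a b n p x y → 4 + s + (a + b + suc n + (p + 6 + x + y)) + z ≡ 4 + (s + z) + (a + b + suc n + (p + (6 + x + y)))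
        shuffle = solve-∀
        lem : ∀ j₀ r s₀ s₁ → let j = 2 + j₀ ; n = suc (r + 3 * j) ; lo = 3 * (j * j) + 3 * j in
          suc (s₁ + s₁) + (lo + (6 * (j * j) + 3 * j + 1 + n) + 3 * (j * (r + r + 2 * j + 1))) + lo + (6 + s₀ + (6 + s₀))
          ≡ 4 + 3 * j * (1 + 1 + 3 * j + 1) + (2 * j * (suc r + suc r + 2 * j + 1) + j₀ * (suc r + 2 * j + (suc r + 2 * j) + j₀ + 1) + suc n + (s₀ + s₁ + (s₀ + s₁) + 3 + (6 + (suc r + suc r) + (r + 3 * j + (r + 3 * j)))))
        lem = solve-∀

    module _ {N τ : ℕ} {K : NSer} (sK : Supp K lo hi τ) (N≤ : N * τ ≤ TriP nrs 1 (3 * j) c₂ lo) where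
      open Supp sK
      private
        X : NSer
        X = Bit3 r (2 * j) K
        cX : NSer
        cX = Bit3 r (2 * j) (cum K)
        monoK : Mono (cum K)
        monoK = cum-Mono K

        Y₁ : NSer
        Y₁ = TriP nrs 1 (3 * j) c₂
        m₁ : Mono Y₁
        m₁ = Mono-TriP nrs 1 (3 * j) (cum-Mono (shN 2 δ))
        b₁ : ∀ m → Y₁ m ≤ tauP 3 nrs 1 (3 * j) 1
        b₁ = ≤τ-TriP nrs 1 (3 * j) c₂-≤
        b₂ = ≤τ-TriP all (suc r) (2 * j) b₁

        below : Below N (hi + sum3 r (2 * j)) (4 + (s₂ + s₂) ℕ.∸ lo + (A₁ + A₁) + (A₂ + A₂) + suc n) (tauP 2 all (suc r) (2 * j) τ)
          (2 * tauP 3 all (suc r + 2 * j) j₀ (tauP 3 all (suc r) (2 * j) (tauP 3 nrs 1 (3 * j) 1))) cX cY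
        below = below-bit (suc n) (≤τ-TriP all (suc r + 2 * j) j₀ b₂) (below-TriP all (suc r + 2 * j) j₀ b₂
          (below-pair3 r (suc r) (2 * j) le m₁ b₁ (below-base m₁ b₁ (palin-TriP nrs 1 (3 * j) c₂-palin) zero-below ≤total full-above N≤)))
          where
          le : suc r + 2 * j ≤ 3 * suc r
          le = ≤-trans (+-monoʳ-≤ (suc r) (*-monoʳ-≤ 2 (≤-trans (≤-trans (m≤m+n j (2 * j)) (m≤m+n (3 * j) e)) (≤-trans (n≤1+n _) (n≤1+n r))))) ≤-refl

        compare : ∀ m → 3 * (N * box M₀ X m) ≤ 2 * (S * shN 2 (box M (Yf δ)) m)
        compare m = subst (λ w → 3 * (N * box M₀ X m) ≤ 2 * (S * w)) (box-sh M 2 (Yf δ) m)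
          (window-dom {M = M} {M₀} m spread below (Bit3-Mono r (2 * j) monoK) (Bit3-bound r (suc r) (2 * j) ≤total)
            (*-mono-≤ {1} {2} (s≤s z≤n) (tauP-≥1 3 all (suc r + 2 * j) j₀ (s≤s z≤n) (tauP-≥1 3 all (suc r) (2 * j) (s≤s z≤n) (tauP-≥1 3 nrs 1 (3 * j) (s≤s z≤n) ≤-refl))))
            len ex ew)
          where
          len : M₀ + (hi + sum3 r (2 * j)) ≤ 4 + (s₂ + s₂) ℕ.∸ lo + (A₁ + A₁) + (A₂ + A₂) + suc n + M
          len = ≤-trans (∸-shift (M₀ + (hi + sum3 r (2 * j))) lo (4 + (s₂ + s₂)) _ (≤-reflexive degrees)) (≤-reflexive (lem (4 + (s₂ + s₂) ℕ.∸ lo) (A₁ + A₁) (A₂ + A₂) (suc n) M))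
            where
            lem : ∀ a b c d e → a + (b + c + d + e) ≡ a + b + c + d + e
            lem = solve-∀
          ex : box M₀ X m + shN M₀ cX m ≡ cX m
          ex = trans (cong (box M₀ X m +_) (shN-cong M₀ (λ i → sym (cum-Bit3 r (2 * j) K i)) m)) (trans (box-cum M₀ X m) (cum-Bit3 r (2 * j) K m))
          ew : box M (shN 2 (Yf δ)) m + shN M cY m ≡ cY m
          ew = trans (cong (box M (shN 2 (Yf δ)) m +_) (shN-cong M (λ i → sym (cY≗ i)) m)) (trans (box-cum M (shN 2 (Yf δ)) m) (cY≗ m))

      -- The common trinomials are divided: multiplication by those whose index is no power of 3
      -- preserves the inequality, while the powers of 3 turn into a box on the left and help to
      -- form the window on the right.
      far-dom : ∀ m → 3 * N * TriP all (1 + 3 * j) e X m ≤ 2 * (12 * j + 1) * T₀ n m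
      far-dom m = subst₂ (λ a b → 3 * N * a ≤ 2 * (12 * j + 1) * b) (sym (rest X m)) (sym (trans (T₀≗ m) (rest G m)))
        (TriP-ratio (all ∩ ∁ p3) (1 + 3 * j) e (3 * N) (2 * (12 * j + 1)) key m)
        where
        rest : ∀ f → TriP all (1 + 3 * j) e f ≗ TriP (all ∩ ∁ p3) (1 + 3 * j) e (mid f)
        rest f m = trans (TriP-split all p3 (1 + 3 * j) e f m) (TriP-TriP p3 (1 + 3 * j) e (all ∩ ∁ p3) (1 + 3 * j) e f m)
        key : ∀ m → 3 * N * mid X m ≤ 2 * (12 * j + 1) * mid G m
        key m = begin
          3 * N * mid X m ≤⟨ *-monoʳ-≤ (3 * N) (pow3-box (1 + 3 * j) e X m) ⟩
          3 * N * box M₀ X m ≡⟨ *-assoc 3 N _ ⟩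
          3 * (N * box M₀ X m) ≤⟨ compare m ⟩
          2 * (S * shN 2 (box M (Yf δ)) m) ≤⟨ *-monoʳ-≤ 2 (*-mono-≤ S≤ (G-≽ m)) ⟩
          2 * ((12 * j + 1) * mid G m) ≡⟨ *-assoc 2 (12 * j + 1) (mid G m) ⟨
          2 * (12 * j + 1) * mid G m ∎
          where open ≤-Reasoning

-- Comparison with the dominant summand when n ≤ 6j + 1

module NearSummands where

  open Windows
  open IntervalProducts
  open Boxes
  open FarSummands
  open import Data.Bool using (Bool; true; false; _∧_; _∨_; not; if_then_else_)
  open import Data.Empty using (⊥-elim)
  open import Data.Nat as ℕ using (ℕ; zero; suc; _+_; _*_; _≤_; _<_; z≤n; s≤s; _≡ᵇ_)
  open import Data.Nat.Properties as ℕ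
  open import Data.Nat.Tactic.RingSolver using (solve-∀)
  open import Data.Product using (Σ; _,_; proj₁; proj₂)
  open import Relation.Binary.PropositionalEquality hiding (setoid)
  open import Relation.Nullary using (yes; no)

  _∖_ : (ℕ → Bool) → ℕ → ℕ → Bool
  (χ ∖ k) i = χ i ∧ not (i ≡ᵇ k)

  ≡ᵇ-refl : ∀ k → (k ≡ᵇ k) ≡ true
  ≡ᵇ-refl zero = refl
  ≡ᵇ-refl (suc k) = ≡ᵇ-refl k

  ≢-≡ᵇ : ∀ i k → i ≢ k → (i ≡ᵇ k) ≡ false
  ≢-≡ᵇ i k p with i ≡ᵇ k in e
  ... | true = ⊥-elim (p (≡ᵇ-sound i k e))
  ... | false = refl

  ∧-not-false : ∀ b → b ∧ not false ≡ b
  ∧-not-false true = refl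
  ∧-not-false false = refl

  ∧-not-true : ∀ b → b ∧ not true ≡ false
  ∧-not-true true = refl
  ∧-not-true false = refl

  ∖-other : ∀ χ k i → i ≢ k → (χ ∖ k) i ≡ χ i
  ∖-other χ k i p = trans (cong (λ b → χ i ∧ not b) (≢-≡ᵇ i k p)) (∧-not-false (χ i))

  ∖-same : ∀ χ k → (χ ∖ k) k ≡ false
  ∖-same χ k = trans (cong (λ b → χ k ∧ not b) (≡ᵇ-refl k)) (∧-not-true (χ k))

  TriP-remove : ∀ χ k a l f → χ k ≡ true → a < k → k ≤ a + l → TriP χ a l f ≗ tri k (TriP (χ ∖ k) a l f)
  TriP-remove χ k a zero f c p q m = ⊥-elim (<-irrefl refl (<-≤-trans p (≤-trans q (≤-reflexive (+-identityʳ a)))))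
  TriP-remove χ k a (suc l) f c p q m with suc (a + l) ≟ k
  ... | yes refl = trans (cong (λ b → triIf b k (TriP χ a l f) m) c) (tri-cong k (λ i → trans (TriP-ext a l f (λ i _ i≤ → sym (∖-other χ k i (<⇒≢ (s≤s i≤)))) i) (cong (λ b → triIf b k (TriP (χ ∖ k) a l f) i) (sym (∖-same χ k)))) m)
  ... | no ≢ = trans (triIf-cong (χ (suc (a + l))) (suc (a + l)) (TriP-remove χ k a l f c p (≤-pred (≤∧≢⇒< (≤-trans q (≤-reflexive (+-suc a l))) (λ e → ≢ (sym e))))) m)
        (trans (triIf-comm (χ (suc (a + l))) (suc (a + l)) true k (TriP (χ ∖ k) a l f) m)
          (tri-cong k (λ i → cong (λ b → triIf b (suc (a + l)) (TriP (χ ∖ k) a l f) i) (sym (∖-other χ k (suc (a + l)) ≢))) m))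

  sumP-remove : ∀ χ k a l → χ k ≡ true → a < k → k ≤ a + l → sumP χ a l ≡ sumP (χ ∖ k) a l + k
  sumP-remove χ k a zero c p q = ⊥-elim (<-irrefl refl (<-≤-trans p (≤-trans q (≤-reflexive (+-identityʳ a)))))
  sumP-remove χ k a (suc l) c p q with suc (a + l) ≟ k
  ... | yes refl = cong₂ _+_ (trans (sumP-ext a l (λ i _ i≤ → sym (∖-other χ k i (<⇒≢ (s≤s i≤))))) (trans (sym (+-identityʳ _)) (cong (λ b → sumP (χ ∖ k) a l + (if b then k else 0)) (sym (∖-same χ k))))) (cong (λ b → if b then k else 0) c)
  ... | no ≢ = trans (cong (_+ (if χ (suc (a + l)) then suc (a + l) else 0)) (sumP-remove χ k a l c p (≤-pred (≤∧≢⇒< (≤-trans q (≤-reflexive (+-suc a l))) (λ e → ≢ (sym e))))))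
        (trans (lem (sumP (χ ∖ k) a l) k _) (cong (λ b → sumP (χ ∖ k) a l + (if b then suc (a + l) else 0) + k) (sym (∖-other χ k (suc (a + l)) ≢))))
    where
    lem : ∀ a b c → a + b + c ≡ a + c + b
    lem = solve-∀

  TriP-χ-mono : ∀ {χ ψ} a l f → (∀ k → χ k ≡ true → ψ k ≡ true) → TriP χ a l f ≼ TriP ψ a l f
  TriP-χ-mono a zero f p m = ≤-refl
  TriP-χ-mono {χ} {ψ} a (suc l) f p m with χ (suc (a + l)) in e
  ... | true = subst (λ b → tri (suc (a + l)) (TriP χ a l f) m ≤ triIf b (suc (a + l)) (TriP ψ a l f) m) (sym (p _ e)) (tri-mono (suc (a + l)) (TriP-χ-mono a l f p) m)
  ... | false = ≤-trans (TriP-χ-mono a l f p m) (TriP-≼ ψ (a + l) 1 (TriP ψ a l f) m ∙ cong (λ k → triIf (ψ (suc k)) (suc k) (TriP ψ a l f) m) (+-identityʳ (a + l)))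
    where
    _∙_ : ∀ {a b c} → a ≤ b → b ≡ c → a ≤ c
    p ∙ refl = p

  np-odd : ∀ m → Σ ℕ λ k → np m ≡ suc (k + k)
  np-odd zero = 1 , refl
  np-odd (suc m) with suc m ≡ᵇ np m | np-odd m
  ... | true | k , e = suc (k + k + k) , trans (cong (3 *_) e) (lem k)
    where
    lem : ∀ k → 3 * suc (k + k) ≡ suc (suc (k + k + k) + suc (k + k + k))
    lem = solve-∀
  ... | false | x = x

  private
    odd≢even : ∀ k h → suc (k + k) ≢ h + h
    odd≢even k zero ()
    odd≢even zero (suc h) e = 1+n≢0 (sym (suc-injective (trans e (cong suc (+-suc h h)))))
    odd≢even (suc k) (suc h) e = odd≢even k h (suc-injective (suc-injective (trans (cong (λ x → suc (suc x)) (sym (+-suc k k))) (trans e (cong suc (+-suc h h))))))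

  -- Powers of 3 are odd, so 2 and 4 are the only even reserved indices.
  nrs-even : ∀ h → 3 ≤ h → nrs (h + h) ≡ true
  nrs-even h 3≤h = cong not (trans (cong (_∨ ((h + h ≡ᵇ 4) ∨ p3 (h + h))) (≢-≡ᵇ (h + h) 2 (≢-sym (<⇒≢ (≤-trans (s≤s (s≤s (s≤s z≤n))) 6≤)))))
    (trans (cong (_∨ p3 (h + h)) (≢-≡ᵇ (h + h) 4 (≢-sym (<⇒≢ (≤-trans (s≤s (s≤s (s≤s (s≤s (s≤s z≤n))))) 6≤))))) (go (h + h) refl)))
    where
    6≤ : 6 ≤ h + h
    6≤ = +-mono-≤ 3≤h 3≤h
    go : ∀ m → m ≡ h + h → p3 m ≡ false
    go zero e = refl
    go (suc m) e = ≢-≡ᵇ (suc m) (np m) (λ q → odd≢even (proj₁ (np-odd m)) h (trans (sym (proj₂ (np-odd m))) (trans (sym q) e)))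

  -- The two removed indices widen the window; being even, they are not powers of 3.
  nrh : ℕ → ℕ → Bool
  nrh h = (nrs ∖ (suc h + suc h)) ∖ (h + h)

  nrh⇒nrs : ∀ h k → nrh h k ≡ true → nrs k ≡ true
  nrh⇒nrs h k e with nrs k
  ... | true = refl
  ... | false = e

  -- Summands with n ≤ 6j + 1: comparison of K ∏_{o < i ≤ o+l} (1 + Q^i) with T₀ n, n = 3j + 1 + l + d

  module NearIndex (j₁ l d o h : ℕ) (3≤h : 3 ≤ h) (h≤ : suc h + suc h ≤ 3 * suc j₁) (M≥ : 12 * suc j₁ ≤ np (3 * suc j₁) + 6 + (h + h + (h + h)) + (suc h + suc h + (suc h + suc h)))
    (l+d≤ : l + d ≤ 3 * suc j₁) (o≥ : 3 * suc j₁ + l ≤ 3 * suc o) (4≤ : 2 ≤ suc j₁) where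

    private
      j w r : ℕ
      j = suc j₁
      w = 2 + 3 * j₁
      r = l + d

      1+w≡ : 3 * j ≡ 1 + w
      1+w≡ = lem j₁
        where
        lem : ∀ j₁ → 3 * suc j₁ ≡ 1 + (2 + 3 * j₁)
        lem = solve-∀

    n : ℕ
    n = 2 + (w + (l + d))

    private
      -- As n may be as small as 3j + 1, no index beyond 3j can be counted on. The consecutive even
      -- indices 2h and 2h + 2 within 3j lengthen the window instead; it has to reach 12j because
      -- the indices of T₀ go up to 6j.
      a₁ a₂ M : ℕ
      a₁ = suc h + suc h
      a₂ = h + h
      M = np (1 + w) + 6 + (a₂ + a₂) + (a₁ + a₁)

      M≥′ : 12 * j ≤ M
      M≥′ = subst (λ x → 12 * j ≤ np x + 6 + (a₂ + a₂) + (a₁ + a₁)) 1+w≡ M≥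

      a₂<a₁ : a₂ < a₁
      a₂<a₁ = s≤s (≤-trans (n≤1+n _) (≤-reflexive (sym (+-suc h h))))

      c₁ : nrs a₁ ≡ true
      c₁ = nrs-even (suc h) (≤-trans 3≤h (n≤1+n h))
      c₂′ : (nrs ∖ a₁) a₂ ≡ true
      c₂′ = trans (∖-other nrs a₁ a₂ (<⇒≢ a₂<a₁)) (nrs-even h 3≤h)

      1<a₂ : 1 < a₂
      1<a₂ = ≤-trans (s≤s (s≤s z≤n)) (+-mono-≤ 3≤h 3≤h)
      a₁≤ : a₁ ≤ 1 + w
      a₁≤ = subst (a₁ ≤_) 1+w≡ h≤

      small : ∀ f → TriP nrs 1 w f ≗ tri a₁ (tri a₂ (TriP (nrh h) 1 w f))
      small f m = trans (TriP-remove nrs a₁ 1 w f c₁ (<-trans 1<a₂ a₂<a₁) a₁≤ m) (tri-cong a₁ (TriP-remove (nrs ∖ a₁) a₂ 1 w f c₂′ 1<a₂ (≤-trans (<⇒≤ a₂<a₁) a₁≤)) m)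

      4+ : Σ ℕ λ x → 1 + w ≡ 4 + x
      4+ = 1 + w ℕ.∸ 4 , sym (m+[n∸m]≡n (≤-trans (s≤s (s≤s (s≤s (s≤s z≤n)))) (≤-trans (*-monoʳ-≤ 3 4≤) (≤-reflexive 1+w≡))))

      cover : ∀ f → shN 2 (box M f) ≼ tri a₁ (tri a₂ (TriP rsv 1 w f))
      cover f = cover-tri (≤-trans a₁≤ (≤-trans w≤ (m≤m+n _ (a₂ + a₂)))) (cover-tri (≤-trans (<⇒≤ a₂<a₁) (≤-trans a₁≤ w≤))
        (λ m → ≤-trans (subst (λ x → shN 2 (box (np x + 6) f) m ≤ TriP rsv 0 x f m) (sym (proj₂ 4+)) (rsv-cover f (proj₁ 4+) m)) (≤-reflexive (TriP-++ rsv 0 1 w f m))))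
        where
        w≤ : 1 + w ≤ np (1 + w) + 6
        w≤ = ≤-trans (<⇒≤ (<np (1 + w))) (m≤m+n _ 6)

      Y : NSer → NSer
      Y f = TriP all (1 + w) r (TriP (nrh h) 1 w (bit (suc n) f))

      T₀-≽ : shN 2 (box M (Y δ)) ≼ T₀ n
      T₀-≽ m = begin
        shN 2 (box M (Y δ)) m ≤⟨ cover (Y δ) m ⟩
        tri a₁ (tri a₂ (TriP rsv 1 w (Y δ))) m ≡⟨ tri-cong a₁ (tri-cong a₂ (TriP-TriP rsv 1 w all (1 + w) r g)) m ⟩
        tri a₁ (tri a₂ (TriP all (1 + w) r (TriP rsv 1 w g))) m ≡⟨ tri-cong a₁ (TriP-triIf true a₂ all (1 + w) r (TriP rsv 1 w g)) m ⟩
        tri a₁ (TriP all (1 + w) r (tri a₂ (TriP rsv 1 w g))) m ≡⟨ TriP-triIf true a₁ all (1 + w) r (tri a₂ (TriP rsv 1 w g)) m ⟩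
        TriP all (1 + w) r (tri a₁ (tri a₂ (TriP rsv 1 w g))) m ≡⟨ TriP-cong all (1 + w) r (λ i → trans (tri-cong a₁ (TriP-triIf true a₂ rsv 1 w g) i) (TriP-triIf true a₁ rsv 1 w (tri a₂ g) i)) m ⟩
        TriP all (1 + w) r (TriP rsv 1 w (tri a₁ (tri a₂ g))) m ≡⟨ TriP-cong all (1 + w) r (λ i → trans (TriP-cong rsv 1 w (λ i → sym (small b i)) i) (sym (TriP-split all rsv 1 w b i))) m ⟩
        TriP all (1 + w) r (TriP all 1 w b) m ≤⟨ TriP-mono all (1 + w) r (TriP-mono all 1 w (lead-≽ n)) m ⟩
        TriP all (1 + w) r (TriP all 1 w (lead n)) m ≡⟨ TriP-++ all 1 w r (lead n) m ⟨
        T₀ n m ∎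
        where
        open ≤-Reasoning
        b = bit (suc n) δ
        g = TriP (nrh h) 1 w b

      cY : NSer
      cY = bit (suc n) (TriP all (1 + w + l) d (TriP all (1 + w) l (TriP (nrh h) 1 w c₂)))

      cY≗ : cum (shN 2 (Y δ)) ≗ cY
      cY≗ m = trans (cum-cong (λ i → trans (shN-TriP 2 all (1 + w) r _ i) (TriP-cong all (1 + w) r (λ i → trans (shN-TriP 2 (nrh h) 1 w (bit (suc n) δ) i) (TriP-cong (nrh h) 1 w sh-bit i)) i)) m)
        (trans (cum-TriP all (1 + w) r _ m) (trans (TriP-cong all (1 + w) r (λ i → trans (cum-TriP (nrh h) 1 w _ i) (TriP-cong (nrh h) 1 w (cum-bit (suc n) (shN 2 δ)) i)) m)
        (trans (TriP-cong all (1 + w) r (λ i → sym (TriP-bit (suc n) (nrh h) 1 w c₂ i)) m)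
        (trans (sym (TriP-bit (suc n) all (1 + w) r _ m)) (bit-cong (suc n) (TriP-++ all (1 + w) l d _) m)))))
        where
        sh-bit : shN 2 (bit (suc n) δ) ≗ bit (suc n) (shN 2 δ)
        sh-bit i = trans (shN-bit 2 (suc n) δ i) (cong (shN 2 δ i +_) (trans (cong (λ k → shN k δ i) (+-comm 2 (suc n))) (sym (shN-shN (suc n) 2 δ i))))

      S : ℕ
      S = 2 + (cntP all (1 + w + l) d + cntP all (1 + w + l) d + (cntP all (1 + w) l + cntP all (1 + w) l + (cntP (nrh h) 1 w + cntP (nrh h) 1 w + 3)))

      S≤ : S ≤ 12 * j + 6
      S≤ = begin
        S ≤⟨ +-monoʳ-≤ 2 (+-mono-≤ (≤-reflexive (cong₂ _+_ (cntP-all _ d) (cntP-all _ d))) (+-mono-≤ (≤-reflexive (cong₂ _+_ (cntP-all _ l) (cntP-all _ l))) (+-monoˡ-≤ 3 (+-mono-≤ (cntP-≤ (nrh h) 1 w) (cntP-≤ (nrh h) 1 w))))) ⟩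
        2 + (d + d + (l + l + (w + w + 3))) ≡⟨ lem d l w ⟩
        (l + d) + (l + d) + (w + w + 5) ≤⟨ +-monoˡ-≤ (w + w + 5) (+-mono-≤ l+d≤ l+d≤) ⟩
        3 * j + 3 * j + (w + w + 5) ≤⟨ m≤m+n _ 3 ⟩
        3 * j + 3 * j + (w + w + 5) + 3 ≡⟨ lem₂ j₁ ⟩
        12 * j + 6 ∎
        where
        open ≤-Reasoning
        lem : ∀ d l w → 2 + (d + d + (l + l + (w + w + 3))) ≡ (l + d) + (l + d) + (w + w + 5)
        lem = solve-∀
        lem₂ : ∀ j₁ → 3 * suc j₁ + 3 * suc j₁ + (2 + 3 * j₁ + (2 + 3 * j₁) + 5) + 3 ≡ 12 * suc j₁ + 6
        lem₂ = solve-∀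

      top≤ : 1 + w + (l + d) ≤ 6 * j
      top≤ = ≤-trans (+-mono-≤ (≤-reflexive (sym 1+w≡)) l+d≤) (≤-reflexive (lem j))
        where
        lem : ∀ j → 3 * j + 3 * j ≡ 6 * j
        lem = solve-∀

      2k≤M : ∀ {k} → k ≤ 1 + w + (l + d) → k + k ≤ M
      2k≤M p = ≤-trans (+-mono-≤ (≤-trans p top≤) (≤-trans p top≤)) (≤-trans (≤-reflexive (lem j)) M≥′)
        where
        lem : ∀ j → 6 * j + 6 * j ≡ 12 * j
        lem = solve-∀

      spread : Spread M S (2 * tauP 3 all (1 + w + l) d (tauP 3 all (1 + w) l (tauP 3 (nrh h) 1 w 1))) cY
      spread = spread-bit (suc n) n≤ (spread-TriP all (1 + w + l) d (λ k _ p _ → 2k≤M (≤-trans p (≤-reflexive (+-assoc (1 + w) l d)))) (spread-TriP all (1 + w) l (λ k _ p _ → 2k≤M (≤-trans p (+-monoʳ-≤ (1 + w) (m≤m+n l d))))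
          (spread-TriP (nrh h) 1 w (λ k _ p _ → 2k≤M (≤-trans p (m≤m+n (1 + w) (l + d)))) (c₂-spread M))))
        where
        n≤ : suc n ≤ M
        n≤ = ≤-trans (+-mono-≤ {2} {6 * j} (*-mono-≤ {1} {6} {2} {j} (s≤s z≤n) 4≤) top≤) (≤-trans (≤-reflexive (lem j)) M≥′)
          where
          lem : ∀ j → 6 * j + 6 * j ≡ 12 * j
          lem = solve-∀

      s₀ s₂ A₁ A₂ : ℕ
      s₀ = sumP p3 0 (1 + w)
      s₂ = sumP (nrh h) 1 w
      A₁ = sumP all (1 + w) l
      A₂ = sumP all (1 + w + l) d

      sum-nrh : s₂ + a₂ + a₁ + (s₂ + a₂ + a₁) + (6 + s₀ + (6 + s₀)) ≡ w * (1 + 1 + w + 1)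
      sum-nrh = trans (cong₂ (λ x y → x + x + (y + y)) (sym (trans (sumP-remove nrs a₁ 1 w c₁ (<-trans 1<a₂ a₂<a₁) a₁≤) (cong (_+ a₁) (sumP-remove (nrs ∖ a₁) a₂ 1 w c₂′ 1<a₂ (≤-trans (<⇒≤ a₂<a₁) a₁≤))))) (sym e₁))
        (trans (lem (sumP nrs 1 w) (sumP rsv 1 w)) (trans (cong (λ x → x + x) (sym (sumP-split all rsv 1 w))) (sumP-all 1 w)))
        where
        lem : ∀ a b → a + a + (b + b) ≡ b + a + (b + a)
        lem = solve-∀
        e₁ : sumP rsv 1 w ≡ 6 + s₀
        e₁ = trans (sym (sumP-++ rsv 0 1 w)) (subst (λ x → sumP rsv 0 x ≡ 6 + sumP p3 0 x) (sym (proj₂ 4+)) (rsv-sum (proj₁ 4+)))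

      A₁₂ : A₁ + A₁ + (A₂ + A₂) ≡ (l + d) * (1 + w + (1 + w) + (l + d) + 1)
      A₁₂ = trans (lem A₁ A₂) (trans (cong (λ x → x + x) (sym (sumP-++ all (1 + w) l d))) (sumP-all (1 + w) (l + d)))
        where
        lem : ∀ a b → a + a + (b + b) ≡ a + b + (a + b)
        lem = solve-∀

      -- One more than the degree n² - 1 of T₀, recovered from its reserved and its remaining
      -- factors; the s₀ of the powers of 3 drops out by `np-sum`.
      total≡ : 4 + (s₂ + s₂) + (A₁ + A₁ + (A₂ + A₂) + suc n + M) ≡ n * n
      total≡ = +-cancelʳ-≡ (6 + s₀ + (6 + s₀)) _ _ (trans (cong (λ x → 4 + (s₂ + s₂) + (A₁ + A₁ + (A₂ + A₂) + suc n + (x + 6 + (a₂ + a₂) + (a₁ + a₁))) + (6 + s₀ + (6 + s₀))) (sym (np-sum (1 + w))))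
        (trans (shuffle s₂ (A₁ + A₁ + (A₂ + A₂)) n s₀ a₁ a₂) (trans (cong₂ (λ x y → 4 + x + (y + suc n + (s₀ + s₀ + 3 + 6))) sum-nrh A₁₂) (lem w (l + d) s₀))))
        where
        shuffle : ∀ s a n s₀ a₁ a₂ → 4 + (s + s) + (a + suc n + (s₀ + s₀ + 3 + 6 + (a₂ + a₂) + (a₁ + a₁))) + (6 + s₀ + (6 + s₀))
          ≡ 4 + (s + a₂ + a₁ + (s + a₂ + a₁) + (6 + s₀ + (6 + s₀))) + (a + suc n + (s₀ + s₀ + 3 + 6))
        shuffle = solve-∀
        lem : ∀ w r s₀ → 4 + w * (1 + 1 + w + 1) + (r * (1 + w + (1 + w) + r + 1) + suc (2 + (w + r)) + (s₀ + s₀ + 3 + 6)) ≡ (2 + (w + r)) * (2 + (w + r)) + (6 + s₀ + (6 + s₀))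
        lem = solve-∀

    module _ {N τ lo hi : ℕ} {K : NSer} (sK : Supp K lo hi τ) (N≤ : N * τ ≤ TriP (nrh h) 1 (2 + 3 * j₁) c₂ lo) (deg : 1 + (hi + sum3 o l) + lo ≤ n * n) where
      open Supp sK
      private
        X cX : NSer
        X = Bit3 o l K
        cX = Bit3 o l (cum K)

        Y₁ : NSer
        Y₁ = TriP (nrh h) 1 w c₂
        m₁ : Mono Y₁
        m₁ = Mono-TriP (nrh h) 1 w (cum-Mono (shN 2 δ))
        b₁ : ∀ m → Y₁ m ≤ tauP 3 (nrh h) 1 w 1
        b₁ = ≤τ-TriP (nrh h) 1 w c₂-≤
        b₂ = ≤τ-TriP all (1 + w) l b₁

        below : Below N (hi + sum3 o l) (4 + (s₂ + s₂) ℕ.∸ lo + (A₁ + A₁) + (A₂ + A₂) + suc n) (tauP 2 all (1 + w) l τ)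
          (2 * tauP 3 all (1 + w + l) d (tauP 3 all (1 + w) l (tauP 3 (nrh h) 1 w 1))) cX cY
        below = below-bit (suc n) (≤τ-TriP all (1 + w + l) d b₂) (below-TriP all (1 + w + l) d b₂
          (below-pair3 o (1 + w) l (subst (λ x → x + l ≤ 3 * suc o) 1+w≡ o≥) m₁ b₁ (below-base m₁ b₁ (palin-TriP (nrh h) 1 w c₂-palin) zero-below ≤total full-above N≤)))

      -- Here T_j has no factor set apart as common with T₀, so the window on its side is a single
      -- coefficient, of length 1.
      near-dom : ∀ m → 3 * N * X m ≤ 2 * (12 * j + 6) * T₀ n m
      near-dom m = begin
        3 * N * X m ≡⟨ *-assoc 3 N _ ⟩
        3 * (N * X m) ≤⟨ subst (λ w → 3 * (N * X m) ≤ 2 * (S * w)) (box-sh M 2 (Y δ) m)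
          (window-dom {M = M} {1} m spread below (Bit3-Mono o l (cum-Mono K)) (Bit3-bound o (1 + w) l ≤total)
            (*-mono-≤ {1} {2} (s≤s z≤n) (tauP-≥1 3 all (1 + w + l) d (s≤s z≤n) (tauP-≥1 3 all (1 + w) l (s≤s z≤n) (tauP-≥1 3 (nrh h) 1 w (s≤s z≤n) ≤-refl))))
            len ex ew) ⟩
        2 * (S * shN 2 (box M (Y δ)) m) ≤⟨ *-monoʳ-≤ 2 (*-mono-≤ S≤ (T₀-≽ m)) ⟩
        2 * ((12 * j + 6) * T₀ n m) ≡⟨ *-assoc 2 (12 * j + 6) (T₀ n m) ⟨
        2 * (12 * j + 6) * T₀ n m ∎
        where
        open ≤-Reasoning
        len : 1 + (hi + sum3 o l) ≤ 4 + (s₂ + s₂) ℕ.∸ lo + (A₁ + A₁) + (A₂ + A₂) + suc n + M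
        len = ≤-trans (∸-shift (1 + (hi + sum3 o l)) lo (4 + (s₂ + s₂)) _ (≤-trans deg (≤-reflexive (sym total≡)))) (≤-reflexive (lem (4 + (s₂ + s₂) ℕ.∸ lo) (A₁ + A₁) (A₂ + A₂) (suc n) M))
          where
          lem : ∀ a b c d e → a + (b + c + d + e) ≡ a + b + c + d + e
          lem = solve-∀
        ex : X m + shN 1 cX m ≡ cX m
        ex = trans (cong (X m +_) (shN-cong 1 (λ i → sym (cum-Bit3 o l K i)) m)) (trans (cum-step X m) (cum-Bit3 o l K m))
        ew : box M (shN 2 (Y δ)) m + shN M cY m ≡ cY m
        ew = trans (cong (box M (shN 2 (Y δ)) m +_) (shN-cong M (λ i → sym (cY≗ i)) m)) (trans (box-cum M (shN 2 (Y δ)) m) (cY≗ m))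

-- Enough choices of small weight

module Counting where

  open Windows
  open IntervalProducts
  open Boxes
  open FarSummands
  open NearSummands
  open import Data.Bool using (Bool; true; false; _∧_; if_then_else_; T)
  open import Data.List using (List; []; _∷_; replicate)
  open import Data.Nat as ℕ using (ℕ; zero; suc; _+_; _*_; _^_; _≤_; _<_; z≤n; s≤s; _≡ᵇ_; _<ᵇ_)
  open import Data.Nat.DivMod using (_/_; _%_; m≡m%n+[m/n]*n; m%n<n)
  open import Data.Nat.Properties as ℕ
  open import Data.Nat.Tactic.RingSolver using (solve-∀)
  open import Data.Unit using (tt)
  open import Relation.Binary.PropositionalEquality hiding (setoid)
  open import Relation.Nullary using (yes; no)

  -- The totals τ to be beaten satisfy 9^(j+1) τ ≤ 64 · 64^j, so that  many  says j²(j+1) τ ≤ count.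

  record Plenty (j w : ℕ) : Set where
    field
      h : ℕ
      3≤h : 3 ≤ h
      h≤ : suc h + suc h ≤ 3 * j
      M≥ : 12 * j ≤ np (3 * j) + 6 + (h + h + (h + h)) + (suc h + suc h + (suc h + suc h))
      many : j * j * suc j * (64 * 64 ^ j) ≤ 9 ^ suc j * TriP (nrh h) 1 w c₂ (3 * (j * j) + 3 * j)

  nth : List ℕ → ℕ → ℕ
  nth [] i = 0
  nth (x ∷ xs) zero = x
  nth (x ∷ xs) (suc i) = nth xs i

  -- Cutting off at the length of the first list keeps the tables at a fixed size. Positions beyond
  -- the end read as 0, which is safe for lower bounds.
  addT : List ℕ → List ℕ → List ℕ
  addT [] ys = []
  addT (x ∷ xs) [] = x ∷ xs
  addT (x ∷ xs) (y ∷ ys) = x + y ∷ addT xs ys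

  delay : ℕ → List ℕ → List ℕ
  delay zero xs = xs
  delay (suc k) xs = 0 ∷ delay k xs

  triL : ℕ → List ℕ → List ℕ
  triL k xs = addT (addT xs (delay k xs)) (delay (k + k) xs)

  TriPL : (ℕ → Bool) → ℕ → ℕ → List ℕ → List ℕ
  TriPL χ a zero xs = xs
  TriPL χ a (suc l) xs = if χ (suc (a + l)) then triL (suc (a + l)) (TriPL χ a l xs) else TriPL χ a l xs

  nth-addT : ∀ xs ys i → nth (addT xs ys) i ≤ nth xs i + nth ys i
  nth-addT [] ys i = z≤n
  nth-addT (x ∷ xs) [] i = m≤m+n _ 0
  nth-addT (x ∷ xs) (y ∷ ys) zero = ≤-refl
  nth-addT (x ∷ xs) (y ∷ ys) (suc i) = nth-addT xs ys i

  nth-delay : ∀ k xs i → nth (delay k xs) i ≡ shN k (nth xs) i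
  nth-delay zero xs i = refl
  nth-delay (suc k) xs zero = refl
  nth-delay (suc k) xs (suc i) = nth-delay k xs i

  nth-triL : ∀ k xs → nth (triL k xs) ≼ tri k (nth xs)
  nth-triL k xs i = ≤-trans (nth-addT (addT xs (delay k xs)) (delay (k + k) xs) i)
    (+-mono-≤ (≤-trans (nth-addT xs (delay k xs) i) (+-monoʳ-≤ (nth xs i) (≤-reflexive (nth-delay k xs i)))) (≤-reflexive (nth-delay (k + k) xs i)))

  nth-TriPL : ∀ χ a l xs → nth (TriPL χ a l xs) ≼ TriP χ a l (nth xs)
  nth-TriPL χ a zero xs i = ≤-refl
  nth-TriPL χ a (suc l) xs i with χ (suc (a + l))
  ... | true = ≤-trans (nth-triL (suc (a + l)) (TriPL χ a l xs) i) (tri-mono (suc (a + l)) (nth-TriPL χ a l xs) i)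
  ... | false = nth-TriPL χ a l xs i

  scan : (ℕ → Bool) → ℕ → ℕ → List ℕ → Bool
  scan χ zero j₁ xs = true
  scan χ (suc f) j₁ xs = (suc j₁ * suc j₁ * suc (suc j₁) * (64 * 64 ^ suc j₁) <ᵇ suc (9 ^ suc (suc j₁) * nth xs (3 * (suc j₁ * suc j₁) + 3 * suc j₁)))
    ∧ scan χ f (suc j₁) (TriPL χ (3 + 3 * j₁) 3 xs)

  scan-sound : ∀ χ f j₁ xs → nth xs ≼ TriP χ 1 (2 + 3 * j₁) c₂ → scan χ f j₁ xs ≡ true → ∀ i → i < f →
    let k = i + j₁ ; j = suc k in j * j * suc j * (64 * 64 ^ j) ≤ 9 ^ suc j * TriP χ 1 (2 + 3 * k) c₂ (3 * (j * j) + 3 * j)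
  scan-sound χ (suc f) j₁ xs lb e i i< with suc j₁ * suc j₁ * suc (suc j₁) * (64 * 64 ^ suc j₁) <ᵇ suc (9 ^ suc (suc j₁) * nth xs (3 * (suc j₁ * suc j₁) + 3 * suc j₁)) in eq
  scan-sound χ (suc f) j₁ xs lb e zero i< | true = ≤-trans (≤-pred (<ᵇ⇒< _ _ (subst T (sym eq) tt))) (*-monoʳ-≤ (9 ^ suc (suc j₁)) (lb _))
  scan-sound χ (suc f) j₁ xs lb e (suc i) (s≤s i<) | true = subst (λ k → suc k * suc k * suc (suc k) * (64 * 64 ^ suc k) ≤ 9 ^ suc (suc k) * TriP χ 1 (2 + 3 * k) c₂ (3 * (suc k * suc k) + 3 * suc k)) (+-suc i j₁)
    (scan-sound χ f (suc j₁) (TriPL χ (3 + 3 * j₁) 3 xs) (λ m → ≤-trans (nth-TriPL χ (3 + 3 * j₁) 3 xs m) (≤-trans (TriP-mono χ (3 + 3 * j₁) 3 lb m)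
       (≤-reflexive (trans (sym (TriP-++ χ 1 (2 + 3 * j₁) 3 c₂ m)) (cong (λ l → TriP χ 1 l c₂ m) (lem j₁)))))) e i i<)
    where
    lem : ∀ j → 2 + 3 * j + 3 ≡ 2 + 3 * suc j
    lem = solve-∀

  -- A prefix of the partial sums `c₂`, so that multiplying by trinomials yields cumulative counts
  -- at once.
  start : ℕ → List ℕ
  start n = 0 ∷ 0 ∷ replicate n 1

  start-≼ : ∀ n → nth (start n) ≼ c₂
  start-≼ n 0 = z≤n
  start-≼ n 1 = z≤n
  start-≼ n (suc (suc m)) = ≤-trans (go n m) (≤-reflexive (sym (c m)))
    where
    go : ∀ n m → nth (replicate n 1) m ≤ 1
    go zero m = z≤n
    go (suc n) zero = ≤-refl
    go (suc n) (suc m) = go n m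
    c : ∀ m → c₂ (2 + m) ≡ 1
    c zero = refl
    c (suc m) = trans (+-identityʳ _) (c m)

  table : ℕ → ℕ → ℕ → List ℕ
  table h j₁ n = TriPL (nrh h) 1 (2 + 3 * j₁) (start n)

  table-≼ : ∀ h j₁ n → nth (table h j₁ n) ≼ TriP (nrh h) 1 (2 + 3 * j₁) c₂
  table-≼ h j₁ n m = ≤-trans (nth-TriPL (nrh h) 1 (2 + 3 * j₁) (start n) m) (TriP-mono (nrh h) 1 (2 + 3 * j₁) (start-≼ n) m)

  all< : (ℕ → Bool) → ℕ → Bool
  all< P zero = true
  all< P (suc f) = P f ∧ all< P f

  all<-sound : ∀ P f → all< P f ≡ true → ∀ i → i < f → P i ≡ true
  all<-sound P (suc f) e i i< with P f in eq | i ≟ f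
  ... | true | yes refl = eq
  ... | true | no ≢ = all<-sound P f e i (≤∧≢⇒< (≤-pred i<) ≢)

  private
    -- 2h + 2 = 50 is the largest even number within 3·17, and the resulting window suffices up to j
    -- = 23, where the bound on the weights is 3·23·24 = 1656. From j = 24 on 2h + 2 = 72 = 3·24 is
    -- possible; it suffices up to j = 44, with 3·44·45 = 5940.
    scan₁ : scan (nrh 24) 7 16 (table 24 16 1656) ≡ true
    scan₁ = refl
    scan₂ : scan (nrh 35) 21 23 (table 35 23 5940) ≡ true
    scan₂ = refl

    M-small : ℕ → ℕ → Bool
    M-small h j = 12 * j <ᵇ suc (np (3 * j) + 6 + (h + h + (h + h)) + (suc h + suc h + (suc h + suc h)))

    plenty₁ : ∀ i → i < 7 → Plenty (suc (i + 16)) (2 + 3 * (i + 16))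
    plenty₁ i i< = record { h = 24 ; 3≤h = ≤ᵇ⇒≤ 3 24 _ ; h≤ = ≤-trans (≤ᵇ⇒≤ 50 51 _) (*-monoʳ-≤ 3 (s≤s (m≤n+m 16 i)))
      ; M≥ = ≤-pred (<ᵇ⇒< _ _ (subst T (sym (all<-sound (λ i → M-small 24 (suc (i + 16))) 7 refl i i<)) tt))
      ; many = scan-sound (nrh 24) 7 16 (table 24 16 1656) (table-≼ 24 16 1656) scan₁ i i< }

    plenty₂ : ∀ i → i < 21 → Plenty (suc (i + 23)) (2 + 3 * (i + 23))
    plenty₂ i i< = record { h = 35 ; 3≤h = ≤ᵇ⇒≤ 3 35 _ ; h≤ = *-monoʳ-≤ 3 (s≤s (m≤n+m 23 i))
      ; M≥ = ≤-pred (<ᵇ⇒< _ _ (subst T (sym (all<-sound (λ i → M-small 35 (suc (i + 23))) 21 refl i i<)) tt))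
      ; many = scan-sound (nrh 35) 21 23 (table 35 23 5940) (table-≼ 35 23 5940) scan₂ i i< }

  np-≤ : ∀ m → np (suc m) ≤ 3 * suc m
  np-≤ zero = ≤-refl
  np-≤ (suc m) with suc (suc m) ≡ᵇ np (suc m) in e
  ... | true = *-monoʳ-≤ 3 (≤-reflexive (sym (≡ᵇ-sound (suc (suc m)) (np (suc m)) e)))
  ... | false = ≤-trans (np-≤ m) (*-monoʳ-≤ 3 (n≤1+n (suc m)))

  -- Of the numbers 1, ..., 4 + x exactly 1, 2, 4 and the powers of 3 are left out; if there are i
  -- such powers of 3, then `np` is 3^(i+1).
  cnt-nrs : ∀ x → 3 ^ cntP nrs 1 (3 + x) * (9 * np (4 + x)) ≡ 3 ^ (4 + x)
  cnt-nrs zero = refl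
  cnt-nrs (suc x) with 5 + x ≡ᵇ np (4 + x)
  ... | true = trans (cong (λ c → 3 ^ c * (9 * (3 * np (4 + x)))) (+-identityʳ (cntP nrs 1 (3 + x)))) (trans (lem (3 ^ cntP nrs 1 (3 + x)) (np (4 + x))) (cong (3 *_) (cnt-nrs x)))
    where
    lem : ∀ a b → a * (9 * (3 * b)) ≡ 3 * (a * (9 * b))
    lem = solve-∀
  ... | false = trans (cong (λ c → 3 ^ c * (9 * np (4 + x))) (+-comm (cntP nrs 1 (3 + x)) 1)) (trans (lem (3 ^ cntP nrs 1 (3 + x)) (np (4 + x))) (cong (3 *_) (cnt-nrs x)))
    where
    lem : ∀ a b → 3 * a * (9 * b) ≡ 3 * (a * (9 * b))
    lem = solve-∀

  -- By symmetry at least half of all choices have at most the average weight.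
  half-count : ∀ x lo → sumP nrs 1 (3 + x) + 2 ≤ lo → 3 ^ (4 + x) ≤ TriP nrs 1 (3 + x) c₂ lo * (54 * (4 + x))
  half-count x lo p = begin
    3 ^ (4 + x) ≡⟨ cnt-nrs x ⟨
    3 ^ cntP nrs 1 (3 + x) * (9 * np (4 + x)) ≡⟨ cong (_* (9 * np (4 + x))) (trans (tauP-^ 3 nrs 1 (3 + x) 1) (*-identityʳ (3 ^ cntP nrs 1 (3 + x)))) ⟨
    tauP 3 nrs 1 (3 + x) 1 * (9 * np (4 + x)) ≤⟨ *-mono-≤ τ≤ (*-monoʳ-≤ 9 (np-≤ (3 + x))) ⟩
    (c lo + c lo) * (9 * (3 * (4 + x))) ≡⟨ lem (c lo) (4 + x) ⟩
    c lo * (54 * (4 + x)) ∎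
    where
    open ≤-Reasoning
    c = TriP nrs 1 (3 + x) c₂
    s = sumP nrs 1 (3 + x)
    mono : Mono c
    mono = Mono-TriP nrs 1 (3 + x) (cum-Mono (shN 2 δ))
    τ≤ : tauP 3 nrs 1 (3 + x) 1 ≤ c lo + c lo
    τ≤ = ≤-trans (≤-reflexive (sym (Palin.sym-sum (palin-TriP nrs 1 (3 + x) c₂-palin) (s + 1) (s + 2) (mid s)))) (+-mono-≤ (mono (≤-trans (+-monoʳ-≤ s (s≤s z≤n)) p)) (mono p))
      where
      mid : ∀ s → s + 1 + (s + 2) + 1 ≡ 4 + (s + s)
      mid = solve-∀
    lem : ∀ c x → (c + c) * (9 * (3 * x)) ≡ c * (54 * x)
    lem = solve-∀

  private
    -- For j = 5i + ρ with ρ ≤ 4 the cube bounds j²(j + 1), and 648 i = 54 · 12 i is the loss in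
    -- `half-count` when the indices go up to 12i; b collects the constants.
    poly : ℕ → ℕ → ℕ
    poly b i = (5 * i + 5) * (5 * i + 5) * (5 * i + 5) * (i * 648) * b

    poly-step : ∀ b i → 1 ≤ i → poly b (suc i) ≤ 16 * poly b i
    poly-step b i 1≤i = ≤-trans (*-monoˡ-≤ b (*-mono-≤ (*-mono-≤ (*-mono-≤ p p) p) q)) (≤-reflexive (lem (5 * i + 5) (i * 648) b))
      where
      p : 5 * suc i + 5 ≤ 2 * (5 * i + 5)
      p = ≤-trans (m≤m+n _ (5 * i)) (≤-reflexive (l i))
        where
        l : ∀ i → 5 * suc i + 5 + 5 * i ≡ 2 * (5 * i + 5)
        l = solve-∀
      q : suc i * 648 ≤ 2 * (i * 648)
      q = ≤-trans (*-monoˡ-≤ 648 {suc i} {2 * i} (≤-trans (+-monoˡ-≤ i 1≤i) (≤-reflexive (cong (i +_) (sym (+-identityʳ i)))))) (≤-reflexive (*-assoc 2 i 648))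
      lem : ∀ a b c → 2 * a * (2 * a) * (2 * a) * (2 * b) * c ≡ 16 * (a * a * a * b * c)
      lem = solve-∀

    pow-suc : ∀ a m k → a ^ (m * suc k) ≡ a ^ m * a ^ (m * k)
    pow-suc a m k = trans (cong (a ^_) (*-suc m k)) (^-distribˡ-+-* a m (m * k))

    -- Raising i by one multiplies the left side by at most 16 a^5 and the right side by b^5 c^12.
    -- For 64, 9 and 3 this is 2^34 < 3^22.
    growth-from : ∀ a b c (p : ℕ → ℕ) → 16 * a ^ 5 ≤ b ^ 5 * c ^ 12 → (∀ i → 1 ≤ i → p (suc i) ≤ 16 * p i) → ∀ k → 1 ≤ k →
      p k * a ^ (5 * k) ≤ b ^ 5 * b ^ (5 * k) * c ^ (12 * k) → ∀ i → p (i + k) * a ^ (5 * (i + k)) ≤ b ^ 5 * b ^ (5 * (i + k)) * c ^ (12 * (i + k))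
    growth-from a b c p r st k 1≤k base zero = base
    growth-from a b c p r st k 1≤k base (suc i) = begin
      p (suc x) * a ^ (5 * suc x) ≡⟨ cong (p (suc x) *_) (pow-suc a 5 x) ⟩
      p (suc x) * (a ^ 5 * a ^ (5 * x)) ≤⟨ *-monoˡ-≤ (a ^ 5 * a ^ (5 * x)) (st x (≤-trans 1≤k (m≤n+m k i))) ⟩
      16 * p x * (a ^ 5 * a ^ (5 * x)) ≡⟨ lem₁ 16 (p x) (a ^ 5) (a ^ (5 * x)) ⟩
      16 * a ^ 5 * (p x * a ^ (5 * x)) ≤⟨ *-mono-≤ r (growth-from a b c p r st k 1≤k base i) ⟩
      b ^ 5 * c ^ 12 * (b ^ 5 * b ^ (5 * x) * c ^ (12 * x)) ≡⟨ lem₂ (b ^ 5) (c ^ 12) (b ^ (5 * x)) (c ^ (12 * x)) ⟩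
      b ^ 5 * (b ^ 5 * b ^ (5 * x)) * (c ^ 12 * c ^ (12 * x)) ≡⟨ cong₂ (λ u v → b ^ 5 * u * v) (pow-suc b 5 x) (pow-suc c 12 x) ⟨
      b ^ 5 * b ^ (5 * suc x) * c ^ (12 * suc x) ∎
      where
      open ≤-Reasoning
      x = i + k
      lem₁ : ∀ a p b c → a * p * (b * c) ≡ a * b * (p * c)
      lem₁ = solve-∀
      lem₂ : ∀ b c u v → b * c * (b * u * v) ≡ b * (b * u) * (c * v)
      lem₂ = solve-∀

    many-arith : ∀ {N n b u eρ A s f k g t v c} → 1 ≤ k * s → u ≡ eρ * A → N ≤ n → eρ * s ≤ f → n * k * (b * f) * A ≤ g * t → g ≡ v * s → t ≤ c * k → N * (b * u) ≤ v * c
    many-arith {N} {n} {b} {u} {eρ} {A} {s} {f} {k} {g} {t} {v} {c} ks eu Nn es gr eg tc = *-cancelʳ-≤ _ _ (k * s) {{ℕ.>-nonZero ks}} (begin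
      N * (b * u) * (k * s) ≡⟨ cong (λ z → N * (b * z) * (k * s)) eu ⟩
      N * (b * (eρ * A)) * (k * s) ≡⟨ lem₁ N b eρ A k s ⟩
      N * k * (b * (eρ * s)) * A ≤⟨ *-monoˡ-≤ A (*-mono-≤ (*-monoˡ-≤ k Nn) (*-monoʳ-≤ b es)) ⟩
      n * k * (b * f) * A ≤⟨ gr ⟩
      g * t ≡⟨ cong (_* t) eg ⟩
      v * s * t ≤⟨ *-monoʳ-≤ (v * s) tc ⟩
      v * s * (c * k) ≡⟨ lem₂ v s c k ⟩
      v * c * (k * s) ∎)
      where
      open ≤-Reasoning
      lem₁ : ∀ N b e A k s → N * (b * (e * A)) * (k * s) ≡ N * k * (b * (e * s)) * A
      lem₁ = solve-∀
      lem₂ : ∀ v s c k → v * s * (c * k) ≡ v * c * (k * s)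
      lem₂ = solve-∀

    pow-swap : ∀ a b ρ σ m → b ≤ a → ρ + σ ≡ m → a ^ ρ * b ^ σ ≤ a ^ m
    pow-swap a b ρ σ m b≤a e = ≤-trans (*-monoʳ-≤ (a ^ ρ) (^-monoˡ-≤ σ b≤a)) (≤-reflexive (trans (sym (^-distribˡ-+-* a ρ σ)) (cong (a ^_) e)))

    pow-split : ∀ a {m} ρ x → m ≡ ρ + x → a ^ m ≡ a ^ ρ * a ^ x
    pow-split a ρ x e = trans (cong (a ^_) e) (^-distribˡ-+-* a ρ x)

    pow-join : ∀ a {m} ρ x σ → ρ + x ≡ m + σ → a ^ ρ * a ^ x ≡ a ^ m * a ^ σ
    pow-join a {m} ρ x σ e = trans (sym (^-distribˡ-+-* a ρ x)) (trans (cong (a ^_) e) (^-distribˡ-+-* a m σ))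

    -- With j = ρ + 5i only the indices up to 12i are kept. Their average total weight is at most
    -- about (12i)²/2 = 72 i², below lo ≥ 3(5i)² = 75 i², so at least half of all choices count.
    -- Taking 2h above 12i keeps the two removed indices out of the way.
    module Large (i′ ρ σ j w x : ℕ) (ρσ : ρ + σ ≡ 4) (ej : j ≡ ρ + 5 * (i′ + 9)) (ew : suc w ≡ 3 * j) (4+x : 4 + x ≡ 12 * (i′ + 9)) where
      i h lo : ℕ
      i = i′ + 9
      h = 6 * i + ρ + 1
      lo = 3 * (j * j) + 3 * j

      ρ≤4 : ρ ≤ 4
      ρ≤4 = subst (ρ ≤_) ρσ (m≤m+n ρ σ)

      5i≤j : 5 * i ≤ j
      5i≤j = subst (5 * i ≤_) (sym ej) (m≤n+m (5 * i) ρ)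

      below-h : ∀ k → k ≤ 12 * i → k < h + h
      below-h k p = ≤-trans (s≤s p) (≤-trans (m≤m+n _ (ρ + ρ + 1)) (≤-reflexive (lem i ρ)))
        where
        lem : ∀ i ρ → suc (12 * i) + (ρ + ρ + 1) ≡ 6 * i + ρ + 1 + (6 * i + ρ + 1)
        lem = solve-∀

      small-average : sumP nrs 1 (3 + x) + 2 ≤ lo
      small-average = *-cancelˡ-≤ 2 (begin
        2 * (s + 2) ≡⟨ lem₀ s ⟩
        s + s + 4 ≤⟨ +-monoˡ-≤ 4 (+-mono-≤ s≤ s≤) ⟩
        sumP all 1 (3 + x) + sumP all 1 (3 + x) + 4 ≡⟨ cong (_+ 4) (sumP-all 1 (3 + x)) ⟩
        (3 + x) * (1 + 1 + (3 + x) + 1) + 4 ≤⟨ m≤m+n _ (x + 2) ⟩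
        (3 + x) * (1 + 1 + (3 + x) + 1) + 4 + (x + 2) ≡⟨ lem₂ x ⟩
        (4 + x) * (4 + x) + 2 * (4 + x) + 0 ≤⟨ +-monoʳ-≤ ((4 + x) * (4 + x) + 2 * (4 + x)) z≤n ⟩
        (4 + x) * (4 + x) + 2 * (4 + x) + 6 * i ≡⟨ cong (λ y → y * y + 2 * y + 6 * i) 4+x ⟩
        12 * i * (12 * i) + 2 * (12 * i) + 6 * i ≤⟨ m≤m+n _ (6 * (i * i)) ⟩
        12 * i * (12 * i) + 2 * (12 * i) + 6 * i + 6 * (i * i) ≡⟨ lem₁ i ⟩
        2 * (3 * (5 * i * (5 * i)) + 3 * (5 * i)) ≤⟨ *-monoʳ-≤ 2 (+-mono-≤ (*-monoʳ-≤ 3 (*-mono-≤ 5i≤j 5i≤j)) (*-monoʳ-≤ 3 5i≤j)) ⟩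
        2 * lo ∎)
        where
        open ≤-Reasoning
        s = sumP nrs 1 (3 + x)
        s≤ : s ≤ sumP all 1 (3 + x)
        s≤ = ≤-trans (m≤n+m s (sumP (all ∩ rsv) 1 (3 + x))) (≤-reflexive (sym (sumP-split all rsv 1 (3 + x))))
        lem₀ : ∀ s → 2 * (s + 2) ≡ s + s + 4
        lem₀ = solve-∀
        lem₂ : ∀ x → (3 + x) * (1 + 1 + (3 + x) + 1) + 4 + (x + 2) ≡ (4 + x) * (4 + x) + 2 * (4 + x) + 0
        lem₂ = solve-∀
        lem₁ : ∀ i → 12 * i * (12 * i) + 2 * (12 * i) + 6 * i + 6 * (i * i) ≡ 2 * (3 * (5 * i * (5 * i)) + 3 * (5 * i))
        lem₁ = solve-∀

      w≡ : w ≡ 3 + x + (3 * i + 3 * ρ)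
      w≡ = suc-injective (trans ew (trans (cong (3 *_) ej) (trans (lem i ρ) (cong (_+ (3 * i + 3 * ρ)) (sym 4+x)))))
        where
        lem : ∀ i ρ → 3 * (ρ + 5 * i) ≡ 12 * i + (3 * i + 3 * ρ)
        lem = solve-∀

      c≥ : TriP nrs 1 (3 + x) c₂ lo ≤ TriP (nrh h) 1 w c₂ lo
      c≥ = ≤-trans (≤-reflexive (TriP-ext 1 (3 + x) c₂ (λ k _ k≤ → sym (nrh-small k (≤-trans k≤ (≤-reflexive 4+x)))) lo))
        (≤-trans (TriP-≼ (nrh h) (1 + (3 + x)) (3 * i + 3 * ρ) (TriP (nrh h) 1 (3 + x) c₂) lo)
          (≤-reflexive (trans (sym (TriP-++ (nrh h) 1 (3 + x) (3 * i + 3 * ρ) c₂ lo)) (cong (λ l → TriP (nrh h) 1 l c₂ lo) (sym w≡)))))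
        where
        nrh-small : ∀ k → k ≤ 12 * i → nrh h k ≡ nrs k
        nrh-small k p = trans (∖-other (nrs ∖ (suc h + suc h)) (h + h) k (<⇒≢ (below-h k p))) (∖-other nrs (suc h + suc h) k (<⇒≢ (<-≤-trans (below-h k p) (+-mono-≤ (n≤1+n h) (n≤1+n h)))))

      j<5i+5 : suc j ≤ 5 * i + 5
      j<5i+5 = ≤-trans (s≤s (≤-reflexive ej)) (≤-trans (s≤s (+-monoˡ-≤ (5 * i) ρ≤4)) (≤-reflexive (+-comm 5 (5 * i))))

      1≤i : 1 ≤ i
      1≤i = ≤-trans (s≤s z≤n) (m≤n+m 9 i′)

      many : j * j * suc j * (64 * 64 ^ j) ≤ 9 ^ suc j * TriP (nrh h) 1 w c₂ lo
      many = many-arith {j * j * suc j} {(5 * i + 5) * (5 * i + 5) * (5 * i + 5)} {64} {64 ^ j} {64 ^ ρ} {64 ^ (5 * i)} {9 ^ σ} {64 ^ 4} {i * 648} {9 ^ 5 * 9 ^ (5 * i)} {3 ^ (12 * i)} {9 ^ suc j} {TriP (nrh h) 1 w c₂ lo} (*-mono-≤ {1} {i * 648} (*-mono-≤ {1} {i} {1} {648} 1≤i (s≤s z≤n)) (m^n>0 9 σ)) (pow-split 64 ρ (5 * i) ej)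
        (*-mono-≤ (*-mono-≤ (≤-trans (n≤1+n j) j<5i+5) (≤-trans (n≤1+n j) j<5i+5)) j<5i+5) (pow-swap 64 9 ρ σ 4 (≤ᵇ⇒≤ 9 64 _) ρσ)
        (growth-from 64 9 3 (poly (64 * 64 ^ 4)) (≤ᵇ⇒≤ (16 * 64 ^ 5) (9 ^ 5 * 3 ^ 12) _) (poly-step (64 * 64 ^ 4)) 9 (s≤s z≤n)
          (≤ᵇ⇒≤ (poly (64 * 64 ^ 4) 9 * 64 ^ 45) (9 ^ 5 * 9 ^ 45 * 3 ^ 108) _) i′)
        (pow-join 9 5 (5 * i) σ e9)
        (≤-trans (≤-reflexive (cong (3 ^_) (sym 4+x))) (≤-trans (half-count x lo small-average) (*-mono-≤ c≥ (≤-reflexive (trans (cong (54 *_) 4+x) (lem i))))))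
        where
        lem : ∀ i → 54 * (12 * i) ≡ i * 648
        lem = solve-∀
        e9 : 5 + 5 * i ≡ suc j + σ
        e9 = trans (cong (λ z → suc z + 5 * i) (sym ρσ)) (trans (lem′ ρ σ (5 * i)) (cong (λ z → suc z + σ) (sym ej)))
          where
          lem′ : ∀ ρ σ i → suc (ρ + σ) + i ≡ suc (ρ + i) + σ
          lem′ = solve-∀

      large : Plenty j w
      large = record { h = h ; 3≤h = ≤-trans (*-mono-≤ {3} {6} {1} {i} (≤ᵇ⇒≤ 3 6 _) 1≤i) (≤-trans (m≤m+n (6 * i) ρ) (m≤m+n _ 1))
        ; h≤ = ≤-trans (≤-trans (m≤m+n _ _) (≤-reflexive (lem₁ i′ ρ))) (≤-reflexive (cong (3 *_) (sym ej)))
        ; M≥ = ≤-trans (≤-reflexive (cong (12 *_) ej)) (≤-trans (≤-trans (≤-trans (≤-reflexive (lem₂ i ρ)) (+-monoˡ-≤ (60 * i) (+-monoʳ-≤ (11 * ρ) ρ≤4))) (≤-trans (m≤m+n _ (3 * i + 15)) (≤-reflexive (lem₃ i ρ))))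
            (+-monoˡ-≤ (suc h + suc h + (suc h + suc h)) (+-monoˡ-≤ (h + h + (h + h)) (+-monoˡ-≤ 6 (≤-trans (≤-reflexive (cong (λ z → suc (3 * z)) (sym ej))) (<np (3 * j)))))))
        ; many = many }
        where
        lem₁ : ∀ i ρ → suc (6 * (i + 9) + ρ + 1) + suc (6 * (i + 9) + ρ + 1) + (23 + 3 * i + ρ) ≡ 3 * (ρ + 5 * (i + 9))
        lem₁ = solve-∀
        lem₂ : ∀ i ρ → 12 * (ρ + 5 * i) ≡ 11 * ρ + ρ + 60 * i
        lem₂ = solve-∀
        lem₃ : ∀ i ρ → 11 * ρ + 4 + 60 * i + (3 * i + 15) ≡ suc (3 * (ρ + 5 * i)) + 6 + (6 * i + ρ + 1 + (6 * i + ρ + 1) + (6 * i + ρ + 1 + (6 * i + ρ + 1))) + (suc (6 * i + ρ + 1) + suc (6 * i + ρ + 1) + (suc (6 * i + ρ + 1) + suc (6 * i + ρ + 1)))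
        lem₃ = solve-∀

  plenty : ∀ j₁ → 16 ≤ j₁ → Plenty (suc j₁) (2 + 3 * j₁)
  plenty j₁ 16≤ with j₁ ℕ.<? 23 | j₁ ℕ.<? 44
  ... | yes p | _ = subst (λ k → Plenty (suc k) (2 + 3 * k)) (m∸n+n≡m 16≤) (plenty₁ (j₁ ℕ.∸ 16) (∸-monoˡ-< p 16≤))
  ... | no p | yes q = subst (λ k → Plenty (suc k) (2 + 3 * k)) (m∸n+n≡m (≮⇒≥ p)) (plenty₂ (j₁ ℕ.∸ 23) (∸-monoˡ-< q (≮⇒≥ p)))
  ... | no _ | no q = Large.large i′ ρ (4 ℕ.∸ ρ) (suc j₁) (2 + 3 * j₁) (12 * (i′ + 9) ℕ.∸ 4) (m+[n∸m]≡n (≤-pred (m%n<n x 5)))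
      (trans (cong suc (sym (m+[n∸m]≡n (≮⇒≥ q)))) (trans (cong (λ z → 45 + z) (m≡m%n+[m/n]*n x 5)) (lem ρ i′))) (lem′ j₁) (m+[n∸m]≡n (≤-trans (≤ᵇ⇒≤ 4 108 _) (*-monoʳ-≤ 12 (m≤n+m 9 i′))))
    where
    x = j₁ ℕ.∸ 44
    ρ = x % 5
    i′ = x / 5
    lem : ∀ ρ i → 45 + (ρ + i * 5) ≡ ρ + 5 * (i + 9)
    lem = solve-∀
    lem′ : ∀ j → suc (2 + 3 * j) ≡ 3 * suc j
    lem′ = solve-∀

-- The summands as products of polynomials

module ClosedForms where

  open PowerSeries
  open SingleSum
  open Windows using (NSer; shN)
  open import Data.Nat as ℕ using (ℕ; zero; suc)
  import Data.Nat.Properties as ℕ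
  import Data.Nat.Tactic.RingSolver as ℕ-Ring
  open import Data.Integer as ℤ using (+_)
  import Data.Integer.Properties as ℤ
  open import Data.List using (List; []; _∷_)
  open import Relation.Binary.PropositionalEquality hiding (setoid)
  open FarSummands using (δ)

  -- [a+b ; a] in Q = q³

  qbN : ℕ → ℕ → NSer
  qbN zero b = δ
  qbN (suc a) zero = δ
  qbN (suc a) (suc b) m = qbN a (suc b) m ℕ.+ shN (3 ℕ.* suc a) (qbN (suc a) b) m

  ι : NSer → Ser
  ι f m = + f m

  sh-ι : ∀ k f → sh k (ι f) ≈ ι (shN k f)
  sh-ι zero f m = refl
  sh-ι (suc k) f zero = refl
  sh-ι (suc k) f (suc m) = sh-ι k f m

  ι-δ : ι δ ≈ 1s
  ι-δ zero = refl
  ι-δ (suc m) = refl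

  qb : ℕ → ℕ → Ser
  qb a b = ι (qbN a b)

  qb-suc : ∀ a b → qb (suc a) (suc b) ≈ qb a (suc b) ⊞ q^ (3 ℕ.* suc a) ⊡ qb (suc a) b
  qb-suc a b m = trans (ℤ.pos-+ (qbN a (suc b) m) _) (cong (λ □ → + qbN a (suc b) m ℤ.+ □) (sym (trans (q^-⊡ (3 ℕ.* suc a) (qb (suc a) b) m) (sh-ι (3 ℕ.* suc a) (qbN (suc a) b) m))))

  private

    1⊡ : ∀ f → 1s ⊡ f ≈ f
    1⊡ = ⊡-identityˡ

    ⊡1 : ∀ f → f ⊡ 1s ≈ f
    ⊡1 f = ≈-trans (⊡-comm f 1s) (1⊡ f)

  pochQ-cong : ∀ {a b} → a ≡ b → pochQ a ≈ pochQ b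
  pochQ-cong refl m = refl

  Q-+ : ∀ a b → q^ (3 ℕ.* (a ℕ.+ b)) ≈ q^ (3 ℕ.* a) ⊡ q^ (3 ℕ.* b)
  Q-+ a b = ≈-trans (q^-cong (ℕ.*-distribˡ-+ 3 a b)) (q^-+ (3 ℕ.* a) (3 ℕ.* b))

  -- Induction along the q-Pascal rule; the step is (1 - x) + x(1 - y) = 1 - xy.
  qb-poch : ∀ a b → qb a b ⊡ (pochQ a ⊡ pochQ b) ≈ pochQ (a ℕ.+ b)
  qb-poch zero b = ≈-trans (⊡-cong ι-δ (1⊡ (pochQ b))) (1⊡ (pochQ b))
  qb-poch (suc a) zero = ≈-trans (⊡-cong ι-δ (⊡1 (pochQ (suc a)))) (≈-trans (1⊡ (pochQ (suc a))) (pochQ-cong (sym (ℕ.+-identityʳ (suc a)))))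
  qb-poch (suc a) (suc b) = begin
    qb (suc a) (suc b) ⊡ (pochQ (suc a) ⊡ pochQ (suc b)) ≈⟨ ⊡-congʳ (pochQ (suc a) ⊡ pochQ (suc b)) (qb-suc a b) ⟩
    (u ⊞ x ⊡ v) ⊡ ((pa ⊡ (1s ⊖ x)) ⊡ (pb ⊡ (1s ⊖ y)))
      ≈⟨ solve 6 (λ u v x y pa pb → (u :+ x :* v) :* ((pa :* (c1 :- x)) :* (pb :* (c1 :- y))) := (u :* (pa :* (pb :* (c1 :- y)))) :* (c1 :- x) :+ x :* ((v :* ((pa :* (c1 :- x)) :* pb)) :* (c1 :- y))) ≈-refl u v x y pa pb ⟩
    (u ⊡ (pa ⊡ pochQ (suc b))) ⊡ (1s ⊖ x) ⊞ x ⊡ ((v ⊡ (pochQ (suc a) ⊡ pb)) ⊡ (1s ⊖ y))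
      ≈⟨ ⊞-cong (⊡-congʳ (1s ⊖ x) (≈-trans (qb-poch a (suc b)) (pochQ-cong (ℕ.+-suc a b)))) (⊡-congˡ x (⊡-congʳ (1s ⊖ y) (qb-poch (suc a) b))) ⟩
    pochQ (suc a ℕ.+ b) ⊡ (1s ⊖ x) ⊞ x ⊡ (pochQ (suc a ℕ.+ b) ⊡ (1s ⊖ y))
      ≈⟨ solve 3 (λ x y p → p :* (c1 :- x) :+ x :* (p :* (c1 :- y)) := p :* (c1 :- x :* y)) ≈-refl x y (pochQ (suc a ℕ.+ b)) ⟩
    pochQ (suc a ℕ.+ b) ⊡ (1s ⊖ x ⊡ y) ≈⟨ ⊡-congˡ (pochQ (suc a ℕ.+ b)) (⊖-cong (≈-sym (≈-trans (q^-cong (cong (3 ℕ.*_) (sym (ℕ.+-suc (suc a) b)))) (Q-+ (suc a) (suc b))))) ⟩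
    pochQ (suc (suc a ℕ.+ b)) ≈⟨ pochQ-cong (sym (ℕ.+-suc (suc a) b)) ⟩
    pochQ (suc a ℕ.+ suc b) ∎
    where
    open ≈-Reasoning
    u = qb a (suc b)
    v = qb (suc a) b
    x = q^ (3 ℕ.* suc a)
    y = q^ (3 ℕ.* suc b)
    pa = pochQ a
    pb = pochQ b

  -- [j - 1 + b ; j - 1], zero for j = 0
  qbN⁻ : ℕ → ℕ → NSer
  qbN⁻ zero b _ = 0
  qbN⁻ (suc a) b = qbN a b

  qb⁻ : ℕ → ℕ → Ser
  qb⁻ j b = ι (qbN⁻ j b)

  qb⁻-poch : ∀ j → qb⁻ j (suc (2 ℕ.* j)) ⊡ (pochQ j ⊡ pochQ (suc (2 ℕ.* j))) ≈ pochQ (3 ℕ.* j) ⊡ (1s ⊖ q^ (3 ℕ.* j))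
  qb⁻-poch zero = ≈-trans (⊡-cong {f = qb⁻ 0 1} {f′ = 0s} {g′ = pochQ 0 ⊡ pochQ 1} (λ _ → refl) ≈-refl) (≈-trans (⊡-zeroˡ _) (≈-sym (≈-trans (1⊡ _) (λ m → ℤ.+-inverseʳ (1s m)))))
  qb⁻-poch (suc a) = ≈-trans (solve 4 (λ u p x r → u :* ((p :* x) :* r) := (u :* (p :* r)) :* x) ≈-refl (qb a b) (pochQ a) (1s ⊖ q^ (3 ℕ.* suc a)) (pochQ b))
    (⊡-congʳ (1s ⊖ q^ (3 ℕ.* suc a)) (≈-trans (qb-poch a b) (pochQ-cong (lem a))))
    where
    b = suc (2 ℕ.* suc a)
    lem : ∀ a → a ℕ.+ suc (2 ℕ.* suc a) ≡ 3 ℕ.* suc a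
    lem = ℕ-Ring.solve-∀

  tE : ℕ → Ser
  tE k = 1s ⊞ q^ k ⊞ q^ (k ℕ.+ k)

  TriE Bit3E : ℕ → ℕ → Ser
  TriE a zero = 1s
  TriE a (suc l) = TriE a l ⊡ tE (suc (a ℕ.+ l))
  Bit3E o zero = 1s
  Bit3E o (suc l) = Bit3E o l ⊡ (1s ⊖ q^ (3 ℕ.* suc (o ℕ.+ l)))

  BitE : List ℕ → Ser
  BitE [] = 1s
  BitE (k ∷ ks) = BitE ks ⊡ (1s ⊖ q^ k)

  1-q-tE : ∀ k → (1s ⊖ q^ k) ⊡ tE k ≈ 1s ⊖ q^ (3 ℕ.* k)
  1-q-tE k = ≈-trans (⊡-congˡ (1s ⊖ q^ k) (⊞-cong {1s ⊞ q^ k} ≈-refl (q^-×2 k)))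
    (≈-trans (solve 1 (λ x → (c1 :- x) :* (c1 :+ x :+ x :* x) := c1 :- x :* x :* x) ≈-refl (q^ k)) (⊖-cong (≈-sym (q^-×3 k))))

  poch-TriE : ∀ m → poch m ⊡ TriE 0 m ≈ pochQ m
  poch-TriE zero = 1⊡ 1s
  poch-TriE (suc m) = ≈-trans (solve 4 (λ p x t y → (p :* x) :* (t :* y) := (p :* t) :* (x :* y)) ≈-refl (poch m) (1s ⊖ q^ (suc m)) (TriE 0 m) (tE (suc m)))
    (⊡-cong (poch-TriE m) (1-q-tE (suc m)))

  TriE-++ : ∀ a l k → TriE a (l ℕ.+ k) ≈ TriE a l ⊡ TriE (a ℕ.+ l) k
  TriE-++ a l zero = ≈-trans (λ m → cong (λ i → TriE a i m) (ℕ.+-identityʳ l)) (≈-sym (⊡1 (TriE a l)))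
  TriE-++ a l (suc k) = ≈-trans (λ m → cong (λ i → TriE a i m) (ℕ.+-suc l k))
    (≈-trans (⊡-cong (TriE-++ a l k) (λ m → cong (λ i → tE (suc i) m) (sym (ℕ.+-assoc a l k)))) (⊡-assoc (TriE a l) (TriE (a ℕ.+ l) k) _))

  Bit3E-poch : ∀ o l → pochQ o ⊡ Bit3E o l ≈ pochQ (o ℕ.+ l)
  Bit3E-poch o zero = ≈-trans (⊡1 (pochQ o)) (pochQ-cong (sym (ℕ.+-identityʳ o)))
  Bit3E-poch o (suc l) = ≈-trans (≈-sym (⊡-assoc (pochQ o) (Bit3E o l) _)) (≈-trans (⊡-congʳ _ (Bit3E-poch o l)) (pochQ-cong (sym (ℕ.+-suc o l))))

  lo : ℕ → ℕ
  lo j = 3 ℕ.* (j ℕ.* j) ℕ.+ 3 ℕ.* j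

  -- The factor 1 - qz + u(1 - q²z) of the summand at n = 3j + 1 + r.
  lin : ℕ → ℕ → Ser
  lin j r = 1s ⊖ q^ (suc (3 ℕ.* j)) ⊞ q^ (suc (3 ℕ.* j ℕ.+ r)) ⊡ (1s ⊖ q^ (2 ℕ.+ 3 ℕ.* j))

  num : ℕ → ℕ → Ser
  num j r = q^ (lo j) ⊡ (pochQ (2 ℕ.* j ℕ.+ r) ⊡ poch (3 ℕ.* j) ⊡ lin j r)

  -- With ρ = r + 1 the factor z - u is z(1 - q^ρ): its second part reduces (q;q)_ρ to (q;q)_r, and
  -- z raises the exponent 3j² to `lo j`. The other denominators are units, so F may be verified
  -- after multiplying by them.
  cT-closed : ∀ j r F → F ⊡ (poch r ⊡ (pochQ j ⊡ pochQ (suc (2 ℕ.* j)))) ≈ num j r → cT j (suc r) ≈ F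
  cT-closed j r F e = begin
    cT j (suc r) ≈⟨ ⊡-cong {f = sT j (suc r)} (⊡-congʳ ij (⊡-congʳ i2 (⊡-congʳ (ipoch (suc r)) (⊡-congʳ (poch (3 ℕ.* j)) (⊡-congˡ (q^ (3 ℕ.* (j ℕ.* j))) (pochQ-cong (cong ℕ.pred (ℕ.+-suc (2 ℕ.* j) r)))))))) γ≈ ⟩
    (a ⊡ P ⊡ p3 ⊡ ipoch (suc r) ⊡ i2 ⊡ ij) ⊡ ((z ⊡ (1s ⊖ q^ (suc r))) ⊡ lin j r)
      ≈⟨ solve 9 (λ a P p ir i2 ij z x l → (a :* P :* p :* ir :* i2 :* ij) :* ((z :* x) :* l) := ((a :* z) :* (P :* p :* l)) :* ((ir :* x) :* (ij :* i2))) ≈-refl a P p3 (ipoch (suc r)) i2 ij z (1s ⊖ q^ (suc r)) (lin j r) ⟩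
    ((a ⊡ z) ⊡ (P ⊡ p3 ⊡ lin j r)) ⊡ ((ipoch (suc r) ⊡ (1s ⊖ q^ (suc r))) ⊡ (ij ⊡ i2))
      ≈⟨ ⊡-cong (⊡-congʳ (P ⊡ p3 ⊡ lin j r) (≈-sym (q^-+ (3 ℕ.* (j ℕ.* j)) (3 ℕ.* j)))) (⊡-congʳ (ij ⊡ i2) (ipoch-suc r)) ⟩
    num j r ⊡ (ipoch r ⊡ (ij ⊡ i2)) ≈⟨ ⊡-congʳ (ipoch r ⊡ (ij ⊡ i2)) (≈-sym e) ⟩
    (F ⊡ (poch r ⊡ (pochQ j ⊡ p2))) ⊡ (ipoch r ⊡ (ij ⊡ i2))
      ≈⟨ solve 7 (λ F a b c a′ b′ c′ → (F :* (a :* (b :* c))) :* (a′ :* (b′ :* c′)) := F :* ((a :* a′) :* ((b :* b′) :* (c :* c′)))) ≈-refl F (poch r) (pochQ j) p2 (ipoch r) ij i2 ⟩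
    F ⊡ ((poch r ⊡ ipoch r) ⊡ ((pochQ j ⊡ ij) ⊡ (p2 ⊡ i2))) ≈⟨ ⊡-congˡ F (≈-trans (⊡-cong (poch-ipoch r) (≈-trans (⊡-cong (pochQ-ipochQ j) (pochQ-ipochQ (suc (2 ℕ.* j)))) (1⊡ 1s))) (1⊡ 1s)) ⟩
    F ⊡ 1s ≈⟨ ⊡1 F ⟩
    F ∎
    where
    open ≈-Reasoning
    a = q^ (3 ℕ.* (j ℕ.* j))
    z = q^ (3 ℕ.* j)
    P = pochQ (2 ℕ.* j ℕ.+ r)
    p3 = poch (3 ℕ.* j)
    p2 = pochQ (suc (2 ℕ.* j))
    i2 = ipochQ (suc (2 ℕ.* j))
    ij = ipochQ j
    u = q^ (3 ℕ.* j ℕ.+ suc r)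
    γ≈ : γP z u ≈ (z ⊡ (1s ⊖ q^ (suc r))) ⊡ lin j r
    γ≈ = ⊡-cong {f = z ⊖ u} (≈-trans (⊞-cong {z} ≈-refl (⊟-cong (q^-+ (3 ℕ.* j) (suc r)))) (solve 2 (λ z x → z :- z :* x := z :* (c1 :- x)) ≈-refl z (q^ (suc r))))
      (⊞-cong (⊖-cong (≈-sym (q^-+ 1 (3 ℕ.* j)))) (⊡-cong (q^-cong (ℕ.+-suc (3 ℕ.* j) r)) (⊖-cong (≈-sym (≈-trans (q^-+ 2 (3 ℕ.* j)) (⊡-congʳ z (q^-+ 1 1)))))))

  -- The factor `lin` does not visibly clear the denominators (Q;Q)_j (Q;Q)_(2j+1). Borrowing the
  -- trinomial of index 3j + 1 turns 1 - q^(3j+1) into 1 - Q^(3j+1), and the quotient becomes this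
  -- combination of q-binomials.
  bracket : ℕ → ℕ → Ser
  bracket j n = qb j (suc (2 ℕ.* j)) ⊞ q^ n ⊡ (qb j (2 ℕ.* j) ⊞ q^ (suc (3 ℕ.* j)) ⊡ qb j (2 ℕ.* j) ⊖ q^ (2 ℕ.+ 3 ℕ.* j) ⊡ qb⁻ j (suc (2 ℕ.* j)))

  bracket-poch : ∀ j n → bracket j n ⊡ (pochQ j ⊡ pochQ (suc (2 ℕ.* j))) ≈ pochQ (3 ℕ.* j) ⊡ tE (suc (3 ℕ.* j)) ⊡ (1s ⊖ q^ (suc (3 ℕ.* j)) ⊞ q^ n ⊡ (1s ⊖ q^ (2 ℕ.+ 3 ℕ.* j)))
  bracket-poch j n = begin
    bracket j n ⊡ D ≈⟨ solve 7 (λ a u x b y c D → (a :+ u :* (b :+ x :* b :- y :* c)) :* D := a :* D :+ u :* ((c1 :+ x) :* (b :* D) :- y :* (c :* D))) ≈-refl (qb j (suc (2 ℕ.* j))) u x (qb j (2 ℕ.* j)) y (qb⁻ j (suc (2 ℕ.* j))) D ⟩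
    qb j (suc (2 ℕ.* j)) ⊡ D ⊞ u ⊡ ((1s ⊞ x) ⊡ (qb j (2 ℕ.* j) ⊡ D) ⊖ y ⊡ (qb⁻ j (suc (2 ℕ.* j)) ⊡ D))
      ≈⟨ ⊞-cong e₁ (⊡-congˡ u (⊞-cong (⊡-congˡ (1s ⊞ x) e₂) (⊟-cong (⊡-congˡ y (qb⁻-poch j))))) ⟩
    P ⊡ (1s ⊖ q^ (3 ℕ.* suc (3 ℕ.* j))) ⊞ u ⊡ ((1s ⊞ x) ⊡ (P ⊡ (1s ⊖ q^ (3 ℕ.* suc (2 ℕ.* j)))) ⊖ y ⊡ (P ⊡ (1s ⊖ z)))
      ≈⟨ ⊞-cong (⊡-congˡ P (≈-sym (1-q-tE (suc (3 ℕ.* j))))) (⊡-congˡ u (⊞-cong (⊡-cong (⊞-cong {1s} ≈-refl x≈) (⊡-congˡ P (⊖-cong Q≈))) (⊟-cong (⊡-congʳ (P ⊡ (1s ⊖ z)) y≈)))) ⟩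
    P ⊡ ((1s ⊖ x) ⊡ tE (suc (3 ℕ.* j))) ⊞ u ⊡ ((1s ⊞ q ⊡ z) ⊡ (P ⊡ (1s ⊖ q ⊡ q ⊡ q ⊡ z ⊡ z)) ⊖ (q ⊡ q ⊡ z) ⊡ (P ⊡ (1s ⊖ z)))
      ≈⟨ ⊞-cong (⊡-congˡ P (⊡-cong (⊖-cong x≈) t≈)) ≈-refl ⟩
    P ⊡ ((1s ⊖ q ⊡ z) ⊡ (1s ⊞ q ⊡ z ⊞ (q ⊡ z) ⊡ (q ⊡ z))) ⊞ u ⊡ ((1s ⊞ q ⊡ z) ⊡ (P ⊡ (1s ⊖ q ⊡ q ⊡ q ⊡ z ⊡ z)) ⊖ (q ⊡ q ⊡ z) ⊡ (P ⊡ (1s ⊖ z)))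
      ≈⟨ solve 4 (λ P q z u → P :* ((c1 :- q :* z) :* (c1 :+ q :* z :+ (q :* z) :* (q :* z))) :+ u :* ((c1 :+ q :* z) :* (P :* (c1 :- q :* q :* q :* z :* z)) :- (q :* q :* z) :* (P :* (c1 :- z)))
          := P :* (c1 :+ q :* z :+ (q :* z) :* (q :* z)) :* (c1 :- q :* z :+ u :* (c1 :- q :* q :* z))) ≈-refl P q z u ⟩
    P ⊡ (1s ⊞ q ⊡ z ⊞ (q ⊡ z) ⊡ (q ⊡ z)) ⊡ (1s ⊖ q ⊡ z ⊞ u ⊡ (1s ⊖ q ⊡ q ⊡ z)) ≈⟨ ⊡-cong (⊡-congˡ P (≈-sym t≈)) (⊞-cong (⊖-cong (≈-sym x≈)) (⊡-congˡ u (⊖-cong (≈-sym y≈)))) ⟩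
    P ⊡ tE (suc (3 ℕ.* j)) ⊡ (1s ⊖ x ⊞ u ⊡ (1s ⊖ y)) ∎
    where
    open ≈-Reasoning
    D = pochQ j ⊡ pochQ (suc (2 ℕ.* j))
    P = pochQ (3 ℕ.* j)
    q = q^ 1
    z = q^ (3 ℕ.* j)
    u = q^ n
    x = q^ (suc (3 ℕ.* j))
    y = q^ (2 ℕ.+ 3 ℕ.* j)
    x≈ : x ≈ q ⊡ z
    x≈ = q^-+ 1 (3 ℕ.* j)
    y≈ : y ≈ q ⊡ q ⊡ z
    y≈ = ≈-trans (q^-+ 2 (3 ℕ.* j)) (⊡-congʳ z (q^-+ 1 1))
    t≈ : tE (suc (3 ℕ.* j)) ≈ 1s ⊞ q ⊡ z ⊞ (q ⊡ z) ⊡ (q ⊡ z)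
    t≈ = ⊞-cong (⊞-cong {1s} ≈-refl x≈) (≈-trans (q^-×2 (suc (3 ℕ.* j))) (⊡-cong x≈ x≈))
    Q≈ : q^ (3 ℕ.* suc (2 ℕ.* j)) ≈ q ⊡ q ⊡ q ⊡ z ⊡ z
    Q≈ = ≈-trans (q^-cong (lem j)) (≈-trans (q^-+ (3 ℕ.* 1 ℕ.+ 3 ℕ.* j) (3 ℕ.* j)) (⊡-congʳ z (≈-trans (q^-+ (3 ℕ.* 1) (3 ℕ.* j)) (⊡-congʳ z (q^-×3 1)))))
      where
      lem : ∀ j → 3 ℕ.* suc (2 ℕ.* j) ≡ 3 ℕ.* 1 ℕ.+ 3 ℕ.* j ℕ.+ 3 ℕ.* j
      lem = ℕ-Ring.solve-∀
    e₁ : qb j (suc (2 ℕ.* j)) ⊡ D ≈ P ⊡ (1s ⊖ q^ (3 ℕ.* suc (3 ℕ.* j)))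
    e₁ = ≈-trans (qb-poch j (suc (2 ℕ.* j))) (pochQ-cong (lem j))
      where
      lem : ∀ j → j ℕ.+ suc (2 ℕ.* j) ≡ suc (3 ℕ.* j)
      lem = ℕ-Ring.solve-∀
    e₂ : qb j (2 ℕ.* j) ⊡ D ≈ P ⊡ (1s ⊖ q^ (3 ℕ.* suc (2 ℕ.* j)))
    e₂ = ≈-trans (solve 4 (λ b p r x → b :* (p :* (r :* x)) := (b :* (p :* r)) :* x) ≈-refl (qb j (2 ℕ.* j)) (pochQ j) (pochQ (2 ℕ.* j)) (1s ⊖ q^ (3 ℕ.* suc (2 ℕ.* j))))
      (⊡-congʳ _ (≈-trans (qb-poch j (2 ℕ.* j)) (pochQ-cong (lem j))))
      where
      lem : ∀ j → j ℕ.+ 2 ℕ.* j ≡ 3 ℕ.* j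
      lem = ℕ-Ring.solve-∀

  -- For r ≥ 3j + 1 the quotient (Q;Q)_r / (q;q)_r is a product of trinomials that includes the one
  -- of index 3j + 1, needed for the bracket.
  far-closed : ∀ j e → let r = suc (3 ℕ.* j ℕ.+ e) ; n = suc (3 ℕ.* j ℕ.+ r) in
    cT j (suc r) ≈ TriE (suc (3 ℕ.* j)) e ⊡ (Bit3E r (2 ℕ.* j) ⊡ (q^ (lo j) ⊡ bracket j n))
  far-closed j e = cT-closed j r _ (begin
    (Te ⊡ (B3 ⊡ (q^ (lo j) ⊡ bracket j n))) ⊡ (poch r ⊡ D)
      ≈⟨ solve 6 (λ Te B a k p D → (Te :* (B :* (a :* k))) :* (p :* D) := a :* (Te :* p :* B :* (k :* D))) ≈-refl Te B3 (q^ (lo j)) (bracket j n) (poch r) D ⟩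
    q^ (lo j) ⊡ (Te ⊡ poch r ⊡ B3 ⊡ (bracket j n ⊡ D)) ≈⟨ ⊡-congˡ (q^ (lo j)) (⊡-congˡ (Te ⊡ poch r ⊡ B3) (≈-trans (bracket-poch j n) (⊡-congʳ (lin j r) (⊡-congʳ t (≈-sym (poch-TriE (3 ℕ.* j))))))) ⟩
    q^ (lo j) ⊡ (Te ⊡ poch r ⊡ B3 ⊡ ((poch (3 ℕ.* j) ⊡ TriE 0 (3 ℕ.* j)) ⊡ t ⊡ lin j r))
      ≈⟨ ⊡-congˡ (q^ (lo j)) (solve 7 (λ Te p B p3 t3 t l → Te :* p :* B :* ((p3 :* t3) :* t :* l) := (p :* (t3 :* t :* Te)) :* B :* p3 :* l) ≈-refl Te (poch r) B3 (poch (3 ℕ.* j)) (TriE 0 (3 ℕ.* j)) t (lin j r)) ⟩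
    q^ (lo j) ⊡ ((poch r ⊡ (TriE 0 (suc (3 ℕ.* j)) ⊡ Te)) ⊡ B3 ⊡ poch (3 ℕ.* j) ⊡ lin j r)
      ≈⟨ ⊡-congˡ (q^ (lo j)) (⊡-congʳ (lin j r) (⊡-congʳ (poch (3 ℕ.* j)) (≈-trans (⊡-congʳ B3 (≈-trans (⊡-congˡ (poch r) (≈-sym (TriE-++ 0 (suc (3 ℕ.* j)) e))) (poch-TriE r))) (≈-trans (Bit3E-poch r (2 ℕ.* j)) (pochQ-cong (ℕ.+-comm r (2 ℕ.* j))))))) ⟩
    num j r ∎)
    where
    open ≈-Reasoning
    r = suc (3 ℕ.* j ℕ.+ e)
    n = suc (3 ℕ.* j ℕ.+ r)
    Te = TriE (suc (3 ℕ.* j)) e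
    B3 = Bit3E r (2 ℕ.* j)
    D = pochQ j ⊡ pochQ (suc (2 ℕ.* j))
    t = tE (suc (3 ℕ.* j))

  -- The integers in (3t, 3(t + u)] that are not divisible by 3. The product of 1 - q^k over them is
  -- (q;q)_(3(t+u)) (Q;Q)_t / ((q;q)_(3t) (Q;Q)_(t+u)).
  between : ℕ → ℕ → List ℕ
  between t zero = []
  between t (suc u) = suc (3 ℕ.* (t ℕ.+ u)) ∷ 2 ℕ.+ 3 ℕ.* (t ℕ.+ u) ∷ between t u

  between-poch : ∀ t u → BitE (between t u) ⊡ (poch (3 ℕ.* t) ⊡ pochQ (t ℕ.+ u)) ≈ poch (3 ℕ.* (t ℕ.+ u)) ⊡ pochQ t
  between-poch t zero = ≈-trans (1⊡ _) (⊡-cong (λ m → cong (λ i → poch (3 ℕ.* i) m) (sym (ℕ.+-identityʳ t))) (pochQ-cong (ℕ.+-identityʳ t)))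
  between-poch t (suc u) = begin
    (b ⊡ x₂ ⊡ x₁) ⊡ (p ⊡ pochQ (t ℕ.+ suc u)) ≈⟨ ⊡-congˡ (b ⊡ x₂ ⊡ x₁) (⊡-congˡ p (pochQ-cong (ℕ.+-suc t u))) ⟩
    (b ⊡ x₂ ⊡ x₁) ⊡ (p ⊡ (pochQ y ⊡ x₃)) ≈⟨ solve 6 (λ b x₂ x₁ p P x₃ → (b :* x₂ :* x₁) :* (p :* (P :* x₃)) := (b :* (p :* P)) :* (x₁ :* x₂ :* x₃)) ≈-refl b x₂ x₁ p (pochQ y) x₃ ⟩
    (b ⊡ (p ⊡ pochQ y)) ⊡ (x₁ ⊡ x₂ ⊡ x₃) ≈⟨ ⊡-congʳ (x₁ ⊡ x₂ ⊡ x₃) (between-poch t u) ⟩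
    (poch (3 ℕ.* y) ⊡ pochQ t) ⊡ (x₁ ⊡ x₂ ⊡ x₃) ≈⟨ ⊡-congˡ (poch (3 ℕ.* y) ⊡ pochQ t) (⊡-congˡ (x₁ ⊡ x₂) (⊖-cong (q^-cong (3*suc y)))) ⟩
    (poch (3 ℕ.* y) ⊡ pochQ t) ⊡ (x₁ ⊡ x₂ ⊡ (1s ⊖ q^ (3 ℕ.+ 3 ℕ.* y))) ≈⟨ solve 5 (λ p P x₁ x₂ x₃ → (p :* P) :* (x₁ :* x₂ :* x₃) := (p :* x₁ :* x₂ :* x₃) :* P) ≈-refl (poch (3 ℕ.* y)) (pochQ t) x₁ x₂ (1s ⊖ q^ (3 ℕ.+ 3 ℕ.* y)) ⟩
    poch (3 ℕ.+ 3 ℕ.* y) ⊡ pochQ t ≈⟨ ⊡-congʳ (pochQ t) (λ m → cong (λ i → poch i m) (lem t u)) ⟩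
    poch (3 ℕ.* (t ℕ.+ suc u)) ⊡ pochQ t ∎
    where
    open ≈-Reasoning
    y = t ℕ.+ u
    b = BitE (between t u)
    p = poch (3 ℕ.* t)
    x₁ = 1s ⊖ q^ (suc (3 ℕ.* y))
    x₂ = 1s ⊖ q^ (2 ℕ.+ 3 ℕ.* y)
    x₃ = 1s ⊖ q^ (3 ℕ.* suc y)
    lem : ∀ t u → 3 ℕ.+ 3 ℕ.* (t ℕ.+ u) ≡ 3 ℕ.* (t ℕ.+ suc u)
    lem = ℕ-Ring.solve-∀

  -- For r ≤ 3j the quotient (q;q)_(3j) / (q;q)_r stays in the numerator. Its factors with exponent
  -- divisible by 3 are spent on (Q;Q)_j, of which (Q;Q)_t remains with t about r/3; `ks` lists the
  -- exponents left over.
  near-closed : ∀ j t l ks → let r = suc (t ℕ.+ l) in BitE ks ⊡ (poch r ⊡ pochQ j) ≈ poch (3 ℕ.* j) ⊡ pochQ t →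
    cT j (suc r) ≈ Bit3E (suc (2 ℕ.* j ℕ.+ t)) l ⊡ (q^ (lo j) ⊡ (lin j r ⊡ (BitE ks ⊡ qb t (suc (2 ℕ.* j)))))
  near-closed j t l ks e = cT-closed j r _ (begin
    (B3 ⊡ (a ⊡ (L ⊡ (b ⊡ qb t (suc (2 ℕ.* j)))))) ⊡ (poch r ⊡ (pochQ j ⊡ P2))
      ≈⟨ solve 8 (λ B a L b k p pj P → (B :* (a :* (L :* (b :* k)))) :* (p :* (pj :* P)) := a :* ((b :* (p :* pj)) :* (k :* P) :* B :* L)) ≈-refl B3 a L b (qb t (suc (2 ℕ.* j))) (poch r) (pochQ j) P2 ⟩
    a ⊡ ((b ⊡ (poch r ⊡ pochQ j)) ⊡ (qb t (suc (2 ℕ.* j)) ⊡ P2) ⊡ B3 ⊡ L) ≈⟨ ⊡-congˡ a (⊡-congʳ L (⊡-congʳ B3 (⊡-congʳ (qb t (suc (2 ℕ.* j)) ⊡ P2) e))) ⟩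
    a ⊡ ((poch (3 ℕ.* j) ⊡ pochQ t) ⊡ (qb t (suc (2 ℕ.* j)) ⊡ P2) ⊡ B3 ⊡ L)
      ≈⟨ ⊡-congˡ a (solve 6 (λ p t k P B L → (p :* t) :* (k :* P) :* B :* L := ((k :* (t :* P)) :* B) :* p :* L) ≈-refl (poch (3 ℕ.* j)) (pochQ t) (qb t (suc (2 ℕ.* j))) P2 B3 L) ⟩
    a ⊡ (((qb t (suc (2 ℕ.* j)) ⊡ (pochQ t ⊡ P2)) ⊡ B3) ⊡ poch (3 ℕ.* j) ⊡ L)
      ≈⟨ ⊡-congˡ a (⊡-congʳ L (⊡-congʳ (poch (3 ℕ.* j)) (≈-trans (⊡-congʳ B3 (≈-trans (qb-poch t (suc (2 ℕ.* j))) (pochQ-cong (lem t j)))) (≈-trans (Bit3E-poch (suc (2 ℕ.* j ℕ.+ t)) l) (pochQ-cong (lem₂ (2 ℕ.* j) t l)))))) ⟩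
    num j r ∎)
    where
    open ≈-Reasoning
    r = suc (t ℕ.+ l)
    a = q^ (lo j)
    L = lin j r
    b = BitE ks
    B3 = Bit3E (suc (2 ℕ.* j ℕ.+ t)) l
    P2 = pochQ (suc (2 ℕ.* j))
    lem : ∀ t j → t ℕ.+ suc (2 ℕ.* j) ≡ suc (2 ℕ.* j ℕ.+ t)
    lem = ℕ-Ring.solve-∀
    lem₂ : ∀ a t l → suc (a ℕ.+ t) ℕ.+ l ≡ a ℕ.+ suc (t ℕ.+ l)
    lem₂ = ℕ-Ring.solve-∀

  -- At r = 0 the linear factor is 1 - Q^(2j+1) and cancels the last factor of (Q;Q)_(2j+1).
  last-closed : ∀ j → cT j 1 ≈ q^ (lo j) ⊡ BitE (between 0 j)
  last-closed j = cT-closed j 0 _ (begin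
    (a ⊡ b) ⊡ (1s ⊡ (pochQ j ⊡ (pochQ (2 ℕ.* j) ⊡ x))) ≈⟨ solve 5 (λ a b p P x → (a :* b) :* (c1 :* (p :* (P :* x))) := a :* (P :* (b :* (c1 :* p)) :* x)) ≈-refl a b (pochQ j) (pochQ (2 ℕ.* j)) x ⟩
    a ⊡ (pochQ (2 ℕ.* j) ⊡ (b ⊡ (1s ⊡ pochQ j)) ⊡ x) ≈⟨ ⊡-congˡ a (⊡-cong (⊡-cong (pochQ-cong (sym (ℕ.+-identityʳ (2 ℕ.* j)))) (≈-trans (between-poch 0 j) (⊡1 (poch (3 ℕ.* j))))) x≈) ⟩
    a ⊡ (pochQ (2 ℕ.* j ℕ.+ 0) ⊡ poch (3 ℕ.* j) ⊡ lin j 0) ∎)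
    where
    open ≈-Reasoning
    a = q^ (lo j)
    b = BitE (between 0 j)
    x = 1s ⊖ q^ (3 ℕ.* suc (2 ℕ.* j))
    x≈ : x ≈ lin j 0
    x≈ = ≈-trans (⊖-cong (≈-trans (q^-cong (lem j)) (q^-+ (suc (3 ℕ.* j ℕ.+ 0)) (2 ℕ.+ 3 ℕ.* j))))
      (≈-trans (solve 2 (λ u y → c1 :- u :* y := c1 :- u :+ u :* (c1 :- y)) ≈-refl (q^ (suc (3 ℕ.* j ℕ.+ 0))) (q^ (2 ℕ.+ 3 ℕ.* j)))
        (⊞-cong (⊖-cong (q^-cong (cong suc (ℕ.+-identityʳ (3 ℕ.* j))))) ≈-refl))
      where
      lem : ∀ j → 3 ℕ.* suc (2 ℕ.* j) ≡ suc (3 ℕ.* j ℕ.+ 0) ℕ.+ (2 ℕ.+ 3 ℕ.* j)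
      lem = ℕ-Ring.solve-∀

-- Majorants, their total mass, and the bounds for j ≥ 17

module SummandBounds where

  open PowerSeries
  open SingleSum
  open Windows
  open IntervalProducts
  open Boxes
  open FarSummands
  open NearSummands
  open Counting
  open ClosedForms
  open import Data.Nat as ℕ using (ℕ; zero; suc; _+_; _*_; _^_; _≤_; _<_; z≤n; s≤s)
  open import Data.Nat.Properties as ℕ
  open import Data.Nat.DivMod using (_/_; _%_; m≡m%n+[m/n]*n; m%n<n)
  open import Data.Nat.Tactic.RingSolver using (solve-∀)
  open import Data.Integer as ℤ using (∣_∣)
  import Data.Integer.Properties as ℤ
  open import Data.List using (List; []; _∷_; length)
  open import Data.Nat.ListAction using (sum)
  open import Data.Product using (Σ; _,_; proj₁; proj₂)
  open import Data.Sum using (inj₁; inj₂)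
  open import Data.Empty using (⊥-elim)
  open import Relation.Binary.PropositionalEquality hiding (setoid)

  record Maj (f : Ser) (g : NSer) : Set where
    constructor maj
    field at : ∀ m → ∣ f m ∣ ≤ g m
  open Maj

  Maj-cong : ∀ {f f′ g} → f ≈ f′ → Maj f′ g → Maj f g
  Maj-cong e p = maj λ m → subst (λ x → ∣ x ∣ ≤ _) (sym (e m)) (at p m)

  Maj-ι : ∀ f → Maj (ι f) f
  Maj-ι f = maj λ m → ≤-refl

  Maj-⊞ : ∀ {f f′ g g′} → Maj f g → Maj f′ g′ → Maj (f ⊞ f′) (λ m → g m + g′ m)
  Maj-⊞ {f} {f′} p q = maj λ m → ≤-trans (ℤ.∣i+j∣≤∣i∣+∣j∣ (f m) (f′ m)) (+-mono-≤ (at p m) (at q m))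

  Maj-⊖ : ∀ {f f′ g g′} → Maj f g → Maj f′ g′ → Maj (f ⊖ f′) (λ m → g m + g′ m)
  Maj-⊖ {f} {f′} p q = maj λ m → ≤-trans (ℤ.∣i-j∣≤∣i∣+∣j∣ (f m) (f′ m)) (+-mono-≤ (at p m) (at q m))

  Maj-sh : ∀ k {f g} → Maj f g → Maj (sh k f) (shN k g)
  Maj-sh k {f} {g} p = maj (go k)
    where
    go : ∀ k m → ∣ sh k f m ∣ ≤ shN k g m
    go zero m = at p m
    go (suc k) zero = z≤n
    go (suc k) (suc m) = go k m

  Maj-q : ∀ k {f g} → Maj f g → Maj (q^ k ⊡ f) (shN k g)
  Maj-q k {f} p = Maj-cong (q^-⊡ k f) (Maj-sh k p)

  -- This is where signs are given up: 1 - q^k is replaced by 1 + q^k.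
  Maj-bit : ∀ k {f g} → Maj f g → Maj ((1s ⊖ q^ k) ⊡ f) (bit k g)
  Maj-bit k {f} p = Maj-cong (solve 2 (λ x f → (c1 :- x) :* f := f :- x :* f) ≈-refl (q^ k) f) (Maj-⊖ p (Maj-q k p))

  Maj-tri : ∀ k {f g} → Maj f g → Maj (tE k ⊡ f) (tri k g)
  Maj-tri k {f} p = Maj-cong (solve 3 (λ x y f → (c1 :+ x :+ y) :* f := f :+ x :* f :+ y :* f) ≈-refl (q^ k) (q^ (k + k)) f) (Maj-⊞ (Maj-⊞ p (Maj-q k p)) (Maj-q (k + k) p))

  ⊡-swapˡ : ∀ a b f → (a ⊡ b) ⊡ f ≈ b ⊡ (a ⊡ f)
  ⊡-swapˡ = solve 3 (λ a b f → (a :* b) :* f := b :* (a :* f)) ≈-refl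

  Maj-TriE : ∀ a l {f g} → Maj f g → Maj (TriE a l ⊡ f) (TriP all a l g)
  Maj-TriE a zero {f} p = Maj-cong (⊡-identityˡ f) p
  Maj-TriE a (suc l) {f} p = Maj-cong (⊡-swapˡ (TriE a l) (tE (suc (a + l))) f) (Maj-tri (suc (a + l)) (Maj-TriE a l p))

  Maj-Bit3E : ∀ o l {f g} → Maj f g → Maj (Bit3E o l ⊡ f) (Bit3 o l g)
  Maj-Bit3E o zero {f} p = Maj-cong (⊡-identityˡ f) p
  Maj-Bit3E o (suc l) {f} p = Maj-cong (⊡-swapˡ (Bit3E o l) (1s ⊖ q^ (3 * suc (o + l))) f) (Maj-bit (3 * suc (o + l)) (Maj-Bit3E o l p))

  BitL : List ℕ → NSer → NSer
  BitL [] f = f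
  BitL (k ∷ ks) f = bit k (BitL ks f)

  Maj-BitE : ∀ ks {f g} → Maj f g → Maj (BitE ks ⊡ f) (BitL ks g)
  Maj-BitE [] {f} p = Maj-cong (⊡-identityˡ f) p
  Maj-BitE (k ∷ ks) {f} p = Maj-cong (⊡-swapˡ (BitE ks) (1s ⊖ q^ k) f) (Maj-bit k (Maj-BitE ks p))

  linN : ℕ → ℕ → NSer → NSer
  linN j r g m = bit (suc (3 * j)) g m + shN (suc (3 * j + r)) (bit (2 + 3 * j) g) m

  Maj-lin : ∀ j r {f g} → Maj f g → Maj (lin j r ⊡ f) (linN j r g)
  Maj-lin j r {f} p = Maj-cong (solve 4 (λ a u b f → (a :+ u :* b) :* f := a :* f :+ u :* (b :* f)) ≈-refl (1s ⊖ q^ (suc (3 * j))) (q^ (suc (3 * j + r))) (1s ⊖ q^ (2 + 3 * j)) f)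
    (Maj-⊞ (Maj-bit (suc (3 * j)) p) (Maj-q (suc (3 * j + r)) (Maj-bit (2 + 3 * j) p)))

  bracketN : ℕ → ℕ → NSer
  bracketN j n m = qbN j (suc (2 * j)) m + shN n (λ i → qbN j (2 * j) i + shN (suc (3 * j)) (qbN j (2 * j)) i + shN (2 + 3 * j) (qbN⁻ j (suc (2 * j))) i) m

  Maj-bracket : ∀ j n → Maj (bracket j n) (bracketN j n)
  Maj-bracket j n = Maj-⊞ (Maj-ι (qbN j (suc (2 * j)))) (Maj-q n (Maj-⊖ (Maj-⊞ (Maj-ι (qbN j (2 * j))) (Maj-q (suc (3 * j)) (Maj-ι (qbN j (2 * j))))) (Maj-q (2 + 3 * j) (Maj-ι (qbN⁻ j (suc (2 * j)))))))

  Supp-weaken : ∀ {f lo lo′ hi hi′ τ} → lo′ ≤ lo → hi ≤ hi′ → Supp f lo hi τ → Supp f lo′ hi′ τ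
  Supp-weaken p q s = record { zero-below = λ m l → zero-below m (<-≤-trans l p) ; ≤total = ≤total ; full-above = λ m l → full-above m (≤-trans q l) }
    where open Supp s

  Supp-+ : ∀ {f g lo hi σ τ} → Supp f lo hi σ → Supp g lo hi τ → Supp (λ m → f m + g m) lo hi (σ + τ)
  Supp-+ {f} {g} s t = record
    { zero-below = λ m l → trans (cum-+ f g m) (cong₂ _+_ (S.zero-below m l) (T.zero-below m l))
    ; ≤total = λ m → ≤-trans (≤-reflexive (cum-+ f g m)) (+-mono-≤ (S.≤total m) (T.≤total m))
    ; full-above = λ m l → trans (cum-+ f g m) (cong₂ _+_ (S.full-above m l) (T.full-above m l)) }
    where
    module S = Supp s
    module T = Supp t

  Supp-sh : ∀ k {f lo hi τ} → Supp f lo hi τ → Supp (shN k f) (k + lo) (k + hi) τ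
  Supp-sh k {f} {lo} {hi} {τ} s = record { zero-below = zb ; ≤total = λ m → ≤-trans (≤-reflexive (cum-shN k f m)) (shN-bound k ≤total m) ; full-above = fa }
    where
    open Supp s
    zb : ∀ m → m < k + lo → cum (shN k f) m ≡ 0
    zb m l with shN-case k (cum f) m
    ... | inj₁ (_ , e) = trans (cum-shN k f m) e
    ... | inj₂ (i , refl , e) = trans (cum-shN k f (k + i)) (trans e (zero-below i (+-cancelˡ-< k i lo l)))
    fa : ∀ m → k + hi ≤ m → cum (shN k f) m ≡ τ
    fa m l with shN-case k (cum f) m
    ... | inj₁ (m<k , _) = ⊥-elim (<-irrefl refl (<-≤-trans m<k (≤-trans (m≤m+n k hi) l)))
    ... | inj₂ (i , refl , e) = trans (cum-shN k f (k + i)) (trans e (full-above i (+-cancelˡ-≤ k hi i l)))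

  Supp-δ : Supp δ 0 0 1
  Supp-δ = record { zero-below = λ _ () ; ≤total = λ m → ≤-reflexive (c m) ; full-above = λ m _ → c m }
    where
    c : ∀ m → cum δ m ≡ 1
    c zero = refl
    c (suc m) = trans (+-identityʳ _) (c m)

  Supp-0 : ∀ hi → Supp (λ _ → 0) 0 hi 0
  Supp-0 hi = record { zero-below = λ _ () ; ≤total = λ m → ≤-reflexive (c m) ; full-above = λ m _ → c m }
    where
    c : ∀ m → cum (λ _ → 0) m ≡ 0
    c zero = refl
    c (suc m) = trans (+-identityʳ _) (c m)

  Supp-bit : ∀ k {f hi τ} → Supp f 0 hi τ → Supp (bit k f) 0 (k + hi) (2 * τ)
  Supp-bit k {f} {hi} {τ} s = subst (Supp (bit k f) 0 (k + hi)) (cong (λ x → τ + x) (sym (+-identityʳ τ))) (Supp-+ (Supp-weaken z≤n (m≤n+m hi k) s) (Supp-weaken z≤n ≤-refl (Supp-sh k s)))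

  Supp-BitL : ∀ ks {f hi τ} → Supp f 0 hi τ → Supp (BitL ks f) 0 (sum ks + hi) (2 ^ length ks * τ)
  Supp-BitL [] {f} {hi} {τ} s = subst (Supp f 0 hi) (sym (+-identityʳ τ)) s
  Supp-BitL (k ∷ ks) {f} {hi} {τ} s = subst₂ (Supp (BitL (k ∷ ks) f) 0) (sym (+-assoc k (sum ks) hi)) (sym (*-assoc 2 (2 ^ length ks) τ)) (Supp-bit k (Supp-BitL ks s))

  -- The binomial coefficient of a + b over a, the value of the q-binomial at q = 1.
  tau : ℕ → ℕ → ℕ
  tau zero b = 1
  tau (suc a) zero = 1
  tau (suc a) (suc b) = tau a (suc b) + tau (suc a) b

  Supp-qb : ∀ a b → Supp (qbN a b) 0 (3 * (a * b)) (tau a b)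
  Supp-qb zero b = Supp-δ
  Supp-qb (suc a) zero = Supp-weaken z≤n z≤n Supp-δ
  Supp-qb (suc a) (suc b) = Supp-+ (Supp-weaken z≤n (*-monoʳ-≤ 3 (*-monoˡ-≤ (suc b) (n≤1+n a))) (Supp-qb a (suc b)))
    (Supp-weaken z≤n (≤-reflexive (lem a b)) (Supp-sh (3 * suc a) (Supp-qb (suc a) b)))
    where
    lem : ∀ a b → 3 * suc a + 3 * (suc a * b) ≡ 3 * (suc a * suc b)
    lem = solve-∀

  -- The left side is one term of the expansion of (1 + 3)^(a+b). For a = j and b = 2j it gives the
  -- growth rate 64/9 that `Plenty` is designed for.
  tau-bound : ∀ a b → tau a b * 3 ^ b ≤ 4 ^ (a + b)
  tau-bound zero b = ≤-trans (≤-reflexive (+-identityʳ (3 ^ b))) (^-monoˡ-≤ b (n≤1+n 3))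
  tau-bound (suc a) zero = m^n>0 4 (suc a + 0)
  tau-bound (suc a) (suc b) = begin
    (tau a (suc b) + tau (suc a) b) * (3 * 3 ^ b) ≡⟨ lem (tau a (suc b)) (tau (suc a) b) (3 ^ b) ⟩
    tau a (suc b) * (3 * 3 ^ b) + 3 * (tau (suc a) b * 3 ^ b) ≤⟨ +-mono-≤ (tau-bound a (suc b)) (*-monoʳ-≤ 3 (tau-bound (suc a) b)) ⟩
    4 ^ (a + suc b) + 3 * 4 ^ (suc a + b) ≡⟨ cong (λ k → 4 ^ (a + suc b) + 3 * 4 ^ k) (sym (+-suc a b)) ⟩
    4 ^ (a + suc b) + 3 * 4 ^ (a + suc b) ∎
    where
    open ≤-Reasoning
    lem : ∀ x y p → (x + y) * (3 * p) ≡ x * (3 * p) + 3 * (y * p)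
    lem = solve-∀

  tau⁻ : ℕ → ℕ → ℕ
  tau⁻ zero b = 0
  tau⁻ (suc a) b = tau a b

  Supp-qb⁻ : ∀ j b → Supp (qbN⁻ j b) 0 (3 * (ℕ.pred j * b)) (tau⁻ j b)
  Supp-qb⁻ zero b = Supp-0 0
  Supp-qb⁻ (suc a) b = Supp-qb a b

  tau⁻-bound : ∀ j b → tau⁻ j b * 3 ^ b ≤ 4 ^ (j + b)
  tau⁻-bound zero b = z≤n
  tau⁻-bound (suc a) b = ≤-trans (tau-bound a b) (m≤m+n _ _)

  bracketτ : ℕ → ℕ
  bracketτ j = tau j (suc (2 * j)) + (tau j (2 * j) + tau j (2 * j) + tau⁻ j (suc (2 * j)))

  Supp-bracket : ∀ j n → Supp (shN (lo j) (bracketN j n)) (lo j) (lo j + (6 * (j * j) + 3 * j + 1 + n)) (bracketτ j)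
  Supp-bracket j n = Supp-weaken (≤-reflexive (sym (+-identityʳ (lo j)))) ≤-refl (Supp-sh (lo j) (Supp-+
      (Supp-weaken z≤n (≤-trans (≤-reflexive (l₁ j)) (m≤m+n _ (1 + n)) ∙ +-assoc (6 * (j * j) + 3 * j) 1 n) (Supp-qb j (suc (2 * j))))
      (Supp-weaken z≤n (≤-reflexive (+-comm n _)) (Supp-sh n (Supp-+ (Supp-+
        (Supp-weaken z≤n (≤-trans (≤-reflexive (l₂ j)) (≤-trans (m≤m+n _ (3 * j)) (m≤m+n _ 1))) (Supp-qb j (2 * j)))
        (Supp-weaken z≤n (≤-reflexive (l₃ j)) (Supp-sh (suc (3 * j)) (Supp-qb j (2 * j)))))
        (third j))))))
    where
    _∙_ : ∀ {a b c} → a ≤ b → c ≡ b → a ≤ c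
    p ∙ refl = p
    l₁ : ∀ j → 3 * (j * suc (2 * j)) ≡ 6 * (j * j) + 3 * j
    l₁ = solve-∀
    l₂ : ∀ j → 3 * (j * (2 * j)) ≡ 6 * (j * j)
    l₂ = solve-∀
    l₃ : ∀ j → suc (3 * j) + 3 * (j * (2 * j)) ≡ 6 * (j * j) + 3 * j + 1
    l₃ = solve-∀
    third : ∀ j → Supp (shN (2 + 3 * j) (qbN⁻ j (suc (2 * j)))) 0 (6 * (j * j) + 3 * j + 1) (tau⁻ j (suc (2 * j)))
    third zero = subst (λ f → Supp f 0 1 0) refl (record { zero-below = λ _ () ; ≤total = λ m → ≤-reflexive (z m) ; full-above = λ m _ → z m })
      where
      z : ∀ m → cum (shN 2 (λ _ → 0)) m ≡ 0
      z m = trans (cum-shN 2 (λ _ → 0) m) (trans (shN-cong 2 (λ i → Supp.full-above (Supp-0 0) i z≤n) m) (shN-zero 2 m))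
    third (suc a) = Supp-weaken z≤n (≤-trans (m≤m+n _ (3 * a + 5)) (≤-reflexive (l₄ a))) (Supp-sh (2 + 3 * suc a) (Supp-qb⁻ (suc a) (suc (2 * suc a))))
      where
      l₄ : ∀ a → 2 + 3 * suc a + 3 * (a * suc (2 * suc a)) + (3 * a + 5) ≡ 6 * (suc a * suc a) + 3 * suc a + 1
      l₄ = solve-∀

  private
    pow64 : ∀ j → 4 ^ (3 * j) ≡ 64 ^ j
    pow64 j = sym (^-*-assoc 4 3 j)

    pow9 : ∀ j → 9 ^ suc j ≡ 3 * 3 ^ suc (2 * j)
    pow9 j = trans (cong (9 *_) (^-*-assoc 3 2 j)) (lem (3 ^ (2 * j)))
      where
      lem : ∀ x → 9 * x ≡ 3 * (3 * x)
      lem = solve-∀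

    to-64 : ∀ j τ → τ * 3 ^ suc (2 * j) ≤ 16 * 4 ^ (3 * j) → 9 ^ suc j * τ ≤ 64 * 64 ^ j
    to-64 j τ p = begin
      9 ^ suc j * τ ≡⟨ cong (_* τ) (pow9 j) ⟩
      3 * 3 ^ suc (2 * j) * τ ≡⟨ lem (3 ^ suc (2 * j)) τ ⟩
      3 * (τ * 3 ^ suc (2 * j)) ≤⟨ *-monoʳ-≤ 3 p ⟩
      3 * (16 * 4 ^ (3 * j)) ≡⟨ *-assoc 3 16 (4 ^ (3 * j)) ⟨
      48 * 4 ^ (3 * j) ≤⟨ *-monoˡ-≤ (4 ^ (3 * j)) (≤ᵇ⇒≤ 48 64 _) ⟩
      64 * 4 ^ (3 * j) ≡⟨ cong (64 *_) (pow64 j) ⟩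
      64 * 64 ^ j ∎
      where
      open ≤-Reasoning
      lem : ∀ a τ → 3 * a * τ ≡ 3 * (τ * a)
      lem = solve-∀

    -- The masses of the q-binomials contribute 4 + 6 + 4 = 14 times 4^(3j).
    bracketτ-bound : ∀ j → bracketτ j * 3 ^ suc (2 * j) ≤ 16 * 4 ^ (3 * j)
    bracketτ-bound j = begin
      bracketτ j * (3 * p) ≡⟨ lem (tau j (suc (2 * j))) (tau j (2 * j)) (tau⁻ j (suc (2 * j))) p ⟩
      tau j (suc (2 * j)) * (3 * p) + (6 * (tau j (2 * j) * p) + tau⁻ j (suc (2 * j)) * (3 * p))
        ≤⟨ +-mono-≤ (tau-bound j (suc (2 * j))) (+-mono-≤ (*-monoʳ-≤ 6 (tau-bound j (2 * j))) (tau⁻-bound j (suc (2 * j)))) ⟩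
      4 ^ (j + suc (2 * j)) + (6 * 4 ^ (j + 2 * j) + 4 ^ (j + suc (2 * j))) ≡⟨ cong₂ (λ a b → 4 ^ a + (6 * 4 ^ b + 4 ^ a)) (e₁ j) (e₂ j) ⟩
      4 * W + (6 * W + 4 * W) ≤⟨ m≤m+n _ (2 * W) ⟩
      4 * W + (6 * W + 4 * W) + 2 * W ≡⟨ lem₂ W ⟩
      16 * W ∎
      where
      open ≤-Reasoning
      p = 3 ^ (2 * j)
      W = 4 ^ (3 * j)
      lem : ∀ a b c p → (a + (b + b + c)) * (3 * p) ≡ a * (3 * p) + (6 * (b * p) + c * (3 * p))
      lem = solve-∀
      lem₂ : ∀ w → 4 * w + (6 * w + 4 * w) + 2 * w ≡ 16 * w
      lem₂ = solve-∀
      e₁ : ∀ j → j + suc (2 * j) ≡ suc (3 * j)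
      e₁ = solve-∀
      e₂ : ∀ j → j + 2 * j ≡ 3 * j
      e₂ = solve-∀

    count-ok : ∀ j N τ c → 9 ^ suc j * τ ≤ 64 * 64 ^ j → N * (64 * 64 ^ j) ≤ 9 ^ suc j * c → N * τ ≤ c
    count-ok j N τ c p q = *-cancelˡ-≤ (9 ^ suc j) {{ℕ.>-nonZero (m^n>0 9 (suc j))}} (begin
      9 ^ suc j * (N * τ) ≡⟨ lem (9 ^ suc j) N τ ⟩
      N * (9 ^ suc j * τ) ≤⟨ *-monoʳ-≤ N p ⟩
      N * (64 * 64 ^ j) ≤⟨ q ⟩
      9 ^ suc j * c ∎)
      where
      open ≤-Reasoning
      lem : ∀ a n t → a * (n * t) ≡ n * (a * t)
      lem = solve-∀

    -- The origin of the constant 10: the window comparison costs 2S ≤ 30 j and gains 3N with N =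
    -- j²(j + 1); cancelling 3j leaves j(j + 1) against 10.
    ratio : ∀ j S x y → 1 ≤ j → 2 * S ≤ 30 * j → 3 * (j * j * suc j) * x ≤ 2 * S * y → j * suc j * x ≤ 10 * y
    ratio j S x y 1≤j p q = *-cancelˡ-≤ (3 * j) {{ℕ.>-nonZero (*-mono-≤ {1} {3} (s≤s z≤n) 1≤j)}} (begin
      3 * j * (j * suc j * x) ≡⟨ lem₁ j x ⟩
      3 * (j * j * suc j) * x ≤⟨ q ⟩
      2 * S * y ≤⟨ *-monoˡ-≤ y p ⟩
      30 * j * y ≡⟨ lem₂ j y ⟩
      3 * j * (10 * y) ∎)
      where
      open ≤-Reasoning
      lem₁ : ∀ j x → 3 * j * (j * suc j * x) ≡ 3 * (j * j * suc j) * x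
      lem₁ = solve-∀
      lem₂ : ∀ j y → 30 * j * y ≡ 3 * j * (10 * y)
      lem₂ = solve-∀

  far-bound : ∀ j₁ e → 16 ≤ j₁ → let j = suc j₁ ; r = suc (3 * j + e) in ∀ m → j * suc j * ∣ cT j (suc r) m ∣ ≤ 10 * T₀ (suc (3 * j + r)) m
  far-bound (suc j₀) e 16≤ m = ratio j (12 * j + 1) ∣ cT j (suc r) m ∣ (T₀ n m) (s≤s z≤n) S≤ (≤-trans (*-monoʳ-≤ (3 * (j * j * suc j)) maj₀) (≤-trans (F.far-dom {j * j * suc j} {bracketτ j} {K} sK N≤ m) (≤-reflexive (cong (λ k → 2 * (12 * j + 1) * T₀ k m) (nn j e)))))
    where
    j = 2 + j₀
    r = suc (3 * j + e)
    n = suc (3 * j + r)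
    module F = FarIndex j₀ e
    K = shN (lo j) (bracketN j F.n)
    open Plenty (plenty (suc j₀) 16≤)
    nn : ∀ j e → 2 + (3 * j + e + 3 * j) ≡ suc (3 * j + suc (3 * j + e))
    nn = solve-∀
    sK : Supp K F.lo F.hi (bracketτ j)
    sK = Supp-bracket j F.n
    -- `Plenty` counts with the two even indices removed and only up to index 3j; restoring them and
    -- adding the index 3j + 1 can only increase the count.
    N≤ : j * j * suc j * bracketτ j ≤ TriP nrs 1 (3 * j) c₂ F.lo
    N≤ = ≤-trans (count-ok j (j * j * suc j) (bracketτ j) (TriP (nrh h) 1 (2 + 3 * suc j₀) c₂ F.lo) (to-64 j (bracketτ j) (bracketτ-bound j)) many)
      (≤-trans (TriP-χ-mono 1 (2 + 3 * suc j₀) c₂ (nrh⇒nrs h) F.lo) (≤-trans (TriP-≼ nrs (3 + 3 * suc j₀) 1 (TriP nrs 1 (2 + 3 * suc j₀) c₂) F.lo)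
        (≤-reflexive (trans (sym (TriP-++ nrs 1 (2 + 3 * suc j₀) 1 c₂ F.lo)) (cong (λ l → TriP nrs 1 l c₂ F.lo) (lem j₀))))))
      where
      lem : ∀ j₀ → 2 + 3 * suc j₀ + 1 ≡ 3 * (2 + j₀)
      lem = solve-∀
    maj₀ : ∣ cT j (suc r) m ∣ ≤ TriP all (1 + 3 * j) e (Bit3 r (2 * j) K) m
    maj₀ = at (Maj-cong (far-closed j e) (Maj-TriE (suc (3 * j)) e (Maj-Bit3E r (2 * j) (Maj-q (lo j) (subst (λ k → Maj (bracket j n) (bracketN j k)) (sym (nn j e)) (Maj-bracket j n)))))) m
    S≤ : 2 * (12 * j + 1) ≤ 30 * j
    S≤ = ≤-trans (m≤m+n _ (10 + 6 * j₀)) (≤-reflexive (lem j₀))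
      where
      lem : ∀ j₀ → 2 * (12 * (2 + j₀) + 1) + (10 + 6 * j₀) ≡ 30 * (2 + j₀)
      lem = solve-∀

  -- Of the l + d trinomials beyond index 3j, the first l are paired with the factors 1 + Q^i for o
  -- < i ≤ o + l, and d are surplus of T₀.
  near-generic : ∀ j₁ l d o {K hi τ} → 16 ≤ j₁ → let j = suc j₁ ; n = suc (3 * j + (l + d)) in
    l + d ≤ 3 * j → 3 * j + l ≤ 3 * suc o → Supp K (lo j) hi τ → τ * 3 ^ suc (2 * j) ≤ 16 * 4 ^ (3 * j) → 1 + (hi + sum3 o l) + lo j ≡ n * n →
    ∀ m → j * suc j * Bit3 o l K m ≤ 10 * T₀ n m
  near-generic j₁ l d o {K} {hi} {τ} 16≤ l+d≤ o≥ sK τ≤ deg m = ratio j (12 * j + 6) (Bit3 o l K m) (T₀ n m) (s≤s z≤n) S≤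
      (≤-trans (NI.near-dom {j * j * suc j} {τ} {lo j} {hi} {K} sK N≤ (≤-reflexive (trans deg (cong (λ k → k * k) (sym (nn j₁ (l + d)))))) m) (≤-reflexive (cong (λ k → 2 * (12 * j + 6) * T₀ k m) (nn j₁ (l + d)))))
    where
    j = suc j₁
    n = suc (3 * j + (l + d))
    open Plenty (plenty j₁ 16≤)
    module NI = NearIndex j₁ l d o h 3≤h h≤ M≥ l+d≤ o≥ (s≤s (≤-trans (s≤s z≤n) 16≤))
    nn : ∀ j₁ r → 2 + (2 + 3 * j₁ + r) ≡ suc (3 * suc j₁ + r)
    nn = solve-∀
    N≤ : j * j * suc j * τ ≤ TriP (nrh h) 1 (2 + 3 * j₁) c₂ (lo j)
    N≤ = count-ok j (j * j * suc j) τ (TriP (nrh h) 1 (2 + 3 * j₁) c₂ (lo j)) (to-64 j τ τ≤) many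
    S≤ : 2 * (12 * j + 6) ≤ 30 * j
    S≤ = ≤-trans (≤-reflexive (lem₁ j)) (≤-trans (+-monoʳ-≤ (24 * j) (*-monoʳ-≤ 6 (s≤s (≤-trans (s≤s z≤n) 16≤)))) (≤-reflexive (lem₂ j)))
      where
      lem₁ : ∀ j → 2 * (12 * j + 6) ≡ 24 * j + 6 * 2
      lem₁ = solve-∀
      lem₂ : ∀ j → 24 * j + 6 * j ≡ 30 * j
      lem₂ = solve-∀

  -- The numbers up to 3m that are not divisible by 3 add up to 3m².
  sum-between : ∀ t u → sum (between t u) + 3 * (t * t) ≡ 3 * ((t + u) * (t + u))
  sum-between t zero = cong (λ x → 3 * (x * x)) (sym (+-identityʳ t))
  sum-between t (suc u) = trans (lem₁ (suc (3 * (t + u))) (2 + 3 * (t + u)) (sum (between t u)) (3 * (t * t))) (trans (cong (suc (3 * (t + u)) + (2 + 3 * (t + u)) +_) (sum-between t u)) (lem₂ t u))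
    where
    lem₁ : ∀ a b c d → a + (b + c) + d ≡ a + b + (c + d)
    lem₁ = solve-∀
    lem₂ : ∀ t u → suc (3 * (t + u)) + (2 + 3 * (t + u)) + 3 * ((t + u) * (t + u)) ≡ 3 * ((t + suc u) * (t + suc u))
    lem₂ = solve-∀

  len-between : ∀ t u → 2 ^ length (between t u) ≡ 4 ^ u
  len-between t zero = refl
  len-between t (suc u) = trans (sym (*-assoc 2 2 (2 ^ length (between t u)))) (cong (4 *_) (len-between t u))

  private
    near-K : ℕ → ℕ → ℕ → List ℕ → NSer
    near-K j r t ks = shN (lo j) (linN j r (BitL ks (qbN t (suc (2 * j)))))

    near-hi : ℕ → ℕ → ℕ → List ℕ → ℕ
    near-hi j r t ks = lo j + (suc (3 * j + r) + (2 + 3 * j + (sum ks + 3 * (t * suc (2 * j)))))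

    near-τ : ℕ → ℕ → List ℕ → ℕ
    near-τ j t ks = 4 * (2 ^ length ks * tau t (suc (2 * j)))

    Supp-near : ∀ j r t ks → Supp (near-K j r t ks) (lo j) (near-hi j r t ks) (near-τ j t ks)
    Supp-near j r t ks = Supp-weaken (≤-reflexive (sym (+-identityʳ (lo j)))) ≤-refl (Supp-sh (lo j)
      (subst (Supp (linN j r f) 0 (n + (2 + 3 * j + h))) (lem τ) (Supp-+ (Supp-weaken z≤n (≤-trans (+-monoˡ-≤ h (n≤1+n (suc (3 * j)))) (m≤n+m _ n)) (Supp-bit (suc (3 * j)) sf)) (Supp-weaken z≤n ≤-refl (Supp-sh n (Supp-bit (2 + 3 * j) sf))))))
      where
      n = suc (3 * j + r)
      f = BitL ks (qbN t (suc (2 * j)))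
      h = sum ks + 3 * (t * suc (2 * j))
      τ = 2 ^ length ks * tau t (suc (2 * j))
      sf : Supp f 0 h τ
      sf = Supp-BitL ks (Supp-qb t (suc (2 * j)))
      lem : ∀ τ → 2 * τ + 2 * τ ≡ 4 * τ
      lem = solve-∀

    near-τ-bound : ∀ j t u ks → j ≡ t + u → 2 ^ length ks ≤ 4 ^ u → near-τ j t ks * 3 ^ suc (2 * j) ≤ 16 * 4 ^ (3 * j)
    near-τ-bound j t u ks ej len = begin
      4 * (L * tau t (suc (2 * j))) * p ≡⟨ lem 4 L (tau t (suc (2 * j))) p ⟩
      4 * (L * (tau t (suc (2 * j)) * p)) ≤⟨ *-monoʳ-≤ 4 (*-mono-≤ len (tau-bound t (suc (2 * j)))) ⟩
      4 * (4 ^ u * 4 ^ (t + suc (2 * j))) ≡⟨ cong (4 *_) (trans (sym (^-distribˡ-+-* 4 u (t + suc (2 * j)))) (cong (4 ^_) (trans (lem₂ u t j) (cong (λ x → suc (x + 2 * j)) (sym ej))))) ⟩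
      4 * (4 * 4 ^ (j + 2 * j)) ≡⟨ *-assoc 4 4 (4 ^ (j + 2 * j)) ⟨
      16 * 4 ^ (3 * j) ∎
      where
      open ≤-Reasoning
      L = 2 ^ length ks
      p = 3 ^ suc (2 * j)
      lem : ∀ a l t p → a * (l * t) * p ≡ a * (l * (t * p))
      lem = solve-∀
      lem₂ : ∀ u t j → u + (t + suc (2 * j)) ≡ suc (t + u + 2 * j)
      lem₂ = solve-∀

    -- A uniform treatment of the residues of r modulo 3, which enter only through t, l and the at
    -- most 2u leftover exponents `ks`.
    near-case : ∀ j₁ t u l ks → 16 ≤ j₁ → let j = suc j₁ ; r = suc (t + l) in j ≡ t + u → r ≤ 3 * j → 2 ^ length ks ≤ 4 ^ u →
      2 * (1 + near-hi j r t ks + lo j) + 3 * (l * (suc (2 * j + t) + suc (2 * j + t) + l + 1)) ≡ 2 * (suc (3 * j + r) * suc (3 * j + r)) →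
      BitE ks ⊡ (poch r ⊡ pochQ j) ≈ poch (3 * j) ⊡ pochQ t →
      ∀ m → j * suc j * ∣ cT j (suc r) m ∣ ≤ 10 * T₀ (suc (3 * j + r)) m
    near-case j₁ t u l ks 16≤ ej r≤ len deg id m = ≤-trans (*-monoʳ-≤ (j * suc j) maj₀) (subst (λ x → j * suc j * Bit3 o l (near-K j r t ks) m ≤ 10 * T₀ (suc (3 * j + x)) m) r≡
        (near-generic j₁ l (suc t) o 16≤ (subst (_≤ 3 * j) (sym r≡) r≤) o≥ (Supp-near j r t ks) (near-τ-bound j t u ks ej len)
          (trans deg′ (cong (λ x → suc (3 * j + x) * suc (3 * j + x)) (sym r≡))) m))
      where
      j = suc j₁
      r = suc (t + l)
      o = suc (2 * j + t)
      r≡ : l + suc t ≡ r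
      r≡ = lem l t
        where
        lem : ∀ l t → l + suc t ≡ suc (t + l)
        lem = solve-∀
      o≥ : 3 * j + l ≤ 3 * suc o
      o≥ = ≤-trans (+-monoʳ-≤ (3 * j) (≤-trans (≤-trans (m≤n+m l t) (n≤1+n _)) r≤)) (≤-trans (m≤m+n _ (6 + 3 * t)) (≤-reflexive (lem j t)))
        where
        lem : ∀ j t → 3 * j + 3 * j + (6 + 3 * t) ≡ 3 * suc (suc (2 * j + t))
        lem = solve-∀
      deg′ : 1 + (near-hi j r t ks + sum3 o l) + lo j ≡ suc (3 * j + r) * suc (3 * j + r)
      deg′ = *-cancelˡ-≡ _ _ 2 (trans (lem (near-hi j r t ks) (sum3 o l) (lo j)) (trans (cong (2 * (1 + near-hi j r t ks + lo j) +_) (sum3-closed o l)) deg))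
        where
        lem : ∀ h s l → 2 * (1 + (h + s) + l) ≡ 2 * (1 + h + l) + 2 * s
        lem = solve-∀
      maj₀ : ∣ cT j (suc r) m ∣ ≤ Bit3 o l (near-K j r t ks) m
      maj₀ = at (Maj-cong (near-closed j t l ks id) (Maj-Bit3E o l (Maj-q (lo j) (Maj-lin j r (Maj-BitE ks (Maj-ι (qbN t (suc (2 * j))))))))) m

    cancel-bit : ∀ t f g → f ⊡ (1s ⊖ q^ (3 * suc t)) ≈ g ⊡ (1s ⊖ q^ (3 * suc t)) → f ≈ g
    cancel-bit t f g e = ≈-trans (≈-sym (inv f)) (≈-trans (⊡-congʳ _ e) (inv g))
      where
      inv : ∀ f → (f ⊡ (1s ⊖ q^ (3 * suc t))) ⊡ geo (2 + 3 * t) ≈ f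
      inv f = ≈-trans (⊡-assoc f _ _) (≈-trans (⊡-congˡ f (geo-inverse₃ t)) (≈-trans (⊡-comm f 1s) (⊡-identityˡ f)))

    poch-cong : ∀ {a b} → a ≡ b → poch a ≈ poch b
    poch-cong refl m = refl

    poch-3suc : ∀ t → poch (3 * suc t) ≈ poch (suc (3 * t)) ⊡ (1s ⊖ q^ (2 + 3 * t)) ⊡ (1s ⊖ q^ (3 * suc t))
    poch-3suc t = ≈-trans (poch-cong (3*suc t)) (⊡-congˡ _ (⊖-cong (q^-cong (sym (3*suc t)))))

    residue₀ : ∀ j₁ t u → 16 ≤ j₁ → suc j₁ ≡ suc t + u → ∀ m → suc j₁ * suc (suc j₁) * ∣ cT (suc j₁) (suc (3 * suc t)) m ∣ ≤ 10 * T₀ (suc (3 * suc j₁ + 3 * suc t)) m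
    residue₀ j₁ t u 16≤ ej m = subst (λ r → j * suc j * ∣ cT j (suc r) m ∣ ≤ 10 * T₀ (suc (3 * j + r)) m) er
        (near-case j₁ (suc t) u (suc (2 * t)) (between (suc t) u) 16≤ ej r≤ (≤-reflexive (len-between (suc t) u)) deg id m)
      where
      j = suc j₁
      er : suc (suc t + suc (2 * t)) ≡ 3 * suc t
      er = lem t
        where
        lem : ∀ t → suc (suc t + suc (2 * t)) ≡ 3 * suc t
        lem = solve-∀
      r≤ : suc (suc t + suc (2 * t)) ≤ 3 * j
      r≤ = ≤-trans (≤-reflexive er) (*-monoʳ-≤ 3 (≤-trans (m≤m+n (suc t) u) (≤-reflexive (sym ej))))
      deg : 2 * (1 + near-hi j (suc (suc t + suc (2 * t))) (suc t) (between (suc t) u) + lo j) + 3 * (suc (2 * t) * (suc (2 * j + suc t) + suc (2 * j + suc t) + suc (2 * t) + 1))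
        ≡ 2 * (suc (3 * j + suc (suc t + suc (2 * t))) * suc (3 * j + suc (suc t + suc (2 * t))))
      deg = +-cancelʳ-≡ (2 * (3 * (suc t * suc t))) _ _ (trans (sh₁ (lo j) (suc (3 * j + suc (suc t + suc (2 * t)))) (2 + 3 * j) (sum (between (suc t) u)) (3 * (suc t * suc (2 * j))) (3 * (suc t * suc t)) _)
          (trans (cong (λ x → 2 * (1 + (lo j + (suc (3 * j + suc (suc t + suc (2 * t))) + (2 + 3 * j + (x + 3 * (suc t * suc (2 * j)))))) + lo j) + 3 * (suc (2 * t) * (suc (2 * j + suc t) + suc (2 * j + suc t) + suc (2 * t) + 1)))
              (trans (sum-between (suc t) u) (cong (λ x → 3 * (x * x)) (sym ej)))) (lem j₁ t)))
        where
        sh₁ : ∀ l n a s b c d → 2 * (1 + (l + (n + (a + (s + b)))) + l) + d + 2 * c ≡ 2 * (1 + (l + (n + (a + ((s + c) + b)))) + l) + d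
        sh₁ = solve-∀
        lem : ∀ j₁ t → let j = suc j₁ in 2 * (1 + (3 * (j * j) + 3 * j + (suc (3 * j + suc (suc t + suc (2 * t))) + (2 + 3 * j + (3 * (j * j) + 3 * (suc t * suc (2 * j)))))) + (3 * (j * j) + 3 * j)) + 3 * (suc (2 * t) * (suc (2 * j + suc t) + suc (2 * j + suc t) + suc (2 * t) + 1))
          ≡ 2 * (suc (3 * j + suc (suc t + suc (2 * t))) * suc (3 * j + suc (suc t + suc (2 * t)))) + 2 * (3 * (suc t * suc t))
        lem = solve-∀
      id : BitE (between (suc t) u) ⊡ (poch (suc (suc t + suc (2 * t))) ⊡ pochQ j) ≈ poch (3 * j) ⊡ pochQ (suc t)
      id = ≈-trans (⊡-congˡ (BitE (between (suc t) u)) (⊡-cong (poch-cong er) (pochQ-cong ej))) (≈-trans (between-poch (suc t) u) (⊡-congʳ (pochQ (suc t)) (poch-cong (cong (3 *_) (sym ej)))))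

    -- After multiplication by 1 - Q^(t+1) the identity is that of the next multiple of 3.
    module Residue (j₁ t u : ℕ) (16≤ : 16 ≤ j₁) (ej : suc j₁ ≡ suc t + u) where
      j = suc j₁
      ks₁ ks₂ : List ℕ
      ks₂ = between (suc t) u
      ks₁ = 2 + 3 * t ∷ ks₂

      next : BitE ks₂ ⊡ (poch (3 * suc t) ⊡ pochQ j) ≈ poch (3 * j) ⊡ pochQ (suc t)
      next = ≈-trans (⊡-congˡ (BitE ks₂) (⊡-congˡ (poch (3 * suc t)) (pochQ-cong ej))) (≈-trans (between-poch (suc t) u) (⊡-congʳ (pochQ (suc t)) (poch-cong (cong (3 *_) (sym ej)))))

      x y : Ser
      x = 1s ⊖ q^ (2 + 3 * t)
      y = 1s ⊖ q^ (3 * suc t)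

      id₀ : (BitE ks₂ ⊡ x) ⊡ (poch (suc (3 * t)) ⊡ pochQ j) ≈ poch (3 * j) ⊡ pochQ t
      id₀ = cancel-bit t _ _ (≈-trans (solve 5 (λ b x p P y → ((b :* x) :* (p :* P)) :* y := b :* ((p :* x :* y) :* P)) ≈-refl (BitE ks₂) x (poch (suc (3 * t))) (pochQ j) y)
        (≈-trans (⊡-congˡ (BitE ks₂) (⊡-congʳ (pochQ j) (≈-sym (poch-3suc t)))) (≈-trans next (≈-sym (⊡-assoc (poch (3 * j)) (pochQ t) y)))))

      er₁ : ∀ t → suc (t + 2 * t) ≡ suc (3 * t)
      er₁ = solve-∀
      er₂ : ∀ t → suc (t + suc (2 * t)) ≡ 2 + 3 * t
      er₂ = solve-∀

      id₁ : BitE ks₁ ⊡ (poch (suc (t + 2 * t)) ⊡ pochQ j) ≈ poch (3 * j) ⊡ pochQ t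
      id₁ = ≈-trans (⊡-congˡ (BitE ks₁) (⊡-congʳ (pochQ j) (poch-cong (er₁ t)))) id₀

      id₂ : BitE ks₂ ⊡ (poch (suc (t + suc (2 * t))) ⊡ pochQ j) ≈ poch (3 * j) ⊡ pochQ t
      id₂ = ≈-trans (⊡-congˡ (BitE ks₂) (⊡-congʳ (pochQ j) (poch-cong (er₂ t)))) (≈-trans (solve 4 (λ b p x P → b :* ((p :* x) :* P) := (b :* x) :* (p :* P)) ≈-refl (BitE ks₂) (poch (suc (3 * t))) x (pochQ j)) id₀)

      ej′ : j ≡ t + suc u
      ej′ = trans ej (sym (+-suc t u))

      3t+3≤ : 3 + 3 * t ≤ 3 * j
      3t+3≤ = ≤-trans (≤-reflexive (lem t)) (*-monoʳ-≤ 3 (≤-trans (m≤m+n (suc t) u) (≤-reflexive (sym ej))))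
        where
        lem : ∀ t → 3 + 3 * t ≡ 3 * suc t
        lem = solve-∀

      sum₂ : sum ks₂ + 3 * (suc t * suc t) ≡ 3 * (j * j)
      sum₂ = trans (sum-between (suc t) u) (cong (λ x → 3 * (x * x)) (sym ej))

      deg₁ : 2 * (1 + near-hi j (suc (t + 2 * t)) t ks₁ + lo j) + 3 * (2 * t * (suc (2 * j + t) + suc (2 * j + t) + 2 * t + 1)) ≡ 2 * (suc (3 * j + suc (t + 2 * t)) * suc (3 * j + suc (t + 2 * t)))
      deg₁ = +-cancelʳ-≡ (2 * (3 * (suc t * suc t))) _ _ (trans (sh₁ (lo j) (suc (3 * j + suc (t + 2 * t))) (2 + 3 * j) (2 + 3 * t) (sum ks₂) (3 * (t * suc (2 * j))) (3 * (suc t * suc t)) _)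
          (trans (cong (λ x → 2 * (1 + (lo j + (suc (3 * j + suc (t + 2 * t)) + (2 + 3 * j + (2 + 3 * t + x + 3 * (t * suc (2 * j)))))) + lo j) + 3 * (2 * t * (suc (2 * j + t) + suc (2 * j + t) + 2 * t + 1))) sum₂) (lem j₁ t)))
        where
        sh₁ : ∀ l n a e s b c d → 2 * (1 + (l + (n + (a + (e + s + b)))) + l) + d + 2 * c ≡ 2 * (1 + (l + (n + (a + (e + (s + c) + b)))) + l) + d
        sh₁ = solve-∀
        lem : ∀ j₁ t → let j = suc j₁ in 2 * (1 + (3 * (j * j) + 3 * j + (suc (3 * j + suc (t + 2 * t)) + (2 + 3 * j + (2 + 3 * t + 3 * (j * j) + 3 * (t * suc (2 * j)))))) + (3 * (j * j) + 3 * j)) + 3 * (2 * t * (suc (2 * j + t) + suc (2 * j + t) + 2 * t + 1))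
          ≡ 2 * (suc (3 * j + suc (t + 2 * t)) * suc (3 * j + suc (t + 2 * t))) + 2 * (3 * (suc t * suc t))
        lem = solve-∀

      deg₂ : 2 * (1 + near-hi j (suc (t + suc (2 * t))) t ks₂ + lo j) + 3 * (suc (2 * t) * (suc (2 * j + t) + suc (2 * j + t) + suc (2 * t) + 1)) ≡ 2 * (suc (3 * j + suc (t + suc (2 * t))) * suc (3 * j + suc (t + suc (2 * t))))
      deg₂ = +-cancelʳ-≡ (2 * (3 * (suc t * suc t))) _ _ (trans (sh₁ (lo j) (suc (3 * j + suc (t + suc (2 * t)))) (2 + 3 * j) (sum ks₂) (3 * (t * suc (2 * j))) (3 * (suc t * suc t)) _)
          (trans (cong (λ x → 2 * (1 + (lo j + (suc (3 * j + suc (t + suc (2 * t))) + (2 + 3 * j + (x + 3 * (t * suc (2 * j)))))) + lo j) + 3 * (suc (2 * t) * (suc (2 * j + t) + suc (2 * j + t) + suc (2 * t) + 1))) sum₂) (lem j₁ t)))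
        where
        sh₁ : ∀ l n a s b c d → 2 * (1 + (l + (n + (a + (s + b)))) + l) + d + 2 * c ≡ 2 * (1 + (l + (n + (a + ((s + c) + b)))) + l) + d
        sh₁ = solve-∀
        lem : ∀ j₁ t → let j = suc j₁ in 2 * (1 + (3 * (j * j) + 3 * j + (suc (3 * j + suc (t + suc (2 * t))) + (2 + 3 * j + (3 * (j * j) + 3 * (t * suc (2 * j)))))) + (3 * (j * j) + 3 * j)) + 3 * (suc (2 * t) * (suc (2 * j + t) + suc (2 * j + t) + suc (2 * t) + 1))
          ≡ 2 * (suc (3 * j + suc (t + suc (2 * t))) * suc (3 * j + suc (t + suc (2 * t)))) + 2 * (3 * (suc t * suc t))
        lem = solve-∀

      residue₁ : ∀ m → j * suc j * ∣ cT j (2 + 3 * t) m ∣ ≤ 10 * T₀ (suc (3 * j + suc (3 * t))) m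
      residue₁ m = subst (λ r → j * suc j * ∣ cT j (suc r) m ∣ ≤ 10 * T₀ (suc (3 * j + r)) m) (er₁ t)
        (near-case j₁ t (suc u) (2 * t) ks₁ 16≤ ej′ (≤-trans (≤-reflexive (er₁ t)) (≤-trans (m≤n+m _ 2) 3t+3≤)) (≤-trans (*-mono-≤ {2} {4} (≤ᵇ⇒≤ 2 4 _) (≤-reflexive (len-between (suc t) u))) ≤-refl) deg₁ id₁ m)

      residue₂ : ∀ m → j * suc j * ∣ cT j (3 + 3 * t) m ∣ ≤ 10 * T₀ (suc (3 * j + (2 + 3 * t))) m
      residue₂ m = subst (λ r → j * suc j * ∣ cT j (suc r) m ∣ ≤ 10 * T₀ (suc (3 * j + r)) m) (er₂ t)
        (near-case j₁ t (suc u) (suc (2 * t)) ks₂ 16≤ ej′ (≤-trans (≤-reflexive (er₂ t)) (≤-trans (m≤n+m _ 1) 3t+3≤)) (≤-trans (≤-reflexive (len-between (suc t) u)) (m≤m+n (4 ^ u) _)) deg₂ id₂ m)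

    -- r = 0 is not of the form t + l + 1 and is handled by its own closed form, without factors 1 -
    -- Q^i.
    residue-0 : ∀ j₁ → 16 ≤ j₁ → ∀ m → suc j₁ * suc (suc j₁) * ∣ cT (suc j₁) 1 m ∣ ≤ 10 * T₀ (suc (3 * suc j₁ + 0)) m
    residue-0 j₁ 16≤ m = ≤-trans (*-monoʳ-≤ (j * suc j) maj₀) (near-generic j₁ 0 0 j 16≤ z≤n (≤-trans (≤-reflexive (+-identityʳ (3 * j))) (*-monoʳ-≤ 3 (n≤1+n j))) sK τ≤ deg m)
      where
      j = suc j₁
      ks = between 0 j
      K = shN (lo j) (BitL ks δ)
      sK : Supp K (lo j) (lo j + (sum ks + 0)) (2 ^ length ks * 1)
      sK = Supp-weaken (≤-reflexive (sym (+-identityʳ (lo j)))) ≤-refl (Supp-sh (lo j) (Supp-BitL ks Supp-δ))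
      maj₀ : ∣ cT j 1 m ∣ ≤ K m
      maj₀ = at (Maj-cong (≈-trans (last-closed j) (⊡-congˡ (q^ (lo j)) (≈-sym (≈-trans (⊡-congˡ (BitE ks) ι-δ) (≈-trans (⊡-comm (BitE ks) 1s) (⊡-identityˡ (BitE ks))))))) (Maj-q (lo j) (Maj-BitE ks (Maj-ι δ)))) m
      τ≤ : 2 ^ length ks * 1 * 3 ^ suc (2 * j) ≤ 16 * 4 ^ (3 * j)
      τ≤ = ≤-trans (*-mono-≤ (≤-reflexive (trans (*-identityʳ (2 ^ length ks)) (len-between 0 j))) (^-monoˡ-≤ (suc (2 * j)) (n≤1+n 3)))
        (≤-trans (≤-reflexive (trans (sym (^-distribˡ-+-* 4 j (suc (2 * j)))) (cong (4 ^_) (lem j)))) (*-monoˡ-≤ (4 ^ (3 * j)) (≤ᵇ⇒≤ 4 16 _)))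
        where
        lem : ∀ j → j + suc (2 * j) ≡ suc (3 * j)
        lem = solve-∀
      deg : 1 + (lo j + (sum ks + 0) + 0) + lo j ≡ suc (3 * j + 0) * suc (3 * j + 0)
      deg = trans (sh₁ (lo j) (sum ks)) (trans (cong (λ x → 1 + (lo j + x) + lo j) (sum-between 0 j)) (lem j))
        where
        sh₁ : ∀ l s → 1 + (l + (s + 0) + 0) + l ≡ 1 + (l + (s + 3 * (0 * 0))) + l
        sh₁ = solve-∀
        lem : ∀ j → 1 + (3 * (j * j) + 3 * j + 3 * (j * j)) + (3 * (j * j) + 3 * j) ≡ suc (3 * j + 0) * suc (3 * j + 0)
        lem = solve-∀

  near-bound : ∀ j₁ r → 16 ≤ j₁ → let j = suc j₁ in r ≤ 3 * j → ∀ m → j * suc j * ∣ cT j (suc r) m ∣ ≤ 10 * T₀ (suc (3 * j + r)) m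
  near-bound j₁ r 16≤ r≤ m = subst G (sym r≡) (go (r % 3) (r / 3) (m%n<n r 3) (subst (_≤ 3 * j) r≡ r≤))
    where
    j = suc j₁
    G : ℕ → Set
    G r = j * suc j * ∣ cT j (suc r) m ∣ ≤ 10 * T₀ (suc (3 * j + r)) m
    r≡ : r ≡ r % 3 + 3 * (r / 3)
    r≡ = trans (m≡m%n+[m/n]*n r 3) (cong (r % 3 +_) (*-comm (r / 3) 3))
    quot : ∀ t → suc (3 * t) ≤ 3 * j → Σ ℕ λ u → j ≡ suc t + u
    quot t p = j ℕ.∸ suc t , sym (m+[n∸m]≡n (*-cancelˡ-< 3 t j p))
    go : ∀ d t → d < 3 → d + 3 * t ≤ 3 * j → G (d + 3 * t)
    go 0 zero _ _ = residue-0 j₁ 16≤ m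
    go 0 (suc t) _ p = residue₀ j₁ t (j ℕ.∸ suc t) 16≤ (sym (m+[n∸m]≡n {suc t} {j} (*-cancelˡ-≤ {suc t} {j} 3 p))) m
    go 1 t _ p = Residue.residue₁ j₁ t (proj₁ (quot t p)) 16≤ (proj₂ (quot t p)) m
    go 2 t _ p = Residue.residue₂ j₁ t (proj₁ (quot t p′)) 16≤ (proj₂ (quot t p′)) m
      where p′ = ≤-trans (n≤1+n _) p
    go (suc (suc (suc d))) t (s≤s (s≤s (s≤s ()))) p

-- Polynomials in v = q^(r+1) with series as coefficients

module Bivariate where

  open PowerSeries
  open SingleSum
  open Kronecker
  open Windows using (shN; tri; cum)
  open IntervalProducts using (TriP; all)
  open FarSummands using (δ; lead; T₀; Supp)
  open ClosedForms
  open SummandBounds using (Supp-qb; ⊡-swapˡ)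
  open import Data.Nat as ℕ using (ℕ; zero; suc)
  import Data.Nat.Properties as ℕ
  import Data.Nat.Tactic.RingSolver as ℕ-Ring
  open import Data.Integer as ℤ using (ℤ; +_; 0ℤ; 1ℤ)
  import Data.Integer.Properties as ℤ
  open import Data.List using (List; []; _∷_; map; replicate; length)
  open import Data.List.Relation.Unary.All using (All; []; _∷_)
  open import Relation.Binary.PropositionalEquality hiding (setoid)

  open Enc
  open Bounded

  -- Horner form of a polynomial in v. For the coefficients used later only j matters, so that a
  -- statement about the list holds for all n at once.
  ev : Ser → List Ser → Ser
  ev v [] = 0s
  ev v (z ∷ zs) = z ⊞ v ⊡ ev v zs

  addS : List Ser → List Ser → List Ser
  addS [] ws = ws
  addS (z ∷ zs) [] = z ∷ zs
  addS (z ∷ zs) (w ∷ ws) = z ⊞ w ∷ addS zs ws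

  ev-add : ∀ v zs ws → ev v (addS zs ws) ≈ ev v zs ⊞ ev v ws
  ev-add v [] ws m = sym (ℤ.+-identityˡ _)
  ev-add v (z ∷ zs) [] m = sym (ℤ.+-identityʳ _)
  ev-add v (z ∷ zs) (w ∷ ws) = ≈-trans (⊞-cong {z ⊞ w} ≈-refl (⊡-congˡ v (ev-add v zs ws)))
    (solve 5 (λ z w v x y → z :+ w :+ v :* (x :+ y) := z :+ v :* x :+ (w :+ v :* y)) ≈-refl z w v (ev v zs) (ev v ws))

  ev-map : ∀ v a (φ : Ser → Ser) → (∀ f → φ f ≈ a ⊡ f) → ∀ zs → ev v (map φ zs) ≈ a ⊡ ev v zs
  ev-map v a φ e [] = ≈-sym (≈-trans (⊡-comm a 0s) (⊡-zeroˡ a))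
  ev-map v a φ e (z ∷ zs) = ≈-trans (⊞-cong (e z) (⊡-congˡ v (ev-map v a φ e zs))) (solve 4 (λ a z v x → a :* z :+ v :* (a :* x) := a :* (z :+ v :* x)) ≈-refl a z v (ev v zs))

  sh-q : ∀ k f → sh k f ≈ q^ k ⊡ f
  sh-q k f = ≈-sym (q^-⊡ k f)

  ev-0∷ : ∀ v zs → ev v (0s ∷ zs) ≈ v ⊡ ev v zs
  ev-0∷ v zs m = ℤ.+-identityˡ _

  -- Because q^(r+1+d) = v q^d, these are the products with the trinomial of index r + 1 + d and
  -- with 1 - Q^(r+1+d), neither of which mentions r when written in v.
  mulT mulB : ℕ → List Ser → List Ser
  mulT d zs = addS zs (0s ∷ addS (map (sh d) zs) (0s ∷ map (sh (d ℕ.+ d)) zs))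
  mulB d zs = addS zs (0s ∷ 0s ∷ 0s ∷ map (λ f → ⊟ sh (3 ℕ.* d) f) zs)

  ev-mulT : ∀ r d zs → ev (q^ (suc r)) (mulT d zs) ≈ tE (suc (r ℕ.+ d)) ⊡ ev (q^ (suc r)) zs
  ev-mulT r d zs = begin
    ev v (mulT d zs) ≈⟨ ev-add v zs _ ⟩
    e ⊞ ev v (0s ∷ addS (map (sh d) zs) (0s ∷ map (sh (d ℕ.+ d)) zs))
      ≈⟨ ⊞-cong {e} ≈-refl (≈-trans (ev-0∷ v (addS (map (sh d) zs) (0s ∷ map (sh (d ℕ.+ d)) zs))) (⊡-congˡ v (≈-trans (ev-add v (map (sh d) zs) (0s ∷ map (sh (d ℕ.+ d)) zs)) (⊞-cong (ev-map v (q^ d) (sh d) (sh-q d) zs) (≈-trans (ev-0∷ v (map (sh (d ℕ.+ d)) zs)) (⊡-congˡ v (ev-map v (q^ (d ℕ.+ d)) (sh (d ℕ.+ d)) (sh-q (d ℕ.+ d)) zs))))))) ⟩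
    e ⊞ v ⊡ (q^ d ⊡ e ⊞ v ⊡ (q^ (d ℕ.+ d) ⊡ e)) ≈⟨ ⊞-cong {e} ≈-refl (⊡-congˡ v (⊞-cong {q^ d ⊡ e} ≈-refl (⊡-congˡ v (⊡-congʳ e (q^-×2 d))))) ⟩
    e ⊞ v ⊡ (q^ d ⊡ e ⊞ v ⊡ ((q^ d ⊡ q^ d) ⊡ e)) ≈⟨ solve 3 (λ e v x → e :+ v :* (x :* e :+ v :* ((x :* x) :* e)) := (c1 :+ v :* x :+ (v :* x) :* (v :* x)) :* e) ≈-refl e v (q^ d) ⟩
    (1s ⊞ v ⊡ q^ d ⊞ (v ⊡ q^ d) ⊡ (v ⊡ q^ d)) ⊡ e ≈⟨ ⊡-congʳ e (⊞-cong (⊞-cong {1s} ≈-refl (≈-sym (q^-+ (suc r) d))) (≈-sym (≈-trans (q^-×2 (suc (r ℕ.+ d))) (⊡-cong (q^-+ (suc r) d) (q^-+ (suc r) d))))) ⟩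
    tE (suc (r ℕ.+ d)) ⊡ e ∎
    where
    open ≈-Reasoning
    v = q^ (suc r)
    e = ev v zs

  ev-mulB : ∀ r d zs → ev (q^ (suc r)) (mulB d zs) ≈ (1s ⊖ q^ (3 ℕ.* suc (r ℕ.+ d))) ⊡ ev (q^ (suc r)) zs
  ev-mulB r d zs = begin
    ev v (mulB d zs) ≈⟨ ev-add v zs _ ⟩
    e ⊞ ev v (0s ∷ 0s ∷ 0s ∷ map φ zs) ≈⟨ ⊞-cong {e} ≈-refl (≈-trans (ev-0∷ v (0s ∷ 0s ∷ map φ zs)) (⊡-congˡ v (≈-trans (ev-0∷ v (0s ∷ map φ zs)) (⊡-congˡ v (≈-trans (ev-0∷ v (map φ zs)) (⊡-congˡ v (ev-map v (⊟ q^ (3 ℕ.* d)) φ φ≈ zs))))))) ⟩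
    e ⊞ v ⊡ (v ⊡ (v ⊡ ((⊟ q^ (3 ℕ.* d)) ⊡ e))) ≈⟨ solve 3 (λ e v x → e :+ v :* (v :* (v :* ((:- x) :* e))) := (c1 :- (v :* v :* v) :* x) :* e) ≈-refl e v (q^ (3 ℕ.* d)) ⟩
    (1s ⊖ (v ⊡ v ⊡ v) ⊡ q^ (3 ℕ.* d)) ⊡ e ≈⟨ ⊡-congʳ e (⊖-cong (≈-sym (≈-trans (Q-+ (suc r) d) (⊡-congʳ (q^ (3 ℕ.* d)) (q^-×3 (suc r)))))) ⟩
    (1s ⊖ q^ (3 ℕ.* suc (r ℕ.+ d))) ⊡ e ∎
    where
    open ≈-Reasoning
    v = q^ (suc r)
    e = ev v zs
    φ : Ser → Ser
    φ f = ⊟ sh (3 ℕ.* d) f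
    φ≈ : ∀ f → φ f ≈ (⊟ q^ (3 ℕ.* d)) ⊡ f
    φ≈ f = ≈-trans (⊟-cong (sh-q (3 ℕ.* d) f)) (solve 2 (λ x f → :- (x :* f) := (:- x) :* f) ≈-refl (q^ (3 ℕ.* d)) f)

  mulTs mulBs : ℕ → List Ser → List Ser
  mulTs zero zs = zs
  mulTs (suc d) zs = mulT d (mulTs d zs)
  mulBs zero zs = zs
  mulBs (suc d) zs = mulB d (mulBs d zs)

  ev-mulTs : ∀ r d zs → ev (q^ (suc r)) (mulTs d zs) ≈ TriE r d ⊡ ev (q^ (suc r)) zs
  ev-mulTs r zero zs = ≈-sym (⊡-identityˡ _)
  ev-mulTs r (suc d) zs = ≈-trans (ev-mulT r d (mulTs d zs)) (≈-trans (⊡-congˡ (tE (suc (r ℕ.+ d))) (ev-mulTs r d zs)) (≈-sym (⊡-swapˡ (TriE r d) (tE (suc (r ℕ.+ d))) _)))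

  ev-mulBs : ∀ r d zs → ev (q^ (suc r)) (mulBs d zs) ≈ Bit3E r d ⊡ ev (q^ (suc r)) zs
  ev-mulBs r zero zs = ≈-sym (⊡-identityˡ _)
  ev-mulBs r (suc d) zs = ≈-trans (ev-mulB r d (mulBs d zs)) (≈-trans (⊡-congˡ (1s ⊖ q^ (3 ℕ.* suc (r ℕ.+ d))) (ev-mulBs r d zs)) (≈-sym (⊡-swapˡ (Bit3E r d) (1s ⊖ q^ (3 ℕ.* suc (r ℕ.+ d))) _)))

  Nonneg : Ser → Set
  Nonneg f = ∀ m → 0ℤ ℤ.≤ f m

  Nonneg-⊞ : ∀ {f g} → Nonneg f → Nonneg g → Nonneg (f ⊞ g)
  Nonneg-⊞ p q m = ℤ.+-mono-≤ (p m) (q m)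

  Nonneg-cong : ∀ {f g} → f ≈ g → Nonneg f → Nonneg g
  Nonneg-cong e p m = subst (0ℤ ℤ.≤_) (e m) (p m)

  Nonneg-q : ∀ k {f} → Nonneg f → Nonneg (q^ k ⊡ f)
  Nonneg-q k {f} p = Nonneg-cong (sh-q k f) (go k)
    where
    go : ∀ k → Nonneg (sh k f)
    go zero m = p m
    go (suc k) zero = ℤ.≤-refl
    go (suc k) (suc m) = go k m

  Nonneg-ev : ∀ k {zs} → All Nonneg zs → Nonneg (ev (q^ k) zs)
  Nonneg-ev k [] m = ℤ.≤-refl
  Nonneg-ev k {z ∷ zs} (p ∷ ps) = Nonneg-⊞ p (Nonneg-q k (Nonneg-ev k ps))

  Nonneg-TriE : ∀ a l {f} → Nonneg f → Nonneg (TriE a l ⊡ f)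
  Nonneg-TriE a zero {f} p = Nonneg-cong (≈-sym (⊡-identityˡ f)) p
  Nonneg-TriE a (suc l) {f} p = Nonneg-cong (≈-trans (solve 3 (λ x y f → f :+ x :* f :+ y :* f := (c1 :+ x :+ y) :* f) ≈-refl (q^ k) (q^ (k ℕ.+ k)) g) (≈-sym (⊡-swapˡ (TriE a l) (tE k) f)))
      (Nonneg-⊞ (Nonneg-⊞ ih (Nonneg-q k ih)) (Nonneg-q (k ℕ.+ k) ih))
    where
    k = suc (a ℕ.+ l)
    g = TriE a l ⊡ f
    ih = Nonneg-TriE a l p

  TriE-ι : ∀ a l f → ι (TriP all a l f) ≈ TriE a l ⊡ ι f
  TriE-ι a zero f = ≈-sym (⊡-identityˡ (ι f))
  TriE-ι a (suc l) f = ≈-trans step (≈-trans (⊡-congˡ (tE k) (TriE-ι a l f)) (≈-sym (⊡-swapˡ (TriE a l) (tE k) (ι f))))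
    where
    k = suc (a ℕ.+ l)
    g = TriP all a l f
    step : ι (tri k g) ≈ tE k ⊡ ι g
    step = ≈-trans (λ m → trans (ℤ.pos-+ (g m ℕ.+ shN k g m) _) (cong₂ ℤ._+_ (trans (ℤ.pos-+ (g m) _) (cong (λ □ → + g m ℤ.+ □) (sym (sh-ι k g m)))) (sym (sh-ι (k ℕ.+ k) g m))))
      (≈-trans (⊞-cong (⊞-cong {ι g} ≈-refl (sh-q k (ι g))) (sh-q (k ℕ.+ k) (ι g))) (solve 3 (λ x y f → f :+ x :* f :+ y :* f := (c1 :+ x :+ y) :* f) ≈-refl (q^ k) (q^ (k ℕ.+ k)) (ι g)))

  lead-ι : ∀ n → ι (lead n) ≈ 1s ⊞ q^ n ⊞ q^ (suc n)
  lead-ι n m = trans (ℤ.pos-+ (δ m ℕ.+ shN n δ m) _) (cong₂ ℤ._+_ (trans (ℤ.pos-+ (δ m) _) (cong₂ ℤ._+_ (ι-δ m) (sδ n))) (sδ (suc n)))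
    where
    sδ : ∀ k → + shN k δ m ≡ q^ k m
    sδ k = trans (sym (sh-ι k δ m)) (sh-cong k ι-δ m)

  -- The case j = 0 of the closed form, in which the bracket collapses to 1 + q^n + q^(n+1).
  cT₀ : ∀ e → cT 0 (2 ℕ.+ e) ≈ ι (T₀ (2 ℕ.+ e))
  cT₀ e = ≈-trans (far-closed 0 e) (≈-trans (⊡-congˡ (TriE 1 e) (≈-trans (⊡-identityˡ _) (≈-trans (⊡-identityˡ _) b))) (≈-sym (TriE-ι 1 e (lead (2 ℕ.+ e)))))
    where
    n = 2 ℕ.+ e
    b : bracket 0 n ≈ ι (lead n)
    b = ≈-trans (⊞-cong ι-δ (⊡-congˡ (q^ n) (⊞-cong (⊞-cong ι-δ (⊡-congˡ (q^ 1) ι-δ)) (⊟-cong (⊡-congˡ (q^ 2) {qb⁻ 0 1} {⟨ 0ℤ ⟩} (λ { zero → refl ; (suc _) → refl }))))))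
      (≈-trans (solve 3 (λ u x y → c1 :+ u :* (c1 :+ x :* c1 :- y :* con 0ℤ) := c1 :+ u :+ x :* u) ≈-refl (q^ n) (q^ 1) (q^ 2)) (≈-trans (⊞-cong {1s ⊞ q^ n} ≈-refl (≈-sym (q^-+ 1 n))) (≈-sym (lead-ι n))))

  addL : List ℤ → List ℤ → List ℤ
  addL [] ws = ws
  addL (z ∷ zs) [] = z ∷ zs
  addL (z ∷ zs) (w ∷ ws) = z ℤ.+ w ∷ addL zs ws

  -- Only q is replaced by the number X while v stays symbolic, so each coefficient in v has its own
  -- value.
  data Pw (X : ℤ) (l : ℕ) : List Ser → List ℤ → Set where
    [] : Pw X l [] []
    _∷_ : ∀ {z zs v vs} → Enc X z l v → Pw X l zs vs → Pw X l (z ∷ zs) (v ∷ vs)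

  Pw-add : ∀ {X l zs ws vs us} → Pw X l zs vs → Pw X l ws us → Pw X l (addS zs ws) (addL vs us)
  Pw-add [] q = q
  Pw-add (p ∷ ps) [] = p ∷ ps
  Pw-add (p ∷ ps) (q ∷ qs) = Enc-⊞ p q ∷ Pw-add ps qs

  Pw-map : ∀ {X l l′ zs vs} (φ : Ser → Ser) (ψ : ℤ → ℤ) → (∀ {z v} → Enc X z l v → Enc X (φ z) l′ (ψ v)) → Pw X l zs vs → Pw X l′ (map φ zs) (map ψ vs)
  Pw-map φ ψ h [] = []
  Pw-map φ ψ h (p ∷ ps) = h p ∷ Pw-map φ ψ h ps

  Pw-mono : ∀ {X l zs vs} l′ → l ℕ.≤ l′ → Pw X l zs vs → Pw X l′ zs vs
  Pw-mono l′ p [] = []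
  Pw-mono l′ p (e ∷ es) = Enc-mono l′ p e ∷ Pw-mono l′ p es

  Enc-0 : ∀ {X} l → Enc X 0s l 0ℤ
  Enc-0 {X} l = Enc-mono l ℕ.z≤n (enc (λ _ _ → refl) refl)

  mulTL : ℤ → ℤ → List ℤ → List ℤ
  mulTL x y vs = addL vs (0ℤ ∷ addL (map (x ℤ.*_) vs) (0ℤ ∷ map (y ℤ.*_) vs))

  mulBL : ℤ → List ℤ → List ℤ
  mulBL x vs = addL vs (0ℤ ∷ 0ℤ ∷ 0ℤ ∷ map (λ v → ℤ.- (x ℤ.* v)) vs)

  Pw-mulT : ∀ {X l zs vs} d → Pw X l zs vs → Pw X ((d ℕ.+ d) ℕ.+ l) (mulT d zs) (mulTL (X ℤ.^ d) (X ℤ.^ (d ℕ.+ d)) vs)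
  Pw-mulT {X} {l} d p = Pw-add (Pw-mono _ (ℕ.m≤n+m l (d ℕ.+ d)) p) (Enc-0 _ ∷ Pw-add
      (Pw-mono _ (ℕ.+-monoˡ-≤ l (ℕ.m≤m+n d d)) (Pw-map (sh d) (X ℤ.^ d ℤ.*_) (Enc-sh d) p))
      (Enc-0 _ ∷ Pw-map (sh (d ℕ.+ d)) (X ℤ.^ (d ℕ.+ d) ℤ.*_) (Enc-sh (d ℕ.+ d)) p))

  Pw-mulB : ∀ {X l zs vs} d → Pw X l zs vs → Pw X (3 ℕ.* d ℕ.+ l) (mulB d zs) (mulBL (X ℤ.^ (3 ℕ.* d)) vs)
  Pw-mulB {X} {l} d p = Pw-add (Pw-mono _ (ℕ.m≤n+m l (3 ℕ.* d)) p) (Enc-0 _ ∷ Enc-0 _ ∷ Enc-0 _ ∷ Pw-map _ _ (λ e → Enc-⊟ (Enc-sh (3 ℕ.* d) e)) p)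

  mulTLs mulBLs : ℤ → ℕ → List ℤ → List ℤ
  mulTLs X zero vs = vs
  mulTLs X (suc d) vs = mulTL (X ℤ.^ d) (X ℤ.^ (d ℕ.+ d)) (mulTLs X d vs)
  mulBLs X zero vs = vs
  mulBLs X (suc d) vs = mulBL (X ℤ.^ (3 ℕ.* d)) (mulBLs X d vs)

  lenT lenB : ℕ → ℕ → ℕ
  lenT zero l = l
  lenT (suc d) l = (d ℕ.+ d) ℕ.+ lenT d l
  lenB zero l = l
  lenB (suc d) l = 3 ℕ.* d ℕ.+ lenB d l

  Pw-mulTs : ∀ {X l zs vs} d → Pw X l zs vs → Pw X (lenT d l) (mulTs d zs) (mulTLs X d vs)
  Pw-mulTs zero p = p
  Pw-mulTs (suc d) p = Pw-mulT d (Pw-mulTs d p)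

  Pw-mulBs : ∀ {X l zs vs} d → Pw X l zs vs → Pw X (lenB d l) (mulBs d zs) (mulBLs X d vs)
  Pw-mulBs zero p = p
  Pw-mulBs (suc d) p = Pw-mulB d (Pw-mulBs d p)

  Bounded-mono : ∀ {a b f} → a ℕ.≤ b → Bounded a f → Bounded b f
  Bounded-mono p q = bounded λ m → ℕ.≤-trans (bound q m) p

  Bounded-0 : ∀ {a} → Bounded a 0s
  Bounded-0 = bounded λ _ → ℕ.z≤n

  All-add : ∀ {a b zs ws} → All (Bounded a) zs → All (Bounded b) ws → All (Bounded (a ℕ.+ b)) (addS zs ws)
  All-add {a} {b} [] q = weaken q
    where
    weaken : ∀ {ws} → All (Bounded b) ws → All (Bounded (a ℕ.+ b)) ws
    weaken [] = []
    weaken (x ∷ xs) = Bounded-mono (ℕ.m≤n+m b a) x ∷ weaken xs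
  All-add {a} {b} (p ∷ ps) [] = weaken (p ∷ ps)
    where
    weaken : ∀ {ws} → All (Bounded a) ws → All (Bounded (a ℕ.+ b)) ws
    weaken [] = []
    weaken (x ∷ xs) = Bounded-mono (ℕ.m≤m+n a b) x ∷ weaken xs
  All-add (p ∷ ps) (q ∷ qs) = Bounded-⊞ p q ∷ All-add ps qs

  All-map : ∀ {a b zs} (φ : Ser → Ser) → (∀ {f} → Bounded a f → Bounded b (φ f)) → All (Bounded a) zs → All (Bounded b) (map φ zs)
  All-map φ h [] = []
  All-map φ h (p ∷ ps) = h p ∷ All-map φ h ps

  bd-mulTs : ∀ {b zs} d → All (Bounded b) zs → All (Bounded (3 ℕ.^ d ℕ.* b)) (mulTs d zs)
  bd-mulTs {b} {zs} zero p = subst (λ c → All (Bounded c) zs) (sym (ℕ.+-identityʳ b)) p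
  bd-mulTs {b} {zs} (suc d) p = subst (λ c → All (Bounded c) (mulTs (suc d) zs)) (lem (3 ℕ.^ d) b)
      (All-add ih (Bounded-0 ∷ All-add (All-map (sh d) (Bounded-sh d) ih) (Bounded-0 ∷ All-map (sh (d ℕ.+ d)) (Bounded-sh (d ℕ.+ d)) ih)))
    where
    ih = bd-mulTs d p
    lem : ∀ a b → a ℕ.* b ℕ.+ (a ℕ.* b ℕ.+ a ℕ.* b) ≡ 3 ℕ.* a ℕ.* b
    lem = ℕ-Ring.solve-∀

  bd-mulBs : ∀ {b zs} d → All (Bounded b) zs → All (Bounded (2 ℕ.^ d ℕ.* b)) (mulBs d zs)
  bd-mulBs {b} {zs} zero p = subst (λ c → All (Bounded c) zs) (sym (ℕ.+-identityʳ b)) p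
  bd-mulBs {b} {zs} (suc d) p = subst (λ c → All (Bounded c) (mulBs (suc d) zs)) (lem (2 ℕ.^ d) b)
      (All-add ih (Bounded-0 ∷ Bounded-0 ∷ Bounded-0 ∷ All-map (λ f → ⊟ sh (3 ℕ.* d) f) (λ p → Bounded-⊟ (Bounded-sh (3 ℕ.* d) p)) ih))
    where
    ih = bd-mulBs d p
    lem : ∀ a b → a ℕ.* b ℕ.+ a ℕ.* b ≡ 2 ℕ.* a ℕ.* b
    lem = ℕ-Ring.solve-∀

  triV : ℤ → ℤ → ℤ
  triV x v = v ℤ.+ x ℤ.* v ℤ.+ x ℤ.* (x ℤ.* v)

  TriEV : ℤ → ℕ → ℤ
  TriEV X zero = 1ℤ
  TriEV X (suc l) = triV (X ℤ.^ (2 ℕ.+ l)) (TriEV X l)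

  lenE : ℕ → ℕ
  lenE zero = 1
  lenE (suc l) = (2 ℕ.+ l) ℕ.+ ((2 ℕ.+ l) ℕ.+ lenE l)

  TriE-sh : ∀ l → TriE 1 (suc l) ≈ TriE 1 l ⊞ sh (2 ℕ.+ l) (TriE 1 l) ⊞ sh (2 ℕ.+ l) (sh (2 ℕ.+ l) (TriE 1 l))
  TriE-sh l = ≈-trans (⊡-congˡ t (⊞-cong {1s ⊞ q^ k} ≈-refl (q^-×2 k))) (≈-trans (solve 2 (λ t x → t :* (c1 :+ x :+ x :* x) := t :+ x :* t :+ x :* (x :* t)) ≈-refl t (q^ k))
      (⊞-cong (⊞-cong {t} ≈-refl (q^-⊡ k t)) (≈-trans (⊡-congˡ (q^ k) (q^-⊡ k t)) (q^-⊡ k (sh k t)))))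
    where
    k = 2 ℕ.+ l
    t = TriE 1 l

  Enc-1 : ∀ {X} → Enc X 1s 1 1ℤ
  Enc-1 {X} = enc (λ { (suc m) _ → refl }) (trans (cong (λ □ → 1ℤ ℤ.+ □) (ℤ.*-zeroʳ X)) refl)

  Enc-TriE : ∀ X l → Enc X (TriE 1 l) (lenE l) (TriEV X l)
  Enc-TriE X zero = Enc-1
  Enc-TriE X (suc l) = Enc-cong (≈-sym (TriE-sh l)) refl (Enc-⊞ (Enc-⊞ (Enc-mono _ (ℕ.≤-trans (ℕ.m≤n+m _ k) (ℕ.m≤n+m _ k)) ih) (Enc-mono _ (ℕ.m≤n+m _ k) (Enc-sh k ih))) (Enc-sh k (Enc-sh k ih)))
    where
    k = 2 ℕ.+ l
    ih = Enc-TriE X l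

  bd-TriE : ∀ l → Bounded (3 ℕ.^ l) (TriE 1 l)
  bd-TriE zero = bounded λ { zero → ℕ.≤-refl ; (suc _) → ℕ.z≤n }
  bd-TriE (suc l) = subst (λ b → Bounded b (TriE 1 (suc l))) (lem (3 ℕ.^ l)) (Bounded-cong (≈-sym (TriE-sh l)) (Bounded-⊞ (Bounded-⊞ ih (Bounded-sh k ih)) (Bounded-sh k (Bounded-sh k ih))))
    where
    k = 2 ℕ.+ l
    ih = bd-TriE l
    lem : ∀ a → a ℕ.+ a ℕ.+ a ≡ 3 ℕ.* a
    lem = ℕ-Ring.solve-∀

  qb-vanish : ∀ a b m → 3 ℕ.* (a ℕ.* b) ℕ.< m → qb a b m ≡ 0ℤ
  qb-vanish a b (suc m) (ℕ.s≤s p) = cong +_ (ℕ.+-cancelˡ-≡ (cum (qbN a b) m) _ _ (trans (full-above (suc m) (ℕ.≤-trans p (ℕ.n≤1+n m))) (trans (sym (full-above m p)) (sym (ℕ.+-identityʳ _)))))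
    where open Supp (Supp-qb a b)

  -- The shift in the Pascal rule overestimates the length; the known degree of the q-binomial
  -- restores it, so that one length serves all entries of a row.
  Enc-shrink : ∀ {X f l l′ v} → Vanish l f → l ℕ.≤ l′ → Enc X f l′ v → Enc X f l v
  Enc-shrink {l′ = l′} z p e = enc z (trans (sym (value (Enc-mono l′ p (enc z refl)))) (value e))

  -- A row of the q-Pascal triangle at X: w is the entry just computed to the left, u the one in the
  -- preceding row.
  scanRow : ℤ → ℤ → List ℤ → List ℤ
  scanRow x w [] = []
  scanRow x w (u ∷ us) = (λ w′ → w′ ∷ scanRow x w′ us) (u ℤ.+ x ℤ.* w)

  nextRow : ℤ → List ℤ → List ℤ
  nextRow x [] = []
  nextRow x (_ ∷ us) = 1ℤ ∷ scanRow x 1ℤ us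

  rows : ℤ → ℕ → ℕ → List ℤ
  rows X B zero = replicate (suc B) 1ℤ
  rows X B (suc a) = nextRow (X ℤ.^ (3 ℕ.* suc a)) (rows X B a)

  data Row (X : ℤ) (D a : ℕ) : ℕ → List ℤ → Set where
    [] : ∀ {b} → Row X D a b []
    _∷_ : ∀ {b v vs} → Enc X (qb a b) D v → Row X D a (suc b) vs → Row X D a b (v ∷ vs)

  Enc-δ : ∀ {X} D → 1 ℕ.≤ D → Enc X (ι δ) D 1ℤ
  Enc-δ D p = Enc-cong (≈-sym ι-δ) refl (Enc-mono D p Enc-1)

  scanRow-ok : ∀ {X D} a b B w us → 3 ℕ.* (suc a ℕ.* B) ℕ.< D → b ℕ.+ length us ℕ.≤ B → Enc X (qb (suc a) b) D w → Row X D a (suc b) us →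
    Row X D (suc a) (suc b) (scanRow (X ℤ.^ (3 ℕ.* suc a)) w us)
  scanRow-ok a b B w [] D< b≤ ew [] = []
  scanRow-ok {X} {D} a b B w (u ∷ us) D< b≤ ew (eu ∷ eus) = ew′ ∷ scanRow-ok a (suc b) B _ us D< b≤′ ew′ eus
    where
    b≤′ : suc b ℕ.+ length us ℕ.≤ B
    b≤′ = ℕ.≤-trans (ℕ.≤-reflexive (sym (ℕ.+-suc b (length us)))) b≤
    van : Vanish D (qb (suc a) (suc b))
    van m p = qb-vanish (suc a) (suc b) m (ℕ.<-≤-trans (ℕ.≤-<-trans (ℕ.*-monoʳ-≤ 3 (ℕ.*-monoʳ-≤ (suc a) (ℕ.≤-trans (ℕ.m≤m+n (suc b) _) b≤′))) D<) p)
    ew′ : Enc X (qb (suc a) (suc b)) D (u ℤ.+ X ℤ.^ (3 ℕ.* suc a) ℤ.* w)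
    ew′ = Enc-shrink van (ℕ.m≤n+m D (3 ℕ.* suc a)) (Enc-cong (≈-sym (≈-trans (qb-suc a b) (⊞-cong {qb a (suc b)} ≈-refl (q^-⊡ (3 ℕ.* suc a) (qb (suc a) b))))) refl
      (Enc-⊞ (Enc-mono _ (ℕ.m≤n+m D (3 ℕ.* suc a)) eu) (Enc-sh (3 ℕ.* suc a) ew)))

  scanRow-length : ∀ x w us → length (scanRow x w us) ≡ length us
  scanRow-length x w [] = refl
  scanRow-length x w (u ∷ us) = cong suc (scanRow-length x _ us)

  rows-length : ∀ X B a → length (rows X B a) ≡ suc B
  rows-length X B zero = cong suc (go B)
    where
    go : ∀ B → length (replicate B 1ℤ) ≡ B
    go zero = refl
    go (suc B) = cong suc (go B)
  rows-length X B (suc a) with rows X B a | rows-length X B a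
  ... | u ∷ us | e = trans (cong suc (scanRow-length (X ℤ.^ (3 ℕ.* suc a)) 1ℤ us)) e

  rows-ok : ∀ X D B a → 3 ℕ.* (a ℕ.* B) ℕ.< D → Row X D a 0 (rows X B a)
  rows-ok X D B zero p = go (suc B)
    where
    go : ∀ B {b} → Row X D 0 b (replicate B 1ℤ)
    go zero = []
    go (suc B) = Enc-δ D p ∷ go B
  rows-ok X D B (suc a) p with rows X B a | rows-ok X D B a (ℕ.≤-<-trans (ℕ.*-monoʳ-≤ 3 (ℕ.*-monoˡ-≤ B (ℕ.n≤1+n a))) p) | rows-length X B a
  ... | u ∷ us | eu ∷ eus | e = e₀ ∷ scanRow-ok a 0 B 1ℤ us p (ℕ.≤-reflexive (ℕ.suc-injective e)) e₀ eus
    where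
    e₀ : Enc X (qb (suc a) 0) D 1ℤ
    e₀ = Enc-δ D (ℕ.≤-trans (ℕ.s≤s ℕ.z≤n) p)

  nthℤ : List ℤ → ℕ → ℤ
  nthℤ [] i = 0ℤ
  nthℤ (v ∷ vs) zero = v
  nthℤ (v ∷ vs) (suc i) = nthℤ vs i

  Row-nth : ∀ {X D a b vs} i → i ℕ.< length vs → Row X D a b vs → Enc X (qb a (b ℕ.+ i)) D (nthℤ vs i)
  Row-nth {X} {D} {a} {b} zero _ (_∷_ {v = v} e es) = subst (λ k → Enc X (qb a k) D v) (sym (ℕ.+-identityʳ b)) e
  Row-nth {X} {D} {a} {b} {v ∷ vs} (suc i) (ℕ.s≤s p) (e ∷ es) = subst (λ k → Enc X (qb a k) D (nthℤ vs i)) (sym (ℕ.+-suc b i)) (Row-nth i p es)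

  Enc-qb : ∀ X D B a b → 3 ℕ.* (a ℕ.* B) ℕ.< D → b ℕ.≤ B → Enc X (qb a b) D (nthℤ (rows X B a) b)
  Enc-qb X D B a b p q = Row-nth b (subst (b ℕ.<_) (sym (rows-length X B a)) (ℕ.s≤s q)) (rows-ok X D B a p)

  bd-qb : ∀ a b → Bounded (2 ℕ.^ (a ℕ.+ b)) (qb a b)
  bd-qb zero b = Bounded-mono (ℕ.m^n>0 2 b) (bounded λ { zero → ℕ.≤-refl ; (suc _) → ℕ.z≤n })
  bd-qb (suc a) zero = Bounded-mono (ℕ.m^n>0 2 (suc a ℕ.+ 0)) (bounded λ { zero → ℕ.≤-refl ; (suc _) → ℕ.z≤n })
  bd-qb (suc a) (suc b) = subst (λ c → Bounded c (qb (suc a) (suc b))) (trans (cong (λ k → 2 ℕ.^ k ℕ.+ 2 ℕ.^ (suc a ℕ.+ b)) (ℕ.+-suc a b)) (trans (cong (2 ℕ.^ (suc a ℕ.+ b) ℕ.+_) (sym (ℕ.+-identityʳ _))) (cong (2 ℕ.^_) (sym (ℕ.+-suc (suc a) b)))))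
    (Bounded-cong (≈-sym (≈-trans (qb-suc a b) (⊞-cong {qb a (suc b)} ≈-refl (q^-⊡ (3 ℕ.* suc a) (qb (suc a) b))))) (Bounded-⊞ (bd-qb a (suc b)) (Bounded-sh (3 ℕ.* suc a) (bd-qb (suc a) b))))

-- The bounds for 1 ≤ j ≤ 16 by finite computation

module SmallIndices where

  open PowerSeries
  open SingleSum
  open Kronecker
  open FarSummands using (lead; T₀)
  open Counting using (all<; all<-sound)
  open ClosedForms
  open Bivariate
  open import Data.Bool using (Bool; true; false; _∧_)
  open import Data.Nat as ℕ using (ℕ; zero; suc)
  import Data.Nat.Properties as ℕ
  import Data.Nat.Tactic.RingSolver as ℕ-Ring
  open import Data.Integer as ℤ using (ℤ; +_; -[1+_]; 0ℤ)
  import Data.Integer.Properties as ℤ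
  open import Data.List using (List; []; _∷_; map)
  open import Data.List.Relation.Unary.All using (All; []; _∷_)
  open import Data.Product using (proj₁; proj₂)
  open import Relation.Binary.PropositionalEquality hiding (setoid)

  scale : ℤ → Ser → Ser
  scale c f m = c ℤ.* f m

  scale-⊡ : ∀ c f → scale c f ≈ ⟨ c ⟩ ⊡ f
  scale-⊡ c f = ≈-sym (≈-trans (⊡-congʳ f e) (≈-trans (⊡-scaleˡ c 1s f) (λ m → cong (c ℤ.*_) (⊡-identityˡ f m))))
    where
    e : ⟨ c ⟩ ≈ scale c 1s
    e zero = sym (ℤ.*-identityʳ c)
    e (suc m) = sym (ℤ.*-zeroʳ c)

  Bounded-scale : ∀ {a f} c → Bounded a f → Bounded (c ℕ.* a) (scale (+ c) f)
  Bounded-scale {a} {f} c p = bounded λ m → ℕ.≤-trans (ℕ.≤-reflexive (ℤ.abs-* (+ c) (f m))) (ℕ.*-monoʳ-≤ c (Bounded.bound p m))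

  -- 2 T₀ + 5j(j+1) T_j without its common factor, as a polynomial in v = q^(r+1)

  startR : ℕ → List Ser
  startR j = P ∷ sh (3 ℕ.* j) P ⊞ sh (suc (3 ℕ.* j)) P ∷ []
    where P = TriE 1 (3 ℕ.* j)

  -- Since q^n = v q^(3j), the bracket is linear in v: one q-binomial is its constant part, and the
  -- others make up the coefficient of v.
  startL : ℕ → List Ser
  startL j = sh (lo j) (qb j (suc (2 ℕ.* j))) ∷ sh (lo j ℕ.+ 3 ℕ.* j) (qb j (2 ℕ.* j) ⊞ sh (suc (3 ℕ.* j)) (qb j (2 ℕ.* j)) ⊖ sh (2 ℕ.+ 3 ℕ.* j) (qb⁻ j (suc (2 ℕ.* j)))) ∷ []

  weight : ℕ → ℕ
  weight j = 5 ℕ.* (j ℕ.* suc j)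

  combined : ℕ → List Ser
  combined j = addS (map (scale (+ 2)) (mulTs (3 ℕ.* j) (startR j))) (map (scale (+ weight j)) (mulBs (2 ℕ.* j) (startL j)))

  -- Apart from v, the size of n enters only through the common trinomials of index in (3j + 1, r],
  -- whose coefficients are nonnegative.
  ev-combined : ∀ j e → let r = suc (3 ℕ.* j ℕ.+ e) ; n = suc (3 ℕ.* j ℕ.+ r) in
    TriE (suc (3 ℕ.* j)) e ⊡ ev (q^ (suc r)) (combined j) ≈ scale (+ 2) (ι (T₀ n)) ⊞ scale (+ weight j) (cT j (suc r))
  ev-combined j e = begin
    Te ⊡ ev v (combined j) ≈⟨ ⊡-congˡ Te (≈-trans (ev-add v (map (scale (+ 2)) (mulTs (3 ℕ.* j) (startR j))) _)
       (⊞-cong (≈-trans (ev-map v ⟨ + 2 ⟩ (scale (+ 2)) (scale-⊡ (+ 2)) (mulTs (3 ℕ.* j) (startR j))) (⊡-congˡ ⟨ + 2 ⟩ (≈-trans (ev-mulTs r (3 ℕ.* j) (startR j)) (⊡-congˡ (TriE r (3 ℕ.* j)) evR))))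
               (≈-trans (ev-map v ⟨ + c ⟩ (scale (+ c)) (scale-⊡ (+ c)) (mulBs (2 ℕ.* j) (startL j))) (⊡-congˡ ⟨ + c ⟩ (≈-trans (ev-mulBs r (2 ℕ.* j) (startL j)) (⊡-congˡ (Bit3E r (2 ℕ.* j)) evL)))))) ⟩
    Te ⊡ (⟨ + 2 ⟩ ⊡ (T₃ ⊡ (P ⊡ l)) ⊞ ⟨ + c ⟩ ⊡ (B₃ ⊡ (q^ (lo j) ⊡ bracket j n)))
      ≈⟨ solve 8 (λ Te a T₃ P l b B K → Te :* (a :* (T₃ :* (P :* l)) :+ b :* (B :* K)) := a :* (((P :* Te) :* T₃) :* l) :+ b :* (Te :* (B :* K))) ≈-refl Te ⟨ + 2 ⟩ T₃ P l ⟨ + c ⟩ B₃ (q^ (lo j) ⊡ bracket j n) ⟩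
    ⟨ + 2 ⟩ ⊡ (((P ⊡ Te) ⊡ T₃) ⊡ l) ⊞ ⟨ + c ⟩ ⊡ (Te ⊡ (B₃ ⊡ (q^ (lo j) ⊡ bracket j n)))
      ≈⟨ ⊞-cong (≈-trans (⊡-congˡ ⟨ + 2 ⟩ (≈-sym T₀≈)) (≈-sym (scale-⊡ (+ 2) (ι (T₀ n))))) (≈-trans (⊡-congˡ ⟨ + c ⟩ (≈-sym (far-closed j e))) (≈-sym (scale-⊡ (+ c) (cT j (suc r))))) ⟩
    scale (+ 2) (ι (T₀ n)) ⊞ scale (+ c) (cT j (suc r)) ∎
    where
    open ≈-Reasoning
    r = suc (3 ℕ.* j ℕ.+ e)
    n = suc (3 ℕ.* j ℕ.+ r)
    c = weight j
    v = q^ (suc r)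
    Te = TriE (suc (3 ℕ.* j)) e
    T₃ = TriE r (3 ℕ.* j)
    B₃ = Bit3E r (2 ℕ.* j)
    P = TriE 1 (3 ℕ.* j)
    z = q^ (3 ℕ.* j)
    z₁ = q^ (suc (3 ℕ.* j))
    l = 1s ⊞ q^ n ⊞ q^ (suc n)
    un : q^ n ≈ v ⊡ z
    un = ≈-trans (q^-cong (cong suc (ℕ.+-comm (3 ℕ.* j) r))) (q^-+ (suc r) (3 ℕ.* j))
    un₁ : q^ (suc n) ≈ v ⊡ z₁
    un₁ = ≈-trans (q^-cong (trans (cong (λ x → suc (suc x)) (ℕ.+-comm (3 ℕ.* j) r)) (sym (ℕ.+-suc (suc r) (3 ℕ.* j))))) (q^-+ (suc r) (suc (3 ℕ.* j)))
    evR : ev v (startR j) ≈ P ⊡ l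
    evR = ≈-trans (⊞-cong {P} ≈-refl (⊡-congˡ v (≈-trans (⊞-cong (⊞-cong (sh-q (3 ℕ.* j) P) (sh-q (suc (3 ℕ.* j)) P)) (≈-trans (⊡-comm v 0s) (⊡-zeroˡ v))) (λ m → ℤ.+-identityʳ _))))
      (≈-trans (solve 4 (λ P v z z₁ → P :+ v :* (z :* P :+ z₁ :* P) := P :* (c1 :+ v :* z :+ v :* z₁)) ≈-refl P v z z₁)
        (⊡-congˡ P (⊞-cong (⊞-cong {1s} ≈-refl (≈-sym un)) (≈-sym un₁))))
    inner : Ser
    inner = qb j (2 ℕ.* j) ⊞ q^ (suc (3 ℕ.* j)) ⊡ qb j (2 ℕ.* j) ⊖ q^ (2 ℕ.+ 3 ℕ.* j) ⊡ qb⁻ j (suc (2 ℕ.* j))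
    evL : ev v (startL j) ≈ q^ (lo j) ⊡ bracket j n
    evL = ≈-trans (⊞-cong (sh-q (lo j) (qb j (suc (2 ℕ.* j)))) (⊡-congˡ v (≈-trans (⊞-cong (≈-trans (sh-q (lo j ℕ.+ 3 ℕ.* j) _) (⊡-cong (q^-+ (lo j) (3 ℕ.* j)) inner≈)) (≈-trans (⊡-comm v 0s) (⊡-zeroˡ v))) (λ m → ℤ.+-identityʳ _))))
      (≈-trans (solve 5 (λ a b v z i → a :* b :+ v :* ((a :* z) :* i) := a :* (b :+ (v :* z) :* i)) ≈-refl (q^ (lo j)) (qb j (suc (2 ℕ.* j))) v z inner)
        (⊡-congˡ (q^ (lo j)) (⊞-cong {qb j (suc (2 ℕ.* j))} ≈-refl (⊡-congʳ inner (≈-sym un)))))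
      where
      inner≈ : qb j (2 ℕ.* j) ⊞ sh (suc (3 ℕ.* j)) (qb j (2 ℕ.* j)) ⊖ sh (2 ℕ.+ 3 ℕ.* j) (qb⁻ j (suc (2 ℕ.* j))) ≈ inner
      inner≈ = ⊞-cong (⊞-cong {qb j (2 ℕ.* j)} ≈-refl (sh-q (suc (3 ℕ.* j)) (qb j (2 ℕ.* j)))) (⊟-cong (sh-q (2 ℕ.+ 3 ℕ.* j) (qb⁻ j (suc (2 ℕ.* j)))))
    T₀≈ : ι (T₀ n) ≈ ((P ⊡ Te) ⊡ T₃) ⊡ l
    T₀≈ = ≈-trans (TriE-ι 1 (n ℕ.∸ 2) (lead n)) (⊡-cong (≈-trans (λ m → cong (λ i → TriE 1 i m) n≡) (≈-trans (TriE-++ 1 (3 ℕ.* j ℕ.+ e) (3 ℕ.* j)) (⊡-congʳ T₃ (TriE-++ 1 (3 ℕ.* j) e)))) (lead-ι n))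
      where
      n≡ : n ℕ.∸ 2 ≡ 3 ℕ.* j ℕ.+ e ℕ.+ 3 ℕ.* j
      n≡ = cong (ℕ._∸ 2) (lem (3 ℕ.* j) e)
        where
        lem : ∀ a e → suc (a ℕ.+ suc (a ℕ.+ e)) ≡ 2 ℕ.+ (a ℕ.+ e ℕ.+ a)
        lem = ℕ-Ring.solve-∀

  startRV : ℤ → ℕ → ℤ → List ℤ
  startRV X j p = p ∷ X ℤ.^ (3 ℕ.* j) ℤ.* p ℤ.+ X ℤ.^ suc (3 ℕ.* j) ℤ.* p ∷ []

  startLV : ℤ → ℕ → ℤ → ℤ → ℤ → List ℤ
  startLV X j a b c = X ℤ.^ lo j ℤ.* a ∷ X ℤ.^ (lo j ℕ.+ 3 ℕ.* j) ℤ.* (b ℤ.+ X ℤ.^ suc (3 ℕ.* j) ℤ.* b ℤ.+ ℤ.- (X ℤ.^ (2 ℕ.+ 3 ℕ.* j) ℤ.* c)) ∷ []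

  combinedV : ℤ → ℕ → List ℤ
  combinedV X j₁ = addL (map (+ 2 ℤ.*_) (mulTLs X (3 ℕ.* j) (startRV X j (TriEV X (3 ℕ.* j)))))
      (map (+ weight j ℤ.*_) (mulBLs X (2 ℕ.* j) (startLV X j (nthℤ (rows X Bd j) (suc (2 ℕ.* j))) (nthℤ (rows X Bd j) (2 ℕ.* j)) (nthℤ (rows X Bd j₁) (suc (2 ℕ.* j))))))
    where
    j = suc j₁
    Bd = suc (2 ℕ.* j)

  lenR lenL : ℕ → ℕ
  lenR j = lenT (3 ℕ.* j) (suc (3 ℕ.* j) ℕ.+ lenE (3 ℕ.* j))
  lenL j = lenB (2 ℕ.* j) (lo j ℕ.+ 3 ℕ.* j ℕ.+ (2 ℕ.+ 3 ℕ.* j ℕ.+ suc (3 ℕ.* (j ℕ.* suc (2 ℕ.* j)))))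

  bdL bdC : ℕ → ℕ
  bdL j₁ = 2 ℕ.^ (j ℕ.+ suc (2 ℕ.* j)) ℕ.+ (2 ℕ.^ (j ℕ.+ 2 ℕ.* j) ℕ.+ 2 ℕ.^ (j ℕ.+ 2 ℕ.* j) ℕ.+ 2 ℕ.^ (j₁ ℕ.+ suc (2 ℕ.* j)))
    where j = suc j₁
  bdC j₁ = 2 ℕ.* (3 ℕ.^ (3 ℕ.* j) ℕ.* (3 ℕ.^ (3 ℕ.* j) ℕ.+ 3 ℕ.^ (3 ℕ.* j))) ℕ.+ weight j ℕ.* (2 ℕ.^ (2 ℕ.* j) ℕ.* bdL j₁)
    where j = suc j₁

  digitsAll : List ℕ → ℕ → List ℤ → Bool
  digitsAll ps h [] = true
  digitsAll ps h (+ v ∷ vs) = digits′ ps h v ∧ digitsAll ps h vs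
  digitsAll ps h (-[1+ _ ] ∷ vs) = false

  -- 2^W bounds the coefficients and 2^d their number; both a priori bounds are verified along with
  -- the digits.
  checkJ : ℕ → ℕ → ℕ → Bool
  checkJ W d j₁ = (lenR (suc j₁) ℕ.<ᵇ suc (2 ℕ.^ d ℕ.* 1)) ∧ (lenL (suc j₁) ℕ.<ᵇ suc (2 ℕ.^ d ℕ.* 1)) ∧ (bdC j₁ ℕ.<ᵇ 2 ℕ.^ W) ∧ digitsAll (squares d (2 ℕ.^ suc W) []) (2 ℕ.^ W) (combinedV (+ (2 ℕ.^ suc W)) j₁)

  digitsAll-sound : ∀ {X h L ps b zs vs} → 0 ℕ.< h → h ℕ.+ h ℕ.≤ X → Squares X ps L → b ℕ.< h → Pw (+ X) L zs vs → All (Bounded b) zs → digitsAll ps h vs ≡ true → All Nonneg zs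
  digitsAll-sound 0<h hX sq b<h [] [] e = []
  digitsAll-sound {ps = ps} {vs = + v ∷ vs} 0<h hX sq b<h (p ∷ ps′) (q ∷ qs) e =
    nonneg-by-digits _ hX sq p ℕ.≤-refl q b<h (digits′-sound ps _ v 0<h (proj₁ (∧-true e))) ∷ digitsAll-sound 0<h hX sq b<h ps′ qs (proj₂ (∧-true {digits′ ps _ v} e))
  digitsAll-sound {vs = -[1+ _ ] ∷ vs} 0<h hX sq b<h (p ∷ ps′) (q ∷ qs) ()

  private
    module Sound (X : ℤ) (j₁ : ℕ) where
      j Bd D : ℕ
      j = suc j₁
      Bd = suc (2 ℕ.* j)
      D = suc (3 ℕ.* (j ℕ.* Bd))

      pwR : Pw X (suc (3 ℕ.* j) ℕ.+ lenE (3 ℕ.* j)) (startR j) (startRV X j (TriEV X (3 ℕ.* j)))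
      pwR = Enc-mono _ (ℕ.m≤n+m _ (suc (3 ℕ.* j))) e ∷ Enc-⊞ (Enc-mono _ (ℕ.n≤1+n _) (Enc-sh (3 ℕ.* j) e)) (Enc-sh (suc (3 ℕ.* j)) e) ∷ []
        where e = Enc-TriE X (3 ℕ.* j)

      pwL : Pw X (lo j ℕ.+ 3 ℕ.* j ℕ.+ (2 ℕ.+ 3 ℕ.* j ℕ.+ D)) (startL j) (startLV X j (nthℤ (rows X Bd j) (suc (2 ℕ.* j))) (nthℤ (rows X Bd j) (2 ℕ.* j)) (nthℤ (rows X Bd j₁) (suc (2 ℕ.* j))))
      pwL = Enc-mono _ (ℕ.+-mono-≤ (ℕ.m≤m+n (lo j) (3 ℕ.* j)) (ℕ.m≤n+m D (2 ℕ.+ 3 ℕ.* j))) (Enc-sh (lo j) (Enc-qb X D Bd j (suc (2 ℕ.* j)) ℕ.≤-refl ℕ.≤-refl))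
          ∷ Enc-sh (lo j ℕ.+ 3 ℕ.* j) (Enc-⊞ (Enc-⊞ (Enc-mono _ (ℕ.m≤n+m D (2 ℕ.+ 3 ℕ.* j)) eb) (Enc-mono _ (ℕ.n≤1+n _) (Enc-sh (suc (3 ℕ.* j)) eb))) (Enc-⊟ (Enc-sh (2 ℕ.+ 3 ℕ.* j) ec))) ∷ []
        where
        eb = Enc-qb X D Bd j (2 ℕ.* j) ℕ.≤-refl (ℕ.n≤1+n _)
        ec = Enc-qb X D Bd j₁ (suc (2 ℕ.* j)) (ℕ.s≤s (ℕ.*-monoʳ-≤ 3 (ℕ.*-monoˡ-≤ Bd (ℕ.n≤1+n j₁)))) ℕ.≤-refl

      pw : ∀ L → lenR j ℕ.≤ L → lenL j ℕ.≤ L → Pw X L (combined j) (combinedV X j₁)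
      pw L p q = Pw-add (Pw-map (scale (+ 2)) (+ 2 ℤ.*_) (Enc-scale (+ 2)) (Pw-mono L p (Pw-mulTs (3 ℕ.* j) pwR)))
        (Pw-map (scale (+ weight j)) (+ weight j ℤ.*_) (Enc-scale (+ weight j)) (Pw-mono L q (Pw-mulBs (2 ℕ.* j) pwL)))

      bd : All (Bounded (bdC j₁)) (combined j)
      bd = All-add (All-map (scale (+ 2)) (Bounded-scale 2) (bd-mulTs (3 ℕ.* j) (Bounded-mono (ℕ.m≤m+n _ _) t ∷ Bounded-⊞ (Bounded-sh (3 ℕ.* j) t) (Bounded-sh (suc (3 ℕ.* j)) t) ∷ [])))
        (All-map (scale (+ weight j)) (Bounded-scale (weight j)) (bd-mulBs (2 ℕ.* j)
          (Bounded-mono (ℕ.m≤m+n _ _) (Bounded-sh (lo j) (bd-qb j (suc (2 ℕ.* j))))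
           ∷ Bounded-mono (ℕ.m≤n+m _ (2 ℕ.^ (j ℕ.+ suc (2 ℕ.* j)))) (Bounded-sh (lo j ℕ.+ 3 ℕ.* j) (Bounded-⊞ (Bounded-⊞ b (Bounded-sh (suc (3 ℕ.* j)) b)) (Bounded-⊟ (Bounded-sh (2 ℕ.+ 3 ℕ.* j) (bd-qb j₁ (suc (2 ℕ.* j))))))) ∷ [])))
        where
        t = bd-TriE (3 ℕ.* j)
        b = bd-qb j (2 ℕ.* j)

  checkJ-sound : ∀ W d j₁ → checkJ W d j₁ ≡ true → All Nonneg (combined (suc j₁))
  checkJ-sound W d j₁ e = digitsAll-sound (ℕ.m^n>0 2 W) (ℕ.≤-reflexive (cong (2 ℕ.^ W ℕ.+_) (sym (ℕ.+-identityʳ (2 ℕ.^ W)))))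
      (squares-sound (2 ℕ.^ suc W) d (ℕ.m^n>0 2 (suc W)) (sym (ℕ.*-identityʳ (2 ℕ.^ suc W))) [])
      (<ᵇ-sound (bdC j₁) (2 ℕ.^ W) (proj₁ e₃)) (pw (2 ℕ.^ d ℕ.* 1) (ℕ.≤-pred (<ᵇ-sound (lenR j) _ (proj₁ e₁))) (ℕ.≤-pred (<ᵇ-sound (lenL j) _ (proj₁ e₂)))) bd (proj₂ e₃)
    where
    open Sound (+ (2 ℕ.^ suc W)) j₁
    e₁ = ∧-true e
    e₂ = ∧-true {lenL j ℕ.<ᵇ suc (2 ℕ.^ d ℕ.* 1)} (proj₂ e₁)
    e₃ = ∧-true {bdC j₁ ℕ.<ᵇ 2 ℕ.^ W} (proj₂ e₂)

  j₀ : ℕ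
  j₀ = 16

  -- The main term 4 · 3^(6j) of the coefficient bound grows by less than 10 bits when j is raised
  -- by one.
  checked-small-j : all< (λ j₁ → checkJ (25 ℕ.+ 10 ℕ.* j₁) 13 j₁) j₀ ≡ true
  checked-small-j = refl

  -- Nonnegative coefficients in v stay nonnegative whatever power of q is substituted for v, hence
  -- the conclusion for every e.
  small-bound : ∀ j₁ e → j₁ ℕ.< j₀ → let j = suc j₁ ; r = suc (3 ℕ.* j ℕ.+ e) in
    ∀ m → 0ℤ ℤ.≤ + 2 ℤ.* + T₀ (suc (3 ℕ.* j ℕ.+ r)) m ℤ.+ + weight j ℤ.* cT j (suc r) m
  small-bound j₁ e j₁< = Nonneg-cong (ev-combined j e) (Nonneg-TriE (suc (3 ℕ.* j)) e (Nonneg-ev (suc (suc (3 ℕ.* j ℕ.+ e)))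
      (checkJ-sound (25 ℕ.+ 10 ℕ.* j₁) 13 j₁ (all<-sound (λ j₁ → checkJ (25 ℕ.+ 10 ℕ.* j₁) 13 j₁) j₀ checked-small-j j₁ j₁<))))
    where j = suc j₁

-- Summation of the bounds

module Positivity where

  open PowerSeries
  open SingleSum
  open Trisection
  open SmallN
  open FarSummands using (T₀)
  open SummandBounds using (far-bound; near-bound)
  open Bivariate using (cT₀)
  open SmallIndices using (small-bound; weight)
  open import Data.Nat as ℕ using (ℕ; zero; suc)
  import Data.Nat.Properties as ℕ
  import Data.Nat.Tactic.RingSolver as ℕ-Ring
  open import Data.Integer as ℤ using (ℤ; +_; -[1+_]; 0ℤ; ∣_∣)
  import Data.Integer.Properties as ℤ
  open import Data.Integer.Tactic.RingSolver using (solve-∀)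
  open import Data.Product using (proj₂)
  open import Relation.Binary.PropositionalEquality hiding (setoid)
  open import Relation.Nullary using (yes; no)

  private
    abs-nonneg : ∀ i y → ∣ i ∣ ℕ.≤ y → 0ℤ ℤ.≤ i ℤ.+ + y
    abs-nonneg (+ a) y p = ℤ.+≤+ ℕ.z≤n
    abs-nonneg -[1+ a ] y p = subst (0ℤ ℤ.≤_) (sym (ℤ.⊖-≥ p)) (ℤ.+≤+ ℕ.z≤n)

    scaled-abs : ∀ k x y t → k ℕ.* ∣ x ∣ ℕ.≤ y ℕ.* t → 0ℤ ℤ.≤ + k ℤ.* x ℤ.+ + y ℤ.* + t
    scaled-abs k x y t p = subst (λ z → 0ℤ ℤ.≤ + k ℤ.* x ℤ.+ z) (ℤ.pos-* y t) (abs-nonneg (+ k ℤ.* x) (y ℕ.* t) (ℕ.≤-trans (ℕ.≤-reflexive (ℤ.abs-* (+ k) x)) p))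

    0≤-cancel : ∀ k y → 0ℤ ℤ.≤ + suc k ℤ.* y → 0ℤ ℤ.≤ y
    0≤-cancel k y p = ℤ.*-cancelˡ-≤-pos 0ℤ y (+ suc k) (subst (ℤ._≤ + suc k ℤ.* y) (sym (ℤ.*-zeroʳ (+ suc k))) p)

    0≤-* : ∀ k y → 0ℤ ℤ.≤ y → 0ℤ ℤ.≤ + k ℤ.* y
    0≤-* k y p = subst (ℤ._≤ + k ℤ.* y) (ℤ.*-zeroʳ (+ k)) (ℤ.*-monoˡ-≤-nonNeg (+ k) p)

    0≤-+ : ∀ {x y} → 0ℤ ℤ.≤ x → 0ℤ ℤ.≤ y → 0ℤ ℤ.≤ x ℤ.+ y
    0≤-+ p q = ℤ.+-mono-≤ p q

  module Tails (n : ℕ) (n>n₀ : n₀ ℕ.< n) (m : ℕ) where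

    private
      t : ℕ
      t = T₀ n m

      term : ∀ j₁ r → 16 ℕ.≤ j₁ → let j = suc j₁ in 3 ℕ.* j ℕ.+ suc r ≡ n → 0ℤ ℤ.≤ + (j ℕ.* suc j) ℤ.* cT j (suc r) m ℤ.+ + 10 ℤ.* + t
      term j₁ r 16≤ e = scaled-abs (j ℕ.* suc j) (cT j (suc r) m) 10 t (subst (λ k → j ℕ.* suc j ℕ.* ∣ cT j (suc r) m ∣ ℕ.≤ 10 ℕ.* T₀ k m) (trans (sym (ℕ.+-suc (3 ℕ.* j) r)) e) bound)
        where
        j = suc j₁
        bound : j ℕ.* suc j ℕ.* ∣ cT j (suc r) m ∣ ℕ.≤ 10 ℕ.* T₀ (suc (3 ℕ.* j ℕ.+ r)) m
        bound with r ℕ.≤? 3 ℕ.* j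
        ... | yes p = near-bound j₁ r 16≤ p m
        ... | no p = subst (λ r → j ℕ.* suc j ℕ.* ∣ cT j (suc r) m ∣ ℕ.≤ 10 ℕ.* T₀ (suc (3 ℕ.* j ℕ.+ r)) m) (ℕ.m+[n∸m]≡n (ℕ.≰⇒> p)) (far-bound j₁ (r ℕ.∸ suc (3 ℕ.* j)) 16≤ m)

      -- The telescoping 10/(j(j+1)) + 10/(j+1) = 10/j, with denominators cleared.
      tail-step : ∀ j₁ x y → let j = suc j₁ in 0ℤ ℤ.≤ + (j ℕ.* suc j) ℤ.* x ℤ.+ + 10 ℤ.* + t → 0ℤ ℤ.≤ + suc j ℤ.* y ℤ.+ + 10 ℤ.* + t → 0ℤ ℤ.≤ + j ℤ.* (x ℤ.+ y) ℤ.+ + 10 ℤ.* + t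
      tail-step j₁ x y p q = 0≤-cancel j _ (subst (0ℤ ℤ.≤_) (trans (cong (λ k → k ℤ.* x ℤ.+ + 10 ℤ.* + t ℤ.+ + j ℤ.* ((+ suc j) ℤ.* y ℤ.+ + 10 ℤ.* + t)) (ℤ.pos-* j (suc j))) (trans (cong (λ k → + j ℤ.* k ℤ.* x ℤ.+ + 10 ℤ.* + t ℤ.+ + j ℤ.* (k ℤ.* y ℤ.+ + 10 ℤ.* + t)) (ℤ.pos-+ 1 j)) (trans (lem (+ j) x y (+ t)) (cong (λ k → k ℤ.* (+ j ℤ.* (x ℤ.+ y) ℤ.+ + 10 ℤ.* + t)) (sym (ℤ.pos-+ 1 j))))))
          (0≤-+ p (0≤-* j _ q)))
        where
        j = suc j₁
        lem : ∀ j x y t → j ℤ.* (+ 1 ℤ.+ j) ℤ.* x ℤ.+ + 10 ℤ.* t ℤ.+ j ℤ.* ((+ 1 ℤ.+ j) ℤ.* y ℤ.+ + 10 ℤ.* t) ≡ (+ 1 ℤ.+ j) ℤ.* (j ℤ.* (x ℤ.+ y) ℤ.+ + 10 ℤ.* t)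
        lem = solve-∀

      0≤10t : 0ℤ ℤ.≤ + 10 ℤ.* + t
      0≤10t = 0≤-* 10 (+ t) (ℤ.+≤+ ℕ.z≤n)

      none : ∀ j → 0ℤ ℤ.≤ + j ℤ.* 0ℤ ℤ.+ + 10 ℤ.* + t
      none j = 0≤-+ {+ j ℤ.* 0ℤ} (ℤ.≤-reflexive (sym (ℤ.*-zeroʳ (+ j)))) 0≤10t

      last : ∀ j₁ r → 16 ℕ.≤ j₁ → 3 ℕ.* suc j₁ ℕ.+ suc r ≡ n → 0ℤ ℤ.≤ + suc j₁ ℤ.* cT (suc j₁) (suc r) m ℤ.+ + 10 ℤ.* + t
      last j₁ r 16≤ e = subst (λ z → 0ℤ ℤ.≤ + suc j₁ ℤ.* z ℤ.+ + 10 ℤ.* + t) (ℤ.+-identityʳ (cT (suc j₁) (suc r) m)) (tail-step j₁ (cT (suc j₁) (suc r) m) 0ℤ (term j₁ r 16≤ e) (none (2 ℕ.+ j₁)))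

      move : ∀ j ρ → 3 ℕ.* j ℕ.+ suc (suc (suc ρ)) ≡ 3 ℕ.* suc j ℕ.+ ρ
      move = ℕ-Ring.solve-∀

      tail : ∀ j₁ ρ → 16 ℕ.≤ j₁ → 3 ℕ.* suc j₁ ℕ.+ ρ ≡ n → 0ℤ ℤ.≤ + suc j₁ ℤ.* Σ3 cT (suc j₁) ρ m ℤ.+ + 10 ℤ.* + t
      tail j₁ zero 16≤ e = subst (λ z → 0ℤ ℤ.≤ + suc j₁ ℤ.* z ℤ.+ + 10 ℤ.* + t) (sym (cT-zero (suc j₁) m)) (none (suc j₁))
      tail j₁ (suc zero) 16≤ e = last j₁ 0 16≤ e
      tail j₁ (suc (suc zero)) 16≤ e = last j₁ 1 16≤ e
      tail j₁ (suc (suc (suc ρ))) 16≤ e = tail-step j₁ (cT (suc j₁) (3 ℕ.+ ρ) m) (Σ3 cT (2 ℕ.+ j₁) ρ m) (term j₁ (2 ℕ.+ ρ) 16≤ e) (tail (suc j₁) ρ (ℕ.≤-trans 16≤ (ℕ.n≤1+n j₁)) (trans (sym (move (suc j₁) ρ)) e))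

      -- 2/(5j) + 48/85 is the sum of 2/(5i(i+1)) over j ≤ i ≤ 16 and of 10/(i(i+1)) over i ≥ 17.
      Head : ℕ → ℤ → Set
      Head j x = 0ℤ ℤ.≤ + 85 ℤ.* (+ j ℤ.* x) ℤ.+ (+ 34 ℤ.+ + 48 ℤ.* + j) ℤ.* + t

      -- Again telescoping, 2/(5j(j+1)) + 2/(5(j+1)) = 2/(5j), while the constant part 48/85 is
      -- carried along; 85 = 5 · 17 is the common denominator.
      head-step : ∀ j₁ x y → let j = suc j₁ in 0ℤ ℤ.≤ + 2 ℤ.* + t ℤ.+ + weight j ℤ.* x → Head (suc j) y → Head j (x ℤ.+ y)
      head-step j₁ x y p q = 0≤-cancel j _ (subst (0ℤ ℤ.≤_) (trans (cong₂ (λ w k → + 17 ℤ.* (+ 2 ℤ.* + t ℤ.+ w ℤ.* x) ℤ.+ + j ℤ.* (+ 85 ℤ.* (k ℤ.* y) ℤ.+ (+ 34 ℤ.+ + 48 ℤ.* k) ℤ.* + t)) we (ℤ.pos-+ 1 j))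
          (trans (lem (+ j) x y (+ t)) (cong (λ k → k ℤ.* (+ 85 ℤ.* (+ j ℤ.* (x ℤ.+ y)) ℤ.+ (+ 34 ℤ.+ + 48 ℤ.* + j) ℤ.* + t)) (sym (ℤ.pos-+ 1 j))))) (0≤-+ (0≤-* 17 _ p) (0≤-* j _ q)))
        where
        j = suc j₁
        we : + weight j ≡ + 5 ℤ.* (+ j ℤ.* (+ 1 ℤ.+ + j))
        we = trans (ℤ.pos-* 5 (j ℕ.* suc j)) (cong (+ 5 ℤ.*_) (trans (ℤ.pos-* j (suc j)) (cong (+ j ℤ.*_) (ℤ.pos-+ 1 j))))
        lem : ∀ j x y t → + 17 ℤ.* (+ 2 ℤ.* t ℤ.+ + 5 ℤ.* (j ℤ.* (+ 1 ℤ.+ j)) ℤ.* x) ℤ.+ j ℤ.* (+ 85 ℤ.* ((+ 1 ℤ.+ j) ℤ.* y) ℤ.+ (+ 34 ℤ.+ + 48 ℤ.* (+ 1 ℤ.+ j)) ℤ.* t)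
          ≡ (+ 1 ℤ.+ j) ℤ.* (+ 85 ℤ.* (j ℤ.* (x ℤ.+ y)) ℤ.+ (+ 34 ℤ.+ + 48 ℤ.* j) ℤ.* t)
        lem = solve-∀

      head : ∀ k j₁ ρ → k ℕ.+ j₁ ≡ 16 → 3 ℕ.* suc j₁ ℕ.+ ρ ≡ n → Head (suc j₁) (Σ3 cT (suc j₁) ρ m)
      -- At j = 17 the bound 2/(5j) + 48/85 equals 10/17, which is the bound for the tail.
      head zero .16 ρ refl e = subst (0ℤ ℤ.≤_) (lem (Σ3 cT 17 ρ m) (+ t)) (0≤-* 85 _ (tail 16 ρ ℕ.≤-refl e))
        where
        lem : ∀ x t → + 85 ℤ.* (+ 17 ℤ.* x ℤ.+ + 10 ℤ.* t) ≡ + 85 ℤ.* (+ 17 ℤ.* x) ℤ.+ (+ 34 ℤ.+ + 48 ℤ.* + 17) ℤ.* t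
        lem = solve-∀
      head (suc k) j₁ ρ ek e = subst (λ ρ → Head j (Σ3 cT j ρ m)) (sym ρ≡) (head-step j₁ (cT j (3 ℕ.+ w) m) (Σ3 cT (suc j) w m) bound (head k (suc j₁) w (trans (ℕ.+-suc k j₁) ek) (trans (sym (move j w)) (trans (cong (3 ℕ.* j ℕ.+_) (sym ρ≡)) e))))
        where
        j = suc j₁
        j₁≤15 : j₁ ℕ.≤ 15
        j₁≤15 = ℕ.≤-trans (ℕ.m≤n+m j₁ k) (ℕ.≤-reflexive (ℕ.suc-injective ek))
        -- From j ≤ 16 and n ≥ 98 follows 6j + 2 ≤ n, so T_j and T₀ have their common factor.
        big : 3 ℕ.* j ℕ.+ (2 ℕ.+ 3 ℕ.* j) ℕ.≤ 3 ℕ.* j ℕ.+ ρ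
        big = ℕ.≤-trans (ℕ.+-mono-≤ (ℕ.*-monoʳ-≤ 3 (ℕ.s≤s j₁≤15)) (ℕ.+-monoʳ-≤ 2 (ℕ.*-monoʳ-≤ 3 (ℕ.s≤s j₁≤15)))) (ℕ.≤-trans n>n₀ (ℕ.≤-reflexive (sym e)))
        u = ρ ℕ.∸ (2 ℕ.+ 3 ℕ.* j)
        w = 3 ℕ.* j ℕ.+ u ℕ.∸ 1
        ρ≡′ : ρ ≡ 2 ℕ.+ (3 ℕ.* j ℕ.+ u)
        ρ≡′ = sym (ℕ.m+[n∸m]≡n (ℕ.+-cancelˡ-≤ (3 ℕ.* j) _ _ big))
        ρ≡ : ρ ≡ 3 ℕ.+ w
        ρ≡ = ρ≡′
        bound : 0ℤ ℤ.≤ + 2 ℤ.* + t ℤ.+ + weight j ℤ.* cT j (3 ℕ.+ w) m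
        bound = subst₂ (λ k ρ → 0ℤ ℤ.≤ + 2 ℤ.* + T₀ k m ℤ.+ + weight j ℤ.* cT j ρ m) (trans (lem (3 ℕ.* j) u) (trans (cong (3 ℕ.* j ℕ.+_) (sym ρ≡′)) e)) refl (small-bound j₁ u (ℕ.s≤s j₁≤15) m)
          where
          lem : ∀ a u → suc (a ℕ.+ suc (a ℕ.+ u)) ≡ a ℕ.+ (2 ℕ.+ (a ℕ.+ u))
          lem = ℕ-Ring.solve-∀

    -- At j = 1 the bounds add up to 82/85, so 3/85 of T₀ is left over.
    tails-nonneg : ∀ ρ → 3 ℕ.+ ρ ≡ n → 0ℤ ℤ.≤ + T₀ n m ℤ.+ Σ3 cT 1 ρ m
    tails-nonneg ρ e = 0≤-cancel 84 _ (subst (0ℤ ℤ.≤_) (lem (Σ3 cT 1 ρ m) (+ t)) (0≤-+ (head 16 0 ρ refl e) (0≤-* 3 (+ t) (ℤ.+≤+ ℕ.z≤n))))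
      where
      lem : ∀ x t → + 85 ℤ.* (+ 1 ℤ.* x) ℤ.+ (+ 34 ℤ.+ + 48 ℤ.* + 1) ℤ.* t ℤ.+ + 3 ℤ.* t ≡ + 85 ℤ.* (t ℤ.+ x)
      lem = solve-∀

  C≥0 : ∀ n m → 0ℤ ℤ.≤ C n m
  C≥0 n m with n ℕ.≤? n₀
  ... | yes p = C≥0-small n p m
  ... | no p = subst (λ k → 0ℤ ℤ.≤ C k m) n≡ (subst (0ℤ ℤ.≤_) (sym (trans (proj₂ (proj₂ (ABC-formula (2 ℕ.+ ρ))) m) (cong (ℤ._+ Σ3 cT 1 ρ m) (cT₀ (suc ρ) m)))) (Tails.tails-nonneg (3 ℕ.+ ρ) (subst (n₀ ℕ.<_) (sym n≡) (ℕ.≰⇒> p)) m ρ refl))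
    where
    ρ = n ℕ.∸ 3
    n≡ : 3 ℕ.+ ρ ≡ n
    n≡ = ℕ.m+[n∸m]≡n (ℕ.≤-trans (ℕ.s≤s (ℕ.s≤s (ℕ.s≤s ℕ.z≤n))) (ℕ.≰⇒> p))

open import Defs
open import Data.Nat using (ℕ; _%_; _≥_)
open import Data.Product using (_×_)
open import Data.Integer using (ℤ; +_) renaming (_≤_ to _≤ℤ_)
open import Relation.Binary.PropositionalEquality using (_≡_; _≢_)

theorem10p2 : (n : ℕ) → n ≥ 1 → (m : ℕ) →
    (m % 3 ≡ 0 → + 0 ≤ℤ coeff m (P n)) × (m % 3 ≢ 0 → coeff m (P n) ≤ℤ + 0)
theorem10p2 n _ m = Trisection.FromC.sign-pattern Positivity.C≥0 n m
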